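{- Let $\mathcal{O}$ be an order in an imaginary quadratic field and let $\ell$ be a prime. Let $\mathfrak{a}$ be an ideal of $\mathcal{O}$ in a well-rounded (proper ideal) class $\mathcal{C}$. Suppose $\mathfrak{p}_\ell$ is a prime proper ideal of $\mathcal{O}$ of norm $\ell$, and suppose $\mathfrak{p}_\ell\mathfrak{a}$ is in a well-rounded class $\mathcal{C}'$. Then $(L,M)=(\mathfrak{a},\mathfrak{p}_\ell\mathfrak{a})$ is a doubly well-rounded form of index $\ell$. Conversely, every doubly well-rounded form of prime index $\ell$ occurs in this way, up to orthogonal transformations and homotheties, for some such $\mathcal{O}$, $\mathfrak{a}$, $\mathfrak{p}_\ell$.
   Context: A lattice in $\mathbb{R}^2\cong\mathbb{C}$ is the $\mathbb{Z}$-span of an $\mathbb{R}$-basis; $\langle\,,\rangle$ is the standard dot product; a homothety is multiplication by a positive real scalar. Let $\ell$ be a prime, $L$ a lattice and $M\subset L$ a sublattice of index $\ell$. The pair $(L,M)$ is a tempered perfect lattice (or form) of index $\ell$ if, after rescaling $L$ and $M$ by a common positive scalar, there exist non-empty sets $S\subset L-M$ and $S'\subset M-\{0\}$ such that, with $A(v)=\langle v,v\rangle$: (i) $A(v)=1$ for all $v\in S$; (ii) $A(v)>1$ for all $v\in L-M$ with $v\notin S$; (iii) $A(v)$ has a common value $u\geqslant 1$ for all $v\in S'$; (iv) $A(v)>u$ for all $v\in M-\{0\}$ with $v\notin S'$; (v) if $B$ is any positive definite quadratic form on $\mathbb{R}^2$ satisfying (i)--(iv) in place of $A$ with the same $S,S'$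 and with common value $u'$ on $S'$, then $B=A$ and $u'=u$. It is an $s$-and-$s'$ form if $S$ consists of $s$ pairs $\pm v$ and $S'$ consists of $s'$ pairs $\pm v$, and doubly well-rounded if $s\geqslant2$ and $s'\geqslant2$. For an imaginary quadratic field $K\subset\mathbb{C}$, a fractional ideal in $K$ is a finitely generated $\mathbb{Z}$-submodule $L$ of $K$ spanning $K$ over $\mathbb{Q}$; its coefficient ring is $\{\alpha\in K\mid\alpha L\subseteq L\}$. It is proper for the order $\mathcal{O}$ if its coefficient ring equals $\mathcal{O}$. Two fractional ideals are similar if they differ by multiplication by a nonzero element of $K$; proper ideal classes are similarity classes of proper fractional ideals of $\mathcal{O}$. The norm of a proper ideal $I\subseteq\mathcal{O}$ is $[\mathcal{O}:I]$. A lattice is well rounded if its nonzero vectors of minimal length contain a $\mathbb{Z}$-basis of it; a class is well rounded if its members are well-rounded lattices in $\mathbb{C}$. -}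

module Defs where

open import Level using (0ℓ)
open import Algebra.Structures using (IsCommutativeRing)
open import Data.Fin using (Fin)
open import Data.Integer using (ℤ; +_; -[1+_])
open import Data.Nat using (ℕ; zero; suc)
import Data.Nat as ℕ
open import Data.Nat.Primality using (Prime)
open import Data.Product using (∃; ∃₂; ∃!; _×_; _,_; proj₂)
open import Data.Rational using (ℚ; ↥_; ↧_)
open import Data.Sum using (_⊎_)
open import Data.Vec.Functional using (foldr)
open import Relation.Binary.Core using (Rel)
open import Relation.Binary.PropositionalEquality using (_≡_; _≢_)
open import Relation.Binary.Structures using (IsStrictTotalOrder)
open import Relation.Nullary using (¬_)
open import Relation.Unary using (Pred; _∈_; _∉_; _⊆_; _≐_; Satisfiable)
import Relation.Binary.Construct.StrictToNonStrict as StrictToNonStrict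

-- The classical real numbers, characterised (up to unique isomorphism) as a
-- Dedekind-complete ordered field.  The inverse is a total function whose
-- value at 0 is unconstrained.
record RealNumbers : Set₁ where
  infix  4 _<_
  infixl 6 _+_
  infixl 7 _*_
  infix  8 -_
  infix  9 _⁻¹
  field
    ℝ       : Set
    _+_ _*_ : ℝ → ℝ → ℝ
    -_ _⁻¹  : ℝ → ℝ
    0ℝ 1ℝ   : ℝ
    _<_     : Rel ℝ 0ℓ

    isCommutativeRing  : IsCommutativeRing _≡_ _+_ _*_ -_ 0ℝ 1ℝ
    *-inverseʳ         : ∀ x → x ≢ 0ℝ → x * x ⁻¹ ≡ 1ℝ

    isStrictTotalOrder : IsStrictTotalOrder _≡_ _<_
    0<1                : 0ℝ < 1ℝ
    +-monoˡ-<          : ∀ z {x y} → x < y → x + z < y + z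
    *-pos              : ∀ {x y} → 0ℝ < x → 0ℝ < y → 0ℝ < x * y

  open StrictToNonStrict _≡_ _<_ public using (_≤_)

  UpperBound : Pred ℝ 0ℓ → Pred ℝ 0ℓ
  UpperBound P b = ∀ {x} → x ∈ P → x ≤ b

  field
    supremum : (P : Pred ℝ 0ℓ) → Satisfiable P → Satisfiable (UpperBound P) →
               ∃ λ s → s ∈ UpperBound P × (∀ {b} → b ∈ UpperBound P → s ≤ b)

module Over (R : RealNumbers) where

  open RealNumbers R public

  fromℕ : ℕ → ℝ
  fromℕ zero    = 0ℝ
  fromℕ (suc n) = 1ℝ + fromℕ n

  fromℤ : ℤ → ℝ
  fromℤ (+ n)    = fromℕ n
  fromℤ -[1+ n ] = - fromℕ (suc n)

  fromℚ : ℚ → ℝ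
  fromℚ q = fromℤ (↥ q) * fromℤ (↧ q) ⁻¹

  ----------------------------------------------------------------------
  -- The plane ℝ² ≅ ℂ, with (x , y) standing for x + iy

  infixl 6 _+ᶜ_ _-ᶜ_
  infixl 7 _*ᶜ_
  infixr 7 _·_
  infix  8 -ᶜ_

  ℂ : Set
  ℂ = ℝ × ℝ

  Subset : Set₁
  Subset = Pred ℂ 0ℓ

  0ᶜ 1ᶜ : ℂ
  0ᶜ = 0ℝ , 0ℝ
  1ᶜ = 1ℝ , 0ℝ

  _+ᶜ_ _*ᶜ_ : ℂ → ℂ → ℂ
  (x , y) +ᶜ (x′ , y′) = (x + x′) , (y + y′)
  (x , y) *ᶜ (x′ , y′) = (x * x′ + - (y * y′)) , (x * y′ + y * x′)

  -ᶜ_ : ℂ → ℂ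
  -ᶜ (x , y) = (- x) , (- y)

  _-ᶜ_ : ℂ → ℂ → ℂ
  v -ᶜ w = v +ᶜ -ᶜ w

  _·_ : ℝ → ℂ → ℂ
  c · (x , y) = (c * x) , (c * y)

  ⟨_,_⟩ : ℂ → ℂ → ℝ
  ⟨ (x , y) , (x′ , y′) ⟩ = x * x′ + y * y′

  A : ℂ → ℝ
  A v = ⟨ v , v ⟩

  sum : ∀ {n} → (Fin n → ℂ) → ℂ
  sum = foldr _+ᶜ_ 0ᶜ

  image : (ℂ → ℂ) → Subset → Subset
  image f L w = ∃ λ v → v ∈ L × w ≡ f v

  record IsOrthogonal (T : ℂ → ℂ) : Set where
    field
      additive    : ∀ v w → T (v +ᶜ w) ≡ T v +ᶜ T w
      homogeneous : ∀ c v → T (c · v) ≡ c · T v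
      isometric   : ∀ v w → ⟨ T v , T w ⟩ ≡ ⟨ v , w ⟩

  ----------------------------------------------------------------------
  -- Lattices

  IsℝBasis : ℂ → ℂ → Set
  IsℝBasis b₁ b₂ =
    ∀ v → ∃! _≡_ λ ((s , t) : ℝ × ℝ) → v ≡ s · b₁ +ᶜ t · b₂

  ℤSpan : ∀ {n} → (Fin n → ℂ) → Subset
  ℤSpan {n} g v = ∃ λ (m : Fin n → ℤ) → v ≡ sum (λ i → fromℤ (m i) · g i)

  ℤSpan₂ : ℂ → ℂ → Subset
  ℤSpan₂ b₁ b₂ v = ∃₂ λ (m n : ℤ) → v ≡ fromℤ m · b₁ +ᶜ fromℤ n · b₂

  IsLatticeBasis : Subset → ℂ → ℂ → Set
  IsLatticeBasis L b₁ b₂ = IsℝBasis b₁ b₂ × L ≐ ℤSpan₂ b₁ b₂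

  IsLattice : Subset → Set
  IsLattice L = ∃₂ (IsLatticeBasis L)

  IsMinimalVector : Subset → ℂ → Set
  IsMinimalVector L b =
    b ∈ L × b ≢ 0ᶜ × (∀ {v} → v ∈ L → v ≢ 0ᶜ → A b ≤ A v)

  WellRounded : Subset → Set
  WellRounded L = IsLattice L ×
    ∃₂ λ b₁ b₂ → IsLatticeBasis L b₁ b₂ ×
                 IsMinimalVector L b₁ × IsMinimalVector L b₂

  -- For a subgroup M of L: there are exactly n cosets of M in L, with a
  -- system of representatives indexed by Fin n.
  HasIndex : Subset → Subset → ℕ → Set
  HasIndex L M n = ∃ λ (r : Fin n → ℂ) →
    (∀ i → r i ∈ L) × (∀ {v} → v ∈ L → ∃! _≡_ λ i → (v -ᶜ r i) ∈ M)

  ----------------------------------------------------------------------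
  -- Tempered perfect forms

  record QuadraticForm : Set where
    constructor form
    field a b c : ℝ

  ⟦_⟧ : QuadraticForm → ℂ → ℝ
  ⟦ form a b c ⟧ (x , y) = a * (x * x) + b * (x * y) + c * (y * y)

  PositiveDefinite : QuadraticForm → Set
  PositiveDefinite B = ∀ {v} → v ≢ 0ᶜ → 0ℝ < ⟦ B ⟧ v

  record Tempered (L M S S′ : Subset) (B : ℂ → ℝ) (u : ℝ) : Set where
    field
      on-S   : ∀ {v} → v ∈ S → B v ≡ 1ℝ
      off-S  : ∀ {v} → v ∈ L → v ∉ M → v ∉ S → 1ℝ < B v
      1≤u    : 1ℝ ≤ u
      on-S′  : ∀ {v} → v ∈ S′ → B v ≡ u
      off-S′ : ∀ {v} → v ∈ M → v ≢ 0ᶜ → v ∉ S′ → u < B v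

  record IsPerfect (L M S S′ : Subset) : Set where
    field
      S-nonempty  : Satisfiable S
      S⊆L-M       : ∀ {v} → v ∈ S → v ∈ L × v ∉ M
      S′-nonempty : Satisfiable S′
      S′⊆M-0      : ∀ {v} → v ∈ S′ → v ∈ M × v ≢ 0ᶜ
      u           : ℝ
      tempered    : Tempered L M S S′ A u
      unique      : ∀ B u′ → PositiveDefinite B →
                    Tempered L M S S′ ⟦ B ⟧ u′ →
                    (∀ v → ⟦ B ⟧ v ≡ A v) × u′ ≡ u

  record TemperedPerfect (ℓ : ℕ) (L M : Subset) : Set₁ where
    field
      prime     : Prime ℓ
      L-lattice : IsLattice L
      M-lattice : IsLattice M
      M⊆L       : M ⊆ L
      index     : HasIndex L M ℓ
      scale     : ℝ
      0<scale   : 0ℝ < scale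
      S S′      : Subset
      perfect   : IsPerfect (image (scale ·_) L) (image (scale ·_) M) S S′

  ConsistsOfPairs : ℕ → Subset → Set
  ConsistsOfPairs s S = ∃ λ (p : Fin s → ℂ) →
    (∀ {i j} → (p i ≡ p j ⊎ p i ≡ -ᶜ p j) → i ≡ j) ×
    S ≐ (λ v → ∃ λ i → v ≡ p i ⊎ v ≡ -ᶜ p i)

  _is_and_form : ∀ {ℓ L M} → TemperedPerfect ℓ L M → ℕ → ℕ → Set
  F is s and s′ form = ConsistsOfPairs s S × ConsistsOfPairs s′ S′
    where open TemperedPerfect F

  DoublyWellRounded : ℕ → Subset → Subset → Set₁
  DoublyWellRounded ℓ L M = ∃ λ (F : TemperedPerfect ℓ L M) →
    ∃₂ λ s s′ → F is s and s′ form × 2 ℕ.≤ s × 2 ℕ.≤ s′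

  ----------------------------------------------------------------------
  -- Imaginary quadratic fields, orders and ideals

  record IsSubfield (K : Subset) : Set where
    field
      0∈         : 0ᶜ ∈ K
      1∈         : 1ᶜ ∈ K
      +-closed   : ∀ {z w} → z ∈ K → w ∈ K → (z +ᶜ w) ∈ K
      neg-closed : ∀ {z} → z ∈ K → (-ᶜ z) ∈ K
      *-closed   : ∀ {z w} → z ∈ K → w ∈ K → (z *ᶜ w) ∈ K
      inverse    : ∀ {z} → z ∈ K → z ≢ 0ᶜ → ∃ λ w → w ∈ K × z *ᶜ w ≡ 1ᶜ

  IsℚBasis : Subset → ℂ → ℂ → Set
  IsℚBasis K b₁ b₂ = b₁ ∈ K × b₂ ∈ K × (∀ {z} → z ∈ K →
    ∃! _≡_ λ ((p , q) : ℚ × ℚ) → z ≡ fromℚ p · b₁ +ᶜ fromℚ q · b₂)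

  record IsImaginaryQuadratic (K : Subset) : Set where
    field
      isSubfield : IsSubfield K
      degree-2   : ∃₂ (IsℚBasis K)
      nonreal    : ∃ λ z → z ∈ K × proj₂ z ≢ 0ℝ

  ℚSpan : Subset → Subset
  ℚSpan L z = ∃ λ n → ∃₂ λ (q : Fin n → ℚ) (w : Fin n → ℂ) →
    (∀ i → w i ∈ L) × z ≡ sum (λ i → fromℚ (q i) · w i)

  record IsFractionalIdeal (K L : Subset) : Set where
    field
      L⊆K   : L ⊆ K
      f-g   : ∃ λ n → ∃ λ (g : Fin n → ℂ) → L ≐ ℤSpan g
      spans : K ⊆ ℚSpan L

  record IsOrder (K 𝒪 : Subset) : Set where
    field
      isFractionalIdeal : IsFractionalIdeal K 𝒪
      1∈                : 1ᶜ ∈ 𝒪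
      *-closed          : ∀ {z w} → z ∈ 𝒪 → w ∈ 𝒪 → (z *ᶜ w) ∈ 𝒪

  coefficientRing : Subset → Subset → Subset
  coefficientRing K L α = α ∈ K × (∀ {v} → v ∈ L → (α *ᶜ v) ∈ L)

  IsProper : (K 𝒪 L : Subset) → Set
  IsProper K 𝒪 L = IsFractionalIdeal K L × coefficientRing K L ≐ 𝒪

  -- Closure under 𝒪 is part of the equality of 𝒪 with the coefficient ring.
  IsProperIdeal : (K 𝒪 I : Subset) → Set
  IsProperIdeal K 𝒪 I = IsProper K 𝒪 I × I ⊆ 𝒪

  IsPrimeIdeal : (𝒪 𝔭 : Subset) → Set
  IsPrimeIdeal 𝒪 𝔭 = 1ᶜ ∉ 𝔭 ×
    (∀ {z w} → z ∈ 𝒪 → w ∈ 𝒪 → (z *ᶜ w) ∈ 𝔭 → z ∈ 𝔭 ⊎ w ∈ 𝔭)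

  infixl 7 _⊗_

  _⊗_ : Subset → Subset → Subset
  (I ⊗ J) z = ∃ λ n → ∃₂ λ (v w : Fin n → ℂ) →
    (∀ i → v i ∈ I) × (∀ i → w i ∈ J) × z ≡ sum (λ i → v i *ᶜ w i)

  Similar : (K I J : Subset) → Set
  Similar K I J = ∃ λ α → α ∈ K × α ≢ 0ᶜ × J ≐ image (α *ᶜ_) I

  properClass : (K 𝒪 I : Subset) → Pred Subset 0ℓ
  properClass K 𝒪 I J = IsProper K 𝒪 J × Similar K I J

  InWellRoundedClass : (K 𝒪 I : Subset) → Set₁
  InWellRoundedClass K 𝒪 I =
    IsProper K 𝒪 I × (∀ {J} → J ∈ properClass K 𝒪 I → WellRounded J)

  record WellRoundedIdealData (ℓ : ℕ) (K 𝒪 𝔞 𝔭 : Subset) : Set₁ where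
    field
      prime                : Prime ℓ
      isImaginaryQuadratic : IsImaginaryQuadratic K
      isOrder              : IsOrder K 𝒪
      𝔞-ideal              : IsProperIdeal K 𝒪 𝔞
      𝔞-wellRounded        : InWellRoundedClass K 𝒪 𝔞
      𝔭-ideal              : IsProperIdeal K 𝒪 𝔭
      𝔭-prime              : IsPrimeIdeal 𝒪 𝔭
      𝔭-norm               : HasIndex 𝒪 𝔭 ℓ
      𝔭𝔞-wellRounded       : InWellRoundedClass K 𝒪 (𝔭 ⊗ 𝔞)

  EquivalentPairs : (L M L′ M′ : Subset) → Set
  EquivalentPairs L M L′ M′ = ∃₂ λ (T : ℂ → ℂ) (c : ℝ) →
    IsOrthogonal T × 0ℝ < c ×
    L ≐ image (λ v → c · T v) L′ × M ≐ image (λ v → c · T v) M′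

{-# OPTIONS --safe #-}
module Submission where

-- Let v₁, v₂ be minimal vectors of length 1 generating L and t = 2⟨v₁, v₂⟩, so
-- that A(m v₁ + n v₂) = m² + t m n + n².  A sublattice M of prime index ℓ avoiding
-- v₁ has the form {m v₁ + n v₂ : ℓ ∣ m + n x}.
--
-- From ideals to forms, the determinant trick gives 𝔭𝔞 ≠ 𝔞 and properness of 𝔞
-- gives 𝔭𝔞 ⊈ ℓ𝔞, so 𝔭𝔞 has index ℓ in 𝔞; it contains no minimal vector of 𝔞, as
-- it would then be generated by such vectors.  Hence S and S′ are the shells of
-- minimal vectors of 𝔞 and 𝔭𝔞.  If (p , q), (r , s) are coordinates of minimal
-- generators of M, then t (p q − r s) = r² + s² − p² − q² determines t, except
-- when L is hexagonal, where a third pair in S determines it.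
--
-- Conversely the same equation makes t = b / a rational, τ = v₂ / v₁ is a root of
-- a X² − b X + a, and 𝒪 = ℤ[a τ] is the coefficient ring of L.  It is also that of
-- M, and M comes from the ideal ℤ ℓ + ℤ (a τ − a x), provided that ℓ divides the
-- norm form on M exactly once.  Otherwise L ⊇ M, or dually M ⊇ ℓ L, is up to sign
-- the sublattice {ℓ ∣ m ± n} of a well-rounded lattice; when it is itself
-- well rounded, the lattice is square with ℓ = 2 or hexagonal with ℓ = 3, and there
-- ℓ does divide the norm form exactly once.

open import Defs
open import Algebra.Bundles using (CommutativeRing; RawRing)
import Algebra.Properties.CommutativeMonoid.Sum as MonoidSum
import Algebra.Properties.Ring as RingProperties
import Algebra.Properties.Semiring.Exp as Exp
import Algebra.Solver.Ring as RingSolver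
import Algebra.Solver.Ring.AlmostCommutativeRing as ACR
open ACR using (_-Raw-AlmostCommutative⟶_)
open import Algebra.Structures using (IsCommutativeRing)
open import Data.Empty using (⊥; ⊥-elim)
open import Data.Fin using (Fin; zero; suc; toℕ; fromℕ<)
open import Data.Fin.Permutation using (Permutation; permutation)
import Data.Fin.Properties as Finₚ
open import Data.Integer using (ℤ; -[1+_]) renaming (+_ to pos)
import Data.Integer as ℤ
import Data.Integer.DivMod as ℤD
open import Data.Integer.Divisibility.Signed using (_∣_; divides; ∣ᵤ⇒∣; ∣⇒∣ᵤ; ∣m∣n⇒∣m+n; ∣m∣n⇒∣m-n; ∣m⇒∣-m; ∣n⇒∣m*n; ∣m⇒∣m*n; *-cancelʳ-∣; ∣-refl; ∣-trans; _∣?_)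
import Data.Integer.GCD as ℤGCD
import Data.Integer.Properties as ℤₚ
import Data.Integer.Solver as ℤSolver
open import Data.Maybe using (Maybe; just; nothing)
open import Data.Nat using (ℕ; zero; suc)
import Data.Nat as ℕ
import Data.Nat.Divisibility as ℕD
import Data.Nat.GCD
open import Data.Nat.GCD using (module Bézout)
open import Data.Nat.Primality using (Prime; euclidsLemma; prime⇒irreducible; prime⇒nonZero; prime⇒nonTrivial)
import Data.Nat.Properties as ℕₚ
open import Data.Product using (∃; ∃₂; ∃!; _×_; _,_; proj₁; proj₂)
open import Data.Rational using (ℚ; ↥_; ↧_)
import Data.Rational as ℚ
import Data.Rational.Properties as ℚₚ
open import Data.Sum using (_⊎_; inj₁; inj₂; [_,_]′)
open import Data.Vec using (Vec; []; _∷_)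
import Data.Vec as Vec
open import Data.Vec.N-ary using (N-ary; _$ⁿ_)
import Data.Vec.Properties as Vecₚ
open import Function using (_∘_; case_of_)
open import Level using (0ℓ)
open import Relation.Binary.Definitions using (Tri; tri<; tri≈; tri>)
open import Relation.Binary.PropositionalEquality
open import Relation.Binary.Structures using (IsStrictTotalOrder)
open import Relation.Nullary using (¬_; Dec; yes; no)
open import Relation.Unary using (_∈_; _∉_; _⊆_; _≐_)

-- Why ℓ has to divide the norm form on M exactly once: let f = a m² + b m n + a n², primitive
-- because a and b are coprime. In the basis (ℓ , 0), (-x , 1) of M it becomes a ℓ² X² - ℓ B X Y +
-- n₀ Y², with B = 2 a x - b and n₀ = f(-x , 1). After division by ℓ the coefficients are a ℓ, -B
-- and n₀ / ℓ. They must be integers for M to be a module over ℤ[a τ], and coprime for the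
-- coefficient ring of M not to be larger.
--
-- Each of the two possible failures yields a congruence modulo ℓ with a sign in it. If ℓ ∤ n₀, then
-- f is n₀ n² modulo ℓ on M, and its equal values at the minimal generators (p , q), (r , s) give q
-- ≡ ± s. If ℓ ∣ B and ℓ² ∣ n₀, then n₀ - x B = a (1 - x²) gives x ≡ ± 1. The first says that ℓ L is
-- of the form {ℓ ∣ m ± n} in M, the second that M is of this form in L.

-- Ring solver with integer coefficients

module IntegerCoefficients
  (C : Set) (_+_ _*_ : C → C → C) (-_ : C → C) (0# 1# : C)
  (isCommutativeRing : IsCommutativeRing _≡_ _+_ _*_ -_ 0# 1#)
  (ι : ℤ → C)
  (ι-+ : ∀ i j → ι (i ℤ.+ j) ≡ (ι i + ι j))
  (ι-* : ∀ i j → ι (i ℤ.* j) ≡ (ι i * ι j))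
  (ι-neg : ∀ i → ι (ℤ.- i) ≡ (- ι i))
  (ι-0 : ι (pos 0) ≡ 0#) (ι-1 : ι (pos 1) ≡ 1#)
  where

  ring : CommutativeRing 0ℓ 0ℓ
  ring = record { isCommutativeRing = isCommutativeRing }

  private
    acr : ACR.AlmostCommutativeRing 0ℓ 0ℓ
    acr = ACR.fromCommutativeRing ring

    ℤ-raw : RawRing 0ℓ 0ℓ
    ℤ-raw = CommutativeRing.rawRing ℤₚ.+-*-commutativeRing

    module E = Exp (CommutativeRing.semiring ring)

  -- Agrees with ι, but sends the literals 0 and 1 to the constants of the ring
  -- definitionally.
  coeff : ℤ → C
  coeff (pos 0) = 0#
  coeff (pos 1) = 1#
  coeff i       = ι i

  coeff≡ : ∀ i → coeff i ≡ ι i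
  coeff≡ (pos 0) = sym ι-0
  coeff≡ (pos 1) = sym ι-1
  coeff≡ (pos (suc (suc n))) = refl
  coeff≡ -[1+ n ] = refl

  private
    lift₂ : (_∙_ : ℤ → ℤ → ℤ) (_⊙_ : C → C → C) →
            (∀ i j → ι (i ∙ j) ≡ (ι i ⊙ ι j)) →
            ∀ i j → coeff (i ∙ j) ≡ (coeff i ⊙ coeff j)
    lift₂ _∙_ _⊙_ h i j = trans (coeff≡ (i ∙ j)) (trans (h i j)
      (sym (cong₂ _⊙_ (coeff≡ i) (coeff≡ j))))

    morphism : ℤ-raw -Raw-AlmostCommutative⟶ acr
    morphism = record
      { ⟦_⟧ = coeff
      ; +-homo = lift₂ ℤ._+_ _+_ ι-+
      ; *-homo = lift₂ ℤ._*_ _*_ ι-*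
      ; -‿homo = λ i → trans (coeff≡ (ℤ.- i)) (trans (ι-neg i) (cong -_ (sym (coeff≡ i))))
      ; 0-homo = refl
      ; 1-homo = refl
      }

  private
    coeff≟ : ∀ i j → Maybe (coeff i ≡ coeff j)
    coeff≟ i j with i ℤₚ.≟ j
    ... | yes eq = just (cong coeff eq)
    ... | no _   = nothing

  open RingSolver ℤ-raw acr morphism coeff≟ public

  evalℤ : ∀ {n} → Polynomial n → Vec ℤ n → ℤ
  evalℤ (op [+] p q) ρ = evalℤ p ρ ℤ.+ evalℤ q ρ
  evalℤ (op [*] p q) ρ = evalℤ p ρ ℤ.* evalℤ q ρ
  evalℤ (con c) ρ = c
  evalℤ (var x) ρ = Vec.lookup ρ x
  evalℤ (p :^ n) ρ = evalℤ p ρ ℤ.^ n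
  evalℤ (:- p) ρ = ℤ.- evalℤ p ρ

  private
    ι-^ : ∀ i n → ι (i ℤ.^ n) ≡ (ι i E.^ n)
    ι-^ i zero = ι-1
    ι-^ i (suc n) = trans (ι-* i (i ℤ.^ n)) (cong (ι i *_) (ι-^ i n))

  ι-eval : ∀ {n} (p : Polynomial n) (ρ : Vec ℤ n) → ι (evalℤ p ρ) ≡ ⟦ p ⟧ (Vec.map ι ρ)
  ι-eval (op [+] p q) ρ = trans (ι-+ (evalℤ p ρ) (evalℤ q ρ)) (cong₂ _+_ (ι-eval p ρ) (ι-eval q ρ))
  ι-eval (op [*] p q) ρ = trans (ι-* (evalℤ p ρ) (evalℤ q ρ)) (cong₂ _*_ (ι-eval p ρ) (ι-eval q ρ))
  ι-eval (con c) ρ = sym (coeff≡ c)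
  ι-eval (var x) ρ = sym (Vecₚ.lookup-map x ι ρ)
  ι-eval (p :^ n) ρ = trans (ι-^ (evalℤ p ρ) n) (cong (E._^ n) (ι-eval p ρ))
  ι-eval (:- p) ρ = trans (ι-neg (evalℤ p ρ)) (cong -_ (ι-eval p ρ))

  -- `evalℤ` reduces to the integer expression itself, so one application carries a whole polynomial
  -- expression through `ι`, in place of a chain of homomorphism steps.
  cast : ∀ n (f : N-ary n (Polynomial n) (Polynomial n)) (ρ : Vec ℤ n) →
         let p = f $ⁿ Vec.map var (Vec.allFin n) in
         ι (evalℤ p ρ) ≡ ⟦ p ⟧ (Vec.map ι ρ)
  cast n f = ι-eval (f $ⁿ Vec.map var (Vec.allFin n))

-- Integer arithmetic

module Integers where
  open import Data.Integer using (_+_; _*_; -_; _-_) renaming (∣_∣ to abs)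
  module Z = ℤSolver.+-*-Solver
  open Z using (solve; _:=_; _:+_; _:*_; _:-_; :-_; con)

  abs-sign : ∀ i → ∃ λ s → pos (abs i) ≡ s * i
  abs-sign i with ℤₚ.+∣i∣≡i⊎+∣i∣≡-i i
  ... | inj₁ e = pos 1 , trans e (sym (ℤₚ.*-identityˡ i))
  ... | inj₂ e = ℤ.- pos 1 , trans e (sym (ℤₚ.-1*i≡-i i))

  record GCD (a b : ℤ) : Set where
    field
      g : ℤ
      g∣a : g ∣ a
      g∣b : g ∣ b
      i j : ℤ
      bezout : i * a + j * b ≡ g

  -- Bézout's identity for the absolute values, with the coefficients multiplied by the signs of a
  -- and b.
  gcd : ∀ a b → GCD a b
  gcd a b with Bézout.lemma (abs a) (abs b) | abs-sign a | abs-sign b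
  ... | Bézout.result d isGCD id | s , sa | t , tb = record
    { g = pos d
    ; g∣a = ∣ᵤ⇒∣ (proj₁ (Data.Nat.GCD.GCD.commonDivisor isGCD))
    ; g∣b = ∣ᵤ⇒∣ (proj₂ (Data.Nat.GCD.GCD.commonDivisor isGCD))
    ; i = proj₁ (ij id) ; j = proj₁ (proj₂ (ij id)) ; bezout = proj₂ (proj₂ (ij id)) }
    where
    push : ∀ x y m n → d ℕ.+ y ℕ.* n ≡ x ℕ.* m → pos d ≡ pos x * pos m - pos y * pos n
    push x y m n eq = begin
      pos d                                     ≡⟨ solve 2 (λ d e → d := d :+ e :- e) refl (pos d) (pos y * pos n) ⟩
      pos d + pos y * pos n - pos y * pos n     ≡⟨ cong (λ w → pos d + w - pos y * pos n) (ℤₚ.pos-* y n) ⟨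
      pos d + pos (y ℕ.* n) - pos y * pos n     ≡⟨ cong (_- pos y * pos n) (trans (sym (ℤₚ.pos-+ d (y ℕ.* n))) (cong pos eq)) ⟩
      pos (x ℕ.* m) - pos y * pos n             ≡⟨ cong (_- pos y * pos n) (ℤₚ.pos-* x m) ⟩
      pos x * pos m - pos y * pos n             ∎
      where open ≡-Reasoning
    ij : Bézout.Identity d (abs a) (abs b) → ∃₂ λ i j → i * a + j * b ≡ pos d
    ij (Bézout.+- x y eq) = pos x * s , - (pos y * t) , sym (trans (push x y (abs a) (abs b) eq)
      (trans (cong₂ (λ u v → pos x * u - pos y * v) sa tb)
      (solve 6 (λ x y s t a b → x :* (s :* a) :- y :* (t :* b) := x :* s :* a :+ :- (y :* t) :* b) refl (pos x) (pos y) s t a b)))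
    ij (Bézout.-+ x y eq) = - (pos x * s) , pos y * t , sym (trans (push y x (abs b) (abs a) eq)
      (trans (cong₂ (λ u v → pos y * v - pos x * u) sa tb)
      (solve 6 (λ x y s t a b → y :* (t :* b) :- x :* (s :* a) := :- (x :* s) :* a :+ (y :* t) :* b) refl (pos x) (pos y) s t a b)))

  ∣abs∣ : ∀ {n i} → (abs i) ≡ n → i ≡ pos n ⊎ i ≡ - pos n
  ∣abs∣ {n} {i} refl with ℤₚ.+∣i∣≡i⊎+∣i∣≡-i i
  ... | inj₁ e = inj₁ (sym e)
  ... | inj₂ e = inj₂ (trans (sym (ℤₚ.neg-involutive i)) (cong -_ (sym e)))

  i*i≢0 : ∀ {i j} → i ≢ pos 0 → j ≢ pos 0 → i * j ≢ pos 0
  i*i≢0 {i} {j} ni nj e with ℤₚ.i*j≡0⇒i≡0∨j≡0 i e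
  ... | inj₁ p = ni p
  ... | inj₂ p = nj p

  cancelʳ : ∀ {i j k} → k ≢ pos 0 → i * k ≡ j * k → i ≡ j
  cancelʳ {i} {j} {k} nz e = ℤₚ.*-cancelʳ-≡ i j k {{ℤ.≢-nonZero nz}} e

  ∣-antisym-± : ∀ {i j} → i ∣ j → j ∣ i → i ≡ j ⊎ i ≡ - j
  ∣-antisym-± {i} {j} p q with ∣abs∣ {(abs j)} {i} (ℕD.∣-antisym (∣⇒∣ᵤ p) (∣⇒∣ᵤ q)) | ℤₚ.+∣i∣≡i⊎+∣i∣≡-i j
  ... | inj₁ e | inj₁ e′ = inj₁ (trans e e′)
  ... | inj₁ e | inj₂ e′ = inj₂ (trans e e′)
  ... | inj₂ e | inj₁ e′ = inj₂ (trans e (cong -_ e′))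
  ... | inj₂ e | inj₂ e′ = inj₁ (trans e (trans (cong -_ e′) (ℤₚ.neg-involutive j)))

  ∣-resp : ∀ {d a b} → d ∣ a → a ≡ b → d ∣ b
  ∣-resp p refl = p

  private
    4r²≤d² : ∀ {r d} → 2 ℕ.* r ℕ.≤ d → pos 4 * (pos r * pos r) ℤ.≤ pos d * pos d
    4r²≤d² {r} {d} h = subst₂ ℤ._≤_ lhs (ℤₚ.pos-* d d) (ℤ.+≤+ (ℕₚ.*-mono-≤ h h))
      where
      lhs : pos (2 ℕ.* r ℕ.* (2 ℕ.* r)) ≡ pos 4 * (pos r * pos r)
      lhs = trans (ℤₚ.pos-* (2 ℕ.* r) (2 ℕ.* r)) (trans (cong (λ w → w * w) (ℤₚ.pos-* 2 r))
        (solve 1 (λ r → con (pos 2) :* r :* (con (pos 2) :* r) := con (pos 4) :* (r :* r)) refl (pos r)))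

    symmetric-divisionℕ : ∀ x d .{{_ : ℕ.NonZero d}} →
      ∃₂ λ q r → x ≡ q * pos d + r × pos 4 * (r * r) ℤ.≤ pos d * pos d
    symmetric-divisionℕ x d with 2 ℕ.* (x ℤD.%ℕ d) ℕ.≤? d
    ... | yes h = x ℤD./ℕ d , pos (x ℤD.%ℕ d)
                , trans (ℤD.a≡a%ℕn+[a/ℕn]*n x d) (ℤₚ.+-comm (pos (x ℤD.%ℕ d)) ((x ℤD./ℕ d) * pos d)) , 4r²≤d² {x ℤD.%ℕ d} {d} h
    -- A remainder r > d / 2 is replaced by r - d = -s, and the quotient goes up by one.
    ... | no h = (x ℤD./ℕ d) + pos 1 , - pos s , eq , subst (ℤ._≤ pos d * pos d) sq (4r²≤d² {s} {d} 2s≤d)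
      where
      r s : ℕ
      r = x ℤD.%ℕ d
      s = d ℕ.∸ r
      r+s : r ℕ.+ s ≡ d
      r+s = ℕₚ.m+[n∸m]≡n (ℕₚ.<⇒≤ (ℤD.n%ℕd<d x d))
      2s≤d : 2 ℕ.* s ℕ.≤ d
      2s≤d = ℕₚ.+-cancelˡ-≤ (2 ℕ.* r) _ _ (begin
        2 ℕ.* r ℕ.+ 2 ℕ.* s   ≡⟨ ℕₚ.*-distribˡ-+ 2 r s ⟨
        2 ℕ.* (r ℕ.+ s)       ≡⟨ cong (2 ℕ.*_) r+s ⟩
        2 ℕ.* d               ≡⟨ cong (d ℕ.+_) (ℕₚ.+-identityʳ d) ⟩
        d ℕ.+ d               ≤⟨ ℕₚ.+-monoˡ-≤ d (ℕₚ.<⇒≤ (ℕₚ.≰⇒> h)) ⟩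
        2 ℕ.* r ℕ.+ d         ∎)
        where open ℕₚ.≤-Reasoning
      sq : pos 4 * (pos s * pos s) ≡ pos 4 * (- pos s * - pos s)
      sq = solve 1 (λ s → con (pos 4) :* (s :* s) := con (pos 4) :* (:- s :* :- s)) refl (pos s)
      eq : x ≡ ((x ℤD./ℕ d) + pos 1) * pos d + - pos s
      eq = begin
        x                                      ≡⟨ ℤD.a≡a%ℕn+[a/ℕn]*n x d ⟩
        pos r + q * pos d                      ≡⟨ solve 4 (λ r s q d → r :+ q :* d := q :* d :+ (r :+ s) :+ :- s) refl (pos r) (pos s) q (pos d) ⟩
        q * pos d + (pos r + pos s) + - pos s  ≡⟨ cong (λ w → q * pos d + w + - pos s) (trans (sym (ℤₚ.pos-+ r s)) (cong pos r+s)) ⟩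
        q * pos d + pos d + - pos s            ≡⟨ solve 3 (λ s q d → q :* d :+ d :+ :- s := (q :+ con (pos 1)) :* d :+ :- s) refl (pos s) q (pos d) ⟩
        (q + pos 1) * pos d + - pos s          ∎
        where
        open ≡-Reasoning
        q = x ℤD./ℕ d

  -- Division with the remainder of least absolute value. The bound |r| ≤ |D| / 2 is squared so that
  -- it passes to ℝ without any discussion of signs.
  symmetric-division : ∀ x D → D ≢ pos 0 →
    ∃₂ λ q r → x ≡ q * D + r × pos 4 * (r * r) ℤ.≤ D * D
  symmetric-division x (pos zero) nz = ⊥-elim (nz refl)
  symmetric-division x (pos (suc d)) nz = symmetric-divisionℕ x (suc d)
  symmetric-division x -[1+ d ] nz with symmetric-divisionℕ x (suc d)
  ... | q , r , e , h = - q , r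
    , trans e (cong (_+ r) (solve 2 (λ q d → q :* d := :- q :* :- d) refl q (pos (suc d)))) , h

  module PrimeKit {ℓ : ℕ} (ℓ-prime : Prime ℓ) where
    L : ℤ
    L = pos ℓ

    ℓ≢0 : ℓ ≢ 0
    ℓ≢0 refl = ℕ.≢-nonZero⁻¹ 0 {{prime⇒nonZero ℓ-prime}} refl

    L≢0 : L ≢ pos 0
    L≢0 e = ℓ≢0 (ℤₚ.+-injective e)

    2≤ℓ : 2 ℕ.≤ ℓ
    2≤ℓ = ℕ.nonTrivial⇒n>1 ℓ {{prime⇒nonTrivial ℓ-prime}}

    L∤1 : ¬ L ∣ pos 1
    L∤1 h = ℕₚ.<⇒≢ 2≤ℓ (sym (ℕD.∣1⇒≡1 (∣⇒∣ᵤ h)))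

    euclid : ∀ {m n} → L ∣ m * n → L ∣ m ⊎ L ∣ n
    euclid {m} {n} h with euclidsLemma (abs m) (abs n) ℓ-prime
                       (subst (ℓ ℕD.∣_) (ℤₚ.abs-* m n) (∣⇒∣ᵤ h))
    ... | inj₁ p = inj₁ (∣ᵤ⇒∣ p)
    ... | inj₂ p = inj₂ (∣ᵤ⇒∣ p)

    divisor-± : ∀ {d} → d ∣ L → (d ≡ pos 1 ⊎ d ≡ - pos 1) ⊎ (d ≡ L ⊎ d ≡ - L)
    divisor-± h with prime⇒irreducible ℓ-prime (∣⇒∣ᵤ h)
    ... | inj₁ e = inj₁ (∣abs∣ e)
    ... | inj₂ e = inj₂ (∣abs∣ e)

    prime-bezout : ∀ {k} → ¬ L ∣ k → ∃₂ λ i j → i * k + j * L ≡ pos 1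
    prime-bezout {k} nd with gcd k L
    ... | record { g = g ; g∣a = g∣k ; g∣b = g∣L ; i = i ; j = j ; bezout = e } with divisor-± g∣L
    ... | inj₁ (inj₁ refl) = i , j , e
    ... | inj₁ (inj₂ refl) = - i , - j , trans
            (solve 4 (λ i j k l → :- i :* k :+ :- j :* l := :- (i :* k :+ j :* l)) refl i j k L) (cong -_ e)
    ... | inj₂ (inj₁ refl) = ⊥-elim (nd g∣k)
    ... | inj₂ (inj₂ refl) = ⊥-elim (nd (∣-trans (divides (- pos 1) (solve 1 (λ l → :- l := con (- pos 1) :* l) refl L) ) g∣k))

module _ (R : RealNumbers) where

  open Integers
  open Over R
  open IsCommutativeRing isCommutativeRing
    using (+-assoc; +-comm; +-identityˡ; +-identityʳ; *-assoc; *-comm; *-identityˡ;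
           *-identityʳ; distribˡ; distribʳ; zeroˡ; zeroʳ; -‿inverseˡ; -‿inverseʳ)
  module O = IsStrictTotalOrder isStrictTotalOrder

  ℝ-ring : CommutativeRing 0ℓ 0ℓ
  ℝ-ring = record { isCommutativeRing = isCommutativeRing }

  open RingProperties (CommutativeRing.ring ℝ-ring)
    using (-‿distribˡ-*; -‿distribʳ-*; -0#≈0#; -‿involutive; -‿+-comm)

  -- The integers inside the reals

  fromℕ-+ : ∀ m n → fromℕ (m ℕ.+ n) ≡ fromℕ m + fromℕ n
  fromℕ-+ zero    n = sym (+-identityˡ _)
  fromℕ-+ (suc m) n = trans (cong (1ℝ +_) (fromℕ-+ m n)) (sym (+-assoc _ _ _))

  fromℕ-* : ∀ m n → fromℕ (m ℕ.* n) ≡ fromℕ m * fromℕ n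
  fromℕ-* zero    n = sym (zeroˡ _)
  fromℕ-* (suc m) n = begin
    fromℕ (n ℕ.+ m ℕ.* n)              ≡⟨ fromℕ-+ n (m ℕ.* n) ⟩
    fromℕ n + fromℕ (m ℕ.* n)          ≡⟨ cong₂ _+_ (sym (*-identityˡ _)) (fromℕ-* m n) ⟩
    1ℝ * fromℕ n + fromℕ m * fromℕ n   ≡⟨ distribʳ _ _ _ ⟨
    fromℕ (suc m) * fromℕ n            ∎
    where open ≡-Reasoning

  fromℤ-neg : ∀ i → fromℤ (ℤ.- i) ≡ - fromℤ i
  fromℤ-neg (pos zero)  = sym -0#≈0#
  fromℤ-neg (pos (suc n)) = refl
  fromℤ-neg -[1+ n ]  = sym (-‿involutive _)

  fromℤ-⊖ : ∀ m n → fromℤ (m ℤ.⊖ n) ≡ fromℕ m + - fromℕ n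
  fromℤ-⊖ m zero = sym (trans (cong (fromℕ m +_) -0#≈0#) (+-identityʳ _))
  fromℤ-⊖ zero (suc n) = sym (+-identityˡ _)
  fromℤ-⊖ (suc m) (suc n) = begin
    fromℤ (suc m ℤ.⊖ suc n)           ≡⟨ cong fromℤ (ℤₚ.[1+m]⊖[1+n]≡m⊖n m n) ⟩
    fromℤ (m ℤ.⊖ n)                   ≡⟨ fromℤ-⊖ m n ⟩
    fromℕ m + - fromℕ n               ≡⟨ cong (_+ - fromℕ n) (sym lem) ⟩
    (- 1ℝ + (1ℝ + fromℕ m)) + - fromℕ n ≡⟨ cong (_+ - fromℕ n) (+-comm _ _) ⟩
    (fromℕ (suc m) + - 1ℝ) + - fromℕ n  ≡⟨ +-assoc _ _ _ ⟩
    fromℕ (suc m) + (- 1ℝ + - fromℕ n)  ≡⟨ cong (fromℕ (suc m) +_) (-‿+-comm _ _) ⟩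
    fromℕ (suc m) + - fromℕ (suc n)     ∎
    where
    open ≡-Reasoning
    lem : - 1ℝ + (1ℝ + fromℕ m) ≡ fromℕ m
    lem = trans (sym (+-assoc _ _ _)) (trans (cong (_+ fromℕ m) (-‿inverseˡ _)) (+-identityˡ _))

  fromℤ-+ : ∀ i j → fromℤ (i ℤ.+ j) ≡ fromℤ i + fromℤ j
  fromℤ-+ (pos m)    (pos n)    = fromℕ-+ m n
  fromℤ-+ (pos m)    -[1+ n ] = fromℤ-⊖ m (suc n)
  fromℤ-+ -[1+ m ] (pos n)    = trans (fromℤ-⊖ n (suc m)) (+-comm _ _)
  fromℤ-+ -[1+ m ] -[1+ n ] = begin
    - fromℕ (suc (suc (m ℕ.+ n)))       ≡⟨ cong (λ k → - fromℕ (suc k)) (ℕₚ.+-suc m n) ⟨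
    - fromℕ (suc m ℕ.+ suc n)           ≡⟨ cong -_ (fromℕ-+ (suc m) (suc n)) ⟩
    - (fromℕ (suc m) + fromℕ (suc n))   ≡⟨ -‿+-comm _ _ ⟨
    - fromℕ (suc m) + - fromℕ (suc n)   ∎
    where open ≡-Reasoning

  fromℤ-pos-* : ∀ m j → fromℤ (pos m ℤ.* j) ≡ fromℕ m * fromℤ j
  fromℤ-pos-* m (pos n) = trans (cong fromℤ (sym (ℤₚ.pos-* m n))) (fromℕ-* m n)
  fromℤ-pos-* m -[1+ n ] = begin
    fromℤ (pos m ℤ.* -[1+ n ])          ≡⟨ cong fromℤ (ℤₚ.neg-distribʳ-* (pos m) (pos (suc n))) ⟨
    fromℤ (ℤ.- (pos m ℤ.* pos (suc n))) ≡⟨ fromℤ-neg (pos m ℤ.* pos (suc n)) ⟩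
    - fromℤ (pos m ℤ.* pos (suc n))     ≡⟨ cong -_ (fromℤ-pos-* m (pos (suc n))) ⟩
    - (fromℕ m * fromℕ (suc n))         ≡⟨ -‿distribʳ-* _ _ ⟩
    fromℕ m * - fromℕ (suc n)           ∎
    where open ≡-Reasoning

  fromℤ-* : ∀ i j → fromℤ (i ℤ.* j) ≡ fromℤ i * fromℤ j
  fromℤ-* (pos m) j = fromℤ-pos-* m j
  fromℤ-* -[1+ m ] j = begin
    fromℤ (-[1+ m ] ℤ.* j)            ≡⟨ cong fromℤ (ℤₚ.neg-distribˡ-* (pos (suc m)) j) ⟨
    fromℤ (ℤ.- (pos (suc m) ℤ.* j))   ≡⟨ fromℤ-neg (pos (suc m) ℤ.* j) ⟩
    - fromℤ (pos (suc m) ℤ.* j)       ≡⟨ cong -_ (fromℤ-pos-* (suc m) j) ⟩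
    - (fromℕ (suc m) * fromℤ j)       ≡⟨ -‿distribˡ-* _ _ ⟩
    - fromℕ (suc m) * fromℤ j         ∎
    where open ≡-Reasoning

  fromℤ-1 : fromℤ (pos 1) ≡ 1ℝ
  fromℤ-1 = +-identityʳ 1ℝ

  module ℝS = IntegerCoefficients ℝ _+_ _*_ (λ x → - x) 0ℝ 1ℝ isCommutativeRing
    fromℤ fromℤ-+ fromℤ-* fromℤ-neg refl fromℤ-1

  -- Ordered field arithmetic

  ≤-refl : ∀ {x} → x ≤ x
  ≤-refl = inj₂ refl

  ≤-trans : ∀ {x y z} → x ≤ y → y ≤ z → x ≤ z
  ≤-trans (inj₁ p) (inj₁ q) = inj₁ (O.trans p q)
  ≤-trans (inj₁ p) (inj₂ refl) = inj₁ p
  ≤-trans (inj₂ refl) q = q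

  <-≤-trans : ∀ {x y z} → x < y → y ≤ z → x < z
  <-≤-trans p (inj₁ q) = O.trans p q
  <-≤-trans p (inj₂ refl) = p

  ≤-<-trans : ∀ {x y z} → x ≤ y → y < z → x < z
  ≤-<-trans (inj₁ p) q = O.trans p q
  ≤-<-trans (inj₂ refl) q = q

  <-irrefl : ∀ {x} → ¬ (x < x)
  <-irrefl = O.irrefl refl

  <⇒≢ : ∀ {x y} → x < y → x ≢ y
  <⇒≢ p refl = <-irrefl p

  <⇒≱ : ∀ {x y} → x < y → ¬ (y ≤ x)
  <⇒≱ p q = <-irrefl (<-≤-trans p q)

  ≤-antisym : ∀ {x y} → x ≤ y → y ≤ x → x ≡ y
  ≤-antisym (inj₂ e) _ = e
  ≤-antisym (inj₁ p) q = ⊥-elim (<⇒≱ p q)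

  ≮⇒≥ : ∀ {x y} → ¬ (x < y) → y ≤ x
  ≮⇒≥ {x} {y} h with O.compare x y
  ... | tri< p _ _ = ⊥-elim (h p)
  ... | tri≈ _ e _ = inj₂ (sym e)
  ... | tri> _ _ p = inj₁ p

  ≰⇒> : ∀ {x y} → ¬ (x ≤ y) → y < x
  ≰⇒> {x} {y} h with O.compare x y
  ... | tri< p _ _ = ⊥-elim (h (inj₁ p))
  ... | tri≈ _ e _ = ⊥-elim (h (inj₂ e))
  ... | tri> _ _ p = p

  ≤∧≢⇒< : ∀ {x y} → x ≤ y → x ≢ y → x < y
  ≤∧≢⇒< (inj₁ p) _ = p
  ≤∧≢⇒< (inj₂ e) n = ⊥-elim (n e)

  open ℝS using (_:=_; _:+_; _:*_; _:-_; :-_; con)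

  x<y⇒0<y-x : ∀ {x y} → x < y → 0ℝ < y + - x
  x<y⇒0<y-x {x} {y} p = subst (_< y + - x) (-‿inverseʳ x) (+-monoˡ-< (- x) p)

  0<y-x⇒x<y : ∀ {x y} → 0ℝ < y + - x → x < y
  0<y-x⇒x<y {x} {y} p = subst₂ _<_ (+-identityˡ x)
    (ℝS.solve 2 (λ x y → y :- x :+ x := y) refl x y) (+-monoˡ-< x p)

  x≤y⇒0≤y-x : ∀ {x y} → x ≤ y → 0ℝ ≤ y + - x
  x≤y⇒0≤y-x (inj₁ p) = inj₁ (x<y⇒0<y-x p)
  x≤y⇒0≤y-x (inj₂ refl) = inj₂ (sym (-‿inverseʳ _))

  0≤y-x⇒x≤y : ∀ {x y} → 0ℝ ≤ y + - x → x ≤ y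
  0≤y-x⇒x≤y (inj₁ p) = inj₁ (0<y-x⇒x<y p)
  0≤y-x⇒x≤y {x} {y} (inj₂ e) = inj₂ (begin
    x              ≡⟨ +-identityˡ x ⟨
    0ℝ + x         ≡⟨ cong (_+ x) e ⟩
    y + - x + x    ≡⟨ ℝS.solve 2 (λ x y → y :- x :+ x := y) refl x y ⟩
    y              ∎)
    where open ≡-Reasoning

  0<-+ : ∀ {x y} → 0ℝ < x → 0ℝ ≤ y → 0ℝ < x + y
  0<-+ {x} {y} p q = ≤-<-trans q
    (subst (_< x + y) (+-identityˡ y) (+-monoˡ-< y p))

  infixl 6 _⊕_
  _⊕_ : ∀ {x y} → 0ℝ ≤ x → 0ℝ ≤ y → 0ℝ ≤ x + y
  inj₁ p ⊕ q = inj₁ (0<-+ p q)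
  _⊕_ {y = y} (inj₂ refl) q = subst (0ℝ ≤_) (sym (+-identityˡ y)) q

  infixl 7 _⊛_
  _⊛_ : ∀ {x y} → 0ℝ ≤ x → 0ℝ ≤ y → 0ℝ ≤ x * y
  inj₁ p ⊛ inj₁ q = inj₁ (*-pos p q)
  _⊛_ {x} (inj₁ p) (inj₂ refl) = inj₂ (sym (zeroʳ x))
  _⊛_ {y = y} (inj₂ refl) q = inj₂ (sym (zeroˡ y))

  0≤x² : ∀ x → 0ℝ ≤ x * x
  0≤x² x with O.compare x 0ℝ
  ... | tri≈ _ refl _ = inj₂ (sym (zeroˡ _))
  ... | tri> _ _ p = inj₁ (*-pos p p)
  ... | tri< p _ _ = subst (0ℝ ≤_) (ℝS.solve 1 (λ x → (con (pos 0) :- x) :* (con (pos 0) :- x) := x :* x) refl x)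
      (inj₁ (*-pos (x<y⇒0<y-x p) (x<y⇒0<y-x p)))

  0≤1 : 0ℝ ≤ 1ℝ
  0≤1 = inj₁ 0<1

  0≤fromℕ : ∀ n → 0ℝ ≤ fromℕ n
  0≤fromℕ zero = ≤-refl
  0≤fromℕ (suc n) = 0≤1 ⊕ 0≤fromℕ n

  0<fromℕ : ∀ n → 0ℝ < fromℕ (suc n)
  0<fromℕ n = 0<-+ 0<1 (0≤fromℕ n)

  0<2 : 0ℝ < fromℤ (pos 2)
  0<2 = 0<fromℕ 1

  fromℤ-mono : ∀ {i j} → i ℤ.≤ j → fromℤ i ≤ fromℤ j
  fromℤ-mono {i} {j} i≤j = 0≤y-x⇒x≤y (subst (0ℝ ≤_) eq (lem (j ℤ.- i) (ℤₚ.i≤j⇒0≤j-i i≤j)))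
    where
    lem : ∀ k → pos 0 ℤ.≤ k → 0ℝ ≤ fromℤ k
    lem (pos n) _ = 0≤fromℕ n
    eq : fromℤ (j ℤ.- i) ≡ fromℤ j + - fromℤ i
    eq = trans (fromℤ-+ j (ℤ.- i)) (cong (fromℤ j +_) (fromℤ-neg i))

  fromℤ-≡0 : ∀ i → fromℤ i ≡ 0ℝ → i ≡ pos 0
  fromℤ-≡0 (pos zero) _ = refl
  fromℤ-≡0 (pos (suc n)) e = ⊥-elim (<⇒≢ (0<fromℕ n) (sym e))
  fromℤ-≡0 -[1+ n ] e = ⊥-elim (<⇒≢ (0<fromℕ n)
    (sym (trans (sym (-‿involutive _)) (trans (cong -_ e) -0#≈0#))))

  fromℤ-injective : ∀ {i j} → fromℤ i ≡ fromℤ j → i ≡ j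
  fromℤ-injective {i} {j} e = ℤₚ.i-j≡0⇒i≡j i j (fromℤ-≡0 (i ℤ.- j) (begin
    fromℤ (i ℤ.- j)        ≡⟨ fromℤ-+ i (ℤ.- j) ⟩
    fromℤ i + fromℤ (ℤ.- j) ≡⟨ cong₂ _+_ e (fromℤ-neg j) ⟩
    fromℤ j + - fromℤ j    ≡⟨ -‿inverseʳ _ ⟩
    0ℝ                     ∎))
    where open ≡-Reasoning

  x*y≡0 : ∀ {x y} → x * y ≡ 0ℝ → x ≢ 0ℝ → y ≡ 0ℝ
  x*y≡0 {x} {y} e nz = begin
    y                  ≡⟨ *-identityˡ y ⟨
    1ℝ * y             ≡⟨ cong (_* y) (*-inverseʳ x nz) ⟨
    (x * x ⁻¹) * y     ≡⟨ ℝS.solve 3 (λ x y z → x :* z :* y := z :* (x :* y)) refl x y (x ⁻¹) ⟩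
    x ⁻¹ * (x * y)     ≡⟨ cong (x ⁻¹ *_) e ⟩
    x ⁻¹ * 0ℝ          ≡⟨ zeroʳ _ ⟩
    0ℝ                 ∎
    where open ≡-Reasoning

  *-≢0 : ∀ {x y} → x ≢ 0ℝ → y ≢ 0ℝ → x * y ≢ 0ℝ
  *-≢0 nx ny e = ny (x*y≡0 e nx)

  *-cancelˡ : ∀ {x y z} → x ≢ 0ℝ → x * y ≡ x * z → y ≡ z
  *-cancelˡ {x} {y} {z} nz e = ≤-antisym (0≤y-x⇒x≤y (inj₂ (sym lem))) (0≤y-x⇒x≤y (inj₂ (sym lem′)))
    where
    d : x * (z + - y) ≡ 0ℝ
    d = trans (ℝS.solve 3 (λ x y z → x :* (z :- y) := x :* z :- x :* y) refl x y z)
              (trans (cong (λ w → w + - (x * y)) (sym e)) (-‿inverseʳ _))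
    lem : z + - y ≡ 0ℝ
    lem = x*y≡0 d nz
    lem′ : y + - z ≡ 0ℝ
    lem′ = trans (ℝS.solve 2 (λ y z → y :- z := :- (z :- y)) refl y z) (trans (cong -_ lem) -0#≈0#)

  x²≡0 : ∀ {x} → x * x ≡ 0ℝ → x ≡ 0ℝ
  x²≡0 {x} e with x O.≟ 0ℝ
  ... | yes p = p
  ... | no np = x*y≡0 e np

  *-cancel-≤ : ∀ {c x y} → 0ℝ < c → c * x ≤ c * y → x ≤ y
  *-cancel-≤ {c} {x} {y} 0<c h = ≮⇒≥ λ y<x → <⇒≱ (0<y-x⇒x<y
    (subst (0ℝ <_) (ℝS.solve 3 (λ c x y → c :* (x :- y) := c :* x :- c :* y) refl c x y)
       (*-pos 0<c (x<y⇒0<y-x y<x)))) h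

  sum-zeroˡ : ∀ {x y} → 0ℝ ≤ x → 0ℝ ≤ y → x + y ≡ 0ℝ → x ≡ 0ℝ
  sum-zeroˡ (inj₂ e) _ _ = sym e
  sum-zeroˡ (inj₁ p) q e = ⊥-elim (<⇒≢ (0<-+ p q) (sym e))

  -- Complex numbers

  ℂ-isCommutativeRing : IsCommutativeRing _≡_ _+ᶜ_ _*ᶜ_ (λ z → -ᶜ z) 0ᶜ 1ᶜ
  ℂ-isCommutativeRing = record
    { isRing = record
      { +-isAbelianGroup = record
        { isGroup = record
          { isMonoid = record
            { isSemigroup = record
              { isMagma = record { isEquivalence = isEquivalence ; ∙-cong = cong₂ _+ᶜ_ }
              ; assoc = λ { (a , b) (c , d) (e , f) → cong₂ _,_ (+-assoc a c e) (+-assoc b d f) }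
              }
            ; identity = (λ { (a , b) → cong₂ _,_ (+-identityˡ a) (+-identityˡ b) })
                       , (λ { (a , b) → cong₂ _,_ (+-identityʳ a) (+-identityʳ b) })
            }
          ; inverse = (λ { (a , b) → cong₂ _,_ (-‿inverseˡ a) (-‿inverseˡ b) })
                    , (λ { (a , b) → cong₂ _,_ (-‿inverseʳ a) (-‿inverseʳ b) })
          ; ⁻¹-cong = cong (λ z → -ᶜ z)
          }
        ; comm = λ { (a , b) (c , d) → cong₂ _,_ (+-comm a c) (+-comm b d) }
        }
      ; *-cong = cong₂ _*ᶜ_
      ; *-assoc = λ { (a , b) (c , d) (e , f) → cong₂ _,_
          (ℝS.solve 6 (λ a b c d e f → (a :* c :- b :* d) :* e :- (a :* d :+ b :* c) :* f
             := a :* (c :* e :- d :* f) :- b :* (c :* f :+ d :* e)) refl a b c d e f)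
          (ℝS.solve 6 (λ a b c d e f → (a :* c :- b :* d) :* f :+ (a :* d :+ b :* c) :* e
             := a :* (c :* f :+ d :* e) :+ b :* (c :* e :- d :* f)) refl a b c d e f) }
      ; *-identity = (λ { (a , b) → cong₂ _,_
          (ℝS.solve 2 (λ a b → con (pos 1) :* a :- con (pos 0) :* b := a) refl a b)
          (ℝS.solve 2 (λ a b → con (pos 1) :* b :+ con (pos 0) :* a := b) refl a b) })
        , (λ { (a , b) → cong₂ _,_
          (ℝS.solve 2 (λ a b → a :* con (pos 1) :- b :* con (pos 0) := a) refl a b)
          (ℝS.solve 2 (λ a b → a :* con (pos 0) :+ b :* con (pos 1) := b) refl a b) })
      ; distrib = (λ { (a , b) (c , d) (e , f) → cong₂ _,_
          (ℝS.solve 6 (λ a b c d e f → a :* (c :+ e) :- b :* (d :+ f)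
             := a :* c :- b :* d :+ (a :* e :- b :* f)) refl a b c d e f)
          (ℝS.solve 6 (λ a b c d e f → a :* (d :+ f) :+ b :* (c :+ e)
             := a :* d :+ b :* c :+ (a :* f :+ b :* e)) refl a b c d e f) })
        , (λ { (a , b) (c , d) (e , f) → cong₂ _,_
          (ℝS.solve 6 (λ a b c d e f → (c :+ e) :* a :- (d :+ f) :* b
             := c :* a :- d :* b :+ (e :* a :- f :* b)) refl a b c d e f)
          (ℝS.solve 6 (λ a b c d e f → (c :+ e) :* b :+ (d :+ f) :* a
             := c :* b :+ d :* a :+ (e :* b :+ f :* a)) refl a b c d e f) })
      }
    ; *-comm = λ { (a , b) (c , d) → cong₂ _,_
          (ℝS.solve 4 (λ a b c d → a :* c :- b :* d := c :* a :- d :* b) refl a b c d)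
          (ℝS.solve 4 (λ a b c d → a :* d :+ b :* c := c :* b :+ d :* a) refl a b c d) }
    }

  ι : ℤ → ℂ
  ι i = fromℤ i , 0ℝ

  ι-* : ∀ i j → ι (i ℤ.* j) ≡ ι i *ᶜ ι j
  ι-* i j = cong₂ _,_
    (trans (fromℤ-* i j) (ℝS.solve 2 (λ x y → x :* y := x :* y :- con (pos 0) :* con (pos 0)) refl (fromℤ i) (fromℤ j)))
    (ℝS.solve 2 (λ x y → con (pos 0) := x :* con (pos 0) :+ con (pos 0) :* y) refl (fromℤ i) (fromℤ j))

  ι-+ : ∀ i j → ι (i ℤ.+ j) ≡ ι i +ᶜ ι j
  ι-+ i j = cong₂ _,_ (fromℤ-+ i j) (sym (+-identityˡ 0ℝ))

  ι-neg : ∀ i → ι (ℤ.- i) ≡ -ᶜ ι i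
  ι-neg i = cong₂ _,_ (fromℤ-neg i) (sym -0#≈0#)

  module C = IntegerCoefficients ℂ _+ᶜ_ _*ᶜ_ (λ z → -ᶜ z) 0ᶜ 1ᶜ ℂ-isCommutativeRing
    ι ι-+ ι-* ι-neg refl (cong (_, 0ℝ) fromℤ-1)

  module CR = CommutativeRing C.ring

  -- Subgroups of the plane and prime index

  record IsSubgroup (M : Subset) : Set where
    field
      0∈   : 0ᶜ ∈ M
      +∈   : ∀ {v w} → v ∈ M → w ∈ M → (v +ᶜ w) ∈ M
      neg∈ : ∀ {v} → v ∈ M → (-ᶜ v) ∈ M

    -∈ : ∀ {v w} → v ∈ M → w ∈ M → (v -ᶜ w) ∈ M
    -∈ p q = +∈ p (neg∈ q)

    ℕ∈ : ∀ n {v} → v ∈ M → (ι (pos n) *ᶜ v) ∈ M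
    ℕ∈ zero {v} p = subst M (sym (CR.zeroˡ v)) 0∈
    ℕ∈ (suc n) {v} p = subst M eq (+∈ p (ℕ∈ n p))
      where
      eq : v +ᶜ ι (pos n) *ᶜ v ≡ ι (pos (suc n)) *ᶜ v
      eq = trans (C.solve 2 (λ v n → v C.:+ n C.:* v C.:= (C.con (pos 1) C.:+ n) C.:* v) refl v (ι (pos n)))
           (cong (_*ᶜ v) (trans (cong (_+ᶜ ι (pos n)) (sym (cong (_, 0ℝ) fromℤ-1))) (sym (ι-+ (pos 1) (pos n)))))

    ℤ∈ : ∀ k {v} → v ∈ M → (ι k *ᶜ v) ∈ M
    ℤ∈ (pos n) p = ℕ∈ n p
    ℤ∈ -[1+ n ] {v} p = subst M (trans (C.solve 2 (λ v n → C.:- (n C.:* v) C.:= C.:- n C.:* v) refl v (ι (pos (suc n))))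
      (cong (_*ᶜ v) (sym (ι-neg (pos (suc n)))))) (neg∈ (ℕ∈ (suc n) p))

    sum∈ : ∀ {n} (f : Fin n → ℂ) → (∀ i → f i ∈ M) → sum f ∈ M
    sum∈ {zero} f h = 0∈
    sum∈ {suc n} f h = +∈ (h zero) (sum∈ (f ∘ suc) (h ∘ suc))

  module Sums = MonoidSum (CommutativeRing.+-commutativeMonoid C.ring)

  sum-const : ∀ n e → sum {n} (λ _ → e) ≡ ι (pos n) *ᶜ e
  sum-const zero e = sym (CR.zeroˡ e)
  sum-const (suc n) e = trans (cong (e +ᶜ_) (sum-const n e))
    (trans (C.solve 2 (λ v n → v C.:+ n C.:* v C.:= (C.con (pos 1) C.:+ n) C.:* v) refl e (ι (pos n)))
     (cong (_*ᶜ e) (trans (cong (_+ᶜ ι (pos n)) (sym (cong (_, 0ℝ) fromℤ-1))) (sym (ι-+ (pos 1) (pos n))))))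

  module PrimeIndex {ℓ : ℕ} (ℓ-prime : Prime ℓ) {L M : Subset}
    (sL : IsSubgroup L) (sM : IsSubgroup M) (index : HasIndex L M ℓ) where

    open PrimeKit ℓ-prime renaming (L to ℓℤ)
    private
      module L = IsSubgroup sL
      module M = IsSubgroup sM

    r : Fin ℓ → ℂ
    r = proj₁ index

    r∈ : ∀ i → r i ∈ L
    r∈ = proj₁ (proj₂ index)

    class : ∀ {v} → v ∈ L → Fin ℓ
    class p = proj₁ (proj₂ (proj₂ index) p)

    class∈ : ∀ {v} (p : v ∈ L) → (v -ᶜ r (class p)) ∈ M
    class∈ p = proj₁ (proj₂ (proj₂ (proj₂ index) p))

    class-unique : ∀ {v} (p : v ∈ L) {i} → (v -ᶜ r i) ∈ M → class p ≡ i
    class-unique p = proj₂ (proj₂ (proj₂ (proj₂ index) p))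

    class-≡ : ∀ {v w} (p : v ∈ L) (q : w ∈ L) → class p ≡ class q → (v -ᶜ w) ∈ M
    class-≡ {v} {w} p q e = subst M
      (C.solve 3 (λ v w r → v C.:- r C.:- (w C.:- r) C.:= v C.:- w) refl v w (r (class q)))
      (M.-∈ (subst (λ i → (v -ᶜ r i) ∈ M) e (class∈ p)) (class∈ q))

    -- Subsets are arbitrary predicates, but the index data assign to each element of L a coset
    -- number in `Fin ℓ`; lying in M means having the same number as 0.
    ∈M? : ∀ {v} → v ∈ L → Dec (v ∈ M)
    ∈M? {v} p with class p Finₚ.≟ class L.0∈
    ... | yes e = yes (subst M (C.solve 1 (λ v → v C.:- C.con (pos 0) C.:= v) refl v) (class-≡ p L.0∈ e))
    ... | no ne = no λ q → ne (class-unique p (subst M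
          (C.solve 2 (λ v r → v C.:+ (C.con (pos 0) C.:- r) C.:= v C.:- r) refl v (r (class L.0∈)))
          (M.+∈ q (class∈ L.0∈))))

    private
      shift : ∀ {e} → e ∈ L → Fin ℓ → Fin ℓ
      shift p i = class (L.+∈ (r∈ i) p)

      shift-inverse : ∀ {e e′} (p : e ∈ L) (q : e′ ∈ L) → e +ᶜ e′ ≡ 0ᶜ → ∀ i → shift p (shift q i) ≡ i
      shift-inverse {e} {e′} p q e+e′ i = class-unique (L.+∈ (r∈ (shift q i)) p) (subst M
          (begin
            -ᶜ (r i +ᶜ e′ -ᶜ r j)            ≡⟨ C.solve 4 (λ a b c d → C.:- (a C.:+ c C.:- d) C.:= d C.:+ b C.:- a C.:- (b C.:+ c)) refl (r i) e e′ (r j) ⟩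
            (r j +ᶜ e) -ᶜ r i -ᶜ (e +ᶜ e′)   ≡⟨ cong (λ z → (r j +ᶜ e) -ᶜ r i -ᶜ z) e+e′ ⟩
            (r j +ᶜ e) -ᶜ r i -ᶜ 0ᶜ          ≡⟨ C.solve 1 (λ z → z C.:- C.con (pos 0) C.:= z) refl ((r j +ᶜ e) -ᶜ r i) ⟩
            (r j +ᶜ e) -ᶜ r i                ∎)
          (M.neg∈ (class∈ (L.+∈ (r∈ i) q))))
        where
        open ≡-Reasoning
        j = shift q i

    -- Translation by e permutes the cosets, so the sum of the representatives
    -- changes by ℓ e, and by an element of M.
    ℓ∈ : ∀ {e} → e ∈ L → (ι ℓℤ *ᶜ e) ∈ M
    ℓ∈ {e} p = subst M eq (M.sum∈ d (λ i → class∈ (L.+∈ (r∈ i) p)))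
      where
      open ≡-Reasoning
      -p = L.neg∈ p
      π : Permutation ℓ ℓ
      π = permutation (shift p) (shift -p)
            (shift-inverse p -p (CR.-‿inverseʳ e)) (shift-inverse -p p (CR.-‿inverseˡ e))
      d : Fin ℓ → ℂ
      d i = (r i +ᶜ e) -ᶜ r (shift p i)
      total : sum d +ᶜ sum r ≡ sum r +ᶜ ι ℓℤ *ᶜ e
      total = begin
        sum d +ᶜ sum r                             ≡⟨ cong (sum d +ᶜ_) (Sums.sum-permute r π) ⟩
        sum d +ᶜ sum (r ∘ shift p)                 ≡⟨ Sums.∑-distrib-+ d (r ∘ shift p) ⟨
        sum (λ i → d i +ᶜ r (shift p i))           ≡⟨ Sums.sum-cong-≗ (λ i → C.solve 3 (λ a b c → a C.:+ b C.:- c C.:+ c C.:= a C.:+ b) refl (r i) e (r (shift p i))) ⟩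
        sum (λ i → r i +ᶜ e)                       ≡⟨ Sums.∑-distrib-+ r (λ _ → e) ⟩
        sum r +ᶜ sum {ℓ} (λ _ → e)                 ≡⟨ cong (sum r +ᶜ_) (sum-const ℓ e) ⟩
        sum r +ᶜ ι ℓℤ *ᶜ e                         ∎
      eq : sum d ≡ ι ℓℤ *ᶜ e
      eq = begin
        sum d                              ≡⟨ C.solve 2 (λ a b → a C.:= a C.:+ b C.:- b) refl (sum d) (sum r) ⟩
        sum d +ᶜ sum r -ᶜ sum r            ≡⟨ cong (_-ᶜ sum r) total ⟩
        sum r +ᶜ ι ℓℤ *ᶜ e -ᶜ sum r        ≡⟨ C.solve 2 (λ a b → a C.:+ b C.:- a C.:= b) refl (sum r) (ι ℓℤ *ᶜ e) ⟩
        ι ℓℤ *ᶜ e                          ∎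

  module Multiples {ℓ : ℕ} (ℓ-prime : Prime ℓ) {M : Subset} (sM : IsSubgroup M) where
    open PrimeKit ℓ-prime renaming (L to ℓℤ)
    private module M = IsSubgroup sM

    bezout∈ : ∀ {e k} → (ι ℓℤ *ᶜ e) ∈ M → ¬ ℓℤ ∣ k → (ι k *ᶜ e) ∈ M → e ∈ M
    bezout∈ {e} {k} ℓe nd ke with prime-bezout nd
    ... | i , j , eq = subst M (begin
        ι i *ᶜ (ι k *ᶜ e) +ᶜ ι j *ᶜ (ι ℓℤ *ᶜ e)  ≡⟨ C.solve 5 (λ i k j l e → i C.:* (k C.:* e) C.:+ j C.:* (l C.:* e) C.:= (i C.:* k C.:+ j C.:* l) C.:* e) refl (ι i) (ι k) (ι j) (ι ℓℤ) e ⟩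
        (ι i *ᶜ ι k +ᶜ ι j *ᶜ ι ℓℤ) *ᶜ e        ≡⟨ cong (_*ᶜ e) (C.cast 4 (λ i k j l → i C.:* k C.:+ j C.:* l) (i ∷ k ∷ j ∷ ℓℤ ∷ [])) ⟨
        ι (i ℤ.* k ℤ.+ j ℤ.* ℓℤ) *ᶜ e           ≡⟨ cong (λ z → ι z *ᶜ e) eq ⟩
        ι (pos 1) *ᶜ e                          ≡⟨ cong (_*ᶜ e) (cong (_, 0ℝ) fromℤ-1) ⟩
        1ᶜ *ᶜ e                                 ≡⟨ CR.*-identityˡ e ⟩
        e                                       ∎)
        (M.+∈ (M.ℤ∈ i ke) (M.ℤ∈ j ℓe))
      where open ≡-Reasoning

    k∈⇒ℓ∣k : ∀ {e k} → (ι ℓℤ *ᶜ e) ∈ M → e ∉ M → (ι k *ᶜ e) ∈ M → ℓℤ ∣ k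
    k∈⇒ℓ∣k {e} {k} ℓe e∉ ke with ℓℤ ∣? k
    ... | yes p = p
    ... | no np = ⊥-elim (e∉ (bezout∈ ℓe np ke))

  pos-∸ : ∀ {i j} → i ℕ.≤ j → pos j ℤ.- pos i ≡ pos (j ℕ.∸ i)
  pos-∸ {i} {j} i≤j = trans (ℤₚ.[+m]-[+n]≡m⊖n j i) (ℤₚ.⊖-≥ i≤j)

  residues-distinct : ∀ {ℓ i j} → i ℕ.< j → j ℕ.< ℓ → ¬ pos ℓ ∣ (pos j ℤ.- pos i)
  residues-distinct {ℓ} {i} {j} i<j j<ℓ h = ℕₚ.<⇒≱ j<ℓ (ℕₚ.≤-trans
    (ℕD.∣⇒≤ {{ℕ.>-nonZero (ℕₚ.m<n⇒0<n∸m i<j)}} (∣⇒∣ᵤ (∣-resp h (pos-∸ (ℕₚ.<⇒≤ i<j)))))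
    (ℕₚ.m∸n≤m j i))

  module PrimeIndexGenerator {ℓ : ℕ} (ℓ-prime : Prime ℓ) {L M : Subset}
    (sL : IsSubgroup L) (sM : IsSubgroup M) (index : HasIndex L M ℓ)
    {e} (e∈L : e ∈ L) (e∉M : e ∉ M) where

    open PrimeKit ℓ-prime renaming (L to ℓℤ)
    open PrimeIndex ℓ-prime sL sM index
    open Multiples ℓ-prime sM
    private
      module L = IsSubgroup sL
      module M = IsSubgroup sM

    -- The ℓ multiples of e and v cannot all lie in distinct cosets.
    generates : ∀ {v} → v ∈ L → ∃ λ k → (v -ᶜ ι k *ᶜ e) ∈ M
    generates {v} p = collision (Finₚ.pigeonhole (ℕₚ.n<1+n ℓ) f)
      where
      je : ∀ (j : Fin ℓ) → (ι (pos (toℕ j)) *ᶜ e) ∈ L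
      je j = L.ℤ∈ (pos (toℕ j)) e∈L
      -- Slot 0 holds v and slot j + 1 holds j e. Two multiples of e in one coset would make ℓ
      -- divide a positive number below ℓ, so the collision must involve v.
      f : Fin (suc ℓ) → Fin ℓ
      f zero = class p
      f (suc j) = class (je j)
      collision : (∃₂ λ i j → i Data.Fin.< j × f i ≡ f j) → ∃ λ k → (v -ᶜ ι k *ᶜ e) ∈ M
      collision (zero , suc j , _ , eq) = pos (toℕ j) , class-≡ p (je j) eq
      collision (suc i , suc j , ℕ.s≤s i<j , eq) = ⊥-elim (residues-distinct i<j (Finₚ.toℕ<n j)
        (k∈⇒ℓ∣k (ℓ∈ e∈L) e∉M (subst M eq′ (class-≡ (je j) (je i) (sym eq)))))
        where
        m = pos (toℕ i)
        n = pos (toℕ j)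
        eq′ : ι n *ᶜ e -ᶜ ι m *ᶜ e ≡ ι (n ℤ.- m) *ᶜ e
        eq′ = trans (C.solve 3 (λ n m e → n C.:* e C.:- m C.:* e C.:= (n C.:- m) C.:* e) refl (ι n) (ι m) e)
              (cong (_*ᶜ e) (sym (C.cast 2 (λ n m → n C.:- m) (n ∷ m ∷ []))))

  ≤-by : ∀ {x y z} → 0ℝ ≤ z → z ≡ y + - x → x ≤ y
  ≤-by h refl = 0≤y-x⇒x≤y h

  0≤-of : ∀ {x y} → 0ℝ ≤ x → x ≡ y → 0ℝ ≤ y
  0≤-of h refl = h

  _≟ᶜ_ : (v w : ℂ) → Dec (v ≡ w)
  (x , y) ≟ᶜ (x′ , y′) with x O.≟ x′ | y O.≟ y′
  ... | yes refl | yes refl = yes refl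
  ... | no n | _ = no λ { refl → n refl }
  ... | _ | no n = no λ { refl → n refl }

  -- Determinants, coordinates and lattice bases

  det : ℂ → ℂ → ℝ
  det (x , y) (x′ , y′) = x * y′ + - (y * x′)

  -- Integer scalars act here by complex multiplication, unlike in `ℤSpan₂`, so that the ring solver
  -- of ℂ treats scalars and vectors alike.
  comb : ℂ → ℂ → ℤ → ℤ → ℂ
  comb b₁ b₂ m n = ι m *ᶜ b₁ +ᶜ ι n *ᶜ b₂

  ·≡ : ∀ c v → c · v ≡ (c , 0ℝ) *ᶜ v
  ·≡ c (x , y) = cong₂ _,_
    (ℝS.solve 3 (λ c x y → c :* x := c :* x :- con (pos 0) :* y) refl c x y)
    (ℝS.solve 3 (λ c x y → c :* y := c :* y :+ con (pos 0) :* x) refl c x y)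

  lin≡comb : ∀ b₁ b₂ m n → fromℤ m · b₁ +ᶜ fromℤ n · b₂ ≡ comb b₁ b₂ m n
  lin≡comb b₁ b₂ m n = cong₂ _+ᶜ_ (·≡ (fromℤ m) b₁) (·≡ (fromℤ n) b₂)

  cramer : ∀ b₁ b₂ v → det b₁ b₂ · v ≡ det v b₂ · b₁ +ᶜ det b₁ v · b₂
  cramer (a , b) (c , d) (x , y) = cong₂ _,_
    (ℝS.solve 6 (λ a b c d x y → (a :* d :- b :* c) :* x := (x :* d :- y :* c) :* a :+ (a :* y :- b :* x) :* c) refl a b c d x y)
    (ℝS.solve 6 (λ a b c d x y → (a :* d :- b :* c) :* y := (x :* d :- y :* c) :* b :+ (a :* y :- b :* x) :* d) refl a b c d x y)

  det-lin : ∀ s t s′ t′ b₁ b₂ → det (s · b₁ +ᶜ t · b₂) (s′ · b₁ +ᶜ t′ · b₂) ≡ (s * t′ + - (t * s′)) * det b₁ b₂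
  det-lin s t s′ t′ (a , b) (c , d) = ℝS.solve 8 (λ s t s′ t′ a b c d →
    (s :* a :+ t :* c) :* (s′ :* b :+ t′ :* d) :- (s :* b :+ t :* d) :* (s′ :* a :+ t′ :* c)
      := (s :* t′ :- t :* s′) :* (a :* d :- b :* c)) refl s t s′ t′ a b c d

  det-linˡ : ∀ s t b₁ b₂ → det (s · b₁ +ᶜ t · b₂) b₂ ≡ s * det b₁ b₂
  det-linˡ s t (a , b) (c , d) = ℝS.solve 6 (λ s t a b c d →
    (s :* a :+ t :* c) :* d :- (s :* b :+ t :* d) :* c := s :* (a :* d :- b :* c)) refl s t a b c d

  det-linʳ : ∀ s t b₁ b₂ → det b₁ (s · b₁ +ᶜ t · b₂) ≡ t * det b₁ b₂
  det-linʳ s t (a , b) (c , d) = ℝS.solve 6 (λ s t a b c d →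
    a :* (s :* b :+ t :* d) :- b :* (s :* a :+ t :* c) := t :* (a :* d :- b :* c)) refl s t a b c d

  unscale : ∀ {c} → c ≢ 0ℝ → ∀ v → c ⁻¹ · (c · v) ≡ v
  unscale {c} nz (x , y) = cong₂ _,_ (lem x) (lem y)
    where
    lem : ∀ x → c ⁻¹ * (c * x) ≡ x
    lem x = trans (ℝS.solve 3 (λ c d x → d :* (c :* x) := c :* d :* x) refl c (c ⁻¹) x)
      (trans (cong (_* x) (*-inverseʳ c nz)) (*-identityˡ x))

  real-coordinates : ∀ {b₁ b₂} → det b₁ b₂ ≢ 0ℝ → ∀ v → ∃₂ λ s t → v ≡ s · b₁ +ᶜ t · b₂
  real-coordinates {b₁} {b₂} nz v = d ⁻¹ * det v b₂ , d ⁻¹ * det b₁ v , (begin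
    v                                             ≡⟨ unscale nz v ⟨
    d ⁻¹ · (d · v)                                ≡⟨ cong (d ⁻¹ ·_) (cramer b₁ b₂ v) ⟩
    d ⁻¹ · (det v b₂ · b₁ +ᶜ det b₁ v · b₂)       ≡⟨ distr (d ⁻¹) (det v b₂) (det b₁ v) b₁ b₂ ⟩
    (d ⁻¹ * det v b₂) · b₁ +ᶜ (d ⁻¹ * det b₁ v) · b₂ ∎)
    where
    open ≡-Reasoning
    d = det b₁ b₂
    distr : ∀ e s t b₁ b₂ → e · (s · b₁ +ᶜ t · b₂) ≡ (e * s) · b₁ +ᶜ (e * t) · b₂
    distr e s t (x , y) (z , w) = cong₂ _,_ (lem x z) (lem y w)
      where
      lem : ∀ x z → e * (s * x + t * z) ≡ e * s * x + e * t * z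
      lem x z = ℝS.solve 5 (λ e s t x z → e :* (s :* x :+ t :* z) := e :* s :* x :+ e :* t :* z) refl e s t x z

  coordinates-unique : ∀ {b₁ b₂} → det b₁ b₂ ≢ 0ℝ → ∀ {s t s′ t′} →
    s · b₁ +ᶜ t · b₂ ≡ s′ · b₁ +ᶜ t′ · b₂ → s ≡ s′ × t ≡ t′
  coordinates-unique {b₁} {b₂} nz {s} {t} {s′} {t′} e =
      *-cancelˡ nz (trans (*-comm _ s) (trans (sym (det-linˡ s t b₁ b₂)) (trans (cong (λ v → det v b₂) e)
        (trans (det-linˡ s′ t′ b₁ b₂) (*-comm s′ _)))))
    , *-cancelˡ nz (trans (*-comm _ t) (trans (sym (det-linʳ s t b₁ b₂)) (trans (cong (det b₁) e)
        (trans (det-linʳ s′ t′ b₁ b₂) (*-comm t′ _)))))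

  det≢0⇒IsℝBasis : ∀ {b₁ b₂} → det b₁ b₂ ≢ 0ℝ → IsℝBasis b₁ b₂
  det≢0⇒IsℝBasis {b₁} {b₂} nz v = (s , t) , proj₂ (proj₂ (real-coordinates nz v)) , λ {x} e → cong₂ _,_ (proj₁ (unique x e)) (proj₂ (unique x e))
    where
    s = proj₁ (real-coordinates nz v)
    t = proj₁ (proj₂ (real-coordinates nz v))
    unique : ∀ (x : ℝ × ℝ) → v ≡ proj₁ x · b₁ +ᶜ proj₂ x · b₂ → s ≡ proj₁ x × t ≡ proj₂ x
    unique x e = coordinates-unique {b₁} {b₂} nz {s} {t} {proj₁ x} {proj₂ x} (trans (sym (proj₂ (proj₂ (real-coordinates nz v)))) e)

  -- For b₁ = (a , b) and b₂ = (c , d) with determinant 0, both c b₁ - a b₂ and d b₁ - b b₂ vanish.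
  -- Uniqueness of the coordinates of 0 gives a = b = 0, so b₁ = 0, and then 1 b₁ + 0 b₂ = 0
  -- violates the same uniqueness.
  IsℝBasis⇒det≢0 : ∀ {b₁ b₂} → IsℝBasis b₁ b₂ → det b₁ b₂ ≢ 0ℝ
  IsℝBasis⇒det≢0 {a , b} {c , d} basis dz = <⇒≢ 0<1 (sym (proj₁ (unique₀ 1ℝ 0ℝ
      (cong₂ _,_ (lem a c a≡0) (lem b d b≡0)))))
    where
    open ≡-Reasoning
    unique₀ : ∀ s t → 0ᶜ ≡ s · (a , b) +ᶜ t · (c , d) → s ≡ 0ℝ × t ≡ 0ℝ
    unique₀ s t e = cong proj₁ eq , cong proj₂ eq
      where
      u = proj₂ (proj₂ (basis 0ᶜ))
      zero-comb : ∀ a c → 0ℝ ≡ 0ℝ * a + 0ℝ * c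
      zero-comb a c = ℝS.solve 2 (λ a c → con (pos 0) := con (pos 0) :* a :+ con (pos 0) :* c) refl a c
      eq : (s , t) ≡ (0ℝ , 0ℝ)
      eq = trans (sym (u {s , t} e)) (u {0ℝ , 0ℝ} (cong₂ _,_ (zero-comb a c) (zero-comb b d)))
    x-zero = unique₀ c (- a) (cong₂ _,_ (ℝS.solve 2 (λ a c → con (pos 0) := c :* a :+ :- a :* c) refl a c)
      (trans (trans (ℝS.solve 0 (con (pos 0) := :- con (pos 0)) refl) (cong -_ (sym dz)))
       (ℝS.solve 4 (λ a b c d → :- (a :* d :- b :* c) := c :* b :+ :- a :* d) refl a b c d)))
    y-zero = unique₀ d (- b) (cong₂ _,_ (trans (sym dz)
       (ℝS.solve 4 (λ a b c d → a :* d :- b :* c := d :* a :+ :- b :* c) refl a b c d))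
       (ℝS.solve 2 (λ b d → con (pos 0) := d :* b :+ :- b :* d) refl b d))
    neg-zero : ∀ {x} → - x ≡ 0ℝ → x ≡ 0ℝ
    neg-zero {x} e = trans (ℝS.solve 1 (λ x → x := :- (:- x)) refl x) (trans (cong -_ e) (ℝS.solve 0 (:- con (pos 0) := con (pos 0)) refl))
    a≡0 = neg-zero (proj₂ x-zero)
    b≡0 = neg-zero (proj₂ y-zero)
    lem : ∀ a c → a ≡ 0ℝ → 0ℝ ≡ 1ℝ * a + 0ℝ * c
    lem a c refl = ℝS.solve 1 (λ c → con (pos 0) := con (pos 1) :* con (pos 0) :+ con (pos 0) :* c) refl c

  -- `IsLatticeBasis` with unique real coordinates replaced by a nonzero determinant, the form that
  -- computations with integer coordinates need.
  record Basis (L : Subset) (b₁ b₂ : ℂ) : Set where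
    field
      independent : det b₁ b₂ ≢ 0ℝ
      coordinates : ∀ {v} → v ∈ L → ∃₂ λ m n → v ≡ comb b₁ b₂ m n
      comb∈       : ∀ m n → comb b₁ b₂ m n ∈ L

  fromLatticeBasis : ∀ {L b₁ b₂} → IsLatticeBasis L b₁ b₂ → Basis L b₁ b₂
  fromLatticeBasis {L} {b₁} {b₂} (basis , ⇒ , ⇐) = record
    { independent = IsℝBasis⇒det≢0 basis
    ; coordinates = λ p → let m , n , e = ⇒ p in m , n , trans e (lin≡comb b₁ b₂ m n)
    ; comb∈ = λ m n → ⇐ (m , n , sym (lin≡comb b₁ b₂ m n))
    }

  toLatticeBasis : ∀ {L b₁ b₂} → Basis L b₁ b₂ → IsLatticeBasis L b₁ b₂
  toLatticeBasis {L} {b₁} {b₂} B = det≢0⇒IsℝBasis B.independent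
    , (λ p → let m , n , e = B.coordinates p in m , n , trans e (sym (lin≡comb b₁ b₂ m n)))
    , λ { (m , n , e) → subst L (trans (sym (lin≡comb b₁ b₂ m n)) (sym e)) (B.comb∈ m n) }
    where module B = Basis B

  comb-0 : ∀ b₁ b₂ → comb b₁ b₂ (pos 0) (pos 0) ≡ 0ᶜ
  comb-0 b₁ b₂ = C.solve 2 (λ a b → con₀ C.:* a C.:+ con₀ C.:* b C.:= con₀) refl b₁ b₂
    where con₀ : ∀ {n} → C.Polynomial n
          con₀ = C.con (pos 0)

  comb-+ : ∀ b₁ b₂ m n m′ n′ → comb b₁ b₂ m n +ᶜ comb b₁ b₂ m′ n′ ≡ comb b₁ b₂ (m ℤ.+ m′) (n ℤ.+ n′)
  comb-+ b₁ b₂ m n m′ n′ = trans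
    (C.solve 6 (λ b₁ b₂ m n m′ n′ → m C.:* b₁ C.:+ n C.:* b₂ C.:+ (m′ C.:* b₁ C.:+ n′ C.:* b₂)
      C.:= (m C.:+ m′) C.:* b₁ C.:+ (n C.:+ n′) C.:* b₂) refl b₁ b₂ (ι m) (ι n) (ι m′) (ι n′))
    (cong₂ (λ x y → x *ᶜ b₁ +ᶜ y *ᶜ b₂) (sym (ι-+ m m′)) (sym (ι-+ n n′)))

  comb-* : ∀ b₁ b₂ k m n → ι k *ᶜ comb b₁ b₂ m n ≡ comb b₁ b₂ (k ℤ.* m) (k ℤ.* n)
  comb-* b₁ b₂ k m n = trans
    (C.solve 5 (λ b₁ b₂ k m n → k C.:* (m C.:* b₁ C.:+ n C.:* b₂)
      C.:= (k C.:* m) C.:* b₁ C.:+ (k C.:* n) C.:* b₂) refl b₁ b₂ (ι k) (ι m) (ι n))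
    (cong₂ (λ x y → x *ᶜ b₁ +ᶜ y *ᶜ b₂) (sym (ι-* k m)) (sym (ι-* k n)))

  comb-neg : ∀ b₁ b₂ m n → -ᶜ comb b₁ b₂ m n ≡ comb b₁ b₂ (ℤ.- m) (ℤ.- n)
  comb-neg b₁ b₂ m n = trans
    (C.solve 4 (λ b₁ b₂ m n → C.:- (m C.:* b₁ C.:+ n C.:* b₂)
      C.:= (C.:- m) C.:* b₁ C.:+ (C.:- n) C.:* b₂) refl b₁ b₂ (ι m) (ι n))
    (cong₂ (λ x y → x *ᶜ b₁ +ᶜ y *ᶜ b₂) (sym (ι-neg m)) (sym (ι-neg n)))

  comb-comb : ∀ b₁ b₂ p q r s m n →
    comb (comb b₁ b₂ p q) (comb b₁ b₂ r s) m n ≡ comb b₁ b₂ (m ℤ.* p ℤ.+ n ℤ.* r) (m ℤ.* q ℤ.+ n ℤ.* s)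
  comb-comb b₁ b₂ p q r s m n = trans (cong₂ _+ᶜ_ (comb-* b₁ b₂ m p q) (comb-* b₁ b₂ n r s))
    (comb-+ b₁ b₂ (m ℤ.* p) (m ℤ.* q) (n ℤ.* r) (n ℤ.* s))

  ι-1 : ι (pos 1) ≡ 1ᶜ
  ι-1 = cong (_, 0ℝ) fromℤ-1

  comb-10 : ∀ b₁ b₂ → comb b₁ b₂ (pos 1) (pos 0) ≡ b₁
  comb-10 b₁ b₂ = trans (cong (λ z → z *ᶜ b₁ +ᶜ ι (pos 0) *ᶜ b₂) ι-1)
    (C.solve 2 (λ a b → C.con (pos 1) C.:* a C.:+ C.con (pos 0) C.:* b C.:= a) refl b₁ b₂)

  comb-01 : ∀ b₁ b₂ → comb b₁ b₂ (pos 0) (pos 1) ≡ b₂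
  comb-01 b₁ b₂ = trans (cong (λ z → ι (pos 0) *ᶜ b₁ +ᶜ z *ᶜ b₂) ι-1)
    (C.solve 2 (λ a b → C.con (pos 0) C.:* a C.:+ C.con (pos 1) C.:* b C.:= b) refl b₁ b₂)

  comb-injective : ∀ {b₁ b₂} → det b₁ b₂ ≢ 0ℝ → ∀ {m n m′ n′} →
    comb b₁ b₂ m n ≡ comb b₁ b₂ m′ n′ → m ≡ m′ × n ≡ n′
  comb-injective {b₁} {b₂} nz {m} {n} {m′} {n′} e =
    let p , q = coordinates-unique nz {fromℤ m} {fromℤ n} {fromℤ m′} {fromℤ n′} (trans (lin≡comb b₁ b₂ m n) (trans e (sym (lin≡comb b₁ b₂ m′ n′))))
    in fromℤ-injective p , fromℤ-injective q

  comb-≢0 : ∀ {b₁ b₂} → det b₁ b₂ ≢ 0ℝ → ∀ {m n} → ¬ (m ≡ pos 0 × n ≡ pos 0) → comb b₁ b₂ m n ≢ 0ᶜ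
  comb-≢0 {b₁} {b₂} nz h e = h (comb-injective nz (trans e (sym (comb-0 b₁ b₂))))

  det-comb : ∀ b₁ b₂ p q r s →
    det (comb b₁ b₂ p q) (comb b₁ b₂ r s) ≡ fromℤ (p ℤ.* s ℤ.- q ℤ.* r) * det b₁ b₂
  det-comb b₁ b₂ p q r s = trans (cong₂ det (sym (lin≡comb b₁ b₂ p q)) (sym (lin≡comb b₁ b₂ r s)))
    (trans (det-lin (fromℤ p) (fromℤ q) (fromℤ r) (fromℤ s) b₁ b₂)
      (cong (_* det b₁ b₂) (sym (ℝS.cast 4 (λ p q r s → p :* s :- q :* r) (p ∷ q ∷ r ∷ s ∷ [])))))

  Basis⇒IsSubgroup : ∀ {L b₁ b₂} → Basis L b₁ b₂ → IsSubgroup L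
  Basis⇒IsSubgroup {L} {b₁} {b₂} B = record
    { 0∈ = subst L (comb-0 b₁ b₂) (B.comb∈ (pos 0) (pos 0))
    ; +∈ = λ p q → case (B.coordinates p , B.coordinates q) of λ
        { ((m , n , refl) , (m′ , n′ , refl)) → subst L (sym (comb-+ b₁ b₂ m n m′ n′)) (B.comb∈ (m ℤ.+ m′) (n ℤ.+ n′)) }
    ; neg∈ = λ p → case B.coordinates p of λ
        { (m , n , refl) → subst L (sym (comb-neg b₁ b₂ m n)) (B.comb∈ (ℤ.- m) (ℤ.- n)) }
    }
    where module B = Basis B

  basis₁∈ : ∀ {L b₁ b₂} → Basis L b₁ b₂ → b₁ ∈ L
  basis₁∈ {L} {b₁} {b₂} B = subst L (comb-10 b₁ b₂) (Basis.comb∈ B (pos 1) (pos 0))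

  basis₂∈ : ∀ {L b₁ b₂} → Basis L b₁ b₂ → b₂ ∈ L
  basis₂∈ {L} {b₁} {b₂} B = subst L (comb-01 b₁ b₂) (Basis.comb∈ B (pos 0) (pos 1))

  -- Norms

  -- The middle coefficient of the norm form in coordinates with respect to v and w.
  cross : ℂ → ℂ → ℝ
  cross v w = fromℤ (pos 2) * ⟨ v , w ⟩

  norm : ℝ → ℝ → ℝ → ℤ → ℤ → ℝ
  norm ρ T σ m n = ρ * (fromℤ m * fromℤ m) + T * (fromℤ m * fromℤ n) + σ * (fromℤ n * fromℤ n)

  A-lin : ∀ s t b₁ b₂ → A (s · b₁ +ᶜ t · b₂) ≡ A b₁ * (s * s) + cross b₁ b₂ * (s * t) + A b₂ * (t * t)
  A-lin s t (a , b) (c , d) = ℝS.solve 6 (λ s t a b c d →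
    (s :* a :+ t :* c) :* (s :* a :+ t :* c) :+ (s :* b :+ t :* d) :* (s :* b :+ t :* d)
    := (a :* a :+ b :* b) :* (s :* s) :+ con (pos 2) :* (a :* c :+ b :* d) :* (s :* t) :+ (c :* c :+ d :* d) :* (t :* t))
    refl s t a b c d

  A-comb : ∀ b₁ b₂ m n → A (comb b₁ b₂ m n) ≡ norm (A b₁) (cross b₁ b₂) (A b₂) m n
  A-comb b₁ b₂ m n = trans (cong A (sym (lin≡comb b₁ b₂ m n))) (A-lin (fromℤ m) (fromℤ n) b₁ b₂)

  0≤A : ∀ v → 0ℝ ≤ A v
  0≤A (x , y) = 0≤x² x ⊕ 0≤x² y

  A≡0 : ∀ {v} → A v ≡ 0ℝ → v ≡ 0ᶜ
  A≡0 {x , y} e = cong₂ _,_ (x²≡0 (sum-zeroˡ (0≤x² x) (0≤x² y) e))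
    (x²≡0 (sum-zeroˡ (0≤x² y) (0≤x² x) (trans (+-comm _ _) e)))

  0<A : ∀ {v} → v ≢ 0ᶜ → 0ℝ < A v
  0<A {v} nz = ≤∧≢⇒< (0≤A v) (λ e → nz (A≡0 (sym e)))

  A-scale : ∀ c v → A (c · v) ≡ c * c * A v
  A-scale c (x , y) = ℝS.solve 3 (λ c x y → c :* x :* (c :* x) :+ c :* y :* (c :* y)
    := c :* c :* (x :* x :+ y :* y)) refl c x y

  det-self-neg : ∀ v → det v (-ᶜ v) ≡ 0ℝ
  det-self-neg (x , y) = ℝS.solve 2 (λ x y → x :* :- y :- y :* :- x := con (pos 0)) refl x y

  det-self : ∀ v → det v v ≡ 0ℝ
  det-self (x , y) = ℝS.solve 2 (λ x y → x :* y :- y :* x := con (pos 0)) refl x y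

  0≢1 : 0ℝ ≢ 1ℝ
  0≢1 = <⇒≢ 0<1

  0<fromℤ² : ∀ {k} → k ≢ pos 0 → 0ℝ < fromℤ k * fromℤ k
  0<fromℤ² {k} nz = ≤∧≢⇒< (0≤x² (fromℤ k)) (λ e → nz (fromℤ-≡0 k (x²≡0 (sym e))))

  -- The values at (1 , 1) and (1 , -1) are 2 ρ ± T; that they are at least ρ is the reduction
  -- condition |T| ≤ ρ of Gauss.
  cross-bounds : ∀ {ρ T} → ρ ≤ norm ρ T ρ (pos 1) (pos 1) → ρ ≤ norm ρ T ρ (pos 1) (ℤ.- pos 1) →
                 0ℝ ≤ ρ + T × 0ℝ ≤ ρ + - T
  cross-bounds {ρ} {T} h₁ h₂ =
      0≤-of (x≤y⇒0≤y-x h₁) (ℝS.solve 2 (λ ρ T → ρ :* (c₁ :* c₁) :+ T :* (c₁ :* c₁) :+ ρ :* (c₁ :* c₁) :- ρ := ρ :+ T) refl ρ T)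
    , 0≤-of (x≤y⇒0≤y-x h₂) (ℝS.solve 2 (λ ρ T → ρ :* (c₁ :* c₁) :+ T :* (c₁ :* :- c₁) :+ ρ :* (:- c₁ :* :- c₁) :- ρ := ρ :- T) refl ρ T)
    where
    -- the literal 1 as it appears after unfolding fromℤ (pos 1)
    c₁ : ∀ {n} → ℝS.Polynomial n
    c₁ = con (pos 1) :+ con (pos 0)

  0<k*x : ∀ k {x} → 0ℝ < x → 0ℝ < fromℤ (pos (suc k)) * x
  0<k*x k p = *-pos (0<fromℕ k) p

  -- 16 D² a is at most 24 ρ (X² + Y²) ≤ 12 ρ D².
  A-shorter : ∀ {ρ T X Y D a} → 0ℝ < ρ → 0ℝ ≤ ρ + T → 0ℝ ≤ ρ + - T → 0ℝ < D * D →
    fromℤ (pos 4) * (X * X) ≤ D * D → fromℤ (pos 4) * (Y * Y) ≤ D * D →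
    D * D * a ≡ ρ * (X * X) + T * (X * Y) + ρ * (Y * Y) → ¬ (ρ ≤ a)
  A-shorter {ρ} {T} {X} {Y} {D} {a} 0<ρ +T -T 0<D hX hY e h = <⇒≱ (0<k*x 3 (*-pos 0<D 0<ρ))
    (≤-by total eq)
    where
    four six sixteen : ∀ {n} → ℝS.Polynomial n
    four = con (pos 4)
    six = con (pos 6)
    sixteen = con (pos 16)
    -- The weights 4, 6 and 16 make the X Y terms, the squares and the terms in a cancel, which
    -- leaves -4 D² ρ for a sum of nonnegative terms.
    total = 0≤fromℕ 4 ⊛ (-T ⊛ 0≤x² (X + Y) ⊕ +T ⊛ 0≤x² (X + - Y))
      ⊕ 0≤fromℕ 6 ⊛ inj₁ 0<ρ ⊛ (x≤y⇒0≤y-x hX ⊕ x≤y⇒0≤y-x hY)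
      ⊕ 0≤fromℕ 16 ⊛ (inj₁ 0<D ⊛ x≤y⇒0≤y-x h)
    eq : fromℤ (pos 4) * ((ρ + - T) * ((X + Y) * (X + Y)) + (ρ + T) * ((X + - Y) * (X + - Y)))
         + fromℤ (pos 6) * ρ * ((D * D + - (fromℤ (pos 4) * (X * X))) + (D * D + - (fromℤ (pos 4) * (Y * Y))))
         + fromℤ (pos 16) * (D * D * (a + - ρ))
         ≡ 0ℝ + - (fromℤ (pos 4) * (D * D * ρ))
    eq = trans (ℝS.solve 6 (λ ρ T X Y D a →
      four :* ((ρ :- T) :* ((X :+ Y) :* (X :+ Y)) :+ (ρ :+ T) :* ((X :- Y) :* (X :- Y)))
      :+ six :* ρ :* ((D :* D :- four :* (X :* X)) :+ (D :* D :- four :* (Y :* Y)))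
      :+ sixteen :* (D :* D :* (a :- ρ))
      := sixteen :* (D :* D :* a :- (ρ :* (X :* X) :+ T :* (X :* Y) :+ ρ :* (Y :* Y))) :+ (con (pos 0) :- four :* (D :* D :* ρ))) refl ρ T X Y D a)
      (trans (cong (λ z → fromℤ (pos 16) * (z + - (ρ * (X * X) + T * (X * Y) + ρ * (Y * Y))) + (0ℝ + - (fromℤ (pos 4) * (D * D * ρ)))) e)
      (ℝS.solve 2 (λ u w → sixteen :* (u :- u) :+ w := w) refl (ρ * (X * X) + T * (X * Y) + ρ * (Y * Y)) (0ℝ + - (fromℤ (pos 4) * (D * D * ρ)))))

  norm-11 : ∀ v w → norm (A v) (cross v w) (A w) (pos 1) (pos 1) ≡ A (v +ᶜ w)
  norm-11 v w = trans (sym (A-comb v w (pos 1) (pos 1))) (cong A (trans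
    (cong₂ (λ x y → x *ᶜ v +ᶜ y *ᶜ w) ι-1 ι-1)
    (C.solve 2 (λ v w → C.con (pos 1) C.:* v C.:+ C.con (pos 1) C.:* w C.:= v C.:+ w) refl v w)))

  norm-1-1 : ∀ v w → norm (A v) (cross v w) (A w) (pos 1) (ℤ.- pos 1) ≡ A (v -ᶜ w)
  norm-1-1 v w = trans (sym (A-comb v w (pos 1) (ℤ.- pos 1))) (cong A (trans
    (cong₂ (λ x y → x *ᶜ v +ᶜ y *ᶜ w) ι-1 (trans (ι-neg (pos 1)) (cong -ᶜ_ ι-1)))
    (C.solve 2 (λ v w → C.con (pos 1) C.:* v C.:+ C.:- C.con (pos 1) C.:* w C.:= v C.:- w) refl v w)))

  det-sum : ∀ v w → det v (v +ᶜ w) ≡ det v w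
  det-sum (a , b) (c , d) = ℝS.solve 4 (λ a b c d → a :* (b :+ d) :- b :* (a :+ c) := a :* d :- b :* c) refl a b c d

  det-difference : ∀ v w → det v (v -ᶜ w) ≡ - det v w
  det-difference (a , b) (c , d) = ℝS.solve 4 (λ a b c d → a :* (b :- d) :- b :* (a :- c) := :- (a :* d :- b :* c)) refl a b c d

  det-0ʳ : ∀ v → det v 0ᶜ ≡ 0ℝ
  det-0ʳ (a , b) = ℝS.solve 2 (λ a b → a :* con (pos 0) :- b :* con (pos 0) := con (pos 0)) refl a b

  neg≢0 : ∀ {x} → x ≢ 0ℝ → - x ≢ 0ℝ
  neg≢0 {x} nz e = nz (trans (ℝS.solve 1 (λ x → x := :- (:- x)) refl x)
    (trans (cong -_ e) (ℝS.solve 0 (:- con (pos 0) := con (pos 0)) refl)))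

  sum≢0 : ∀ {v w} → det v w ≢ 0ℝ → v +ᶜ w ≢ 0ᶜ
  sum≢0 {v} {w} nz e = nz (trans (sym (det-sum v w)) (trans (cong (det v) e) (det-0ʳ v)))

  difference≢0 : ∀ {v w} → det v w ≢ 0ℝ → v -ᶜ w ≢ 0ᶜ
  difference≢0 {v} {w} nz e = neg≢0 nz (trans (sym (det-difference v w)) (trans (cong (det v) e) (det-0ʳ v)))

  det≢0⇒≢0ˡ : ∀ {v w} → det v w ≢ 0ℝ → v ≢ 0ᶜ
  det≢0⇒≢0ˡ {v} {c , d} nz refl = nz (ℝS.solve 2 (λ c d → con (pos 0) :* d :- con (pos 0) :* c := con (pos 0)) refl c d)

  det≢0⇒≢0ʳ : ∀ {v w} → det v w ≢ 0ℝ → w ≢ 0ᶜ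
  det≢0⇒≢0ʳ {v} nz refl = nz (det-0ʳ v)

  -- Lattices generated by their minimal vectors

  LowerBound : Subset → ℝ → Set
  LowerBound L ρ = ∀ {v} → v ∈ L → v ≢ 0ᶜ → ρ ≤ A v

  minimal-cross-bounds : ∀ {L v w ρ} → IsSubgroup L → LowerBound L ρ → v ∈ L → w ∈ L →
    A v ≡ ρ → A w ≡ ρ → det v w ≢ 0ℝ → 0ℝ ≤ ρ + cross v w × 0ℝ ≤ ρ + - cross v w
  minimal-cross-bounds {L} {v} {w} {ρ} sL min v∈ w∈ refl ew nz = cross-bounds
    (≤-trans (min (+∈ v∈ w∈) (sum≢0 nz)) (inj₂ (trans (sym (norm-11 v w)) (cong (λ z → norm ρ (cross v w) z (pos 1) (pos 1)) ew))))
    (≤-trans (min (-∈ v∈ w∈) (difference≢0 nz)) (inj₂ (trans (sym (norm-1-1 v w)) (cong (λ z → norm ρ (cross v w) z (pos 1) (ℤ.- pos 1)) ew))))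
    where open IsSubgroup sL

  -- Cramer's rule, with the determinant kept on the left so that everything stays integral.
  cramer-comb : ∀ b₁ b₂ p q r s m n → ι (p ℤ.* s ℤ.- q ℤ.* r) *ᶜ comb b₁ b₂ m n ≡
                comb (comb b₁ b₂ p q) (comb b₁ b₂ r s) (m ℤ.* s ℤ.- n ℤ.* r) (p ℤ.* n ℤ.- q ℤ.* m)
  cramer-comb b₁ b₂ p q r s m n = begin
    ι (p ℤ.* s ℤ.- q ℤ.* r) *ᶜ comb b₁ b₂ m n
      ≡⟨ cong (_*ᶜ comb b₁ b₂ m n) (C.cast 4 (λ p s q r → p C.:* s C.:- q C.:* r) (p ∷ s ∷ q ∷ r ∷ [])) ⟩
    (ι p *ᶜ ι s -ᶜ ι q *ᶜ ι r) *ᶜ comb b₁ b₂ m n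
      ≡⟨ C.solve 8 (λ b₁ b₂ p q r s m n →
           (p C.:* s C.:- q C.:* r) C.:* (m C.:* b₁ C.:+ n C.:* b₂) C.:=
           (m C.:* s C.:- n C.:* r) C.:* (p C.:* b₁ C.:+ q C.:* b₂) C.:+ (p C.:* n C.:- q C.:* m) C.:* (r C.:* b₁ C.:+ s C.:* b₂))
           refl b₁ b₂ (ι p) (ι q) (ι r) (ι s) (ι m) (ι n) ⟩
    (ι m *ᶜ ι s -ᶜ ι n *ᶜ ι r) *ᶜ comb b₁ b₂ p q +ᶜ (ι p *ᶜ ι n -ᶜ ι q *ᶜ ι m) *ᶜ comb b₁ b₂ r s
      ≡⟨ cong₂ (λ x y → x *ᶜ comb b₁ b₂ p q +ᶜ y *ᶜ comb b₁ b₂ r s)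
           (C.cast 4 (λ p s q r → p C.:* s C.:- q C.:* r) (m ∷ s ∷ n ∷ r ∷ []))
           (C.cast 4 (λ p s q r → p C.:* s C.:- q C.:* r) (p ∷ n ∷ q ∷ m ∷ [])) ⟨
    comb (comb b₁ b₂ p q) (comb b₁ b₂ r s) (m ℤ.* s ℤ.- n ℤ.* r) (p ℤ.* n ℤ.- q ℤ.* m) ∎
    where open ≡-Reasoning

  sub-comb : ∀ v w {D x y i j x′ y′ z} → ι D *ᶜ z ≡ comb v w x y → x ≡ i ℤ.* D ℤ.+ x′ → y ≡ j ℤ.* D ℤ.+ y′ →
             ι D *ᶜ (z -ᶜ comb v w i j) ≡ comb v w x′ y′
  sub-comb v w {D} {x} {y} {i} {j} {x′} {y′} {z} Dz xe ye = begin
    ι D *ᶜ (z -ᶜ comb v w i j)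
      ≡⟨ C.solve 3 (λ d z c → d C.:* (z C.:- c) C.:= d C.:* z C.:- d C.:* c) refl (ι D) z (comb v w i j) ⟩
    ι D *ᶜ z -ᶜ ι D *ᶜ comb v w i j
      ≡⟨ cong (_-ᶜ ι D *ᶜ comb v w i j) (trans Dz (cong₂ (λ x y → x *ᶜ v +ᶜ y *ᶜ w) (lem x i x′ xe) (lem y j y′ ye))) ⟩
    (ι i *ᶜ ι D +ᶜ ι x′) *ᶜ v +ᶜ (ι j *ᶜ ι D +ᶜ ι y′) *ᶜ w -ᶜ ι D *ᶜ comb v w i j
      ≡⟨ C.solve 7 (λ v w d i j x y → (i C.:* d C.:+ x) C.:* v C.:+ (j C.:* d C.:+ y) C.:* w C.:- d C.:* (i C.:* v C.:+ j C.:* w)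
           C.:= x C.:* v C.:+ y C.:* w) refl v w (ι D) (ι i) (ι j) (ι x′) (ι y′) ⟩
    comb v w x′ y′ ∎
    where
    open ≡-Reasoning
    lem : ∀ x i x′ → x ≡ i ℤ.* D ℤ.+ x′ → ι x ≡ ι i *ᶜ ι D +ᶜ ι x′
    lem x i x′ e = trans (cong ι e) (C.cast 3 (λ i d x → i C.:* d C.:+ x) (i ∷ D ∷ x′ ∷ []))

  A-lattice : ∀ {v w ρ D x y z} → A v ≡ ρ → A w ≡ ρ → ι D *ᶜ z ≡ comb v w x y →
    fromℤ D * fromℤ D * A z ≡ ρ * (fromℤ x * fromℤ x) + cross v w * (fromℤ x * fromℤ y) + ρ * (fromℤ y * fromℤ y)
  A-lattice {v} {w} {ρ} {D} {x} {y} {z} ev ew Dz = begin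
    fromℤ D * fromℤ D * A z     ≡⟨ A-scale (fromℤ D) z ⟨
    A (fromℤ D · z)             ≡⟨ cong A (trans (·≡ (fromℤ D) z) Dz) ⟩
    A (comb v w x y)            ≡⟨ A-comb v w x y ⟩
    norm (A v) (cross v w) (A w) x y ≡⟨ cong₂ (λ a b → norm a (cross v w) b x y) ev ew ⟩
    norm ρ (cross v w) ρ x y    ∎
    where open ≡-Reasoning

  fromℤ-square : ∀ {k D} → pos 4 ℤ.* (k ℤ.* k) ℤ.≤ D ℤ.* D → fromℤ (pos 4) * (fromℤ k * fromℤ k) ≤ fromℤ D * fromℤ D
  fromℤ-square {k} {D} h = subst₂ _≤_ (ℝS.cast 1 (λ k → con (pos 4) :* (k :* k)) (k ∷ []))
    (fromℤ-* D D) (fromℤ-mono h)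

  -- Subtracting a nearest point of ℤ v + ℤ w from z leaves a vector
  -- shorter than the minimum.
  nearest-point : ∀ {L v w ρ} → IsSubgroup L → 0ℝ < ρ → LowerBound L ρ → v ∈ L → w ∈ L →
    A v ≡ ρ → A w ≡ ρ → det v w ≢ 0ℝ → ∀ {z D x y} → z ∈ L → D ≢ pos 0 → ι D *ᶜ z ≡ comb v w x y →
    ∃₂ λ m n → z ≡ comb v w m n
  nearest-point {L} {v} {w} {ρ} sL 0<ρ min v∈ w∈ ev ew nz {z} {D} {x} {y} z∈ D≢0 Dz
    with symmetric-division x D D≢0 | symmetric-division y D D≢0
  ... | i , x′ , xe , hx | j , y′ , ye , hy with (z -ᶜ comb v w i j) ≟ᶜ 0ᶜ
  ...   | yes e = i , j , trans (C.solve 2 (λ z c → z C.:= z C.:- c C.:+ c) refl z (comb v w i j))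
                   (trans (cong (_+ᶜ comb v w i j) e) (C.solve 1 (λ c → C.con (pos 0) C.:+ c C.:= c) refl (comb v w i j)))
  ...   | no ne = ⊥-elim (A-shorter {ρ} {cross v w} {fromℤ x′} {fromℤ y′} {fromℤ D} {A (z -ᶜ comb v w i j)}
             0<ρ (proj₁ bounds) (proj₂ bounds) (0<fromℤ² D≢0) (fromℤ-square {x′} {D} hx) (fromℤ-square {y′} {D} hy)
             (A-lattice {v} {w} {ρ} {D} {x′} {y′} {z -ᶜ comb v w i j} ev ew
               (sub-comb v w {D} {x} {y} {i} {j} {x′} {y′} {z} Dz xe ye))
             (min (-∈ z∈ (+∈ (ℤ∈ i v∈) (ℤ∈ j w∈))) ne))
    where
    open IsSubgroup sL
    bounds = minimal-cross-bounds sL min v∈ w∈ ev ew nz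

  -- In the plane independent minimal vectors always generate. The given basis b₁, b₂ only supplies
  -- the integer D = det for which D z is an integral combination of v and w; `nearest-point` then
  -- removes D.
  minimal⇒Basis : ∀ {L b₁ b₂ v w ρ} → Basis L b₁ b₂ → 0ℝ < ρ → LowerBound L ρ → v ∈ L → w ∈ L →
    A v ≡ ρ → A w ≡ ρ → det v w ≢ 0ℝ → Basis L v w
  minimal⇒Basis {L} {b₁} {b₂} {v} {w} {ρ} B 0<ρ min v∈ w∈ ev ew nz = record
    { independent = nz
    ; coordinates = coords
    ; comb∈ = λ m n → L.+∈ (L.ℤ∈ m v∈) (L.ℤ∈ n w∈)
    }
    where
    module B = Basis B
    module L = IsSubgroup (Basis⇒IsSubgroup B)
    coords : ∀ {z} → z ∈ L → ∃₂ λ m n → z ≡ comb v w m n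
    coords {z} z∈ with B.coordinates v∈ | B.coordinates w∈ | B.coordinates z∈
    ... | p , q , v≡ | r , s , w≡ | m , n , z≡ =
      nearest-point (Basis⇒IsSubgroup B) 0<ρ min v∈ w∈ ev ew nz
        {z} {p ℤ.* s ℤ.- q ℤ.* r} {m ℤ.* s ℤ.- n ℤ.* r} {p ℤ.* n ℤ.- q ℤ.* m} z∈
        (λ e → nz (trans (cong₂ det v≡ w≡) (trans (det-comb b₁ b₂ p q r s)
          (trans (cong (λ d → fromℤ d * det b₁ b₂) e) (zeroˡ (det b₁ b₂))))))
        (trans (cong (ι (p ℤ.* s ℤ.- q ℤ.* r) *ᶜ_) z≡) (trans (cramer-comb b₁ b₂ p q r s m n)
          (sym (cong₂ (λ v w → comb v w (m ℤ.* s ℤ.- n ℤ.* r) (p ℤ.* n ℤ.- q ℤ.* m)) v≡ w≡))))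

  -- With N the value of the form, (ρ + T)(m + 2 n)² + (ρ - T)(m - 2 n)² + 6 ρ (m² - 4) = 8 N - 24
  -- ρ. For m² ≥ 4 this is nonnegative, so N ≥ 3 ρ.
  six-bound : ∀ {ρ T m n} → 0ℝ < ρ → 0ℝ ≤ ρ + T → 0ℝ ≤ ρ + - T →
    ρ * (m * m) + T * (m * n) + ρ * (n * n) ≡ ρ → ¬ (fromℤ (pos 4) ≤ m * m)
  six-bound {ρ} {T} {m} {n} 0<ρ +T -T e h = <⇒≱ (0<k*x 15 0<ρ) (≤-by
      (+T ⊛ 0≤x² (m + fromℤ (pos 2) * n) ⊕ -T ⊛ 0≤x² (m + - (fromℤ (pos 2) * n))
       ⊕ 0≤fromℕ 6 ⊛ (inj₁ 0<ρ ⊛ x≤y⇒0≤y-x h))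
      (trans (ℝS.solve 4 (λ ρ T m n →
         (ρ :+ T) :* ((m :+ two :* n) :* (m :+ two :* n)) :+ (ρ :- T) :* ((m :- two :* n) :* (m :- two :* n))
           :+ con (pos 6) :* (ρ :* (m :* m :- con (pos 4)))
         := con (pos 8) :* (ρ :* (m :* m) :+ T :* (m :* n) :+ ρ :* (n :* n)) :- con (pos 24) :* ρ) refl ρ T m n)
       (trans (cong (λ z → fromℤ (pos 8) * z + - (fromℤ (pos 24) * ρ)) e)
         (ℝS.solve 1 (λ ρ → con (pos 8) :* ρ :- con (pos 24) :* ρ := con (pos 0) :- con (pos 16) :* ρ) refl ρ))))
    where
    two : ∀ {n} → ℝS.Polynomial n
    two = con (pos 2)

  data Small : ℤ → Set where
    -1ˢ : Small -[1+ 0 ]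
    0ˢ : Small (pos 0)
    1ˢ : Small (pos 1)

  4≤square : ∀ k → Small k ⊎ fromℤ (pos 4) ≤ fromℤ k * fromℤ k
  4≤square (pos 0) = inj₁ 0ˢ
  4≤square (pos 1) = inj₁ 1ˢ
  4≤square -[1+ 0 ] = inj₁ -1ˢ
  4≤square k@(pos (suc (suc n))) = inj₂ (subst (fromℤ (pos 4) ≤_) (fromℤ-* k k)
    (fromℤ-mono (ℤ.+≤+ (ℕₚ.*-mono-≤ {2} {suc (suc n)} {2} {suc (suc n)} (ℕ.s≤s (ℕ.s≤s ℕ.z≤n)) (ℕ.s≤s (ℕ.s≤s ℕ.z≤n))))))
  4≤square k@(-[1+ suc n ]) = inj₂ (subst (fromℤ (pos 4) ≤_) (fromℤ-* k k)
    (fromℤ-mono (ℤ.+≤+ (ℕₚ.*-mono-≤ {2} {suc (suc n)} {2} {suc (suc n)} (ℕ.s≤s (ℕ.s≤s ℕ.z≤n)) (ℕ.s≤s (ℕ.s≤s ℕ.z≤n))))))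

  -- Besides the two basis vectors, a third pair ±(1 , 1) or ±(1 , -1) can be minimal only at the
  -- ends T = -ρ and T = ρ of the reduced range, that is, for the hexagonal lattice.
  data Minimal (ρ T : ℝ) : ℤ → ℤ → Set where
    ±10 : ∀ {k} → k ≡ pos 1 ⊎ k ≡ -[1+ 0 ] → Minimal ρ T k (pos 0)
    ±01 : ∀ {k} → k ≡ pos 1 ⊎ k ≡ -[1+ 0 ] → Minimal ρ T (pos 0) k
    ±11 : ∀ {k} → k ≡ pos 1 ⊎ k ≡ -[1+ 0 ] → T ≡ - ρ → Minimal ρ T k k
    ±1-1 : ∀ {k} → k ≡ pos 1 ⊎ k ≡ -[1+ 0 ] → T ≡ ρ → Minimal ρ T k (ℤ.- k)

  minimal-coordinates : ∀ {ρ T} → 0ℝ < ρ → 0ℝ ≤ ρ + T → 0ℝ ≤ ρ + - T → ∀ m n →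
    norm ρ T ρ m n ≡ ρ → Minimal ρ T m n
  minimal-coordinates {ρ} {T} 0<ρ +T -T m n e with 4≤square m | 4≤square n
  ... | inj₂ h | _ = ⊥-elim (six-bound {ρ} {T} {fromℤ m} {fromℤ n} 0<ρ +T -T e h)
  ... | inj₁ _ | inj₂ h = ⊥-elim (six-bound {ρ} {T} {fromℤ n} {fromℤ m} 0<ρ +T -T
          (trans (ℝS.solve 4 (λ ρ T m n → ρ :* (n :* n) :+ T :* (n :* m) :+ ρ :* (m :* m) := ρ :* (m :* m) :+ T :* (m :* n) :+ ρ :* (n :* n)) refl ρ T (fromℤ m) (fromℤ n)) e) h)
  ... | inj₁ sm | inj₁ sn = small sm sn e
    where
    one mone zer : ∀ {n} → ℝS.Polynomial n
    one = con (pos 1) :+ con (pos 0)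
    mone = :- one
    zer = con (pos 0)
    T≡ : ∀ {x} → ρ + ρ + x ≡ ρ → x ≡ - ρ
    T≡ {x} h = trans (ℝS.solve 2 (λ ρ x → x := ρ :+ ρ :+ x :- ρ :- ρ) refl ρ x)
      (trans (cong (λ z → z + - ρ + - ρ) h) (ℝS.solve 1 (λ ρ → ρ :- ρ :- ρ := :- ρ) refl ρ))
    T≡′ : ρ + ρ + - T ≡ ρ → T ≡ ρ
    T≡′ h = trans (ℝS.solve 1 (λ T → T := :- (:- T)) refl T) (trans (cong -_ (T≡ h)) (ℝS.solve 1 (λ T → :- (:- T) := T) refl ρ))
    small : ∀ {m n} → Small m → Small n → norm ρ T ρ m n ≡ ρ → Minimal ρ T m n
    small 0ˢ 0ˢ e = ⊥-elim (<⇒≢ 0<ρ (trans (ℝS.solve 2 (λ ρ T → zer := ρ :* (zer :* zer) :+ T :* (zer :* zer) :+ ρ :* (zer :* zer)) refl ρ T) e))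
    small 1ˢ 0ˢ e = ±10 (inj₁ refl)
    small -1ˢ 0ˢ e = ±10 (inj₂ refl)
    small 0ˢ 1ˢ e = ±01 (inj₁ refl)
    small 0ˢ -1ˢ e = ±01 (inj₂ refl)
    small 1ˢ 1ˢ e = ±11 (inj₁ refl) (T≡ (trans (ℝS.solve 2 (λ ρ T → ρ :+ ρ :+ T := ρ :* (one :* one) :+ T :* (one :* one) :+ ρ :* (one :* one)) refl ρ T) e))
    small -1ˢ -1ˢ e = ±11 (inj₂ refl) (T≡ (trans (ℝS.solve 2 (λ ρ T → ρ :+ ρ :+ T := ρ :* (mone :* mone) :+ T :* (mone :* mone) :+ ρ :* (mone :* mone)) refl ρ T) e))
    small 1ˢ -1ˢ e = ±1-1 (inj₁ refl) (T≡′ (trans (ℝS.solve 2 (λ ρ T → ρ :+ ρ :- T := ρ :* (one :* one) :+ T :* (one :* mone) :+ ρ :* (mone :* mone)) refl ρ T) e))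
    small -1ˢ 1ˢ e = ±1-1 (inj₂ refl) (T≡′ (trans (ℝS.solve 2 (λ ρ T → ρ :+ ρ :- T := ρ :* (mone :* mone) :+ T :* (mone :* one) :+ ρ :* (one :* one)) refl ρ T) e))

  -- Well-rounded sublattices {ℓ ∣ m ± n}

  parity : ∀ n → (∃ λ k → n ≡ 2 ℕ.* k) ⊎ (∃ λ k → n ≡ 1 ℕ.+ 2 ℕ.* k)
  parity zero = inj₁ (0 , refl)
  parity (suc n) with parity n
  ... | inj₁ (k , refl) = inj₂ (k , refl)
  ... | inj₂ (k , refl) = inj₁ (suc k , sym (ℕₚ.*-suc 2 k))

  prime-parity : ∀ {ℓ} → Prime ℓ → ℓ ≡ 2 ⊎ ∃ λ k → ℓ ≡ 3 ℕ.+ 2 ℕ.* k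
  prime-parity {ℓ} ℓ-prime with parity ℓ
  ... | inj₁ (k , e) with prime⇒irreducible ℓ-prime (ℕD.divides k (trans e (ℕₚ.*-comm 2 k)))
  ...   | inj₂ e′ = inj₁ (sym e′)
  prime-parity ℓ-prime | inj₂ (zero , e) = ⊥-elim (PrimeKit.L∤1 ℓ-prime (subst (λ n → pos n ∣ pos 1) (sym e) ∣-refl))
  prime-parity ℓ-prime | inj₂ (suc k , e) = inj₂ (k , trans e (cong suc (ℕₚ.*-suc 2 k)))

  0<fromℤ⇒1≤ : ∀ i → 0ℝ < fromℤ i → 1ℝ ≤ fromℤ i
  0<fromℤ⇒1≤ (pos zero) p = ⊥-elim (<-irrefl p)
  0<fromℤ⇒1≤ (pos (suc n)) _ = ≤-by (0≤fromℕ n) (ℝS.solve 1 (λ n → n := con (pos 1) :+ n :- con (pos 1)) refl (fromℕ n))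
  0<fromℤ⇒1≤ -[1+ n ] p = ⊥-elim (<⇒≱ p (≤-by (0≤fromℕ (suc n)) (ℝS.solve 1 (λ n → n := con (pos 0) :- (:- n)) refl (fromℕ (suc n)))))

  1≤square : ∀ {k} → k ≢ pos 0 → 1ℝ ≤ fromℤ k * fromℤ k
  1≤square {k} nz = subst (1ℝ ≤_) (fromℤ-* k k) (0<fromℤ⇒1≤ (k ℤ.* k) (subst (0ℝ <_) (sym (fromℤ-* k k)) (0<fromℤ² nz)))

  -- Four times the form is (2 x - y)² + 3 y², hence positive, and a positive integer is at least 1.
  1≤hex : ∀ x y → y ≢ pos 0 → 1ℝ ≤ fromℤ x * fromℤ x + - (fromℤ x * fromℤ y) + fromℤ y * fromℤ y
  1≤hex x y nz = subst (1ℝ ≤_) e (0<fromℤ⇒1≤ (x ℤ.* x ℤ.- x ℤ.* y ℤ.+ y ℤ.* y) (subst (0ℝ <_) (sym e)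
      (≰⇒> λ h → <⇒≱ (0<k*x 2 (0<fromℤ² nz)) (≤-by (0≤x² (fromℤ (pos 2) * X + - Y) ⊕ 0≤fromℕ 4 ⊛ x≤y⇒0≤y-x h)
        (ℝS.solve 2 (λ x y → (con (pos 2) :* x :- y) :* (con (pos 2) :* x :- y) :+ con (pos 4) :* (con (pos 0) :- (x :* x :- x :* y :+ y :* y))
          := con (pos 0) :- con (pos 3) :* (y :* y)) refl X Y)))))
    where
    X = fromℤ x
    Y = fromℤ y
    e : fromℤ (x ℤ.* x ℤ.- x ℤ.* y ℤ.+ y ℤ.* y) ≡ X * X + - (X * Y) + Y * Y
    e = ℝS.cast 2 (λ x y → x :* x :- x :* y :+ y :* y) (x ∷ y ∷ [])

  antidiagonal : ∀ p q r s → p ℤ.+ q ≡ pos 0 → r ℤ.+ s ≡ pos 0 → p ℤ.* s ℤ.- q ℤ.* r ≡ pos 0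
  antidiagonal p q r s e₁ e₂ = trans
    (Z.solve 4 (λ p q r s → p Z.:* s Z.:- q Z.:* r Z.:= (p Z.:+ q) Z.:* s Z.:- q Z.:* (r Z.:+ s)) refl p q r s)
    (trans (cong₂ (λ a b → a ℤ.* s ℤ.- q ℤ.* b) e₁ e₂)
      (Z.solve 2 (λ q s → Z.con (pos 0) Z.:* s Z.:- q Z.:* Z.con (pos 0) Z.:= Z.con (pos 0)) refl q s))

  diagonal : ∀ p q r s → q ℤ.- p ≡ pos 0 → s ℤ.- r ≡ pos 0 → p ℤ.* s ℤ.- q ℤ.* r ≡ pos 0
  diagonal p q r s e₁ e₂ = trans
    (Z.solve 4 (λ p q r s → p Z.:* s Z.:- q Z.:* r Z.:= p Z.:* (s Z.:- r) Z.:- (q Z.:- p) Z.:* r) refl p q r s)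
    (trans (cong₂ (λ a b → p ℤ.* a ℤ.- b ℤ.* r) e₂ e₁)
      (Z.solve 2 (λ p r → p Z.:* Z.con (pos 0) Z.:- Z.con (pos 0) Z.:* r Z.:= Z.con (pos 0)) refl p r))

  half-difference : ∀ p q y → p ℤ.+ q ≡ y ℤ.* pos 2 → q ℤ.- y ≡ pos 0 → q ℤ.- p ≡ pos 0
  half-difference p q y e z = trans
    (Z.solve 3 (λ p q y → q Z.:- p Z.:= Z.con (pos 2) Z.:* (q Z.:- y) Z.:+ (y Z.:* Z.con (pos 2) Z.:- (p Z.:+ q))) refl p q y)
    (trans (cong₂ (λ a b → pos 2 ℤ.* a ℤ.+ (y ℤ.* pos 2 ℤ.- b)) z e)
      (Z.solve 1 (λ y → Z.con (pos 2) Z.:* Z.con (pos 0) Z.:+ (y Z.:* Z.con (pos 2) Z.:- y Z.:* Z.con (pos 2)) Z.:= Z.con (pos 0)) refl y))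

  half-coordinate : ∀ p q y → p ℤ.+ q ≡ y ℤ.* pos 2 → p ≡ y ℤ.- (q ℤ.- y)
  half-coordinate p q y e = trans (Z.solve 2 (λ p q → p Z.:= p Z.:+ q Z.:- q) refl p q)
    (trans (cong (ℤ._- q) e) (Z.solve 2 (λ q y → y Z.:* Z.con (pos 2) Z.:- q Z.:= y Z.:- (q Z.:- y)) refl q y))

  minus-plus : ∀ q y → q ≡ q ℤ.- y ℤ.+ y
  minus-plus q y = Z.solve 2 (λ q y → q Z.:= q Z.:- y Z.:+ y) refl q y

  module WellRoundedSublattice
    {ρ T u : ℝ} (0<ρ : 0ℝ < ρ) (+T : 0ℝ ≤ ρ + T) (-T : 0ℝ ≤ ρ + - T)
    {ℓ : ℕ} (ℓ-prime : Prime ℓ)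
    (min : ∀ m n → ¬ (m ≡ pos 0 × n ≡ pos 0) → pos ℓ ∣ m ℤ.+ n → u ≤ norm ρ T ρ m n)
    where

    -- The vector (-1 , 1) belongs to the sublattice for every ℓ.
    u≤2ρ-T : u ≤ fromℤ (pos 2) * ρ + - T
    u≤2ρ-T = ≤-trans (min -[1+ 0 ] (pos 1) (λ ()) (divides (pos 0) refl)) (inj₂
      (ℝS.solve 2 (λ ρ T → ρ :* (:- one :* :- one) :+ T :* (:- one :* one) :+ ρ :* (one :* one) := con (pos 2) :* ρ :- T) refl ρ T))
      where
      one : ∀ {n} → ℝS.Polynomial n
      one = con (pos 1) :+ con (pos 0)

    0≤2ρ-T : 0ℝ ≤ fromℤ (pos 2) * ρ + - T
    0≤2ρ-T = 0≤-of (inj₁ 0<ρ ⊕ -T) (ℝS.solve 2 (λ ρ T → ρ :+ (ρ :- T) := con (pos 2) :* ρ :- T) refl ρ T)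

    0≤2ρ+T : 0ℝ ≤ fromℤ (pos 2) * ρ + T
    0≤2ρ+T = 0≤-of (inj₁ 0<ρ ⊕ +T) (ℝS.solve 2 (λ ρ T → ρ :+ (ρ :+ T) := con (pos 2) :* ρ :+ T) refl ρ T)

    -- For ℓ = 2 k + 3 the sublattice has the basis (-1 , 1), (k + 2 , k + 1). Their inner product
    -- is -(2 ρ - T) / 2, as it would be in a hexagonal lattice of minimum 2 ρ - T; `excess` is the
    -- amount by which the norm of the second vector surpasses that of the first.
    module Odd (k : ℕ) (ℓ≡ : ℓ ≡ 3 ℕ.+ 2 ℕ.* k) where
      K Λ excess : ℝ
      K = fromℕ k
      Λ = fromℤ (pos ℓ)
      excess = K * (K + fromℤ (pos 3)) * ρ + ((1ℝ + K) * (1ℝ + K) + (1ℝ + K) + 1ℝ) * (ρ + T)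

      Λ≡ : Λ ≡ fromℤ (pos 3) + fromℤ (pos 2) * K
      Λ≡ = trans (cong fromℕ ℓ≡) (trans (fromℕ-+ 3 (2 ℕ.* k)) (cong (fromℕ 3 +_) (fromℕ-* 2 k)))

      0≤1+K : 0ℝ ≤ 1ℝ + K
      0≤1+K = 0≤1 ⊕ 0≤fromℕ k

      e₁ = 0≤fromℕ k ⊛ (0≤fromℕ k ⊕ 0≤fromℕ 3) ⊛ inj₁ 0<ρ
      e₂ = ((0≤1+K ⊛ 0≤1+K) ⊕ 0≤1+K ⊕ 0≤1) ⊛ +T

      0≤excess : 0ℝ ≤ excess
      0≤excess = e₁ ⊕ e₂

      norm≡ : ∀ p q y → p ℤ.+ q ≡ y ℤ.* pos ℓ → ∃ λ x →
        norm ρ T ρ p q ≡ (fromℤ (pos 2) * ρ + - T) * (fromℤ x * fromℤ x + - (fromℤ x * fromℤ y) + fromℤ y * fromℤ y) + excess * (fromℤ y * fromℤ y)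
      norm≡ p q y e = q ℤ.- pos (suc k) ℤ.* y , (begin
        norm ρ T ρ p q
          ≡⟨ cong₂ (λ P Q → ρ * (P * P) + T * (P * Q) + ρ * (Q * Q)) P≡ Q≡ ⟩
        ρ * (P * P) + T * (P * Q) + ρ * (Q * Q)
          ≡⟨ ℝS.solve 5 (λ ρ T X Y K → let Q = X :+ (con (pos 1) :+ K) :* Y ; P = Y :* (con (pos 3) :+ con (pos 2) :* K) :- Q in
               ρ :* (P :* P) :+ T :* (P :* Q) :+ ρ :* (Q :* Q) :=
               (con (pos 2) :* ρ :- T) :* (X :* X :- X :* Y :+ Y :* Y)
               :+ (K :* (K :+ con (pos 3)) :* ρ :+ ((con (pos 1) :+ K) :* (con (pos 1) :+ K) :+ (con (pos 1) :+ K) :+ con (pos 1)) :* (ρ :+ T)) :* (Y :* Y))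
               refl ρ T X Y K ⟩
        (fromℤ (pos 2) * ρ + - T) * (X * X + - (X * Y) + Y * Y) + excess * (Y * Y) ∎)
        where
        open ≡-Reasoning
        X = fromℤ (q ℤ.- pos (suc k) ℤ.* y)
        Y = fromℤ y
        Q = X + (1ℝ + K) * Y
        P = Y * (fromℤ (pos 3) + fromℤ (pos 2) * K) + - Q
        Q≡ : fromℤ q ≡ Q
        Q≡ = trans (ℝS.solve 2 (λ q y → q := q :- y :+ y) refl (fromℤ q) ((1ℝ + K) * Y))
          (cong (_+ (1ℝ + K) * Y) (sym (ℝS.cast 3 (λ q k y → q :- k :* y) (q ∷ pos (suc k) ∷ y ∷ []))))
        P≡ : fromℤ p ≡ P
        P≡ = trans (ℝS.solve 2 (λ p q → p := p :+ q :- q) refl (fromℤ p) (fromℤ q))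
          (cong₂ (λ a b → a + - b) (trans (sym (fromℤ-+ p q)) (trans (cong fromℤ e) (trans (fromℤ-* y (pos ℓ)) (cong (Y *_) Λ≡)))) Q≡)

      -- Together with `u≤2ρ-T` the hypothesis makes `excess` zero, so both of its nonnegative
      -- summands vanish. The second gives T = -ρ, the first gives k = 0 because ρ > 0; hence ℓ = 3
      -- and u = 3 ρ.
      rigidity : fromℤ (pos 2) * ρ + - T + excess ≤ u → u ≡ Λ * ρ × T ≡ - ρ
      rigidity h₁ = u≡ , T≡
        where
        excess≡0 : excess ≡ 0ℝ
        excess≡0 = ≤-antisym (≤-by (x≤y⇒0≤y-x (≤-trans h₁ u≤2ρ-T))
          (ℝS.solve 2 (λ a e → a :- (a :+ e) := con (pos 0) :- e) refl (fromℤ (pos 2) * ρ + - T) excess)) 0≤excess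
        u≡′ : u ≡ fromℤ (pos 2) * ρ + - T
        u≡′ = ≤-antisym u≤2ρ-T (≤-trans (inj₂ (trans (sym (+-identityʳ _)) (cong (fromℤ (pos 2) * ρ + - T +_) (sym excess≡0)))) h₁)
        T≡ : T ≡ - ρ
        T≡ = trans (ℝS.solve 2 (λ ρ T → T := ρ :+ T :- ρ) refl ρ T) (trans (cong (_+ - ρ)
          (x*y≡0 (sum-zeroˡ e₂ e₁ (trans (+-comm _ _) excess≡0)) (λ z → <⇒≢ (0<-+ 0<1 ((0≤1+K ⊛ 0≤1+K) ⊕ 0≤1+K)) (sym (trans (+-comm 1ℝ _) z)))))
          (+-identityˡ (- ρ)))
        K≡0 : K ≡ 0ℝ
        K≡0 with K O.≟ 0ℝ
        ... | yes z = z
        ... | no nz = ⊥-elim (*-≢0 (*-≢0 nz (λ z → <⇒≢ (0<-+ (0<fromℕ 2) (0≤fromℕ k)) (sym (trans (+-comm _ _) z)))) (λ z → <⇒≢ 0<ρ (sym z)) (sum-zeroˡ e₁ e₂ excess≡0))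
        u≡ : u ≡ Λ * ρ
        u≡ = trans u≡′ (trans (cong (λ t → fromℤ (pos 2) * ρ + - t) T≡)
          (trans (ℝS.solve 1 (λ ρ → con (pos 2) :* ρ :- (:- ρ) := (con (pos 3) :+ con (pos 2) :* con (pos 0)) :* ρ) refl ρ)
            (cong (_* ρ) (trans (cong (λ k → fromℤ (pos 3) + fromℤ (pos 2) * k) (sym K≡0)) (sym Λ≡)))))

      conclude : ∀ p q y → p ℤ.+ q ≡ y ℤ.* pos ℓ → y ≢ pos 0 → norm ρ T ρ p q ≡ u → u ≡ Λ * ρ × T ≡ - ρ
      conclude p q y e y≢0 nu = rigidity (bound (norm≡ p q y e))
        where
        a = fromℤ (pos 2) * ρ + - T
        S = fromℤ y * fromℤ y
        hex : ℤ → ℝ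
        hex x = fromℤ x * fromℤ x + - (fromℤ x * fromℤ y) + S
        bound : (∃ λ x → norm ρ T ρ p q ≡ a * hex x + excess * S) → a + excess ≤ u
        bound (x , eq) = ≤-by (0≤2ρ-T ⊛ x≤y⇒0≤y-x (1≤hex x y y≢0) ⊕ 0≤excess ⊛ x≤y⇒0≤y-x (1≤square y≢0))
          (trans (ℝS.solve 4 (λ a h e s → a :* (h :- con (pos 1)) :+ e :* (s :- con (pos 1)) := a :* h :+ e :* s :- (a :+ e)) refl
             a (hex x) excess S)
            (cong (_+ - (a + excess)) (trans (sym eq) nu)))

      result : ∀ p q r s → p ℤ.* s ℤ.- q ℤ.* r ≢ pos 0 → ∀ y₁ y₂ → p ℤ.+ q ≡ y₁ ℤ.* pos ℓ → r ℤ.+ s ≡ y₂ ℤ.* pos ℓ →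
        norm ρ T ρ p q ≡ u → norm ρ T ρ r s ≡ u → u ≡ Λ * ρ × T ≡ - ρ
      result p q r s nz y₁ y₂ e₁ e₂ n₁ n₂ = by-cases (y₁ ℤₚ.≟ pos 0) (y₂ ℤₚ.≟ pos 0)
        where
        by-cases : Dec (y₁ ≡ pos 0) → Dec (y₂ ≡ pos 0) → u ≡ Λ * ρ × T ≡ - ρ
        by-cases (no ne) _ = conclude p q y₁ e₁ ne n₁
        by-cases _ (no ne) = conclude r s y₂ e₂ ne n₂
        -- Now both vectors lie on the line through (-1 , 1), against their independence.
        by-cases (yes z₁) (yes z₂) = ⊥-elim (nz (antidiagonal p q r s
          (trans e₁ (cong (ℤ._* pos ℓ) z₁)) (trans e₂ (cong (ℤ._* pos ℓ) z₂))))

    -- The basis (-1 , 1), (1 , 1) of the sublattice is orthogonal, with norms 2 ρ - T and 2 ρ + T.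
    -- Two independent minimal vectors involve both basis vectors, so both norms equal u, and T = 0.
    module Two (ℓ≡2 : ℓ ≡ 2) where
      u≤2ρ+T : u ≤ fromℤ (pos 2) * ρ + T
      u≤2ρ+T = ≤-trans (min (pos 1) (pos 1) (λ ()) (subst (λ l → pos l ∣ pos 2) (sym ℓ≡2) ∣-refl)) (inj₂
        (ℝS.solve 2 (λ ρ T → ρ :* (one :* one) :+ T :* (one :* one) :+ ρ :* (one :* one) := con (pos 2) :* ρ :+ T) refl ρ T))
        where
        one : ∀ {n} → ℝS.Polynomial n
        one = con (pos 1) :+ con (pos 0)

      norm≡ : ∀ p q x y → p ≡ y ℤ.- x → q ≡ x ℤ.+ y →
        norm ρ T ρ p q ≡ (fromℤ (pos 2) * ρ + - T) * (fromℤ x * fromℤ x) + (fromℤ (pos 2) * ρ + T) * (fromℤ y * fromℤ y)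
      norm≡ p q x y pe qe = trans (cong₂ (λ P Q → ρ * (P * P) + T * (P * Q) + ρ * (Q * Q))
          (trans (cong fromℤ pe) (ℝS.cast 2 (λ x y → y :- x) (x ∷ y ∷ [])))
          (trans (cong fromℤ qe) (fromℤ-+ x y)))
        (ℝS.solve 4 (λ ρ T X Y → let P = Y :- X ; Q = X :+ Y in
          ρ :* (P :* P) :+ T :* (P :* Q) :+ ρ :* (Q :* Q) :=
          (con (pos 2) :* ρ :- T) :* (X :* X) :+ (con (pos 2) :* ρ :+ T) :* (Y :* Y)) refl ρ T (fromℤ x) (fromℤ y))

      dominates : ∀ {a b x y} → 0ℝ ≤ a → 0ℝ ≤ b → y ≢ pos 0 → a * (fromℤ x * fromℤ x) + b * (fromℤ y * fromℤ y) ≡ u → b ≤ u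
      dominates {a} {b} {x} {y} 0≤a 0≤b nz e = ≤-by (0≤a ⊛ 0≤x² (fromℤ x) ⊕ 0≤b ⊛ x≤y⇒0≤y-x (1≤square nz))
        (trans (ℝS.solve 4 (λ a b X Y → a :* X :+ b :* (Y :- con (pos 1)) := a :* X :+ b :* Y :- b) refl a b (fromℤ x * fromℤ x) (fromℤ y * fromℤ y))
          (cong (_+ - b) e))

      conclude : fromℤ (pos 2) * ρ + T ≤ u → fromℤ (pos 2) * ρ + - T ≤ u → u ≡ fromℤ (pos ℓ) * ρ × T ≡ 0ℝ
      conclude h₁ h₂ = trans u+ (trans (cong (fromℤ (pos 2) * ρ +_) T≡0) (trans (+-identityʳ _) (cong (λ l → fromℤ (pos l) * ρ) (sym ℓ≡2)))) , T≡0
        where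
        u+ = ≤-antisym u≤2ρ+T h₁
        u- = ≤-antisym u≤2ρ-T h₂
        T≡0 : T ≡ 0ℝ
        T≡0 = x*y≡0 {fromℤ (pos 2)} {T} (trans (ℝS.solve 2 (λ ρ T → con (pos 2) :* T := con (pos 2) :* ρ :+ T :- (con (pos 2) :* ρ :- T)) refl ρ T)
          (trans (cong₂ (λ a b → a + - b) (sym u+) (sym u-)) (-‿inverseʳ u))) (λ z → <⇒≢ 0<2 (sym z))

      norm-half : ∀ p q y → p ℤ.+ q ≡ y ℤ.* pos 2 → norm ρ T ρ p q ≡ u →
        (fromℤ (pos 2) * ρ + - T) * (fromℤ (q ℤ.- y) * fromℤ (q ℤ.- y)) + (fromℤ (pos 2) * ρ + T) * (fromℤ y * fromℤ y) ≡ u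
      norm-half p q y e n = trans (sym (norm≡ p q (q ℤ.- y) y (half-coordinate p q y e) (minus-plus q y))) n

      result : ∀ p q r s → p ℤ.* s ℤ.- q ℤ.* r ≢ pos 0 → ∀ y₁ y₂ → p ℤ.+ q ≡ y₁ ℤ.* pos 2 → r ℤ.+ s ≡ y₂ ℤ.* pos 2 →
        norm ρ T ρ p q ≡ u → norm ρ T ρ r s ≡ u → u ≡ fromℤ (pos ℓ) * ρ × T ≡ 0ℝ
      result p q r s nz y₁ y₂ e₁ e₂ n₁ n₂ =
        conclude (Y-bound (y₁ ℤₚ.≟ pos 0) (y₂ ℤₚ.≟ pos 0)) (X-bound ((q ℤ.- y₁) ℤₚ.≟ pos 0) ((s ℤ.- y₂) ℤₚ.≟ pos 0))
        where
        Y-bound : Dec (y₁ ≡ pos 0) → Dec (y₂ ≡ pos 0) → fromℤ (pos 2) * ρ + T ≤ u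
        Y-bound (no ne) _ = dominates {fromℤ (pos 2) * ρ + - T} {fromℤ (pos 2) * ρ + T} {q ℤ.- y₁} {y₁} 0≤2ρ-T 0≤2ρ+T ne (norm-half p q y₁ e₁ n₁)
        Y-bound _ (no ne) = dominates {fromℤ (pos 2) * ρ + - T} {fromℤ (pos 2) * ρ + T} {s ℤ.- y₂} {y₂} 0≤2ρ-T 0≤2ρ+T ne (norm-half r s y₂ e₂ n₂)
        Y-bound (yes z₁) (yes z₂) = ⊥-elim (nz (antidiagonal p q r s
          (trans e₁ (cong (ℤ._* pos 2) z₁)) (trans e₂ (cong (ℤ._* pos 2) z₂))))
        X-bound : Dec (q ℤ.- y₁ ≡ pos 0) → Dec (s ℤ.- y₂ ≡ pos 0) → fromℤ (pos 2) * ρ + - T ≤ u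
        X-bound (no ne) _ = dominates {fromℤ (pos 2) * ρ + T} {fromℤ (pos 2) * ρ + - T} {y₁} {q ℤ.- y₁} 0≤2ρ+T 0≤2ρ-T ne (trans (+-comm _ _) (norm-half p q y₁ e₁ n₁))
        X-bound _ (no ne) = dominates {fromℤ (pos 2) * ρ + T} {fromℤ (pos 2) * ρ + - T} {y₂} {s ℤ.- y₂} 0≤2ρ+T 0≤2ρ-T ne (trans (+-comm _ _) (norm-half r s y₂ e₂ n₂))
        X-bound (yes z₁) (yes z₂) = ⊥-elim (nz (diagonal p q r s
          (half-difference p q y₁ e₁ z₁) (half-difference r s y₂ e₂ z₂)))

    -- A well-rounded sublattice {m + n ≡ 0 mod ℓ} of a well-rounded lattice is
    -- the square lattice of index 2 or the hexagonal lattice of index 3.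
    sublattice : ∀ p q r s → p ℤ.* s ℤ.- q ℤ.* r ≢ pos 0 → pos ℓ ∣ p ℤ.+ q → pos ℓ ∣ r ℤ.+ s →
      norm ρ T ρ p q ≡ u → norm ρ T ρ r s ≡ u →
      u ≡ fromℤ (pos ℓ) * ρ × ((ℓ ≡ 2 × T ≡ 0ℝ) ⊎ T ≡ - ρ)
    sublattice p q r s nz (divides y₁ e₁) (divides y₂ e₂) n₁ n₂ = by-parity (prime-parity ℓ-prime)
      where
      at-2 : ∀ {a} y → ℓ ≡ 2 → a ≡ y ℤ.* pos ℓ → a ≡ y ℤ.* pos 2
      at-2 y refl e = e
      by-parity : (ℓ ≡ 2 ⊎ ∃ λ k → ℓ ≡ 3 ℕ.+ 2 ℕ.* k) → u ≡ fromℤ (pos ℓ) * ρ × ((ℓ ≡ 2 × T ≡ 0ℝ) ⊎ T ≡ - ρ)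
      by-parity (inj₁ ℓ≡2) = let a , b = Two.result ℓ≡2 p q r s nz y₁ y₂ (at-2 y₁ ℓ≡2 e₁) (at-2 y₂ ℓ≡2 e₂) n₁ n₂ in a , inj₁ (ℓ≡2 , b)
      by-parity (inj₂ (k , ℓ≡)) = let a , b = Odd.result k ℓ≡ p q r s nz y₁ y₂ e₁ e₂ n₁ n₂ in a , inj₂ b

  data Sign : Set where
    plus minus : Sign

  ± : Sign → ℤ
  ± plus = pos 1
  ± minus = -[1+ 0 ]

  ±±1 : ∀ σ k → ± σ ℤ.* (± σ ℤ.* k) ≡ k
  ±±1 plus = Z.solve 1 (λ k → Z.con (pos 1) Z.:* (Z.con (pos 1) Z.:* k) Z.:= k) refl
  ±±1 minus = Z.solve 1 (λ k → Z.con -[1+ 0 ] Z.:* (Z.con -[1+ 0 ] Z.:* k) Z.:= k) refl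

  norm-sign : ∀ ρ T σ m n → norm ρ (fromℤ (± σ) * T) ρ m n ≡ norm ρ T ρ m (± σ ℤ.* n)
  norm-sign ρ T plus m n = trans
    (ℝS.solve 4 (λ ρ T m n → let s = con (pos 1) :+ con (pos 0) in ρ :* (m :* m) :+ (s :* T) :* (m :* n) :+ ρ :* (n :* n)
      := ρ :* (m :* m) :+ T :* (m :* (s :* n)) :+ ρ :* ((s :* n) :* (s :* n))) refl ρ T (fromℤ m) (fromℤ n))
    (cong (λ N → ρ * (fromℤ m * fromℤ m) + T * (fromℤ m * N) + ρ * (N * N)) (sym (fromℤ-* (pos 1) n)))
  norm-sign ρ T minus m n = trans
    (ℝS.solve 4 (λ ρ T m n → let s = :- (con (pos 1) :+ con (pos 0)) in ρ :* (m :* m) :+ (s :* T) :* (m :* n) :+ ρ :* (n :* n)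
      := ρ :* (m :* m) :+ T :* (m :* (s :* n)) :+ ρ :* ((s :* n) :* (s :* n))) refl ρ T (fromℤ m) (fromℤ n))
    (cong (λ N → ρ * (fromℤ m * fromℤ m) + T * (fromℤ m * N) + ρ * (N * N)) (sym (fromℤ-* -[1+ 0 ] n)))

  det-sign : ∀ σ p q r s → p ℤ.* (± σ ℤ.* s) ℤ.- (± σ ℤ.* q) ℤ.* r ≡ ± σ ℤ.* (p ℤ.* s ℤ.- q ℤ.* r)
  det-sign σ p q r s = Z.solve 5 (λ e p q r s → p Z.:* (e Z.:* s) Z.:- (e Z.:* q) Z.:* r Z.:= e Z.:* (p Z.:* s Z.:- q Z.:* r)) refl (± σ) p q r s

  ±≢0 : ∀ σ → ± σ ≢ pos 0
  ±≢0 plus ()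
  ±≢0 minus ()

  sign-cancel : ∀ σ {T ρ} → fromℤ (± σ) * T ≡ - ρ → T ≡ - (fromℤ (± σ) * ρ)
  sign-cancel plus {T} {ρ} e = trans (ℝS.solve 1 (λ T → T := (con (pos 1) :+ con (pos 0)) :* T) refl T)
    (trans e (ℝS.solve 1 (λ ρ → :- ρ := :- ((con (pos 1) :+ con (pos 0)) :* ρ)) refl ρ))
  sign-cancel minus {T} {ρ} e = trans (ℝS.solve 1 (λ T → T := :- ((:- (con (pos 1) :+ con (pos 0))) :* T)) refl T)
    (trans (cong -_ e) (ℝS.solve 1 (λ ρ → :- (:- ρ) := :- ((:- (con (pos 1) :+ con (pos 0))) :* ρ)) refl ρ))

  signed-bounds : ∀ σ {ρ T} → 0ℝ ≤ ρ + T → 0ℝ ≤ ρ + - T → 0ℝ ≤ ρ + fromℤ (± σ) * T × 0ℝ ≤ ρ + - (fromℤ (± σ) * T)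
  signed-bounds plus {ρ} {T} +T -T =
      0≤-of +T (ℝS.solve 2 (λ ρ T → ρ :+ T := ρ :+ (con (pos 1) :+ con (pos 0)) :* T) refl ρ T)
    , 0≤-of -T (ℝS.solve 2 (λ ρ T → ρ :- T := ρ :- (con (pos 1) :+ con (pos 0)) :* T) refl ρ T)
  signed-bounds minus {ρ} {T} +T -T =
      0≤-of -T (ℝS.solve 2 (λ ρ T → ρ :- T := ρ :+ (:- (con (pos 1) :+ con (pos 0))) :* T) refl ρ T)
    , 0≤-of +T (ℝS.solve 2 (λ ρ T → ρ :+ T := ρ :- (:- (con (pos 1) :+ con (pos 0))) :* T) refl ρ T)

  -- The substitution n ↦ ± n turns the congruence into m + n ≡ 0 and T into ± T, and it preserves
  -- |T| ≤ ρ.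
  signed-sublattice : ∀ σ {ρ T u} → 0ℝ < ρ → 0ℝ ≤ ρ + T → 0ℝ ≤ ρ + - T → ∀ {ℓ} → Prime ℓ →
    (∀ m n → ¬ (m ≡ pos 0 × n ≡ pos 0) → pos ℓ ∣ m ℤ.+ ± σ ℤ.* n → u ≤ norm ρ T ρ m n) →
    ∀ p q r s → p ℤ.* s ℤ.- q ℤ.* r ≢ pos 0 → pos ℓ ∣ p ℤ.+ ± σ ℤ.* q → pos ℓ ∣ r ℤ.+ ± σ ℤ.* s →
    norm ρ T ρ p q ≡ u → norm ρ T ρ r s ≡ u →
    u ≡ fromℤ (pos ℓ) * ρ × ((ℓ ≡ 2 × T ≡ 0ℝ) ⊎ T ≡ - (fromℤ (± σ) * ρ))
  signed-sublattice σ {ρ} {T} {u} 0<ρ +T -T {ℓ} ℓ-prime min p q r s nz d₁ d₂ n₁ n₂ =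
    finish (WellRoundedSublattice.sublattice {ρ} {fromℤ (± σ) * T} {u} 0<ρ
      (proj₁ (signed-bounds σ +T -T)) (proj₂ (signed-bounds σ +T -T)) ℓ-prime min′
      p (± σ ℤ.* q) r (± σ ℤ.* s) (λ e → i*i≢0 (±≢0 σ) nz (trans (sym (det-sign σ p q r s)) e)) d₁ d₂
      (trans (norm-sign ρ T σ p (± σ ℤ.* q)) (trans (cong (norm ρ T ρ p) (±±1 σ q)) n₁))
      (trans (norm-sign ρ T σ r (± σ ℤ.* s)) (trans (cong (norm ρ T ρ r) (±±1 σ s)) n₂)))
    where
    min′ : ∀ m n → ¬ (m ≡ pos 0 × n ≡ pos 0) → pos ℓ ∣ m ℤ.+ n → u ≤ norm ρ (fromℤ (± σ) * T) ρ m n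
    min′ m n nz d = subst (u ≤_) (sym (norm-sign ρ T σ m n)) (min m (± σ ℤ.* n)
      (λ (a , b) → nz (a , trans (sym (±±1 σ n)) (trans (cong (± σ ℤ.*_) b) (ℤₚ.*-zeroʳ (± σ)))))
      (subst (λ k → pos ℓ ∣ m ℤ.+ k) (sym (±±1 σ n)) d))
    finish : _ → _
    finish (a , inj₁ (b , c)) = a , inj₁ (b , x*y≡0 {fromℤ (± σ)} {T} c (λ z → ±≢0 σ (fromℤ-≡0 (± σ) z)))
    finish (a , inj₂ c) = a , inj₂ (sign-cancel σ c)

  -- The arithmetic of a reduced pair

  ∣-by : ∀ {d a b} → d ∣ a → b ≡ a → d ∣ b
  ∣-by p refl = p

  ∣-*-* : ∀ {d a b} → d ∣ a → d ∣ b → d ℤ.* d ∣ a ℤ.* b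
  ∣-*-* {d} {a} {b} (divides i e) (divides j f) = divides (i ℤ.* j) (trans (cong₂ ℤ._*_ e f)
    (Z.solve 3 (λ i j d → (i Z.:* d) Z.:* (j Z.:* d) Z.:= (i Z.:* j) Z.:* (d Z.:* d)) refl i j d))

  square-roots : ∀ x y → x ℤ.* x ≡ y ℤ.* y → ∃ λ σ → x ≡ ± σ ℤ.* y
  square-roots x y e with ℤₚ.i*j≡0⇒i≡0∨j≡0 (x ℤ.- y) {x ℤ.+ y}
    (trans (Z.solve 2 (λ x y → (x Z.:- y) Z.:* (x Z.:+ y) Z.:= x Z.:* x Z.:- y Z.:* y) refl x y) (trans (cong (ℤ._- y ℤ.* y) e) (ℤₚ.+-inverseʳ (y ℤ.* y))))
  ... | inj₁ z = plus , trans (ℤₚ.i-j≡0⇒i≡j x y z) (sym (ℤₚ.*-identityˡ y))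
  ... | inj₂ z = minus , trans (Z.solve 2 (λ x y → x Z.:= x Z.:+ y Z.:+ Z.con -[1+ 0 ] Z.:* y) refl x y)
        (trans (cong (ℤ._+ -[1+ 0 ] ℤ.* y) z) (ℤₚ.+-identityˡ (-[1+ 0 ] ℤ.* y)))

  cancel-2 : ∀ {a b} → pos 2 ℤ.* a ≡ pos 2 ℤ.* b → a ≡ b
  cancel-2 {a} {b} e = ℤₚ.*-cancelˡ-≡ (pos 2) a b e

  -- Product and sum of squares determine (p + q)² and (p - q)², hence p + q and p - q up to
  -- independent signs: equal signs give the same pair, different signs the swapped one.
  same-or-swapped : ∀ p q r s → p ℤ.* q ≡ r ℤ.* s → p ℤ.* p ℤ.+ q ℤ.* q ≡ r ℤ.* r ℤ.+ s ℤ.* s →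
    (∃ λ σ → p ≡ ± σ ℤ.* r × q ≡ ± σ ℤ.* s) ⊎ (∃ λ σ → p ≡ ± σ ℤ.* s × q ≡ ± σ ℤ.* r)
  same-or-swapped p q r s e₁ e₂ = combine (square-roots (p ℤ.+ q) (r ℤ.+ s) sum²) (square-roots (p ℤ.- q) (r ℤ.- s) diff²)
    where
    sum² : (p ℤ.+ q) ℤ.* (p ℤ.+ q) ≡ (r ℤ.+ s) ℤ.* (r ℤ.+ s)
    sum² = trans (Z.solve 2 (λ p q → (p Z.:+ q) Z.:* (p Z.:+ q) Z.:= (p Z.:* p Z.:+ q Z.:* q) Z.:+ Z.con (pos 2) Z.:* (p Z.:* q)) refl p q)
      (trans (cong₂ (λ a b → a ℤ.+ pos 2 ℤ.* b) e₂ e₁)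
        (Z.solve 2 (λ p q → (p Z.:* p Z.:+ q Z.:* q) Z.:+ Z.con (pos 2) Z.:* (p Z.:* q) Z.:= (p Z.:+ q) Z.:* (p Z.:+ q)) refl r s))
    diff² : (p ℤ.- q) ℤ.* (p ℤ.- q) ≡ (r ℤ.- s) ℤ.* (r ℤ.- s)
    diff² = trans (Z.solve 2 (λ p q → (p Z.:- q) Z.:* (p Z.:- q) Z.:= (p Z.:* p Z.:+ q Z.:* q) Z.:- Z.con (pos 2) Z.:* (p Z.:* q)) refl p q)
      (trans (cong₂ (λ a b → a ℤ.- pos 2 ℤ.* b) e₂ e₁)
        (Z.solve 2 (λ p q → (p Z.:* p Z.:+ q Z.:* q) Z.:- Z.con (pos 2) Z.:* (p Z.:* q) Z.:= (p Z.:- q) Z.:* (p Z.:- q)) refl r s))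
    halves : ∀ {a b} → p ℤ.+ q ≡ a → p ℤ.- q ≡ b → pos 2 ℤ.* p ≡ a ℤ.+ b × pos 2 ℤ.* q ≡ a ℤ.- b
    halves e f = trans (Z.solve 2 (λ p q → Z.con (pos 2) Z.:* p Z.:= (p Z.:+ q) Z.:+ (p Z.:- q)) refl p q) (cong₂ ℤ._+_ e f)
               , trans (Z.solve 2 (λ p q → Z.con (pos 2) Z.:* q Z.:= (p Z.:+ q) Z.:- (p Z.:- q)) refl p q) (cong₂ ℤ._-_ e f)
    twice : ∀ σ y z → ± σ ℤ.* y ℤ.+ ± σ ℤ.* z ≡ ± σ ℤ.* (y ℤ.+ z) × ± σ ℤ.* y ℤ.- ± σ ℤ.* z ≡ ± σ ℤ.* (y ℤ.- z)
    twice σ y z = Z.solve 3 (λ e y z → e Z.:* y Z.:+ e Z.:* z Z.:= e Z.:* (y Z.:+ z)) refl (± σ) y z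
                , Z.solve 3 (λ e y z → e Z.:* y Z.:- e Z.:* z Z.:= e Z.:* (y Z.:- z)) refl (± σ) y z
    r+s+r-s : ∀ e → e ℤ.* ((r ℤ.+ s) ℤ.+ (r ℤ.- s)) ≡ pos 2 ℤ.* (e ℤ.* r)
    r+s+r-s e = Z.solve 3 (λ e r s → e Z.:* ((r Z.:+ s) Z.:+ (r Z.:- s)) Z.:= Z.con (pos 2) Z.:* (e Z.:* r)) refl e r s
    r+s-r-s : ∀ e → e ℤ.* ((r ℤ.+ s) ℤ.- (r ℤ.- s)) ≡ pos 2 ℤ.* (e ℤ.* s)
    r+s-r-s e = Z.solve 3 (λ e r s → e Z.:* ((r Z.:+ s) Z.:- (r Z.:- s)) Z.:= Z.con (pos 2) Z.:* (e Z.:* s)) refl e r s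
    same : ∀ σ → p ℤ.+ q ≡ ± σ ℤ.* (r ℤ.+ s) → p ℤ.- q ≡ ± σ ℤ.* (r ℤ.- s) → p ≡ ± σ ℤ.* r × q ≡ ± σ ℤ.* s
    same σ e f = let g , h = halves e f ; u , v = twice σ (r ℤ.+ s) (r ℤ.- s) in
        cancel-2 (trans g (trans u (r+s+r-s (± σ)))) , cancel-2 (trans h (trans v (r+s-r-s (± σ))))
    opposite : ∀ τ y → ± τ ℤ.* y ≡ ± (case τ of λ { plus → minus ; minus → plus }) ℤ.* (ℤ.- y)
    opposite plus y = Z.solve 1 (λ y → Z.con (pos 1) Z.:* y Z.:= Z.con -[1+ 0 ] Z.:* (Z.:- y)) refl y
    opposite minus y = Z.solve 1 (λ y → Z.con -[1+ 0 ] Z.:* y Z.:= Z.con (pos 1) Z.:* (Z.:- y)) refl y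
    swapped : ∀ σ → p ℤ.+ q ≡ ± σ ℤ.* (r ℤ.+ s) → p ℤ.- q ≡ ± σ ℤ.* (ℤ.- (r ℤ.- s)) → p ≡ ± σ ℤ.* s × q ≡ ± σ ℤ.* r
    swapped σ e f = let g , h = halves e f ; u , v = twice σ (r ℤ.+ s) (ℤ.- (r ℤ.- s)) in
        cancel-2 (trans g (trans u (r+s-r-s (± σ))))
      , cancel-2 (trans h (trans v (trans (cong (λ z → ± σ ℤ.* ((r ℤ.+ s) ℤ.+ z)) (ℤₚ.neg-involutive (r ℤ.- s))) (r+s+r-s (± σ)))))
    combine : (∃ λ σ → p ℤ.+ q ≡ ± σ ℤ.* (r ℤ.+ s)) → (∃ λ σ → p ℤ.- q ≡ ± σ ℤ.* (r ℤ.- s)) →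
      (∃ λ σ → p ≡ ± σ ℤ.* r × q ≡ ± σ ℤ.* s) ⊎ (∃ λ σ → p ≡ ± σ ℤ.* s × q ≡ ± σ ℤ.* r)
    combine (plus , e) (plus , f) = inj₁ (plus , same plus e f)
    combine (minus , e) (minus , f) = inj₁ (minus , same minus e f)
    combine (plus , e) (minus , f) = inj₂ (plus , swapped plus e (trans f (opposite minus (r ℤ.- s))))
    combine (minus , e) (plus , f) = inj₂ (minus , swapped minus e (trans f (opposite plus (r ℤ.- s))))

  norm₁ : ℝ → ℤ → ℤ → ℝ
  norm₁ t = norm 1ℝ t 1ℝ

  -- L = ℤ² with the form m² + t m n + n², and M = {ℓ ∣ m + n x} with
  -- minimal basis (p , q), (r , s).
  record ReducedPair (ℓ : ℕ) (t u : ℝ) (x p q r s : ℤ) : Set where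
    field
      ℓ-prime : Prime ℓ
      +t : 0ℝ ≤ 1ℝ + t
      -t : 0ℝ ≤ 1ℝ + - t
      1≤u : 1ℝ ≤ u
      minimalL : ∀ m n → ¬ (m ≡ pos 0 × n ≡ pos 0) → 1ℝ ≤ norm₁ t m n
      minimalM : ∀ m n → ¬ (m ≡ pos 0 × n ≡ pos 0) → pos ℓ ∣ m ℤ.+ n ℤ.* x → u ≤ norm₁ t m n
      pq∈ : pos ℓ ∣ p ℤ.+ q ℤ.* x
      rs∈ : pos ℓ ∣ r ℤ.+ s ℤ.* x
      norm-pq : norm₁ t p q ≡ u
      norm-rs : norm₁ t r s ≡ u
      D≡ : p ℤ.* s ℤ.- q ℤ.* r ≡ pos ℓ ⊎ p ℤ.* s ℤ.- q ℤ.* r ≡ ℤ.- pos ℓ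

    open PrimeKit ℓ-prime renaming (L to ℓℤ)

    0<u : 0ℝ < u
    0<u = <-≤-trans 0<1 1≤u

    D : ℤ
    D = p ℤ.* s ℤ.- q ℤ.* r

    D≢0 : D ≢ pos 0
    D≢0 e with D≡
    ... | inj₁ f = L≢0 (trans (sym f) e)
    ... | inj₂ f = L≢0 (trans (sym (ℤₚ.neg-involutive ℓℤ)) (cong (λ z → ℤ.- z) (trans (sym f) e)))

    D∣ℓ : D ∣ ℓℤ
    D∣ℓ with D≡
    ... | inj₁ f = divides (pos 1) (trans (sym f) (sym (ℤₚ.*-identityˡ D)))
    ... | inj₂ f = divides -[1+ 0 ] (trans (sym (ℤₚ.neg-involutive ℓℤ)) (trans (cong (λ z → ℤ.- z) (sym f)) (sym (ℤₚ.-1*i≡-i D))))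

    ℓ²∤D : ¬ ℓℤ ℤ.* ℓℤ ∣ D
    ℓ²∤D h = L∤1 (*-cancelʳ-∣ ℓℤ {{ℤ.≢-nonZero L≢0}} (subst (ℓℤ ℤ.* ℓℤ ∣_) (sym (ℤₚ.*-identityˡ ℓℤ)) (∣-trans h D∣ℓ)))

    signed-minimalM : ∀ σ → ℓℤ ∣ ± σ ℤ.- x → ∀ m n → ¬ (m ≡ pos 0 × n ≡ pos 0) →
                      ℓℤ ∣ m ℤ.+ ± σ ℤ.* n → u ≤ norm₁ t m n
    signed-minimalM σ σ-x m n nz d = minimalM m n nz (∣-by (∣m∣n⇒∣m-n d (∣n⇒∣m*n n σ-x))
      (Z.solve 4 (λ m n e x → m Z.:+ n Z.:* x Z.:= m Z.:+ e Z.:* n Z.:- n Z.:* (e Z.:- x)) refl m n (± σ) x))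

    signed∈ : ∀ σ → ℓℤ ∣ ± σ ℤ.- x → ∀ m n → ℓℤ ∣ m ℤ.+ n ℤ.* x → ℓℤ ∣ m ℤ.+ ± σ ℤ.* n
    signed∈ σ σ-x m n d = ∣-by (∣m∣n⇒∣m+n d (∣n⇒∣m*n n σ-x))
      (Z.solve 4 (λ m n e x → m Z.:+ e Z.:* n Z.:= m Z.:+ n Z.:* x Z.:+ n Z.:* (e Z.:- x)) refl m n (± σ) x)

    -- For x ≡ ± 1 the condition ℓ ∣ m + n x is ℓ ∣ m ± n, so M is one of the rigid sublattices,
    -- with ρ = 1.
    M-signed : ∀ σ → ℓℤ ∣ ± σ ℤ.- x → u ≡ fromℤ ℓℤ * 1ℝ × ((ℓ ≡ 2 × t ≡ 0ℝ) ⊎ t ≡ - (fromℤ (± σ) * 1ℝ))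
    M-signed σ σ-x = signed-sublattice σ {1ℝ} {t} {u} 0<1 +t -t ℓ-prime (signed-minimalM σ σ-x) p q r s D≢0
      (signed∈ σ σ-x p q pq∈) (signed∈ σ σ-x r s rs∈) norm-pq norm-rs

    norms-agree : fromℤ p * fromℤ q ≡ fromℤ r * fromℤ s →
      fromℤ p * fromℤ p + fromℤ q * fromℤ q ≡ fromℤ r * fromℤ r + fromℤ s * fromℤ s
    norms-agree e = trans
      (ℝS.solve 3 (λ t p q → p :* p :+ q :* q := con (pos 1) :* (p :* p) :+ t :* (p :* q) :+ con (pos 1) :* (q :* q) :- t :* (p :* q)) refl t (fromℤ p) (fromℤ q))
      (trans (cong₂ (λ a b → a + - (t * b)) (trans norm-pq (sym norm-rs)) e)
      (ℝS.solve 3 (λ t p q → con (pos 1) :* (p :* p) :+ t :* (p :* q) :+ con (pos 1) :* (q :* q) :- t :* (p :* q) := p :* p :+ q :* q) refl t (fromℤ r) (fromℤ s)))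

    -- The determining equation t (p q − r s) = r² + s² − p² − q² degenerates only
    -- for the hexagonal lattice.
    degenerate : p ℤ.* q ≡ r ℤ.* s → ∃ λ σ → t ≡ - (fromℤ (± σ) * 1ℝ)
    degenerate e₁ = split (same-or-swapped p q r s e₁ e₂)
      where
      e₂ : p ℤ.* p ℤ.+ q ℤ.* q ≡ r ℤ.* r ℤ.+ s ℤ.* s
      e₂ = fromℤ-injective (trans (ℝS.cast 2 (λ p q → p :* p :+ q :* q) (p ∷ q ∷ []))
        (trans (norms-agree (trans (sym (fromℤ-* p q)) (trans (cong fromℤ e₁) (fromℤ-* r s))))
          (sym (ℝS.cast 2 (λ p q → p :* p :+ q :* q) (r ∷ s ∷ [])))))
      same-det : ∀ e p q r s → p ≡ e ℤ.* r → q ≡ e ℤ.* s → p ℤ.* s ℤ.- q ℤ.* r ≡ pos 0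
      same-det e p q r s refl refl = Z.solve 3 (λ e r s → (e Z.:* r) Z.:* s Z.:- (e Z.:* s) Z.:* r Z.:= Z.con (pos 0)) refl e r s
      swapped-det : ∀ τ p q r s → p ≡ ± τ ℤ.* s → q ≡ ± τ ℤ.* r → p ℤ.* s ℤ.- q ℤ.* r ≡ ± τ ℤ.* ((p ℤ.- q) ℤ.* (p ℤ.+ q))
      swapped-det plus p q r s refl refl = Z.solve 2 (λ r s → let e = Z.con (pos 1) in (e Z.:* s) Z.:* s Z.:- (e Z.:* r) Z.:* r
        Z.:= e Z.:* ((e Z.:* s Z.:- e Z.:* r) Z.:* (e Z.:* s Z.:+ e Z.:* r))) refl r s
      swapped-det minus p q r s refl refl = Z.solve 2 (λ r s → let e = Z.con -[1+ 0 ] in (e Z.:* s) Z.:* s Z.:- (e Z.:* r) Z.:* r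
        Z.:= e Z.:* ((e Z.:* s Z.:- e Z.:* r) Z.:* (e Z.:* s Z.:+ e Z.:* r))) refl r s
      ∣product : ∀ τ → p ≡ ± τ ℤ.* s → q ≡ ± τ ℤ.* r → ℓℤ ∣ (p ℤ.- q) ℤ.* (p ℤ.+ q)
      ∣product τ e f = ∣-by (∣n⇒∣m*n (± τ) ℓ∣D) (trans (sym (±±1 τ ((p ℤ.- q) ℤ.* (p ℤ.+ q)))) (cong (± τ ℤ.*_) (sym (swapped-det τ p q r s e f))))
        where
        ℓ∣D : ℓℤ ∣ D
        ℓ∣D with D≡
        ... | inj₁ g = ∣-by ∣-refl g
        ... | inj₂ g = ∣-by (∣m⇒∣-m ∣-refl) g
      not-both : ∀ τ → p ≡ ± τ ℤ.* s → q ≡ ± τ ℤ.* r → ℓℤ ∣ p ℤ.- q → ℓℤ ∣ p ℤ.+ q → ⊥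
      not-both τ e f d₁ d₂ = ℓ²∤D (∣-by (∣n⇒∣m*n (± τ) (∣-*-* d₁ d₂)) (swapped-det τ p q r s e f))
      -- M now contains (q , p) along with (p , q). Difference and sum of the two congruences show
      -- that ℓ divides (p - q)(1 - x) and (p + q)(1 + x).
      ∈swapped : ∀ τ → p ≡ ± τ ℤ.* s → q ≡ ± τ ℤ.* r → ℓℤ ∣ q ℤ.+ p ℤ.* x
      ∈swapped τ e f = ∣-by (∣n⇒∣m*n (± τ) rs∈) (trans (cong₂ (λ a b → a ℤ.+ b ℤ.* x) f e)
        (Z.solve 4 (λ e r s x → e Z.:* r Z.:+ (e Z.:* s) Z.:* x Z.:= e Z.:* (r Z.:+ s Z.:* x)) refl (± τ) r s x))
      hexagonal : ∀ σ → ¬ ((ℓ ≡ 2) × ℓℤ ∣ p ℤ.+ ± σ ℤ.* q × ¬ ℓℤ ∣ p ℤ.- ± σ ℤ.* q) → ℓℤ ∣ p ℤ.+ ± σ ℤ.* q → ¬ ℓℤ ∣ p ℤ.- ± σ ℤ.* q →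
        ℓℤ ∣ ± σ ℤ.- x → t ≡ - (fromℤ (± σ) * 1ℝ)
      hexagonal σ not-2 d nd σ-x = [ (λ (ℓ≡2 , _) → ⊥-elim (not-2 (ℓ≡2 , d , nd))) , (λ e → e) ]′ (proj₂ (M-signed σ σ-x))
      -- At ℓ = 2 the factors p − q and p + q would have the same parity.
      parity-⊥ : ∀ σ → ¬ ((ℓ ≡ 2) × ℓℤ ∣ p ℤ.+ ± σ ℤ.* q × ¬ ℓℤ ∣ p ℤ.- ± σ ℤ.* q)
      parity-⊥ σ (refl , d , nd) = nd (∣-by (∣m∣n⇒∣m-n d (∣n⇒∣m*n (± σ ℤ.* q) (∣-refl {pos 2})))
        (Z.solve 2 (λ p q → p Z.:- q Z.:= p Z.:+ q Z.:- q Z.:* Z.con (pos 2)) refl p (± σ ℤ.* q)))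
      split : _ → ∃ λ σ → t ≡ - (fromℤ (± σ) * 1ℝ)
      split (inj₁ (τ , e , f)) = ⊥-elim (D≢0 (same-det (± τ) p q r s e f))
      -- Up to sign, (p - q)(p + q) is D = ± ℓ, so ℓ divides exactly one factor. The factor it does
      -- not divide is cancelled from one of the congruences above, which leaves x ≡ ± 1.
      split (inj₂ (τ , e , f)) with euclid {p ℤ.- q} {p ℤ.+ q} (∣product τ e f)
      ... | inj₂ d = plus , hexagonal plus (parity-⊥ plus) d′ nd′ (∣-by (cofactor (euclid {p ℤ.- q} {pos 1 ℤ.- x}
              (∣-by (∣m∣n⇒∣m-n pq∈ (∈swapped τ e f)) (Z.solve 3 (λ p q x → (p Z.:- q) Z.:* (Z.con (pos 1) Z.:- x) Z.:= p Z.:+ q Z.:* x Z.:- (q Z.:+ p Z.:* x)) refl p q x)))) refl)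
        where
        nd : ¬ ℓℤ ∣ p ℤ.- q
        nd h = not-both τ e f h d
        d′ = ∣-by d (cong (λ z → p ℤ.+ z) (ℤₚ.*-identityˡ q))
        nd′ = λ h → nd (∣-by h (cong (λ z → p ℤ.- z) (sym (ℤₚ.*-identityˡ q))))
        cofactor : _ ⊎ _ → _
        cofactor (inj₁ h) = ⊥-elim (nd h)
        cofactor (inj₂ h) = h
      ... | inj₁ d = minus , hexagonal minus (parity-⊥ minus) d′ nd′ (∣-by (∣m⇒∣-m (cofactor (euclid {p ℤ.+ q} {pos 1 ℤ.+ x}
              (∣-by (∣m∣n⇒∣m+n pq∈ (∈swapped τ e f)) (Z.solve 3 (λ p q x → (p Z.:+ q) Z.:* (Z.con (pos 1) Z.:+ x) Z.:= p Z.:+ q Z.:* x Z.:+ (q Z.:+ p Z.:* x)) refl p q x)))))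
              (Z.solve 1 (λ x → Z.con -[1+ 0 ] Z.:- x Z.:= Z.:- (Z.con (pos 1) Z.:+ x)) refl x))
        where
        nd : ¬ ℓℤ ∣ p ℤ.+ q
        nd h = not-both τ e f d h
        d′ = ∣-by d (Z.solve 2 (λ p q → p Z.:+ Z.con -[1+ 0 ] Z.:* q Z.:= p Z.:- q) refl p q)
        nd′ = λ h → nd (∣-by h (Z.solve 2 (λ p q → p Z.:+ q Z.:= p Z.:- Z.con -[1+ 0 ] Z.:* q) refl p q))
        cofactor : _ ⊎ _ → _
        cofactor (inj₁ h) = ⊥-elim (nd h)
        cofactor (inj₂ h) = h

    -- The middle coefficient of the norm form of M in its basis (p , q), (r , s).
    T′ : ℝ
    T′ = fromℤ (pos 2) * (fromℤ p * fromℤ r) + t * (fromℤ p * fromℤ s + fromℤ q * fromℤ r) + fromℤ (pos 2) * (fromℤ q * fromℤ s)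

    fst snd : ℤ → ℤ → ℤ
    fst m n = m ℤ.* p ℤ.+ n ℤ.* r
    snd m n = m ℤ.* q ℤ.+ n ℤ.* s

    norm-M : ∀ m n → norm u T′ u m n ≡ norm₁ t (fst m n) (snd m n)
    norm-M m n = trans (cong₂ (λ a b → a * (fromℤ m * fromℤ m) + T′ * (fromℤ m * fromℤ n) + b * (fromℤ n * fromℤ n)) (sym norm-pq) (sym norm-rs))
      (trans (ℝS.solve 7 (λ t m n p q r s →
        (con (pos 1) :* (p :* p) :+ t :* (p :* q) :+ con (pos 1) :* (q :* q)) :* (m :* m)
          :+ (con (pos 2) :* (p :* r) :+ t :* (p :* s :+ q :* r) :+ con (pos 2) :* (q :* s)) :* (m :* n)
          :+ (con (pos 1) :* (r :* r) :+ t :* (r :* s) :+ con (pos 1) :* (s :* s)) :* (n :* n)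
        := let P = m :* p :+ n :* r ; Q = m :* q :+ n :* s in con (pos 1) :* (P :* P) :+ t :* (P :* Q) :+ con (pos 1) :* (Q :* Q))
        refl t (fromℤ m) (fromℤ n) (fromℤ p) (fromℤ q) (fromℤ r) (fromℤ s))
      (cong₂ (λ P Q → 1ℝ * (P * P) + t * (P * Q) + 1ℝ * (Q * Q))
        (sym (ℝS.cast 4 (λ m p n r → m :* p :+ n :* r) (m ∷ p ∷ n ∷ r ∷ [])))
        (sym (ℝS.cast 4 (λ m p n r → m :* p :+ n :* r) (m ∷ q ∷ n ∷ s ∷ [])))))

    M-nonzero : ∀ m n → ¬ (m ≡ pos 0 × n ≡ pos 0) → ¬ (fst m n ≡ pos 0 × snd m n ≡ pos 0)
    M-nonzero m n nz (e₁ , e₂) = nz (vanish (Z.solve 6 (λ p q r s m n → m Z.:* (p Z.:* s Z.:- q Z.:* r) Z.:= (m Z.:* p Z.:+ n Z.:* r) Z.:* s Z.:- (m Z.:* q Z.:+ n Z.:* s) Z.:* r) refl p q r s m n)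
        (trans (cong₂ (λ a b → a ℤ.* s ℤ.- b ℤ.* r) e₁ e₂) (Z.solve 2 (λ s r → Z.con (pos 0) Z.:* s Z.:- Z.con (pos 0) Z.:* r Z.:= Z.con (pos 0)) refl s r))
      , vanish (Z.solve 6 (λ p q r s m n → n Z.:* (p Z.:* s Z.:- q Z.:* r) Z.:= p Z.:* (m Z.:* q Z.:+ n Z.:* s) Z.:- q Z.:* (m Z.:* p Z.:+ n Z.:* r)) refl p q r s m n)
        (trans (cong₂ (λ a b → p ℤ.* b ℤ.- q ℤ.* a) e₁ e₂) (Z.solve 2 (λ p q → p Z.:* Z.con (pos 0) Z.:- q Z.:* Z.con (pos 0) Z.:= Z.con (pos 0)) refl p q)))
      where
      vanish : ∀ {m k} → m ℤ.* D ≡ k → k ≡ pos 0 → m ≡ pos 0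
      vanish {m} e z = [ (λ h → h) , (λ h → ⊥-elim (D≢0 h)) ]′ (ℤₚ.i*j≡0⇒i≡0∨j≡0 m (trans e z))

    M-lower : ∀ m n → ¬ (m ≡ pos 0 × n ≡ pos 0) → u ≤ norm u T′ u m n
    M-lower m n nz = subst (u ≤_) (sym (norm-M m n)) (minimalM (fst m n) (snd m n) (M-nonzero m n nz)
      (∣-by (∣m∣n⇒∣m+n (∣n⇒∣m*n m pq∈) (∣n⇒∣m*n n rs∈))
        (Z.solve 7 (λ p q r s m n x → m Z.:* p Z.:+ n Z.:* r Z.:+ (m Z.:* q Z.:+ n Z.:* s) Z.:* x Z.:= m Z.:* (p Z.:+ q Z.:* x) Z.:+ n Z.:* (r Z.:+ s Z.:* x)) refl p q r s m n x)))

    ℓ² : ℝ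
    ℓ² = fromℤ ℓℤ * fromℤ ℓℤ

    norm-ℓ : ∀ m n m′ n′ → m ≡ m′ ℤ.* ℓℤ → n ≡ n′ ℤ.* ℓℤ → norm₁ t m n ≡ ℓ² * norm₁ t m′ n′
    norm-ℓ m n m′ n′ e₁ e₂ = trans (cong₂ (λ P Q → 1ℝ * (P * P) + t * (P * Q) + 1ℝ * (Q * Q))
        (trans (cong fromℤ e₁) (fromℤ-* m′ ℓℤ)) (trans (cong fromℤ e₂) (fromℤ-* n′ ℓℤ)))
      (ℝS.solve 4 (λ t m n l → let P = m :* l ; Q = n :* l in con (pos 1) :* (P :* P) :+ t :* (P :* Q) :+ con (pos 1) :* (Q :* Q)
        := l :* l :* (con (pos 1) :* (m :* m) :+ t :* (m :* n) :+ con (pos 1) :* (n :* n))) refl t (fromℤ m′) (fromℤ n′) (fromℤ ℓℤ))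

    ∣fst : ∀ {m n} → ℓℤ ∣ snd m n → ℓℤ ∣ fst m n
    ∣fst {m} {n} d = ∣-by (∣m∣n⇒∣m-n (∣m∣n⇒∣m+n (∣n⇒∣m*n m pq∈) (∣n⇒∣m*n n rs∈)) (∣m⇒∣m*n x d))
        (Z.solve 7 (λ p q r s m n x → m Z.:* p Z.:+ n Z.:* r Z.:= m Z.:* (p Z.:+ q Z.:* x) Z.:+ n Z.:* (r Z.:+ s Z.:* x) Z.:- (m Z.:* q Z.:+ n Z.:* s) Z.:* x) refl p q r s m n x)

    -- On M, a second coordinate divisible by ℓ forces the first to be so as well, since ℓ ∣ m + n
    -- x. The vector is then ℓ times a nonzero vector of L, whose norm is at least 1.
    ℓL-lower : ∀ m n → ¬ (m ≡ pos 0 × n ≡ pos 0) → ℓℤ ∣ snd m n → ℓ² ≤ norm u T′ u m n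
    ℓL-lower m n nz d = go (∣fst {m} {n} d) d
      where
      go : ℓℤ ∣ fst m n → ℓℤ ∣ snd m n → ℓ² ≤ norm u T′ u m n
      go (divides m′ e₁) (divides n′ e₂) = subst (ℓ² ≤_) (sym (trans (norm-M m n) (norm-ℓ (fst m n) (snd m n) m′ n′ e₁ e₂)))
        (≤-by (0≤x² (fromℤ ℓℤ) ⊛ x≤y⇒0≤y-x (minimalL m′ n′ λ (z₁ , z₂) → M-nonzero m n nz
            (trans e₁ (cong (ℤ._* ℓℤ) z₁) , trans e₂ (cong (ℤ._* ℓℤ) z₂))))
          (ℝS.solve 2 (λ l n → l :* (n :- con (pos 1)) := l :* n :- l) refl ℓ² (norm₁ t m′ n′)))

    D²≡ℓ² : fromℤ D * fromℤ D ≡ ℓ²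
    D²≡ℓ² with D≡
    ... | inj₁ e = cong (λ d → fromℤ d * fromℤ d) e
    ... | inj₂ e = trans (cong (λ d → d * d) (trans (cong fromℤ e) (fromℤ-neg ℓℤ))) (ℝS.solve 1 (λ l → :- l :* :- l := l :* l) refl (fromℤ ℓℤ))

    norm-D0 : ∀ m n → m ≡ D → n ≡ pos 0 → norm₁ t m n ≡ ℓ²
    norm-D0 m n refl refl = trans (ℝS.solve 2 (λ t d → con (pos 1) :* (d :* d) :+ t :* (d :* con (pos 0)) :+ con (pos 1) :* (con (pos 0) :* con (pos 0)) := d :* d) refl t (fromℤ D)) D²≡ℓ²

    norm-0D : ∀ m n → m ≡ pos 0 → n ≡ D → norm₁ t m n ≡ ℓ²
    norm-0D m n refl refl = trans (ℝS.solve 2 (λ t d → con (pos 1) :* (con (pos 0) :* con (pos 0)) :+ t :* (con (pos 0) :* d) :+ con (pos 1) :* (d :* d) := d :* d) refl t (fromℤ D)) D²≡ℓ²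

    -- ℓ L is a sublattice of index ℓ of M, with minimal basis ℓ e₁, ℓ e₂.
    dual-signed : ∀ σ → ℓℤ ∣ ± σ ℤ.* q ℤ.- s → u ≡ fromℤ ℓℤ * 1ℝ
    -- By Cramer's rule s (p , q) - q (r , s) = (D , 0) and -r (p , q) + p (r , s) = (0 , D) with D
    -- = ± ℓ. These are the minimal vectors of ℓ L, of norm ℓ². The rigidity statement with u as
    -- minimum of the larger lattice reads ℓ² = ℓ u.
    dual-signed σ d = sym (trans (*-identityʳ (fromℤ ℓℤ)) (*-cancelˡ {fromℤ ℓℤ} (λ z → L≢0 (fromℤ-≡0 ℓℤ z)) (proj₁
        (signed-sublattice σ {u} {T′} {ℓ²} 0<u (proj₁ bounds) (proj₂ bounds) ℓ-prime lower s (ℤ.- q) (ℤ.- r) p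
          (λ e → D≢0 (trans (Z.solve 4 (λ p q r s → p Z.:* s Z.:- q Z.:* r Z.:= s Z.:* p Z.:- (Z.:- q) Z.:* (Z.:- r)) refl p q r s) e))
          (∣-by (∣m⇒∣-m d) (Z.solve 3 (λ e q s → s Z.:+ e Z.:* (Z.:- q) Z.:= Z.:- (e Z.:* q Z.:- s)) refl (± σ) q s))
          (∣-by (∣m∣n⇒∣m-n (∣m∣n⇒∣m-n (∣n⇒∣m*n (± σ) pq∈) rs∈) (∣n⇒∣m*n x d))
            (Z.solve 6 (λ e p q r s x → Z.:- r Z.:+ e Z.:* p Z.:= e Z.:* (p Z.:+ q Z.:* x) Z.:- (r Z.:+ s Z.:* x) Z.:- x Z.:* (e Z.:* q Z.:- s)) refl (± σ) p q r s x))
          (trans (norm-M s (ℤ.- q)) (norm-D0 (fst s (ℤ.- q)) (snd s (ℤ.- q))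
            (Z.solve 4 (λ p q r s → s Z.:* p Z.:+ (Z.:- q) Z.:* r Z.:= p Z.:* s Z.:- q Z.:* r) refl p q r s)
            (Z.solve 2 (λ q s → s Z.:* q Z.:+ (Z.:- q) Z.:* s Z.:= Z.con (pos 0)) refl q s)))
          (trans (norm-M (ℤ.- r) p) (norm-0D (fst (ℤ.- r) p) (snd (ℤ.- r) p)
            (Z.solve 2 (λ p r → (Z.:- r) Z.:* p Z.:+ p Z.:* r Z.:= Z.con (pos 0)) refl p r)
            (Z.solve 4 (λ p q r s → (Z.:- r) Z.:* q Z.:+ p Z.:* s Z.:= p Z.:* s Z.:- q Z.:* r) refl p q r s)))))))
      where
      bounds = cross-bounds {u} {T′} (M-lower (pos 1) (pos 1) λ ()) (M-lower (pos 1) (ℤ.- pos 1) λ ())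
      lower : ∀ m n → ¬ (m ≡ pos 0 × n ≡ pos 0) → ℓℤ ∣ m ℤ.+ ± σ ℤ.* n → ℓ² ≤ norm u T′ u m n
      lower m n nz h = ℓL-lower m n nz (∣-by (∣m∣n⇒∣m-n (∣m⇒∣m*n q h) (∣n⇒∣m*n n d))
        (Z.solve 5 (λ e m n q s → m Z.:* q Z.:+ n Z.:* s Z.:= (m Z.:+ e Z.:* n) Z.:* q Z.:- n Z.:* (e Z.:* q Z.:- s)) refl (± σ) m n q s))

    module Integral (a b : ℤ) (at≡b : fromℤ a * t ≡ fromℤ b) {i j} (bezout : i ℤ.* a ℤ.+ j ℤ.* b ≡ pos 1) where

      f : ℤ → ℤ → ℤ
      f m n = a ℤ.* (m ℤ.* m) ℤ.+ b ℤ.* (m ℤ.* n) ℤ.+ a ℤ.* (n ℤ.* n)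

      -- The value f(-x , 1) at the vector that generates M modulo ℓ L.
      n₀ : ℤ
      n₀ = a ℤ.* (x ℤ.* x) ℤ.- b ℤ.* x ℤ.+ a

      f-norm : ∀ m n → fromℤ (f m n) ≡ fromℤ a * norm₁ t m n
      f-norm m n = trans (ℝS.cast 4 (λ a b m n → a :* (m :* m) :+ b :* (m :* n) :+ a :* (n :* n)) (a ∷ b ∷ m ∷ n ∷ []))
        (trans (cong (λ z → fromℤ a * (fromℤ m * fromℤ m) + z * (fromℤ m * fromℤ n) + fromℤ a * (fromℤ n * fromℤ n)) (sym at≡b))
          (ℝS.solve 4 (λ a t m n → a :* (m :* m) :+ (a :* t) :* (m :* n) :+ a :* (n :* n) := a :* (con (pos 1) :* (m :* m) :+ t :* (m :* n) :+ con (pos 1) :* (n :* n))) refl (fromℤ a) t (fromℤ m) (fromℤ n)))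

      f-ℓ : ∀ m n → u ≡ fromℤ ℓℤ * 1ℝ → norm₁ t m n ≡ u → f m n ≡ a ℤ.* ℓℤ
      f-ℓ m n u≡ n≡ = fromℤ-injective (trans (f-norm m n) (trans (cong (fromℤ a *_) (trans n≡ (trans u≡ (*-identityʳ (fromℤ ℓℤ))))) (sym (fromℤ-* a ℓℤ))))

      -- This is f in the basis (ℓ , 0), (-x , 1) of M: the vector (m , n) is k (ℓ , 0) + n (-x ,
      -- 1).
      f-expand : ∀ m n k → m ℤ.+ n ℤ.* x ≡ k ℤ.* ℓℤ →
        f m n ≡ (a ℤ.* (k ℤ.* k)) ℤ.* (ℓℤ ℤ.* ℓℤ) ℤ.+ (ℤ.- (k ℤ.* n)) ℤ.* (ℓℤ ℤ.* (pos 2 ℤ.* (a ℤ.* x) ℤ.- b)) ℤ.+ (n ℤ.* n) ℤ.* n₀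
      f-expand m n k e = trans (cong (λ m → f m n) m≡)
        (Z.solve 6 (λ a b x n k l → let m = k Z.:* l Z.:- n Z.:* x in
          a Z.:* (m Z.:* m) Z.:+ b Z.:* (m Z.:* n) Z.:+ a Z.:* (n Z.:* n) Z.:=
          (a Z.:* (k Z.:* k)) Z.:* (l Z.:* l) Z.:+ (Z.:- (k Z.:* n)) Z.:* (l Z.:* (Z.con (pos 2) Z.:* (a Z.:* x) Z.:- b)) Z.:+ (n Z.:* n) Z.:* (a Z.:* (x Z.:* x) Z.:- b Z.:* x Z.:+ a))
          refl a b x n k ℓℤ)
        where
        m≡ : m ≡ k ℤ.* ℓℤ ℤ.- n ℤ.* x
        m≡ = trans (Z.solve 3 (λ m n x → m Z.:= m Z.:+ n Z.:* x Z.:- n Z.:* x) refl m n x) (cong (ℤ._- n ℤ.* x) e)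

      ∤a : ℓℤ ∣ b → ¬ ℓℤ ∣ a
      ∤a d e = L∤1 (∣-by (∣m∣n⇒∣m+n (∣n⇒∣m*n i e) (∣n⇒∣m*n j d)) (sym bezout))

      B : ℤ
      B = pos 2 ℤ.* (a ℤ.* x) ℤ.- b

      -- Otherwise ℓ divides n₀ - x B = a (1 - x²) but not a, as a and b are coprime, so x ≡ ± 1.
      -- Rigidity of M then gives u = ℓ, that is f(p , q) = a ℓ, whereas ℓ² divides every value of f
      -- on M; so ℓ would divide a.
      ℓ²∤n₀ : ℓℤ ∣ B → ¬ ℓℤ ℤ.* ℓℤ ∣ n₀
      ℓ²∤n₀ dB dn = contradiction (euclid {pos 1 ℤ.- x} {pos 1 ℤ.+ x} ([ (λ h → ⊥-elim (ℓ∤a h)) , (λ h → h) ]′ (euclid {a} {(pos 1 ℤ.- x) ℤ.* (pos 1 ℤ.+ x)}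
          (∣-by (∣m∣n⇒∣m-n (∣-trans (divides ℓℤ refl) dn) (∣n⇒∣m*n x dB))
            (Z.solve 3 (λ a b x → a Z.:* ((Z.con (pos 1) Z.:- x) Z.:* (Z.con (pos 1) Z.:+ x)) Z.:= a Z.:* (x Z.:* x) Z.:- b Z.:* x Z.:+ a Z.:- x Z.:* (Z.con (pos 2) Z.:* (a Z.:* x) Z.:- b)) refl a b x)))))
        where
        ℓ∤a : ¬ ℓℤ ∣ a
        ℓ∤a h = ∤a (∣-by (∣m∣n⇒∣m-n (∣n⇒∣m*n (pos 2) (∣m⇒∣m*n x h)) dB)
          (Z.solve 2 (λ b c → b Z.:= c Z.:- (c Z.:- b)) refl b (pos 2 ℤ.* (a ℤ.* x)))) h
        ∣f : ∀ m n → ℓℤ ∣ m ℤ.+ n ℤ.* x → ℓℤ ℤ.* ℓℤ ∣ f m n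
        ∣f m n (divides k e) = ∣-by (∣m∣n⇒∣m+n (∣m∣n⇒∣m+n (∣n⇒∣m*n (a ℤ.* (k ℤ.* k)) ∣-refl)
          (∣n⇒∣m*n (ℤ.- (k ℤ.* n)) (∣-*-* ∣-refl dB))) (∣n⇒∣m*n (n ℤ.* n) dn)) (f-expand m n k e)
        contra : ∀ σ → ℓℤ ∣ ± σ ℤ.- x → ⊥
        contra σ d = ℓ∤a (*-cancelʳ-∣ ℓℤ {{ℤ.≢-nonZero L≢0}} (∣-by (∣f p q pq∈) (sym (f-ℓ p q (proj₁ (M-signed σ d)) norm-pq))))
        contradiction : ℓℤ ∣ pos 1 ℤ.- x ⊎ ℓℤ ∣ pos 1 ℤ.+ x → ⊥
        contradiction (inj₁ d) = contra plus d
        contradiction (inj₂ d) = contra minus (∣-by (∣m⇒∣-m d) (Z.solve 1 (λ x → Z.con -[1+ 0 ] Z.:- x Z.:= Z.:- (Z.con (pos 1) Z.:+ x)) refl x))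

      f-mod : ∀ m n → ℓℤ ∣ m ℤ.+ n ℤ.* x → ℓℤ ∣ f m n ℤ.- (n ℤ.* n) ℤ.* n₀
      f-mod m n (divides k e) = ∣-by (∣m∣n⇒∣m+n (∣n⇒∣m*n (a ℤ.* (k ℤ.* k)) (∣m⇒∣m*n ℓℤ ∣-refl)) (∣n⇒∣m*n (ℤ.- (k ℤ.* n)) (∣m⇒∣m*n B ∣-refl)))
        (trans (cong (ℤ._- (n ℤ.* n) ℤ.* n₀) (f-expand m n k e))
          (Z.solve 3 (λ a b c → a Z.:+ b Z.:+ c Z.:- c Z.:= a Z.:+ b) refl ((a ℤ.* (k ℤ.* k)) ℤ.* (ℓℤ ℤ.* ℓℤ)) ((ℤ.- (k ℤ.* n)) ℤ.* (ℓℤ ℤ.* B)) ((n ℤ.* n) ℤ.* n₀)))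

      -- Suppose not. On M one has f ≡ n² n₀ modulo ℓ, and f(p , q) = f(r , s), so q ≡ ± s. Then
      -- `dual-signed` gives u = ℓ, and both values of f are a ℓ ≡ 0. Hence ℓ divides q and s, by
      -- the congruences also p and r, and ℓ² would divide D = ± ℓ.
      ℓ∣n₀ : ℓℤ ∣ n₀
      ℓ∣n₀ = decide (ℓℤ ∣? n₀)
        where
        f≡ : f p q ≡ f r s
        f≡ = fromℤ-injective (trans (f-norm p q) (trans (cong (fromℤ a *_) (trans norm-pq (sym norm-rs))) (sym (f-norm r s))))
        decide : Dec (ℓℤ ∣ n₀) → ℓℤ ∣ n₀
        decide (yes d) = d
        decide (no nd) = ⊥-elim (by-sign (euclid {q ℤ.- s} {q ℤ.+ s} (n₀-cancel (∣-by (∣m∣n⇒∣m-n (f-mod r s rs∈) (f-mod p q pq∈))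
            (trans (Z.solve 4 (λ q s n z → n Z.:* ((q Z.:- s) Z.:* (q Z.:+ s)) Z.:= z Z.:- (s Z.:* s) Z.:* n Z.:- (z Z.:- (q Z.:* q) Z.:* n)) refl q s n₀ (f r s))
              (cong (λ z → f r s ℤ.- (s ℤ.* s) ℤ.* n₀ ℤ.- (z ℤ.- (q ℤ.* q) ℤ.* n₀)) (sym f≡)))))))
          where
          n₀-cancel : ∀ {k} → ℓℤ ∣ n₀ ℤ.* k → ℓℤ ∣ k
          n₀-cancel {k} h = [ (λ g → ⊥-elim (nd g)) , (λ g → g) ]′ (euclid {n₀} {k} h)
          self : ∀ {k} → ℓℤ ∣ k ⊎ ℓℤ ∣ k → ℓℤ ∣ k
          self (inj₁ h) = h
          self (inj₂ h) = h
          ∣second : ∀ m n → u ≡ fromℤ ℓℤ * 1ℝ → norm₁ t m n ≡ u → ℓℤ ∣ m ℤ.+ n ℤ.* x → ℓℤ ∣ n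
          ∣second m n u≡ n≡ d = self (euclid {n} {n} (n₀-cancel (∣-by (∣m∣n⇒∣m-n (∣n⇒∣m*n a (∣-refl {ℓℤ})) (f-mod m n d))
            (trans (Z.solve 3 (λ n z g → z Z.:* (n Z.:* n) Z.:= g Z.:- (g Z.:- (n Z.:* n) Z.:* z)) refl n n₀ (f m n))
              (cong (ℤ._- (f m n ℤ.- (n ℤ.* n) ℤ.* n₀)) (f-ℓ m n u≡ n≡))))))
          ∣first : ∀ m n → ℓℤ ∣ m ℤ.+ n ℤ.* x → ℓℤ ∣ n → ℓℤ ∣ m
          ∣first m n d e = ∣-by (∣m∣n⇒∣m-n d (∣m⇒∣m*n x e)) (Z.solve 2 (λ m k → m Z.:= m Z.:+ k Z.:- k) refl m (n ℤ.* x))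
          absurd : u ≡ fromℤ ℓℤ * 1ℝ → ⊥
          absurd u≡ = ℓ²∤D (∣m∣n⇒∣m-n (∣-*-* (∣first p q pq∈ dq) ds) (∣-*-* dq (∣first r s rs∈ ds)))
            where
            dq = ∣second p q u≡ norm-pq pq∈
            ds = ∣second r s u≡ norm-rs rs∈
          by-sign : ℓℤ ∣ q ℤ.- s ⊎ ℓℤ ∣ q ℤ.+ s → ⊥
          by-sign (inj₁ h) = absurd (dual-signed plus (∣-by h (cong (ℤ._- s) (ℤₚ.*-identityˡ q))))
          by-sign (inj₂ h) = absurd (dual-signed minus (∣-by (∣m⇒∣-m h) (Z.solve 2 (λ q s → Z.con -[1+ 0 ] Z.:* q Z.:- s Z.:= Z.:- (q Z.:+ s)) refl q s)))

    record Rational : Set where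
      field
        a b i j : ℤ
        0<a : 0ℝ < fromℤ a
        at≡b : fromℤ a * t ≡ fromℤ b
        bezout : i ℤ.* a ℤ.+ j ℤ.* b ≡ pos 1

    positive-denominator : ∀ a b i j → a ≢ pos 0 → fromℤ a * t ≡ fromℤ b → i ℤ.* a ℤ.+ j ℤ.* b ≡ pos 1 → Rational
    positive-denominator (pos zero) b i j nz _ _ = ⊥-elim (nz refl)
    positive-denominator a@(pos (suc n)) b i j _ e f = record { a = a ; b = b ; i = i ; j = j ; 0<a = 0<fromℕ n ; at≡b = e ; bezout = f }
    positive-denominator -[1+ n ] b i j _ e f = record
      { a = pos (suc n) ; b = ℤ.- b ; i = ℤ.- i ; j = ℤ.- j ; 0<a = 0<fromℕ n
      ; at≡b = trans (ℝS.solve 2 (λ n t → n :* t := :- (:- n :* t)) refl (fromℕ (suc n)) t) (trans (cong -_ e) (sym (fromℤ-neg b)))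
      ; bezout = trans (Z.solve 4 (λ i j n b → (Z.:- i) Z.:* n Z.:+ (Z.:- j) Z.:* (Z.:- b) Z.:= i Z.:* (Z.:- n) Z.:+ j Z.:* b) refl i j (pos (suc n)) b) f
      }

    fraction : ∀ d e → d ≢ pos 0 → fromℤ d * t ≡ fromℤ e → Rational
    fraction d e d≢0 dt = reduce (gcd d e)
      where
      reduce : GCD d e → Rational
      reduce record { g = g ; g∣a = divides a d≡ ; g∣b = divides b e≡ ; i = i ; j = j ; bezout = bz } =
        positive-denominator a b i j (λ z → d≢0 (trans d≡ (cong (ℤ._* g) z)))
          (*-cancelˡ {fromℤ g} (λ z → g≢0 (fromℤ-≡0 g z)) (trans (ℝS.solve 3 (λ g a t → g :* (a :* t) := a :* g :* t) refl (fromℤ g) (fromℤ a) t)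
            (trans (cong (_* t) (trans (sym (fromℤ-* a g)) (cong fromℤ (sym d≡)))) (trans dt (trans (cong fromℤ e≡) (trans (fromℤ-* b g) (*-comm _ _)))))))
          (cancelʳ g≢0 (trans (Z.solve 5 (λ i a j b g → (i Z.:* a Z.:+ j Z.:* b) Z.:* g Z.:= i Z.:* (a Z.:* g) Z.:+ j Z.:* (b Z.:* g)) refl i a j b g)
            (trans (cong₂ (λ x y → i ℤ.* x ℤ.+ j ℤ.* y) (sym d≡) (sym e≡)) (trans bz (sym (ℤₚ.*-identityˡ g))))))
        where
        g≢0 : g ≢ pos 0
        g≢0 z = d≢0 (trans d≡ (trans (cong (a ℤ.*_) z) (ℤₚ.*-zeroʳ a)))

    rational : Rational
    rational = decide ((p ℤ.* q ℤ.- r ℤ.* s) ℤₚ.≟ pos 0)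
      where
      decide : Dec (p ℤ.* q ℤ.- r ℤ.* s ≡ pos 0) → Rational
      decide (yes z) = hexagonal (degenerate (ℤₚ.i-j≡0⇒i≡j (p ℤ.* q) (r ℤ.* s) z))
        where
        hexagonal : (∃ λ σ → t ≡ - (fromℤ (± σ) * 1ℝ)) → Rational
        -- Here t = ∓ 1, so the denominator is 1 and the numerator ∓ 1.
        hexagonal (σ , e) = positive-denominator (pos 1) (ℤ.- ± σ) (pos 1) (pos 0) (λ ())
          (trans (cong (_* t) fromℤ-1) (trans (*-identityˡ t) (trans e (trans (cong -_ (*-identityʳ _)) (sym (fromℤ-neg (± σ)))))))
          (Z.solve 1 (λ e → Z.con (pos 1) Z.:* Z.con (pos 1) Z.:+ Z.con (pos 0) Z.:* (Z.:- e) Z.:= Z.con (pos 1)) refl (± σ))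
      decide (no nz) = fraction (p ℤ.* q ℤ.- r ℤ.* s) (r ℤ.* r ℤ.+ s ℤ.* s ℤ.- p ℤ.* p ℤ.- q ℤ.* q) nz
        (trans (cong (_* t) (ℝS.cast 4 (λ p q r s → p :* q :- r :* s) (p ∷ q ∷ r ∷ s ∷ [])))
        (trans (ℝS.solve 5 (λ t p q r s → (p :* q :- r :* s) :* t :=
            (con (pos 1) :* (p :* p) :+ t :* (p :* q) :+ con (pos 1) :* (q :* q)) :- (con (pos 1) :* (r :* r) :+ t :* (r :* s) :+ con (pos 1) :* (s :* s))
            :+ (r :* r :+ s :* s :- p :* p :- q :* q)) refl t (fromℤ p) (fromℤ q) (fromℤ r) (fromℤ s))
        (trans (cong₂ (λ x y → x + - y + (fromℤ r * fromℤ r + fromℤ s * fromℤ s + - (fromℤ p * fromℤ p) + - (fromℤ q * fromℤ q))) norm-pq norm-rs)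
        (trans (ℝS.solve 2 (λ u w → u :- u :+ w := w) refl u (fromℤ r * fromℤ r + fromℤ s * fromℤ s + - (fromℤ p * fromℤ p) + - (fromℤ q * fromℤ q)))
          (sym (ℝS.cast 4 (λ p q r s → r :* r :+ s :* s :- p :* p :- q :* q) (p ∷ q ∷ r ∷ s ∷ [])))))))

  -- Multiplication by a complex number

  A-* : ∀ z w → A (z *ᶜ w) ≡ A z * A w
  A-* (a , b) (c , d) = ℝS.solve 4 (λ a b c d → (a :* c :- b :* d) :* (a :* c :- b :* d) :+ (a :* d :+ b :* c) :* (a :* d :+ b :* c)
    := (a :* a :+ b :* b) :* (c :* c :+ d :* d)) refl a b c d

  det-* : ∀ z v w → det (z *ᶜ v) (z *ᶜ w) ≡ A z * det v w
  det-* (a , b) (c , d) (e , f) = ℝS.solve 6 (λ a b c d e f →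
    (a :* c :- b :* d) :* (a :* f :+ b :* e) :- (a :* d :+ b :* c) :* (a :* e :- b :* f)
    := (a :* a :+ b :* b) :* (c :* f :- d :* e)) refl a b c d e f

  conj : ℂ → ℂ
  conj (x , y) = x , - y

  *-conj : ∀ z → z *ᶜ conj z ≡ (A z , 0ℝ)
  *-conj (x , y) = cong₂ _,_ (ℝS.solve 2 (λ x y → x :* x :- y :* :- y := x :* x :+ y :* y) refl x y)
    (ℝS.solve 2 (λ x y → x :* :- y :+ y :* x := con (pos 0)) refl x y)

  invᶜ : ℂ → ℂ
  invᶜ z = (A z ⁻¹ , 0ℝ) *ᶜ conj z

  *-inverse : ∀ {z} → z ≢ 0ᶜ → z *ᶜ invᶜ z ≡ 1ᶜ
  *-inverse {z} nz = begin
    z *ᶜ ((A z ⁻¹ , 0ℝ) *ᶜ conj z)  ≡⟨ C.solve 3 (λ z i c → z C.:* (i C.:* c) C.:= i C.:* (z C.:* c)) refl z (A z ⁻¹ , 0ℝ) (conj z) ⟩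
    (A z ⁻¹ , 0ℝ) *ᶜ (z *ᶜ conj z)  ≡⟨ cong ((A z ⁻¹ , 0ℝ) *ᶜ_) (*-conj z) ⟩
    (A z ⁻¹ , 0ℝ) *ᶜ (A z , 0ℝ)     ≡⟨ cong₂ _,_
          (trans (ℝS.solve 2 (λ a b → b :* a :- con (pos 0) :* con (pos 0) := a :* b) refl (A z) (A z ⁻¹)) (*-inverseʳ (A z) (λ e → nz (A≡0 e))))
          (ℝS.solve 2 (λ a b → b :* con (pos 0) :+ con (pos 0) :* a := con (pos 0)) refl (A z) (A z ⁻¹)) ⟩
    1ᶜ ∎
    where open ≡-Reasoning

  *ᶜ-cancelˡ : ∀ {z v w} → z ≢ 0ᶜ → z *ᶜ v ≡ z *ᶜ w → v ≡ w
  *ᶜ-cancelˡ {z} {v} {w} nz e = trans (sym (lem v)) (trans (cong (invᶜ z *ᶜ_) e) (lem w))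
    where
    lem : ∀ v → invᶜ z *ᶜ (z *ᶜ v) ≡ v
    lem v = trans (C.solve 3 (λ z i v → i C.:* (z C.:* v) C.:= z C.:* i C.:* v) refl z (invᶜ z) v)
      (trans (cong (_*ᶜ v) (*-inverse nz)) (CommutativeRing.*-identityˡ C.ring v))

  *ᶜ-zeroʳ : ∀ z → z *ᶜ 0ᶜ ≡ 0ᶜ
  *ᶜ-zeroʳ z = CommutativeRing.zeroʳ C.ring z

  *ᶜ≢0 : ∀ {z w} → z ≢ 0ᶜ → w ≢ 0ᶜ → z *ᶜ w ≢ 0ᶜ
  *ᶜ≢0 {z} {w} nz nw e = nw (*ᶜ-cancelˡ nz (trans e (sym (*ᶜ-zeroʳ z))))

  1ᶜ≢0 : 1ᶜ ≢ 0ᶜ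
  1ᶜ≢0 e = 0≢1 (sym (cong proj₁ e))

  ι≢0 : ∀ {k} → k ≢ pos 0 → ι k ≢ 0ᶜ
  ι≢0 {k} nz e = nz (fromℤ-≡0 k (cong proj₁ e))

  comb-mult : ∀ γ b₁ b₂ m n → comb (γ *ᶜ b₁) (γ *ᶜ b₂) m n ≡ γ *ᶜ comb b₁ b₂ m n
  comb-mult γ b₁ b₂ m n = C.solve 5 (λ g b₁ b₂ m n → m C.:* (g C.:* b₁) C.:+ n C.:* (g C.:* b₂) C.:= g C.:* (m C.:* b₁ C.:+ n C.:* b₂)) refl γ b₁ b₂ (ι m) (ι n)

  Basis-≐ : ∀ {L L′ b₁ b₂} → L ≐ L′ → Basis L b₁ b₂ → Basis L′ b₁ b₂
  Basis-≐ (⇒ , ⇐) B = record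
    { independent = B.independent
    ; coordinates = λ p → B.coordinates (⇐ p)
    ; comb∈ = λ m n → ⇒ (B.comb∈ m n)
    }
    where module B = Basis B

  -- Minimal bases and sublattices given by a congruence

  record MinimalBasis (L : Subset) (b₁ b₂ : ℂ) (ρ : ℝ) : Set where
    field
      basis : Basis L b₁ b₂
      A₁ : A b₁ ≡ ρ
      A₂ : A b₂ ≡ ρ
      lower : LowerBound L ρ

    open Basis basis public

    subgroup : IsSubgroup L
    subgroup = Basis⇒IsSubgroup basis

    b₁∈ : b₁ ∈ L
    b₁∈ = basis₁∈ basis

    b₂∈ : b₂ ∈ L
    b₂∈ = basis₂∈ basis

    0<ρ : 0ℝ < ρ
    0<ρ = subst (0ℝ <_) A₁ (0<A (det≢0⇒≢0ˡ independent))

    T : ℝ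
    T = cross b₁ b₂

    bounds : 0ℝ ≤ ρ + T × 0ℝ ≤ ρ + - T
    bounds = minimal-cross-bounds subgroup lower b₁∈ b₂∈ A₁ A₂ independent

    A-norm : ∀ m n → A (comb b₁ b₂ m n) ≡ norm ρ T ρ m n
    A-norm m n = trans (A-comb b₁ b₂ m n) (cong₂ (λ a b → norm a T b m n) A₁ A₂)

  fromWellRounded : ∀ {L} → WellRounded L → ∃₂ λ b₁ b₂ → ∃ λ ρ → MinimalBasis L b₁ b₂ ρ
  fromWellRounded (_ , b₁ , b₂ , B , (b₁∈ , b₁≢0 , min₁) , (b₂∈ , b₂≢0 , min₂)) = b₁ , b₂ , A b₁ , record
    { basis = fromLatticeBasis B
    ; A₁ = refl
    ; A₂ = ≤-antisym (min₂ b₁∈ b₁≢0) (min₁ b₂∈ b₂≢0)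
    ; lower = min₁
    }

  toWellRounded : ∀ {L b₁ b₂ ρ} → MinimalBasis L b₁ b₂ ρ → WellRounded L
  toWellRounded {L} {b₁} {b₂} B = (b₁ , b₂ , toLatticeBasis basis) , b₁ , b₂ , toLatticeBasis basis
    , (b₁∈ , det≢0⇒≢0ˡ independent , λ p nz → ≤-trans (inj₂ A₁) (lower p nz))
    , (b₂∈ , det≢0⇒≢0ʳ independent , λ p nz → ≤-trans (inj₂ A₂) (lower p nz))
    where open MinimalBasis B

  MinimalBasis-≐ : ∀ {L L′ b₁ b₂ ρ} → L ≐ L′ → MinimalBasis L b₁ b₂ ρ → MinimalBasis L′ b₁ b₂ ρ
  MinimalBasis-≐ h B = record { basis = Basis-≐ h basis ; A₁ = A₁ ; A₂ = A₂ ; lower = λ p → lower (proj₂ h p) }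
    where open MinimalBasis B

  record Congruence (ℓ : ℕ) (L M : Subset) (v₁ v₂ : ℂ) (x : ℤ) : Set where
    field
      basis : Basis L v₁ v₂
      ∈⇒ : ∀ {v} → v ∈ M → ∃₂ λ m n → v ≡ comb v₁ v₂ m n × pos ℓ ∣ m ℤ.+ n ℤ.* x
      ⇒∈ : ∀ m n → pos ℓ ∣ m ℤ.+ n ℤ.* x → comb v₁ v₂ m n ∈ M

    open Basis basis

    M⊆ : M ⊆ L
    M⊆ p = case ∈⇒ p of λ { (m , n , e , _) → subst L (sym e) (comb∈ m n) }

    ∈M⇒ : ∀ m n → comb v₁ v₂ m n ∈ M → pos ℓ ∣ m ℤ.+ n ℤ.* x
    ∈M⇒ m n p = case ∈⇒ p of λ { (m′ , n′ , e , d) → let a , b = comb-injective independent {m} {n} {m′} {n′} e in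
      subst₂ (λ m n → pos ℓ ∣ m ℤ.+ n ℤ.* x) (sym a) (sym b) d }

  -- The map f is separate from γ so that the module serves both real rescalings `c ·_` and complex
  -- multiplications `γ *ᶜ_`, which differ definitionally.
  module Image (γ : ℂ) (γ≢0 : γ ≢ 0ᶜ) (f : ℂ → ℂ) (f≡ : ∀ z → f z ≡ γ *ᶜ z) where

    f-injective : ∀ {v w} → f v ≡ f w → v ≡ w
    f-injective {v} {w} e = *ᶜ-cancelˡ γ≢0 (trans (sym (f≡ v)) (trans e (f≡ w)))

    f-- : ∀ v w → f v -ᶜ f w ≡ f (v -ᶜ w)
    f-- v w = trans (cong₂ _-ᶜ_ (f≡ v) (f≡ w)) (trans (C.solve 3 (λ g v w → g C.:* v C.:- g C.:* w C.:= g C.:* (v C.:- w)) refl γ v w) (sym (f≡ (v -ᶜ w))))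

    f-comb : ∀ b₁ b₂ m n → f (comb b₁ b₂ m n) ≡ comb (γ *ᶜ b₁) (γ *ᶜ b₂) m n
    f-comb b₁ b₂ m n = trans (f≡ (comb b₁ b₂ m n)) (sym (comb-mult γ b₁ b₂ m n))

    f0 : f 0ᶜ ≡ 0ᶜ
    f0 = trans (f≡ 0ᶜ) (*ᶜ-zeroʳ γ)

    A-f : ∀ v → A (f v) ≡ A γ * A v
    A-f v = trans (cong A (f≡ v)) (A-* γ v)

    0<Aγ : 0ℝ < A γ
    0<Aγ = 0<A γ≢0

    basis-image : ∀ {L b₁ b₂} → Basis L b₁ b₂ → Basis (image f L) (γ *ᶜ b₁) (γ *ᶜ b₂)
    basis-image {L} {b₁} {b₂} B = record
      { independent = λ e → *-≢0 (λ z → <⇒≢ 0<Aγ (sym z)) B.independent (trans (sym (det-* γ b₁ b₂)) e)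
      ; coordinates = λ { (v , v∈ , e) → case B.coordinates v∈ of λ
          { (m , n , e′) → m , n , trans e (trans (cong f e′) (f-comb b₁ b₂ m n)) } }
      ; comb∈ = λ m n → comb b₁ b₂ m n , B.comb∈ m n , sym (f-comb b₁ b₂ m n)
      }
      where module B = Basis B

    minimalBasis-image : ∀ {L b₁ b₂ ρ} → MinimalBasis L b₁ b₂ ρ → MinimalBasis (image f L) (γ *ᶜ b₁) (γ *ᶜ b₂) (A γ * ρ)
    minimalBasis-image {L} {b₁} {b₂} {ρ} B = record
      { basis = basis-image B.basis
      ; A₁ = trans (A-* γ b₁) (cong (A γ *_) B.A₁)
      ; A₂ = trans (A-* γ b₂) (cong (A γ *_) B.A₂)
      ; lower = λ { (v , v∈ , e) nz → lower v v∈ e nz }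
      }
      where
      module B = MinimalBasis B
      lower : ∀ v → v ∈ L → ∀ {w} → w ≡ f v → w ≢ 0ᶜ → A γ * ρ ≤ A w
      lower v v∈ refl nz = ≤-by (inj₁ 0<Aγ ⊛ x≤y⇒0≤y-x (B.lower v∈ (λ z → nz (trans (cong f z) f0))))
        (trans (ℝS.solve 3 (λ g a r → g :* (a :- r) := g :* a :- g :* r) refl (A γ) (A v) ρ) (cong (_+ - (A γ * ρ)) (sym (A-f v))))

    congruence-image : ∀ {ℓ L M v₁ v₂ x} → Congruence ℓ L M v₁ v₂ x → Congruence ℓ (image f L) (image f M) (γ *ᶜ v₁) (γ *ᶜ v₂) x
    congruence-image {v₁ = v₁} {v₂} c = record
      { basis = basis-image c.basis
      ; ∈⇒ = λ { (v , v∈ , e) → case c.∈⇒ v∈ of λ { (m , n , e′ , d) → m , n , trans e (trans (cong f e′) (f-comb v₁ v₂ m n)) , d } }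
      ; ⇒∈ = λ m n d → comb v₁ v₂ m n , c.⇒∈ m n d , sym (f-comb v₁ v₂ m n)
      }
      where module c = Congruence c

    index-image : ∀ {L M n} → HasIndex L M n → HasIndex (image f L) (image f M) n
    index-image {L} {M} {n} (r , r∈ , h) = f ∘ r , (λ i → r i , r∈ i , refl) , λ { (w , w∈ , e) → class w w∈ e }
      where
      class : ∀ w → w ∈ L → ∀ {v} → v ≡ f w → ∃! _≡_ λ i → (v -ᶜ f (r i)) ∈ image f M
      class w w∈ refl = case h w∈ of λ { (i , p , u) → i , (w -ᶜ r i , p , f-- w (r i)) , λ {j} q → u (back j q) }
        where
        back : ∀ j → (f w -ᶜ f (r j)) ∈ image f M → (w -ᶜ r j) ∈ M
        back j (z , z∈ , e) = subst M (sym (f-injective (trans (sym (f-- w (r j))) e))) z∈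

  module _ {ℓ} (ℓ-prime : Prime ℓ) where
    open PrimeKit ℓ-prime renaming (L to ℓℤ)

    -- Modulo M one has v₂ ≡ x v₁, so m v₁ + n v₂ ≡ (m + n x) v₁; and v₁ has order exactly ℓ modulo
    -- M.
    sublattice-congruence : ∀ {L M v₁ v₂ x} → Basis L v₁ v₂ → IsSubgroup M → M ⊆ L →
      (ι ℓℤ *ᶜ v₁) ∈ M → v₁ ∉ M → (v₂ -ᶜ ι x *ᶜ v₁) ∈ M → Congruence ℓ L M v₁ v₂ x
    sublattice-congruence {L} {M} {v₁} {v₂} {x} B sM M⊆L ℓv₁ v₁∉ w∈ = record { basis = B ; ∈⇒ = ∈⇒ ; ⇒∈ = ⇒∈ }
      where
      open IsSubgroup sM
      module B = Basis B
      split : ∀ m n → comb v₁ v₂ m n ≡ ι n *ᶜ (v₂ -ᶜ ι x *ᶜ v₁) +ᶜ ι (m ℤ.+ n ℤ.* x) *ᶜ v₁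
      split m n = trans (C.solve 5 (λ v w m n x → m C.:* v C.:+ n C.:* w C.:= n C.:* (w C.:- x C.:* v) C.:+ (m C.:+ n C.:* x) C.:* v) refl v₁ v₂ (ι m) (ι n) (ι x))
        (cong (λ z → ι n *ᶜ (v₂ -ᶜ ι x *ᶜ v₁) +ᶜ z *ᶜ v₁) (sym (C.cast 3 (λ m n x → m C.:+ n C.:* x) (m ∷ n ∷ x ∷ []))))
      ∈⇒ : ∀ {v} → v ∈ M → ∃₂ λ m n → v ≡ comb v₁ v₂ m n × ℓℤ ∣ m ℤ.+ n ℤ.* x
      ∈⇒ {v} v∈ = case B.coordinates (M⊆L v∈) of λ { (m , n , e) → m , n , e ,
        Multiples.k∈⇒ℓ∣k ℓ-prime sM {v₁} {m ℤ.+ n ℤ.* x} ℓv₁ v₁∉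
          (subst M (trans (cong (_-ᶜ ι n *ᶜ (v₂ -ᶜ ι x *ᶜ v₁)) (trans e (split m n)))
            (C.solve 2 (λ a b → a C.:+ b C.:- a C.:= b) refl (ι n *ᶜ (v₂ -ᶜ ι x *ᶜ v₁)) (ι (m ℤ.+ n ℤ.* x) *ᶜ v₁)))
            (-∈ v∈ (ℤ∈ n w∈))) }
      ⇒∈ : ∀ m n → ℓℤ ∣ m ℤ.+ n ℤ.* x → comb v₁ v₂ m n ∈ M
      ⇒∈ m n (divides k e) = subst M (sym (trans (split m n) (cong (ι n *ᶜ (v₂ -ᶜ ι x *ᶜ v₁) +ᶜ_)
          (trans (cong (λ z → ι z *ᶜ v₁) e) (trans (cong (_*ᶜ v₁) (ι-* k ℓℤ)) (CommutativeRing.*-assoc C.ring (ι k) (ι ℓℤ) v₁))))))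
        (+∈ (ℤ∈ n w∈) (ℤ∈ k ℓv₁))

    -- Representatives are 0, v₁, ..., (ℓ - 1) v₁, and the coset of m v₁ + n v₂ is the residue of m
    -- + n x.
    congruence-index : ∀ {L M v₁ v₂ x} → Congruence ℓ L M v₁ v₂ x → HasIndex L M ℓ
    congruence-index {L} {M} {v₁} {v₂} {x} c = (λ i → rep (toℕ i)) , (λ i → subst L (sym (rep-comb (toℕ i))) (comb∈ (pos (toℕ i)) (pos 0))) , λ p → case coordinates p of λ { (m , n , e) → class m n e }
      where
      open Congruence c
      open Basis basis
      instance _ = ℕ.≢-nonZero ℓ≢0
      rep : ℕ → ℂ
      rep j = ι (pos j) *ᶜ v₁
      rep-comb : ∀ j → rep j ≡ comb v₁ v₂ (pos j) (pos 0)
      rep-comb j = C.solve 3 (λ j v w → j C.:* v C.:= j C.:* v C.:+ C.con (pos 0) C.:* w) refl (ι (pos j)) v₁ v₂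
      shifted : ∀ m n j → comb v₁ v₂ m n -ᶜ rep j ≡ comb v₁ v₂ (m ℤ.- pos j) n
      shifted m n j = trans (C.solve 5 (λ v w m n j → m C.:* v C.:+ n C.:* w C.:- j C.:* v C.:= (m C.:- j) C.:* v C.:+ n C.:* w) refl v₁ v₂ (ι m) (ι n) (ι (pos j)))
        (cong (λ z → z *ᶜ v₁ +ᶜ ι n *ᶜ v₂) (sym (C.cast 2 (λ m j → m C.:- j) (m ∷ pos j ∷ []))))
      residue : ∀ k → ℓℤ ∣ k ℤ.- pos (k ℤD.%ℕ ℓ)
      residue k = divides (k ℤD./ℕ ℓ) (trans (cong (ℤ._- pos (k ℤD.%ℕ ℓ)) (ℤD.a≡a%ℕn+[a/ℕn]*n k ℓ))
        (Z.solve 2 (λ r q → r Z.:+ q Z.:- r Z.:= q) refl (pos (k ℤD.%ℕ ℓ)) ((k ℤD./ℕ ℓ) ℤ.* ℓℤ)))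
      class : ∀ m n {v} → v ≡ comb v₁ v₂ m n → ∃! _≡_ λ i → (v -ᶜ rep (toℕ i)) ∈ M
      class m n refl = i , subst M (sym (shifted m n (toℕ i))) (⇒∈ (m ℤ.- pos (toℕ i)) n (∣-by (subst (λ j → ℓℤ ∣ k ℤ.- pos j) (sym toℕ-i) (residue k)) (reorder (toℕ i)))) , λ {j} q → unique j q
        where
        k = m ℤ.+ n ℤ.* x
        i = fromℕ< (ℤD.n%ℕd<d k ℓ)
        toℕ-i = Finₚ.toℕ-fromℕ< (ℤD.n%ℕd<d k ℓ)
        reorder : ∀ j → m ℤ.- pos j ℤ.+ n ℤ.* x ≡ k ℤ.- pos j
        reorder j = Z.solve 3 (λ m j z → m Z.:- j Z.:+ z Z.:= m Z.:+ z Z.:- j) refl m (pos j) (n ℤ.* x)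
        unique : ∀ j → (comb v₁ v₂ m n -ᶜ rep (toℕ j)) ∈ M → i ≡ j
        unique j q = Finₚ.toℕ-injective (equal (toℕ i) (toℕ j) (Finₚ.toℕ<n i) (Finₚ.toℕ<n j)
            (subst (λ j → ℓℤ ∣ k ℤ.- pos j) (sym toℕ-i) (residue k))
            (∣-by (∈M⇒ (m ℤ.- pos (toℕ j)) n (subst M (shifted m n (toℕ j)) q)) (sym (reorder (toℕ j)))))
          where
          equal : ∀ a b → a ℕ.< ℓ → b ℕ.< ℓ → ℓℤ ∣ k ℤ.- pos a → ℓℤ ∣ k ℤ.- pos b → a ≡ b
          equal a b a< b< da db = compare (ℕₚ.<-cmp a b)
            where
            compare : Tri (a ℕ.< b) (a ≡ b) (b ℕ.< a) → a ≡ b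
            compare (tri≈ _ e _) = e
            compare (tri< lt _ _) = ⊥-elim (residues-distinct lt b< (∣-by (∣m∣n⇒∣m-n da db) (Z.solve 3 (λ a b k → b Z.:- a Z.:= k Z.:- a Z.:- (k Z.:- b)) refl (pos a) (pos b) k)))
            compare (tri> _ _ gt) = ⊥-elim (residues-distinct gt a< (∣-by (∣m∣n⇒∣m-n db da) (Z.solve 3 (λ a b k → a Z.:- b Z.:= k Z.:- b Z.:- (k Z.:- a)) refl (pos a) (pos b) k)))

    -- The vectors (ℓ , 0) and (-x , 1) of M have determinant ℓ, which is therefore a multiple of D.
    -- Conversely D is a combination of p + q x and r + s x, both divisible by ℓ.
    congruence-det : ∀ {L M v₁ v₂ x} → Congruence ℓ L M v₁ v₂ x → ∀ {w₁ w₂} → Basis M w₁ w₂ →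
      ∀ {p q r s} → w₁ ≡ comb v₁ v₂ p q → w₂ ≡ comb v₁ v₂ r s →
      p ℤ.* s ℤ.- q ℤ.* r ≡ ℓℤ ⊎ p ℤ.* s ℤ.- q ℤ.* r ≡ ℤ.- ℓℤ
    congruence-det {L} {M} {v₁} {v₂} {x} c {w₁} {w₂} W {p} {q} {r} {s} refl refl =
      ∣-antisym-± (D∣ℓ (W.coordinates (⇒∈ ℓℤ (pos 0) (∣-by ∣-refl (Z.solve 2 (λ l x → l Z.:+ Z.con (pos 0) Z.:* x Z.:= l) refl ℓℤ x))))
                       (W.coordinates (⇒∈ (ℤ.- x) (pos 1) (divides (pos 0) (Z.solve 1 (λ x → (Z.:- x) Z.:+ Z.con (pos 1) Z.:* x Z.:= Z.con (pos 0)) refl x)))))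
                  (ℓ∣D (∈M⇒ p q (basis₁∈ W)) (∈M⇒ r s (basis₂∈ W)))
      where
      open Congruence c
      module W = Basis W
      coords : ∀ m n i j → comb v₁ v₂ m n ≡ comb (comb v₁ v₂ p q) (comb v₁ v₂ r s) i j → m ≡ i ℤ.* p ℤ.+ j ℤ.* r × n ≡ i ℤ.* q ℤ.+ j ℤ.* s
      coords m n i j e = comb-injective (Basis.independent basis) {m} {n} {i ℤ.* p ℤ.+ j ℤ.* r} {i ℤ.* q ℤ.+ j ℤ.* s} (trans e (comb-comb v₁ v₂ p q r s i j))
      D∣ℓ : _ → _ → p ℤ.* s ℤ.- q ℤ.* r ∣ ℓℤ
      D∣ℓ (i , j , e) (k , l , f) = let a , b = coords ℓℤ (pos 0) i j e ; g , h = coords (ℤ.- x) (pos 1) k l f in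
        divides (i ℤ.* l ℤ.- j ℤ.* k) (begin
          ℓℤ                                               ≡⟨ Z.solve 2 (λ l x → l Z.:= l Z.:* Z.con (pos 1) Z.:- Z.con (pos 0) Z.:* (Z.:- x)) refl ℓℤ x ⟩
          ℓℤ ℤ.* pos 1 ℤ.- pos 0 ℤ.* (ℤ.- x)               ≡⟨ cong₂ ℤ._-_ (cong₂ ℤ._*_ a h) (cong₂ ℤ._*_ b g) ⟩
          (i ℤ.* p ℤ.+ j ℤ.* r) ℤ.* (k ℤ.* q ℤ.+ l ℤ.* s) ℤ.- (i ℤ.* q ℤ.+ j ℤ.* s) ℤ.* (k ℤ.* p ℤ.+ l ℤ.* r)
            ≡⟨ Z.solve 8 (λ i j k l p q r s → (i Z.:* p Z.:+ j Z.:* r) Z.:* (k Z.:* q Z.:+ l Z.:* s) Z.:- (i Z.:* q Z.:+ j Z.:* s) Z.:* (k Z.:* p Z.:+ l Z.:* r)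
                 Z.:= (i Z.:* l Z.:- j Z.:* k) Z.:* (p Z.:* s Z.:- q Z.:* r)) refl i j k l p q r s ⟩
          (i ℤ.* l ℤ.- j ℤ.* k) ℤ.* (p ℤ.* s ℤ.- q ℤ.* r) ∎)
        where open ≡-Reasoning
      ℓ∣D : ℓℤ ∣ p ℤ.+ q ℤ.* x → ℓℤ ∣ r ℤ.+ s ℤ.* x → ℓℤ ∣ p ℤ.* s ℤ.- q ℤ.* r
      ℓ∣D d e = ∣-by (∣m∣n⇒∣m-n (∣m⇒∣m*n s d) (∣n⇒∣m*n q e))
        (Z.solve 5 (λ p q r s x → p Z.:* s Z.:- q Z.:* r Z.:= (p Z.:+ q Z.:* x) Z.:* s Z.:- q Z.:* (r Z.:+ s Z.:* x)) refl p q r s x)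

    reducedPair : ∀ {L M v₁ v₂ x w₁ w₂ u} → Congruence ℓ L M v₁ v₂ x → MinimalBasis L v₁ v₂ 1ℝ → MinimalBasis M w₁ w₂ u → 1ℝ ≤ u →
      ∀ {p q r s} → w₁ ≡ comb v₁ v₂ p q → w₂ ≡ comb v₁ v₂ r s → ReducedPair ℓ (cross v₁ v₂) u x p q r s
    reducedPair {L} {M} {v₁} {v₂} {x} {w₁} {w₂} {u} c V W 1≤u {p} {q} {r} {s} e₁ e₂ = record
      { ℓ-prime = ℓ-prime
      ; +t = proj₁ V.bounds
      ; -t = proj₂ V.bounds
      ; 1≤u = 1≤u
      ; minimalL = λ m n nz → subst (1ℝ ≤_) (V.A-norm m n) (V.lower (V.comb∈ m n) (comb-≢0 V.independent nz))
      ; minimalM = λ m n nz d → subst (u ≤_) (V.A-norm m n) (W.lower (c.⇒∈ m n d) (comb-≢0 V.independent nz))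
      ; pq∈ = c.∈M⇒ p q (subst M e₁ W.b₁∈)
      ; rs∈ = c.∈M⇒ r s (subst M e₂ W.b₂∈)
      ; norm-pq = trans (sym (V.A-norm p q)) (trans (cong A (sym e₁)) W.A₁)
      ; norm-rs = trans (sym (V.A-norm r s)) (trans (cong A (sym e₂)) W.A₂)
      ; D≡ = congruence-det c W.basis {p} {q} {r} {s} e₁ e₂
      }
      where
      module V = MinimalBasis V
      module W = MinimalBasis W
      module c = Congruence c

  -- Quadratic orders

  fromℤ≢0 : ∀ {k} → k ≢ pos 0 → fromℤ k ≢ 0ℝ
  fromℤ≢0 {k} nz e = nz (fromℤ-≡0 k e)

  ↧≢0 : ∀ q → fromℤ (↧ q) ≢ 0ℝ
  ↧≢0 q = λ e → <⇒≢ (0<fromℕ (ℚ.denominator-1 q)) (sym e)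

  fromℚ-* : ∀ q → fromℚ q * fromℤ (↧ q) ≡ fromℤ (↥ q)
  fromℚ-* q = trans (ℝS.solve 3 (λ n d e → n :* e :* d := n :* (d :* e)) refl (fromℤ (↥ q)) (fromℤ (↧ q)) (fromℤ (↧ q) ⁻¹))
    (trans (cong (fromℤ (↥ q) *_) (*-inverseʳ _ (↧≢0 q))) (*-identityʳ _))

  fromℚ-/ : ∀ m d .{{_ : ℕ.NonZero d}} → fromℚ (m ℚ./ d) * fromℕ d ≡ fromℤ m
  fromℚ-/ m d = begin
    fromℚ q * fromℕ d                            ≡⟨ cong (λ z → fromℚ q * fromℤ z) (sym (ℚₚ.↧-/ m d)) ⟩
    fromℚ q * fromℤ (↧ q ℤ.* g)                  ≡⟨ cong (fromℚ q *_) (fromℤ-* (↧ q) g) ⟩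
    fromℚ q * (fromℤ (↧ q) * fromℤ g)            ≡⟨ *-assoc _ _ _ ⟨
    fromℚ q * fromℤ (↧ q) * fromℤ g              ≡⟨ cong (_* fromℤ g) (fromℚ-* q) ⟩
    fromℤ (↥ q) * fromℤ g                        ≡⟨ fromℤ-* (↥ q) g ⟨
    fromℤ (↥ q ℤ.* g)                            ≡⟨ cong fromℤ (ℚₚ.↥-/ m d) ⟩
    fromℤ m                                      ∎
    where
    open ≡-Reasoning
    q = m ℚ./ d
    g = ℤGCD.gcd m (pos d)

  fromℚ-injective : ∀ p q → fromℚ p ≡ fromℚ q → p ≡ q
  fromℚ-injective p q e = ℚₚ.≃⇒≡ (ℚ.*≡* (fromℤ-injective {↥ p ℤ.* ↧ q} {↥ q ℤ.* ↧ p} (begin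
    fromℤ (↥ p ℤ.* ↧ q)                            ≡⟨ fromℤ-* (↥ p) (↧ q) ⟩
    fromℤ (↥ p) * fromℤ (↧ q)                      ≡⟨ cong (_* fromℤ (↧ q)) (sym (fromℚ-* p)) ⟩
    fromℚ p * fromℤ (↧ p) * fromℤ (↧ q)            ≡⟨ cong (λ z → z * fromℤ (↧ p) * fromℤ (↧ q)) e ⟩
    fromℚ q * fromℤ (↧ p) * fromℤ (↧ q)            ≡⟨ ℝS.solve 3 (λ a b c → a :* b :* c := a :* c :* b) refl (fromℚ q) (fromℤ (↧ p)) (fromℤ (↧ q)) ⟩
    fromℚ q * fromℤ (↧ q) * fromℤ (↧ p)            ≡⟨ cong (_* fromℤ (↧ p)) (fromℚ-* q) ⟩
    fromℤ (↥ q) * fromℤ (↧ p)                      ≡⟨ fromℤ-* (↥ q) (↧ p) ⟨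
    fromℤ (↥ q ℤ.* ↧ p)                            ∎)))
    where open ≡-Reasoning

  Span : ℂ → ℂ → Subset
  Span g₁ g₂ v = ∃₂ λ m n → v ≡ comb g₁ g₂ m n

  span-basis : ∀ {g₁ g₂} → det g₁ g₂ ≢ 0ℝ → Basis (Span g₁ g₂) g₁ g₂
  span-basis nz = record { independent = nz ; coordinates = λ p → p ; comb∈ = λ m n → m , n , refl }

  module QuadraticOrder (ω : ℂ) (b c : ℤ) (ω² : ω *ᶜ ω ≡ ι b *ᶜ ω -ᶜ ι c) (independent : det 1ᶜ ω ≢ 0ℝ) where

    e : ℤ → ℤ → ℂ
    e = comb 1ᶜ ω

    𝒪 : Subset
    𝒪 = Span 1ᶜ ω

    -- This is ℚ(ω), written with one common denominator, so that the field operations reduce to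
    -- those of 𝒪.
    K : Subset
    K z = ∃ λ d → ∃₂ λ m n → ι (pos (suc d)) *ᶜ z ≡ e m n

    𝒪-basis : Basis 𝒪 1ᶜ ω
    𝒪-basis = span-basis independent

    open IsSubgroup (Basis⇒IsSubgroup 𝒪-basis) public
      renaming (0∈ to 0∈𝒪; +∈ to +∈𝒪; neg∈ to neg∈𝒪; -∈ to -∈𝒪; ℤ∈ to ℤ∈𝒪)

    1∈𝒪 : 1ᶜ ∈ 𝒪
    1∈𝒪 = basis₁∈ 𝒪-basis

    ω∈𝒪 : ω ∈ 𝒪
    ω∈𝒪 = basis₂∈ 𝒪-basis

    ι∈𝒪 : ∀ k → ι k ∈ 𝒪
    ι∈𝒪 k = subst 𝒪 (CR.*-identityʳ (ι k)) (ℤ∈𝒪 k 1∈𝒪)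

    e-* : ∀ m n m′ n′ → e m n *ᶜ e m′ n′ ≡ e (m ℤ.* m′ ℤ.- n ℤ.* n′ ℤ.* c) (m ℤ.* n′ ℤ.+ n ℤ.* m′ ℤ.+ n ℤ.* n′ ℤ.* b)
    e-* m n m′ n′ = begin
      e m n *ᶜ e m′ n′
        ≡⟨ C.solve 7 (λ w b c m n m′ n′ → let o = C.con (pos 1) in
             (m C.:* o C.:+ n C.:* w) C.:* (m′ C.:* o C.:+ n′ C.:* w) C.:=
             (m C.:* m′ C.:- n C.:* n′ C.:* c) C.:* o C.:+ (m C.:* n′ C.:+ n C.:* m′ C.:+ n C.:* n′ C.:* b) C.:* w
               C.:+ n C.:* n′ C.:* (w C.:* w C.:- (b C.:* w C.:- c))) refl ω (ι b) (ι c) (ι m) (ι n) (ι m′) (ι n′) ⟩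
      X *ᶜ 1ᶜ +ᶜ Y *ᶜ ω +ᶜ ι n *ᶜ ι n′ *ᶜ (ω *ᶜ ω -ᶜ (ι b *ᶜ ω -ᶜ ι c))
        ≡⟨ cong (λ z → X *ᶜ 1ᶜ +ᶜ Y *ᶜ ω +ᶜ ι n *ᶜ ι n′ *ᶜ (z -ᶜ (ι b *ᶜ ω -ᶜ ι c))) ω² ⟩
      X *ᶜ 1ᶜ +ᶜ Y *ᶜ ω +ᶜ ι n *ᶜ ι n′ *ᶜ ((ι b *ᶜ ω -ᶜ ι c) -ᶜ (ι b *ᶜ ω -ᶜ ι c))
        ≡⟨ C.solve 3 (λ a k z → a C.:+ k C.:* (z C.:- z) C.:= a) refl (X *ᶜ 1ᶜ +ᶜ Y *ᶜ ω) (ι n *ᶜ ι n′) (ι b *ᶜ ω -ᶜ ι c) ⟩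
      X *ᶜ 1ᶜ +ᶜ Y *ᶜ ω
        ≡⟨ cong₂ (λ x y → x *ᶜ 1ᶜ +ᶜ y *ᶜ ω)
             (C.cast 5 (λ m m′ n n′ c → m C.:* m′ C.:- n C.:* n′ C.:* c) (m ∷ m′ ∷ n ∷ n′ ∷ c ∷ []))
             (C.cast 5 (λ m m′ n n′ b → m C.:* n′ C.:+ n C.:* m′ C.:+ n C.:* n′ C.:* b) (m ∷ m′ ∷ n ∷ n′ ∷ b ∷ [])) ⟨
      e (m ℤ.* m′ ℤ.- n ℤ.* n′ ℤ.* c) (m ℤ.* n′ ℤ.+ n ℤ.* m′ ℤ.+ n ℤ.* n′ ℤ.* b) ∎
      where
      open ≡-Reasoning
      X = ι m *ᶜ ι m′ -ᶜ ι n *ᶜ ι n′ *ᶜ ι c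
      Y = ι m *ᶜ ι n′ +ᶜ ι n *ᶜ ι m′ +ᶜ ι n *ᶜ ι n′ *ᶜ ι b

    *∈𝒪 : ∀ {z w} → z ∈ 𝒪 → w ∈ 𝒪 → (z *ᶜ w) ∈ 𝒪
    *∈𝒪 (m , n , refl) (m′ , n′ , refl) = m ℤ.* m′ ℤ.- n ℤ.* n′ ℤ.* c , m ℤ.* n′ ℤ.+ n ℤ.* m′ ℤ.+ n ℤ.* n′ ℤ.* b , e-* m n m′ n′

    toK : ∀ d {z w} → d ≢ pos 0 → w ∈ 𝒪 → ι d *ᶜ z ≡ w → z ∈ K
    toK (pos zero) nz _ _ = ⊥-elim (nz refl)
    toK (pos (suc d)) nz (m , n , e₁) e₂ = d , m , n , trans e₂ e₁
    toK -[1+ d ] {z} nz w∈ e₂ with neg∈𝒪 w∈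
    ... | m , n , e₁ = d , m , n , trans (trans (C.solve 2 (λ d z → d C.:* z C.:= C.:- (C.:- d C.:* z)) refl (ι (pos (suc d))) z)
            (cong (λ w → -ᶜ w) (trans (cong (_*ᶜ z) (sym (ι-neg (pos (suc d))))) e₂))) e₁

    fromK : ∀ {z} → z ∈ K → ∃₂ λ d w → d ≢ pos 0 × w ∈ 𝒪 × ι d *ᶜ z ≡ w
    fromK (d , m , n , e₁) = pos (suc d) , e m n , (λ ()) , (m , n , refl) , e₁

    𝒪⊆K : 𝒪 ⊆ K
    𝒪⊆K {z} (m , n , e₁) = 0 , m , n , trans (cong (_*ᶜ z) ι-1) (trans (CR.*-identityˡ z) e₁)

    -- The conjugate of ω is b - ω, so the second factor is the conjugate of m + n ω and the product
    -- is its norm.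
    conjugate : ∀ m n → e m n *ᶜ e (m ℤ.+ n ℤ.* b) (ℤ.- n) ≡ ι (m ℤ.* m ℤ.+ m ℤ.* n ℤ.* b ℤ.+ n ℤ.* n ℤ.* c)
    conjugate m n = trans (e-* m n (m ℤ.+ n ℤ.* b) (ℤ.- n)) (trans (cong₂ e
        (Z.solve 4 (λ m n b c → m Z.:* (m Z.:+ n Z.:* b) Z.:- n Z.:* (Z.:- n) Z.:* c Z.:= m Z.:* m Z.:+ m Z.:* n Z.:* b Z.:+ n Z.:* n Z.:* c) refl m n b c)
        (Z.solve 3 (λ m n b → m Z.:* (Z.:- n) Z.:+ n Z.:* (m Z.:+ n Z.:* b) Z.:+ n Z.:* (Z.:- n) Z.:* b Z.:= Z.con (pos 0)) refl m n b))
      (C.solve 2 (λ k w → k C.:* C.con (pos 1) C.:+ C.con (pos 0) C.:* w C.:= k) refl (ι (m ℤ.* m ℤ.+ m ℤ.* n ℤ.* b ℤ.+ n ℤ.* n ℤ.* c)) ω))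

    e≢0⇒ : ∀ {m n} → e m n ≢ 0ᶜ → e (m ℤ.+ n ℤ.* b) (ℤ.- n) ≢ 0ᶜ
    e≢0⇒ {m} {n} nz z = nz (trans (cong₂ e m≡0 n≡0) (comb-0 1ᶜ ω))
      where
      zeros = comb-injective independent {m ℤ.+ n ℤ.* b} {ℤ.- n} {pos 0} {pos 0} (trans z (sym (comb-0 1ᶜ ω)))
      n≡0 : n ≡ pos 0
      n≡0 = trans (sym (ℤₚ.neg-involutive n)) (cong (λ k → ℤ.- k) (proj₂ zeros))
      m≡0 : m ≡ pos 0
      m≡0 = trans (Z.solve 2 (λ m k → m Z.:= m Z.:+ k Z.:- k) refl m (n ℤ.* b))
        (trans (cong₂ (λ x y → x ℤ.- y ℤ.* b) (proj₁ zeros) n≡0) (Z.solve 1 (λ b → Z.con (pos 0) Z.:- Z.con (pos 0) Z.:* b Z.:= Z.con (pos 0)) refl b))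

    K-inverse : ∀ {z} → z ∈ K → z ≢ 0ᶜ → ∃ λ w → w ∈ K × z *ᶜ w ≡ 1ᶜ
    K-inverse {z} (d , m , n , e₁) nz = w , toK N {w} N≢0 (ℤ∈𝒪 D (m ℤ.+ n ℤ.* b , ℤ.- n , refl)) Nw , zw
      where
      open ≡-Reasoning
      D = pos (suc d)
      N = m ℤ.* m ℤ.+ m ℤ.* n ℤ.* b ℤ.+ n ℤ.* n ℤ.* c
      ē = e (m ℤ.+ n ℤ.* b) (ℤ.- n)
      D≢0 : ι D ≢ 0ᶜ
      D≢0 = ι≢0 {D} λ ()
      e≢0 : e m n ≢ 0ᶜ
      e≢0 h = *ᶜ≢0 D≢0 nz (trans e₁ h)
      N≢0 : N ≢ pos 0
      N≢0 h = *ᶜ≢0 e≢0 (e≢0⇒ {m} {n} e≢0) (trans (conjugate m n) (cong ι h))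
      -- From D z = m + n ω, of conjugate ē and norm N, the inverse of z is D ē / N.
      w = ι D *ᶜ ē *ᶜ invᶜ (ι N)
      Nw : ι N *ᶜ w ≡ ι D *ᶜ ē
      Nw = trans (C.solve 3 (λ n a i → n C.:* (a C.:* i) C.:= a C.:* (n C.:* i)) refl (ι N) (ι D *ᶜ ē) (invᶜ (ι N)))
        (trans (cong (ι D *ᶜ ē *ᶜ_) (*-inverse (ι≢0 N≢0))) (CR.*-identityʳ (ι D *ᶜ ē)))
      zw : z *ᶜ w ≡ 1ᶜ
      zw = begin
        z *ᶜ (ι D *ᶜ ē *ᶜ invᶜ (ι N))     ≡⟨ C.solve 4 (λ z d k i → z C.:* (d C.:* k C.:* i) C.:= (d C.:* z) C.:* k C.:* i) refl z (ι D) ē (invᶜ (ι N)) ⟩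
        (ι D *ᶜ z) *ᶜ ē *ᶜ invᶜ (ι N)     ≡⟨ cong (λ y → y *ᶜ ē *ᶜ invᶜ (ι N)) e₁ ⟩
        e m n *ᶜ ē *ᶜ invᶜ (ι N)          ≡⟨ cong (_*ᶜ invᶜ (ι N)) (conjugate m n) ⟩
        ι N *ᶜ invᶜ (ι N)                 ≡⟨ *-inverse (ι≢0 N≢0) ⟩
        1ᶜ                                ∎

    Denominator : ℂ → Set
    Denominator z = ∃₂ λ d w → d ≢ pos 0 × w ∈ 𝒪 × ι d *ᶜ z ≡ w

    K-+ : ∀ {z w} → Denominator z → Denominator w → (z +ᶜ w) ∈ K
    K-+ {z} {w} (d , z′ , dn , z∈ , ez) (d′ , w′ , dn′ , w∈ , ew) =
      toK (d ℤ.* d′) {z +ᶜ w} (i*i≢0 dn dn′) (+∈𝒪 (ℤ∈𝒪 d′ z∈) (ℤ∈𝒪 d w∈))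
        (trans (cong (_*ᶜ (z +ᶜ w)) (ι-* d d′)) (trans (C.solve 4 (λ d d′ z w → d C.:* d′ C.:* (z C.:+ w) C.:= d′ C.:* (d C.:* z) C.:+ d C.:* (d′ C.:* w)) refl (ι d) (ι d′) z w)
          (cong₂ (λ x y → ι d′ *ᶜ x +ᶜ ι d *ᶜ y) ez ew)))

    K-* : ∀ {z w} → Denominator z → Denominator w → (z *ᶜ w) ∈ K
    K-* {z} {w} (d , z′ , dn , z∈ , ez) (d′ , w′ , dn′ , w∈ , ew) =
      toK (d ℤ.* d′) {z *ᶜ w} (i*i≢0 dn dn′) (*∈𝒪 z∈ w∈)
        (trans (cong (_*ᶜ (z *ᶜ w)) (ι-* d d′)) (trans (C.solve 4 (λ d d′ z w → d C.:* d′ C.:* (z C.:* w) C.:= (d C.:* z) C.:* (d′ C.:* w)) refl (ι d) (ι d′) z w)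
          (cong₂ _*ᶜ_ ez ew)))

    K-isSubfield : IsSubfield K
    K-isSubfield = record
      { 0∈ = 𝒪⊆K 0∈𝒪
      ; 1∈ = 𝒪⊆K 1∈𝒪
      ; +-closed = λ {z} {w} p q → K-+ {z} {w} (fromK p) (fromK q)
      ; neg-closed = λ {z} p → case fromK p of λ { (d , z′ , dn , z∈ , ez) → toK d { -ᶜ z} dn (neg∈𝒪 z∈)
          (trans (C.solve 2 (λ d z → d C.:* (C.:- z) C.:= C.:- (d C.:* z)) refl (ι d) z) (cong (λ w → -ᶜ w) ez)) }
      ; *-closed = λ {z} {w} p q → K-* {z} {w} (fromK p) (fromK q)
      ; inverse = K-inverse
      }

    rational-coordinates : ∀ {z} d m n → ι (pos (suc d)) *ᶜ z ≡ e m n →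
      z ≡ fromℚ (m ℚ./ suc d) · 1ᶜ +ᶜ fromℚ (n ℚ./ suc d) · ω
    rational-coordinates {z} d m n e₁ = *ᶜ-cancelˡ (ι≢0 {pos (suc d)} λ ()) (trans e₁ (sym (begin
      ι D *ᶜ (P · 1ᶜ +ᶜ Q · ω)                      ≡⟨ cong₂ (λ x y → ι D *ᶜ (x +ᶜ y)) (·≡ P 1ᶜ) (·≡ Q ω) ⟩
      ι D *ᶜ ((P , 0ℝ) *ᶜ 1ᶜ +ᶜ (Q , 0ℝ) *ᶜ ω)      ≡⟨ C.solve 5 (λ d p q o w → d C.:* (p C.:* o C.:+ q C.:* w) C.:= (p C.:* d) C.:* o C.:+ (q C.:* d) C.:* w) refl (ι D) (P , 0ℝ) (Q , 0ℝ) 1ᶜ ω ⟩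
      ((P , 0ℝ) *ᶜ ι D) *ᶜ 1ᶜ +ᶜ ((Q , 0ℝ) *ᶜ ι D) *ᶜ ω ≡⟨ cong₂ (λ x y → x *ᶜ 1ᶜ +ᶜ y *ᶜ ω) (real P m (fromℚ-/ m (suc d))) (real Q n (fromℚ-/ n (suc d))) ⟩
      e m n                                          ∎)))
      where
      open ≡-Reasoning
      D = pos (suc d)
      P = fromℚ (m ℚ./ suc d)
      Q = fromℚ (n ℚ./ suc d)
      real : ∀ P m → P * fromℤ D ≡ fromℤ m → (P , 0ℝ) *ᶜ ι D ≡ ι m
      real P m h = trans (sym (·≡ P (ι D))) (cong₂ _,_ h (zeroʳ P))

    K-isImaginaryQuadratic : IsImaginaryQuadratic K
    K-isImaginaryQuadratic = record
      { isSubfield = K-isSubfield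
      ; degree-2 = 1ᶜ , ω , 𝒪⊆K 1∈𝒪 , 𝒪⊆K ω∈𝒪 , λ { (d , m , n , e₁) →
          (m ℚ./ suc d , n ℚ./ suc d) , rational-coordinates d m n e₁ , λ {(p , q)} e₂ →
            let a , b = coordinates-unique independent {fromℚ (m ℚ./ suc d)} {fromℚ (n ℚ./ suc d)} {fromℚ p} {fromℚ q} (trans (sym (rational-coordinates d m n e₁)) e₂)
            in cong₂ _,_ (fromℚ-injective _ p a) (fromℚ-injective _ q b) }
      ; nonreal = ω , 𝒪⊆K ω∈𝒪 , λ h → independent (trans (ℝS.solve 2 (λ x y → con (pos 1) :* y :- con (pos 0) :* x := y) refl (proj₁ ω) (proj₂ ω)) h)
      }

    -- Having N and N ω in I is a convenient certificate that I spans K: rational multiples of these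
    -- two already give 1 and ω.
    fractionalIdeal : ∀ {I g₁ g₂} → Basis I g₁ g₂ → I ⊆ K → ∀ N → N ≢ pos 0 → ι N ∈ I → (ι N *ᶜ ω) ∈ I → IsFractionalIdeal K I
    fractionalIdeal {I} {g₁} {g₂} B I⊆K N N≢0 N∈ Nω∈ = record
      { L⊆K = I⊆K
      ; f-g = 2 , gen , (λ p → case B.coordinates p of λ { (m , n , e₁) → co m n , trans e₁ (sum≡ m n) })
            , λ { (m , e₁) → subst I (trans (sum≡ (m zero) (m (suc zero))) (sym e₁)) (B.comb∈ (m zero) (m (suc zero))) }
      ; spans = spans (ℤ∈ s N∈) (ℤ∈ s Nω∈)
      }
      where
      module B = Basis B
      open IsSubgroup (Basis⇒IsSubgroup B)
      gen : Fin 2 → ℂ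
      gen zero = g₁
      gen (suc zero) = g₂
      co : ℤ → ℤ → Fin 2 → ℤ
      co m n zero = m
      co m n (suc zero) = n
      sum≡ : ∀ m n → comb g₁ g₂ m n ≡ fromℤ m · g₁ +ᶜ (fromℤ n · g₂ +ᶜ 0ᶜ)
      sum≡ m n = trans (sym (lin≡comb g₁ g₂ m n)) (cong (fromℤ m · g₁ +ᶜ_) (sym (CR.+-identityʳ (fromℤ n · g₂))))
      -- The sign with s N = |N|: the denominators of `ℚ./` are natural numbers.
      s = proj₁ (abs-sign N)
      spans : (ι s *ᶜ ι N) ∈ I → (ι s *ᶜ (ι N *ᶜ ω)) ∈ I → K ⊆ ℚSpan I
      spans p∈ q∈ {z} (d , m , n , e₁) = by-abs ℤ.∣ N ∣ refl
        where
        by-abs : ∀ k → k ≡ ℤ.∣ N ∣ → z ∈ ℚSpan I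
        by-abs zero h = ⊥-elim (N≢0 (ℤₚ.∣i∣≡0⇒i≡0 (sym h)))
        by-abs (suc k) h = 2 , q′ , w , w∈ , (begin
            z                                                ≡⟨ rational-coordinates d m n e₁ ⟩
            fromℚ (m ℚ./ suc d) · 1ᶜ +ᶜ fromℚ (n ℚ./ suc d) · ω ≡⟨ cong₂ _+ᶜ_ (part m 1ᶜ) (part n ω) ⟩
            q zero · (ι A′ *ᶜ 1ᶜ) +ᶜ q (suc zero) · (ι A′ *ᶜ ω)
              ≡⟨ cong₂ (λ x y → q zero · x +ᶜ q (suc zero) · y) (trans (CR.*-identityʳ (ι A′)) ιA′) (trans (cong (_*ᶜ ω) ιA′) (CR.*-assoc (ι s) (ι N) ω)) ⟩
            q zero · w zero +ᶜ q (suc zero) · w (suc zero)   ≡⟨ cong (q zero · w zero +ᶜ_) (sym (CR.+-identityʳ _)) ⟩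
            q zero · w zero +ᶜ (q (suc zero) · w (suc zero) +ᶜ 0ᶜ) ∎)
          where
          open ≡-Reasoning
          A′ = pos (suc k)
          ιA′ : ι A′ ≡ ι s *ᶜ ι N
          ιA′ = trans (cong (λ k → ι (pos k)) h) (trans (cong ι (proj₂ (abs-sign N))) (ι-* s N))
          infixr 7 _·′_
          _·′_ = _·_
          qq : ℤ → ℚ
          qq m = m ℚ./ (suc d ℕ.* suc k)
          q′ : Fin 2 → ℚ
          q′ zero = qq m
          q′ (suc zero) = qq n
          q : Fin 2 → ℝ
          q i = fromℚ (q′ i)
          w : Fin 2 → ℂ
          w zero = ι s *ᶜ ι N
          w (suc zero) = ι s *ᶜ (ι N *ᶜ ω)
          w∈ : ∀ i → w i ∈ I
          w∈ zero = p∈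
          w∈ (suc zero) = q∈
          part : ∀ m v → fromℚ (m ℚ./ suc d) · v ≡ fromℚ (qq m) · (ι A′ *ᶜ v)
          part m v = trans (cong (_· v) (*-cancelˡ {fromℕ (suc d)} (λ h → <⇒≢ (0<fromℕ d) (sym h))
              (trans (*-comm _ _) (trans (fromℚ-/ m (suc d)) (trans (sym (fromℚ-/ m (suc d ℕ.* suc k))) (trans (cong (fromℚ (qq m) *_) (fromℕ-* (suc d) (suc k)))
                (ℝS.solve 3 (λ q d k → q :* (d :* k) := d :* (q :* k)) refl (fromℚ (qq m)) (fromℕ (suc d)) (fromℕ (suc k)))))))))
            (trans (scale-scale (fromℚ (qq m)) (fromℕ (suc k)) v) (cong (fromℚ (qq m) ·_) (·≡ (fromℕ (suc k)) v)))
            where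
            scale-scale : ∀ a b v → (a * b) · v ≡ a · (b · v)
            scale-scale a b (x , y) = cong₂ _,_ (*-assoc a b x) (*-assoc a b y)

    -- For a lattice ℤ g₁ + ℤ g₂ with σ = g₂ / g₁ a root of the primitive polynomial
    -- A X² − B X + C, the coefficient ring is ℤ[A σ].
    module Proper {I g₁ g₂} (basis : Basis I g₁ g₂) (k A′ B C′ : ℤ)
      (on₁ : (ω -ᶜ ι k) *ᶜ g₁ ≡ ι A′ *ᶜ g₂)
      (on₂ : (ω -ᶜ ι k) *ᶜ g₂ ≡ ι B *ᶜ g₂ -ᶜ ι C′ *ᶜ g₁)
      {i j l} (bezout : i ℤ.* A′ ℤ.+ j ℤ.* B ℤ.+ l ℤ.* C′ ≡ pos 1) (A′≢0 : A′ ≢ pos 0) where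

      private module B′ = Basis basis
      open IsSubgroup (Basis⇒IsSubgroup basis)

      ω′ : ℂ
      ω′ = ω -ᶜ ι k

      ω′∈ : ∀ {v} → v ∈ I → (ω′ *ᶜ v) ∈ I
      ω′∈ v∈ = case B′.coordinates v∈ of λ { (m , n , refl) → subst I (sym (trans
          (C.solve 5 (λ w g₁ g₂ m n → w C.:* (m C.:* g₁ C.:+ n C.:* g₂) C.:= m C.:* (w C.:* g₁) C.:+ n C.:* (w C.:* g₂)) refl ω′ g₁ g₂ (ι m) (ι n))
          (cong₂ (λ x y → ι m *ᶜ x +ᶜ ι n *ᶜ y) on₁ on₂)))
        (+∈ (ℤ∈ m (ℤ∈ A′ (basis₂∈ basis))) (ℤ∈ n (-∈ (ℤ∈ B (basis₂∈ basis)) (ℤ∈ C′ (basis₁∈ basis))))) }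

      e-shift : ∀ m n → e m n ≡ ι (m ℤ.+ n ℤ.* k) +ᶜ ι n *ᶜ ω′
      e-shift m n = trans (C.solve 4 (λ w m n k → m C.:* C.con (pos 1) C.:+ n C.:* w C.:= m C.:+ n C.:* k C.:+ n C.:* (w C.:- k)) refl ω (ι m) (ι n) (ι k))
        (cong (_+ᶜ ι n *ᶜ ω′) (sym (C.cast 3 (λ m n k → m C.:+ n C.:* k) (m ∷ n ∷ k ∷ []))))

      𝒪-closed : ∀ {α v} → α ∈ 𝒪 → v ∈ I → (α *ᶜ v) ∈ I
      𝒪-closed {v = v} (m , n , refl) v∈ = subst I (sym (trans (cong (_*ᶜ v) (e-shift m n))
          (C.solve 4 (λ x n w v → (x C.:+ n C.:* w) C.:* v C.:= x C.:* v C.:+ n C.:* (w C.:* v)) refl (ι (m ℤ.+ n ℤ.* k)) (ι n) ω′ v)))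
        (+∈ (ℤ∈ (m ℤ.+ n ℤ.* k) v∈) (ℤ∈ n (ω′∈ v∈)))

      g₁≢0 : g₁ ≢ 0ᶜ
      g₁≢0 = det≢0⇒≢0ˡ B′.independent

      -- If α g₁ = m g₁ + n g₂, then A α = A m + n ω′. Comparing coordinates of A α g₂ shows that A
      -- divides n C and n B, hence n by primitivity, and so α = m + (n / A) ω′.
      coefficient : ∀ {α} → (∀ {v} → v ∈ I → (α *ᶜ v) ∈ I) → α ∈ 𝒪
      coefficient {α} stable = from (B′.coordinates (stable (basis₁∈ basis))) (B′.coordinates (stable (basis₂∈ basis)))
        where
        from : (∃₂ λ m n → α *ᶜ g₁ ≡ comb g₁ g₂ m n) → (∃₂ λ m n → α *ᶜ g₂ ≡ comb g₁ g₂ m n) → α ∈ 𝒪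
        from (m , n , e₁) (m′ , n′ , e₂) = conclude A′∣n
          where
          open ≡-Reasoning
          Aα : ι A′ *ᶜ α ≡ ι A′ *ᶜ ι m +ᶜ ι n *ᶜ ω′
          Aα = *ᶜ-cancelˡ g₁≢0 (begin
            g₁ *ᶜ (ι A′ *ᶜ α)                             ≡⟨ C.solve 3 (λ g a x → g C.:* (a C.:* x) C.:= a C.:* (x C.:* g)) refl g₁ (ι A′) α ⟩
            ι A′ *ᶜ (α *ᶜ g₁)                             ≡⟨ cong (ι A′ *ᶜ_) e₁ ⟩
            ι A′ *ᶜ comb g₁ g₂ m n                        ≡⟨ C.solve 5 (λ g h a m n → a C.:* (m C.:* g C.:+ n C.:* h) C.:= a C.:* m C.:* g C.:+ n C.:* (a C.:* h)) refl g₁ g₂ (ι A′) (ι m) (ι n) ⟩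
            ι A′ *ᶜ ι m *ᶜ g₁ +ᶜ ι n *ᶜ (ι A′ *ᶜ g₂)      ≡⟨ cong (λ z → ι A′ *ᶜ ι m *ᶜ g₁ +ᶜ ι n *ᶜ z) (sym on₁) ⟩
            ι A′ *ᶜ ι m *ᶜ g₁ +ᶜ ι n *ᶜ (ω′ *ᶜ g₁)        ≡⟨ C.solve 4 (λ g x n w → x C.:* g C.:+ n C.:* (w C.:* g) C.:= g C.:* (x C.:+ n C.:* w)) refl g₁ (ι A′ *ᶜ ι m) (ι n) ω′ ⟩
            g₁ *ᶜ (ι A′ *ᶜ ι m +ᶜ ι n *ᶜ ω′)              ∎)
          coords : comb g₁ g₂ (A′ ℤ.* m′) (A′ ℤ.* n′) ≡ comb g₁ g₂ (ℤ.- (n ℤ.* C′)) (A′ ℤ.* m ℤ.+ n ℤ.* B)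
          coords = begin
            comb g₁ g₂ (A′ ℤ.* m′) (A′ ℤ.* n′)            ≡⟨ comb-* g₁ g₂ A′ m′ n′ ⟨
            ι A′ *ᶜ comb g₁ g₂ m′ n′                      ≡⟨ cong (ι A′ *ᶜ_) (sym e₂) ⟩
            ι A′ *ᶜ (α *ᶜ g₂)                             ≡⟨ CR.*-assoc (ι A′) α g₂ ⟨
            ι A′ *ᶜ α *ᶜ g₂                               ≡⟨ cong (_*ᶜ g₂) Aα ⟩
            (ι A′ *ᶜ ι m +ᶜ ι n *ᶜ ω′) *ᶜ g₂              ≡⟨ C.solve 4 (λ x n w h → (x C.:+ n C.:* w) C.:* h C.:= x C.:* h C.:+ n C.:* (w C.:* h)) refl (ι A′ *ᶜ ι m) (ι n) ω′ g₂ ⟩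
            ι A′ *ᶜ ι m *ᶜ g₂ +ᶜ ι n *ᶜ (ω′ *ᶜ g₂)        ≡⟨ cong (λ z → ι A′ *ᶜ ι m *ᶜ g₂ +ᶜ ι n *ᶜ z) on₂ ⟩
            ι A′ *ᶜ ι m *ᶜ g₂ +ᶜ ι n *ᶜ (ι B *ᶜ g₂ -ᶜ ι C′ *ᶜ g₁)
              ≡⟨ C.solve 7 (λ g h a m n b c → a C.:* m C.:* h C.:+ n C.:* (b C.:* h C.:- c C.:* g) C.:= C.:- (n C.:* c) C.:* g C.:+ (a C.:* m C.:+ n C.:* b) C.:* h) refl g₁ g₂ (ι A′) (ι m) (ι n) (ι B) (ι C′) ⟩
            -ᶜ (ι n *ᶜ ι C′) *ᶜ g₁ +ᶜ (ι A′ *ᶜ ι m +ᶜ ι n *ᶜ ι B) *ᶜ g₂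
              ≡⟨ cong₂ (λ x y → x *ᶜ g₁ +ᶜ y *ᶜ g₂) (C.cast 2 (λ n c → C.:- (n C.:* c)) (n ∷ C′ ∷ [])) (C.cast 4 (λ a m n b → a C.:* m C.:+ n C.:* b) (A′ ∷ m ∷ n ∷ B ∷ [])) ⟨
            comb g₁ g₂ (ℤ.- (n ℤ.* C′)) (A′ ℤ.* m ℤ.+ n ℤ.* B) ∎
          eqs = comb-injective B′.independent {A′ ℤ.* m′} {A′ ℤ.* n′} {ℤ.- (n ℤ.* C′)} {A′ ℤ.* m ℤ.+ n ℤ.* B} coords
          A′∣n : A′ ∣ n
          A′∣n = ∣-by (∣m∣n⇒∣m+n (∣m∣n⇒∣m+n (∣n⇒∣m*n (i ℤ.* n) ∣-refl) (∣n⇒∣m*n j nB)) (∣n⇒∣m*n l nC))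
            (trans (Z.solve 1 (λ n → n Z.:= n Z.:* Z.con (pos 1)) refl n) (trans (cong (n ℤ.*_) (sym bezout))
              (Z.solve 7 (λ n i a j b l c → n Z.:* (i Z.:* a Z.:+ j Z.:* b Z.:+ l Z.:* c) Z.:= i Z.:* n Z.:* a Z.:+ j Z.:* (n Z.:* b) Z.:+ l Z.:* (n Z.:* c)) refl n i A′ j B l C′)))
            where
            nC : A′ ∣ n ℤ.* C′
            nC = ∣-by (∣m⇒∣m*n (ℤ.- m′) ∣-refl) (trans (sym (ℤₚ.neg-involutive (n ℤ.* C′))) (trans (cong (λ z → ℤ.- z) (sym (proj₁ eqs)))
              (Z.solve 2 (λ a m → Z.:- (a Z.:* m) Z.:= a Z.:* (Z.:- m)) refl A′ m′)))
            nB : A′ ∣ n ℤ.* B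
            nB = ∣-by (∣m∣n⇒∣m-n (∣m⇒∣m*n n′ ∣-refl) (∣m⇒∣m*n m ∣-refl))
              (trans (Z.solve 2 (λ x y → y Z.:= x Z.:+ y Z.:- x) refl (A′ ℤ.* m) (n ℤ.* B)) (cong (ℤ._- A′ ℤ.* m) (sym (proj₂ eqs))))
          conclude : A′ ∣ n → α ∈ 𝒪
          conclude (divides n″ n≡) = m ℤ.- n″ ℤ.* k , n″ , *ᶜ-cancelˡ (ι≢0 A′≢0) (begin
            ι A′ *ᶜ α                                      ≡⟨ Aα ⟩
            ι A′ *ᶜ ι m +ᶜ ι n *ᶜ ω′                       ≡⟨ cong (λ z → ι A′ *ᶜ ι m +ᶜ z *ᶜ ω′) (trans (cong ι n≡) (ι-* n″ A′)) ⟩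
            ι A′ *ᶜ ι m +ᶜ ι n″ *ᶜ ι A′ *ᶜ ω′              ≡⟨ C.solve 5 (λ a m n w k → a C.:* m C.:+ n C.:* a C.:* (w C.:- k) C.:= a C.:* ((m C.:- n C.:* k) C.:* C.con (pos 1) C.:+ n C.:* w)) refl (ι A′) (ι m) (ι n″) ω (ι k) ⟩
            ι A′ *ᶜ ((ι m -ᶜ ι n″ *ᶜ ι k) *ᶜ 1ᶜ +ᶜ ι n″ *ᶜ ω) ≡⟨ cong (λ z → ι A′ *ᶜ (z *ᶜ 1ᶜ +ᶜ ι n″ *ᶜ ω)) (C.cast 3 (λ m n k → m C.:- n C.:* k) (m ∷ n″ ∷ k ∷ [])) ⟨
            ι A′ *ᶜ e (m ℤ.- n″ ℤ.* k) n″                  ∎)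

      coefficientRing≐ : coefficientRing K I ≐ 𝒪
      coefficientRing≐ = (λ { (_ , stable) → coefficient stable }) , λ α∈ → 𝒪⊆K α∈ , 𝒪-closed α∈

  -- Square roots

  positive-inverse : ∀ {x} → 0ℝ < x → 0ℝ < x ⁻¹
  positive-inverse {x} 0<x = ≰⇒> λ h → <⇒≱ 0<1 (≤-by (inj₁ 0<x ⊛ x≤y⇒0≤y-x h)
    (trans (ℝS.solve 2 (λ x y → x :* (con (pos 0) :- y) := con (pos 0) :- x :* y) refl x (x ⁻¹))
      (cong (λ z → 0ℝ + - z) (*-inverseʳ x (λ e → <⇒≢ 0<x (sym e))))))

  square-< : ∀ {x y} → 0ℝ ≤ y → y < x → y * y < x * x
  square-< {x} {y} 0≤y y<x = 0<y-x⇒x<y (subst (0ℝ <_)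
    (ℝS.solve 2 (λ x y → (x :- y) :* (x :- y :+ (y :+ y)) := x :* x :- y :* y) refl x y)
    (*-pos (x<y⇒0<y-x y<x) (0<-+ (x<y⇒0<y-x y<x) (0≤y ⊕ 0≤y))))

  -- The supremum of all x with x² ≤ a, a set bounded by 1 + a. The root is needed to rescale a
  -- lattice to minimum 1.
  sqrt : ∀ {a} → 0ℝ < a → ∃ λ s → 0ℝ < s × s * s ≡ a
  sqrt {a} 0<a = s , 0<s , s²≡a
    where
    P : ℝ → Set
    P x = x * x ≤ a
    bound : UpperBound P (1ℝ + a)
    bound {x} h = ≮⇒≥ λ lt → <⇒≱ (square-< 0≤1+a lt) (≤-trans h (≤-by (0≤1 ⊕ inj₁ 0<a ⊕ 0≤x² a)
      (ℝS.solve 1 (λ a → con (pos 1) :+ a :+ a :* a := (con (pos 1) :+ a) :* (con (pos 1) :+ a) :- a) refl a)))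
      where
      0≤1+a : 0ℝ ≤ 1ℝ + a
      0≤1+a = 0≤1 ⊕ inj₁ 0<a
    sup = supremum P (0ℝ , subst (_≤ a) (sym (zeroˡ 0ℝ)) (inj₁ 0<a)) (1ℝ + a , bound)
    s = proj₁ sup
    s-upper : UpperBound P s
    s-upper = proj₁ (proj₂ sup)
    s-least : ∀ {b} → b ∈ UpperBound P → s ≤ b
    s-least = proj₂ (proj₂ sup)
    0≤s : 0ℝ ≤ s
    0≤s = s-upper {0ℝ} (subst (_≤ a) (sym (zeroˡ 0ℝ)) (inj₁ 0<a))
    s²≮a : ¬ s * s < a
    s²≮a s²<a = <⇒≱ 0<ε (≤-by (x≤y⇒0≤y-x (s-upper {s + ε} s+ε∈))
        (ℝS.solve 2 (λ s e → s :- (s :+ e) := con (pos 0) :- e) refl s ε))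
      where
      δ d ε : ℝ
      δ = a + - (s * s)
      -- With this d, ε = δ / d is at most 1 and ε (1 + 2 s) = δ - ε δ ≤ δ, hence (s + ε)² ≤ s² + δ
      -- = a.
      d = 1ℝ + (s + s + δ)
      ε = δ * d ⁻¹
      0<δ = x<y⇒0<y-x s²<a
      0<d : 0ℝ < d
      0<d = 0<-+ 0<1 (0≤s ⊕ 0≤s ⊕ inj₁ 0<δ)
      0<ε : 0ℝ < ε
      0<ε = *-pos 0<δ (positive-inverse 0<d)
      dε≡δ : d * ε ≡ δ
      dε≡δ = trans (ℝS.solve 3 (λ d e i → d :* (e :* i) := e :* (d :* i)) refl d δ (d ⁻¹))
        (trans (cong (δ *_) (*-inverseʳ d (λ e → <⇒≢ 0<d (sym e)))) (*-identityʳ δ))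
      ε≤1 : ε ≤ 1ℝ
      ε≤1 = *-cancel-≤ {d} 0<d (≤-by (0≤1 ⊕ 0≤s ⊕ 0≤s) (trans
        (ℝS.solve 2 (λ s e → con (pos 1) :+ s :+ s := (con (pos 1) :+ (s :+ s :+ e)) :* con (pos 1) :- e) refl s δ) (cong (λ z → d * 1ℝ + - z) (sym dε≡δ))))
      s+ε∈ : P (s + ε)
      s+ε∈ = ≤-by (inj₁ (*-pos 0<ε 0<δ) ⊕ inj₁ 0<ε ⊛ x≤y⇒0≤y-x ε≤1) (trans
        (ℝS.solve 3 (λ a s e → let D = a :- s :* s in e :* D :+ e :* (con (pos 1) :- e)
          := D :- (D :- (con (pos 1) :+ (s :+ s :+ D)) :* e) :- (s :* e :+ s :* e :+ e :* e)) refl a s ε)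
        (trans (cong (λ z → δ + - (δ + - z) + - (s * ε + s * ε + ε * ε)) dε≡δ)
        (ℝS.solve 3 (λ a s e → let D = a :- s :* s in D :- (D :- D) :- (s :* e :+ s :* e :+ e :* e) := a :- (s :+ e) :* (s :+ e)) refl a s ε)))
    -- One Newton step from above gives a smaller upper bound.
    a≮s² : ¬ a < s * s
    a≮s² a<s² = <⇒≱ t<s (s-least {t} (λ {x} x∈ → ≮⇒≥ λ t<x → <⇒≱ (≤-<-trans a≤t² (square-< 0≤t t<x)) x∈))
      where
      s≢0 : s ≢ 0ℝ
      s≢0 e = <-irrefl (O.trans 0<a (subst (a <_) (trans (cong (λ z → z * z) e) (zeroˡ 0ℝ)) a<s²))
      0<s′ : 0ℝ < s
      0<s′ = ≤∧≢⇒< 0≤s (λ e → s≢0 (sym e))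
      i h t : ℝ
      i = s ⁻¹
      h = fromℤ (pos 2) ⁻¹
      t = h * (s + a * i)
      0<h : 0ℝ < h
      0<h = positive-inverse 0<2
      0<i = positive-inverse 0<s′
      2h : fromℤ (pos 2) * h ≡ 1ℝ
      2h = *-inverseʳ (fromℤ (pos 2)) (λ e → <⇒≢ 0<2 (sym e))
      si : s * i ≡ 1ℝ
      si = *-inverseʳ s s≢0
      0≤t : 0ℝ ≤ t
      0≤t = inj₁ 0<h ⊛ (0≤s ⊕ inj₁ (*-pos 0<a 0<i))
      2t : fromℤ (pos 2) * t ≡ s + a * i
      2t = trans (sym (*-assoc _ h _)) (trans (cong (_* (s + a * i)) 2h) (*-identityˡ _))
      ai<s : a * i < s
      ai<s = 0<y-x⇒x<y (subst (0ℝ <_) (trans (ℝS.solve 3 (λ a s i → (s :* s :- a) :* i := s :* (s :* i) :- a :* i) refl a s i)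
        (cong (_+ - (a * i)) (trans (cong (s *_) si) (*-identityʳ s)))) (*-pos (x<y⇒0<y-x a<s²) 0<i))
      t<s : t < s
      t<s = ≰⇒> λ s≤t → <⇒≱ ai<s (≤-by (0≤fromℕ 2 ⊛ x≤y⇒0≤y-x s≤t) (trans (ℝS.solve 2 (λ s t → con (pos 2) :* (t :- s) := con (pos 2) :* t :- s :- s) refl s t)
        (trans (cong (λ z → z + - s + - s) 2t) (ℝS.solve 2 (λ s b → s :+ b :- s :- s := b :- s) refl s (a * i)))))
      a≤t² : a ≤ t * t
      a≤t² = *-cancel-≤ {fromℤ (pos 4)} (0<fromℕ 3) (≤-by (0≤x² (s + - (a * i))) (trans
        (ℝS.solve 3 (λ a s i → (s :- a :* i) :* (s :- a :* i) := (s :+ a :* i) :* (s :+ a :* i) :- con (pos 4) :* (a :* (s :* i))) refl a s i)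
        (cong₂ (λ x y → x + - (fromℤ (pos 4) * y)) (trans (cong (λ z → z * z) (sym 2t)) (ℝS.solve 1 (λ t → con (pos 2) :* t :* (con (pos 2) :* t) := con (pos 4) :* (t :* t)) refl t))
          (trans (cong (a *_) si) (*-identityʳ a)))))
    s²≡a : s * s ≡ a
    s²≡a = ≤-antisym (≮⇒≥ a≮s²) (≮⇒≥ s²≮a)
    0<s : 0ℝ < s
    0<s = ≤∧≢⇒< 0≤s (λ e → <⇒≢ 0<a (trans (sym (zeroˡ 0ℝ)) (trans (cong (λ z → z * z) e) s²≡a)))

  -- Minimal vectors

  A-neg : ∀ v → A (-ᶜ v) ≡ A v
  A-neg (x , y) = ℝS.solve 2 (λ x y → :- x :* :- x :+ :- y :* :- y := x :* x :+ y :* y) refl x y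

  Shell : Subset → ℝ → Subset
  Shell L ρ v = v ∈ L × A v ≡ ρ

  module ShellPairs {L b₁ b₂ ρ} (V : MinimalBasis L b₁ b₂ ρ) where
    open MinimalBasis V

    -- Independence excludes p i = p j and p i = - p j at once.
    pairs : ∀ {s} (p : Fin s → ℂ) → (∀ i → p i ∈ Shell L ρ) → (∀ i j → i ≢ j → det (p i) (p j) ≢ 0ℝ) →
      (∀ {v} → v ∈ Shell L ρ → ∃ λ i → v ≡ p i ⊎ v ≡ -ᶜ p i) → ConsistsOfPairs s (Shell L ρ)
    pairs p p∈ ind complete = p , injective , complete , λ
        { (i , inj₁ refl) → p∈ i
        ; (i , inj₂ refl) → IsSubgroup.neg∈ subgroup (proj₁ (p∈ i)) , trans (A-neg (p i)) (proj₂ (p∈ i)) }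
      where
      injective : ∀ {i j} → p i ≡ p j ⊎ p i ≡ -ᶜ p j → i ≡ j
      injective {i} {j} h with i Finₚ.≟ j
      ... | yes e = e
      injective {i} {j} (inj₁ e) | no ne = ⊥-elim (ind i j ne (trans (cong (λ v → det v (p j)) e) (det-self (p j))))
      injective {i} {j} (inj₂ e) | no ne = ⊥-elim (ind j i (λ h → ne (sym h)) (trans (cong (det (p j)) e) (det-self-neg (p j))))

    -- The basis vectors again, written as combinations so that `det-comb≢0` decides independence of
    -- any two shell vectors by an integer determinant.
    v₁ v₂ : ℂ
    v₁ = comb b₁ b₂ (pos 1) (pos 0)
    v₂ = comb b₁ b₂ (pos 0) (pos 1)

    v₁∈ : v₁ ∈ Shell L ρ
    v₁∈ = comb∈ (pos 1) (pos 0) , trans (cong A (comb-10 b₁ b₂)) A₁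

    v₂∈ : v₂ ∈ Shell L ρ
    v₂∈ = comb∈ (pos 0) (pos 1) , trans (cong A (comb-01 b₁ b₂)) A₂

    det-comb≢0 : ∀ p q r s → p ℤ.* s ℤ.- q ℤ.* r ≢ pos 0 → det (comb b₁ b₂ p q) (comb b₁ b₂ r s) ≢ 0ℝ
    det-comb≢0 p q r s nz e = *-≢0 (λ z → nz (fromℤ-≡0 (p ℤ.* s ℤ.- q ℤ.* r) z)) independent (trans (sym (det-comb b₁ b₂ p q r s)) e)

    negated : ∀ {v} m n → v ≡ comb b₁ b₂ (ℤ.- m) (ℤ.- n) → v ≡ -ᶜ comb b₁ b₂ m n
    negated m n e = trans e (sym (comb-neg b₁ b₂ m n))

    coordinates-of : ∀ {v} → v ∈ Shell L ρ → ∃₂ λ m n → v ≡ comb b₁ b₂ m n × Minimal ρ T m n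
    coordinates-of (v∈ , Av) = case coordinates v∈ of λ { (m , n , e) → m , n , e
      , minimal-coordinates 0<ρ (proj₁ bounds) (proj₂ bounds) m n (trans (sym (A-norm m n)) (trans (cong A (sym e)) Av)) }

    two : T ≢ ρ → T ≢ - ρ → ConsistsOfPairs 2 (Shell L ρ)
    two T≢ρ T≢-ρ = pairs p p∈ ind complete
      where
      p : Fin 2 → ℂ
      p zero = v₁
      p (suc zero) = v₂
      p∈ : ∀ i → p i ∈ Shell L ρ
      p∈ zero = v₁∈
      p∈ (suc zero) = v₂∈
      ind : ∀ i j → i ≢ j → det (p i) (p j) ≢ 0ℝ
      ind zero zero h = ⊥-elim (h refl)
      ind zero (suc zero) _ = det-comb≢0 (pos 1) (pos 0) (pos 0) (pos 1) λ ()
      ind (suc zero) zero _ = det-comb≢0 (pos 0) (pos 1) (pos 1) (pos 0) λ ()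
      ind (suc zero) (suc zero) h = ⊥-elim (h refl)
      classify : ∀ {v m n} → v ≡ comb b₁ b₂ m n → Minimal ρ T m n → ∃ λ i → v ≡ p i ⊎ v ≡ -ᶜ p i
      classify e (±10 (inj₁ refl)) = zero , inj₁ e
      classify e (±10 (inj₂ refl)) = zero , inj₂ (negated (pos 1) (pos 0) e)
      classify e (±01 (inj₁ refl)) = suc zero , inj₁ e
      classify e (±01 (inj₂ refl)) = suc zero , inj₂ (negated (pos 0) (pos 1) e)
      classify e (±11 _ h) = ⊥-elim (T≢-ρ h)
      classify e (±1-1 _ h) = ⊥-elim (T≢ρ h)
      complete : ∀ {v} → v ∈ Shell L ρ → ∃ λ i → v ≡ p i ⊎ v ≡ -ᶜ p i
      complete v∈ = case coordinates-of v∈ of λ { (m , n , e , h) → classify e h }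

    three : ∀ σ → T ≡ - (fromℤ (± σ) * ρ) → ConsistsOfPairs 3 (Shell L ρ)
    three σ T≡ = pairs (p σ) p∈ (ind σ) complete
      where
      p : Sign → Fin 3 → ℂ
      p σ zero = v₁
      p σ (suc zero) = v₂
      p σ (suc (suc zero)) = comb b₁ b₂ (pos 1) (± σ)
      one : ∀ {n} → ℝS.Polynomial n
      one = con (pos 1) :+ con (pos 0)
      norm₃ : ∀ σ {T} → T ≡ - (fromℤ (± σ) * ρ) → norm ρ T ρ (pos 1) (± σ) ≡ ρ
      norm₃ plus refl = ℝS.solve 1 (λ r → r :* (one :* one) :+ (:- (one :* r)) :* (one :* one) :+ r :* (one :* one) := r) refl ρ
      norm₃ minus refl = ℝS.solve 1 (λ r → r :* (one :* one) :+ (:- (:- one :* r)) :* (one :* :- one) :+ r :* (:- one :* :- one) := r) refl ρ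
      p∈ : ∀ i → p σ i ∈ Shell L ρ
      p∈ zero = v₁∈
      p∈ (suc zero) = v₂∈
      p∈ (suc (suc zero)) = comb∈ (pos 1) (± σ) , trans (A-norm (pos 1) (± σ)) (norm₃ σ T≡)
      ind : ∀ σ i j → i ≢ j → det (p σ i) (p σ j) ≢ 0ℝ
      ind σ zero zero h = ⊥-elim (h refl)
      ind σ zero (suc zero) _ = det-comb≢0 (pos 1) (pos 0) (pos 0) (pos 1) λ ()
      ind plus zero (suc (suc zero)) _ = det-comb≢0 (pos 1) (pos 0) (pos 1) (pos 1) λ ()
      ind minus zero (suc (suc zero)) _ = det-comb≢0 (pos 1) (pos 0) (pos 1) -[1+ 0 ] λ ()
      ind σ (suc zero) zero _ = det-comb≢0 (pos 0) (pos 1) (pos 1) (pos 0) λ ()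
      ind σ (suc zero) (suc zero) h = ⊥-elim (h refl)
      ind plus (suc zero) (suc (suc zero)) _ = det-comb≢0 (pos 0) (pos 1) (pos 1) (pos 1) λ ()
      ind minus (suc zero) (suc (suc zero)) _ = det-comb≢0 (pos 0) (pos 1) (pos 1) -[1+ 0 ] λ ()
      ind plus (suc (suc zero)) zero _ = det-comb≢0 (pos 1) (pos 1) (pos 1) (pos 0) λ ()
      ind minus (suc (suc zero)) zero _ = det-comb≢0 (pos 1) -[1+ 0 ] (pos 1) (pos 0) λ ()
      ind plus (suc (suc zero)) (suc zero) _ = det-comb≢0 (pos 1) (pos 1) (pos 0) (pos 1) λ ()
      ind minus (suc (suc zero)) (suc zero) _ = det-comb≢0 (pos 1) -[1+ 0 ] (pos 0) (pos 1) λ ()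
      ind σ (suc (suc zero)) (suc (suc zero)) h = ⊥-elim (h refl)
      x≡-x⇒ : ∀ {x} → x ≡ - x → x ≡ 0ℝ
      x≡-x⇒ {x} e = x*y≡0 {fromℤ (pos 2)} {x} (trans (ℝS.solve 1 (λ x → con (pos 2) :* x := x :+ x) refl x) (trans (cong (x +_) e) (-‿inverseʳ x))) (λ z → <⇒≢ 0<2 (sym z))
      opposite-signs : ρ ≡ - ρ → ⊥
      opposite-signs e = <⇒≢ 0<ρ (sym (x≡-x⇒ e))
      one*ρ : - (fromℤ (pos 1) * ρ) ≡ - ρ
      one*ρ = ℝS.solve 1 (λ r → :- (one :* r) := :- r) refl ρ
      -one*ρ : - (fromℤ -[1+ 0 ] * ρ) ≡ ρ
      -one*ρ = ℝS.solve 1 (λ r → :- ((:- one) :* r) := r) refl ρ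
      classify : ∀ σ → T ≡ - (fromℤ (± σ) * ρ) → ∀ {v m n} → v ≡ comb b₁ b₂ m n → Minimal ρ T m n → ∃ λ i → v ≡ p σ i ⊎ v ≡ -ᶜ p σ i
      classify σ _ e (±10 (inj₁ refl)) = zero , inj₁ e
      classify σ _ e (±10 (inj₂ refl)) = zero , inj₂ (negated (pos 1) (pos 0) e)
      classify σ _ e (±01 (inj₁ refl)) = suc zero , inj₁ e
      classify σ _ e (±01 (inj₂ refl)) = suc zero , inj₂ (negated (pos 0) (pos 1) e)
      classify plus _ e (±11 (inj₁ refl) _) = suc (suc zero) , inj₁ e
      classify plus _ e (±11 (inj₂ refl) _) = suc (suc zero) , inj₂ (negated (pos 1) (pos 1) e)
      classify minus _ e (±1-1 (inj₁ refl) _) = suc (suc zero) , inj₁ e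
      classify minus _ e (±1-1 (inj₂ refl) _) = suc (suc zero) , inj₂ (negated (pos 1) -[1+ 0 ] e)
      classify plus T≡ e (±1-1 _ h) = ⊥-elim (opposite-signs (trans (sym h) (trans T≡ one*ρ)))
      classify minus T≡ e (±11 _ h) = ⊥-elim (opposite-signs (trans (sym -one*ρ) (trans (sym T≡) h)))
      complete : ∀ {v} → v ∈ Shell L ρ → ∃ λ i → v ≡ p σ i ⊎ v ≡ -ᶜ p σ i
      complete v∈ = case coordinates-of v∈ of λ { (m , n , e , h) → classify σ T≡ e h }

    shell-pairs : ∃ λ s → 2 ℕ.≤ s × ConsistsOfPairs s (Shell L ρ)
    shell-pairs with T O.≟ ρ | T O.≟ - ρ
    ... | yes e | _ = 3 , ℕ.s≤s (ℕ.s≤s ℕ.z≤n) , three minus (trans e (ℝS.solve 1 (λ r → r := :- ((:- (con (pos 1) :+ con (pos 0))) :* r)) refl ρ))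
    ... | no _ | yes e = 3 , ℕ.s≤s (ℕ.s≤s ℕ.z≤n) , three plus (trans e (ℝS.solve 1 (λ r → :- r := :- ((con (pos 1) :+ con (pos 0)) :* r)) refl ρ))
    ... | no ne | no ne′ = 2 , ℕ.s≤s (ℕ.s≤s ℕ.z≤n) , two ne ne′

  -- Uniqueness of the form

  polar : QuadraticForm → ℂ → ℂ → ℝ
  polar B v w = ⟦ B ⟧ (v +ᶜ w) + - ⟦ B ⟧ v + - ⟦ B ⟧ w

  form-lin : ∀ B s t v w → ⟦ B ⟧ (s · v +ᶜ t · w) ≡ ⟦ B ⟧ v * (s * s) + polar B v w * (s * t) + ⟦ B ⟧ w * (t * t)
  form-lin (form a b c) s t (x , y) (x′ , y′) = ℝS.solve 9 (λ a b c s t x y x′ y′ →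
    let Q = λ x y → a :* (x :* x) :+ b :* (x :* y) :+ c :* (y :* y) in
    Q (s :* x :+ t :* x′) (s :* y :+ t :* y′) := Q x y :* (s :* s) :+ (Q (x :+ x′) (y :+ y′) :- Q x y :- Q x′ y′) :* (s :* t) :+ Q x′ y′ :* (t :* t))
    refl a b c s t x y x′ y′

  module Tempered-pair {ℓ : ℕ} (ℓ-prime : Prime ℓ) {L M : Subset} {v₁ v₂ w₁ w₂ : ℂ} {x : ℤ} {u : ℝ}
    (congruence : Congruence ℓ L M v₁ v₂ x) (V : MinimalBasis L v₁ v₂ 1ℝ) (W : MinimalBasis M w₁ w₂ u) (1<u : 1ℝ < u) where

    private
      module V = MinimalBasis V
      module W = MinimalBasis W

    S S′ : Subset
    S = Shell L 1ℝ
    S′ = Shell M u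

    t : ℝ
    t = cross v₁ v₂

    ≢0 : ∀ {v ρ} → 0ℝ < ρ → A v ≡ ρ → v ≢ 0ᶜ
    ≢0 0<ρ e refl = <⇒≢ 0<ρ (trans (ℝS.solve 0 (con (pos 0) := con (pos 0) :* con (pos 0) :+ con (pos 0) :* con (pos 0)) refl) e)

    -- The strict inequality 1 < u is what keeps the shell of L out of M.
    S∉M : ∀ {v} → v ∈ S → v ∉ M
    S∉M (v∈ , e) v∈M = <⇒≱ 1<u (≤-trans (W.lower v∈M (≢0 0<1 e)) (inj₂ e))

    temperedA : Tempered L M S S′ A u
    temperedA = record
      { on-S = proj₂
      ; off-S = λ {v} v∈ v∉M v∉S → ≤∧≢⇒< (V.lower v∈ (λ z → v∉M (subst M (sym z) (IsSubgroup.0∈ W.subgroup)))) (λ e → v∉S (v∈ , sym e))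
      ; 1≤u = inj₁ 1<u
      ; on-S′ = proj₂
      ; off-S′ = λ {v} v∈ nz v∉ → ≤∧≢⇒< (W.lower v∈ nz) (λ e → v∉ (v∈ , sym e))
      }

    module Unique (B : QuadraticForm) (u′ : ℝ) (temperedB : Tempered L M S S′ ⟦ B ⟧ u′) where
      open Tempered temperedB

      -- Since B takes the value 1 at v₁ and v₂, it is determined by this middle coefficient alone.
      t′ : ℝ
      t′ = polar B v₁ v₂

      B-lin : ∀ s r → ⟦ B ⟧ (s · v₁ +ᶜ r · v₂) ≡ 1ℝ * (s * s) + t′ * (s * r) + 1ℝ * (r * r)
      B-lin s r = trans (form-lin B s r v₁ v₂) (cong₂ (λ a b → a * (s * s) + t′ * (s * r) + b * (r * r)) (on-S (V.b₁∈ , V.A₁)) (on-S (V.b₂∈ , V.A₂)))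

      B-comb : ∀ m n → ⟦ B ⟧ (comb v₁ v₂ m n) ≡ norm 1ℝ t′ 1ℝ m n
      B-comb m n = trans (cong ⟦ B ⟧ (sym (lin≡comb v₁ v₂ m n))) (B-lin (fromℤ m) (fromℤ n))

      equal : t′ ≡ t → (∀ v → ⟦ B ⟧ v ≡ A v) × u′ ≡ u
      equal e = B≡A , trans (sym (on-S′ (W.b₁∈ , W.A₁))) (trans (B≡A w₁) W.A₁)
        where
        B≡A : ∀ v → ⟦ B ⟧ v ≡ A v
        B≡A v = case real-coordinates V.independent v of λ { (s , r , h) → trans (cong ⟦ B ⟧ h) (trans (B-lin s r)
          (trans (cong (λ t → 1ℝ * (s * s) + t * (s * r) + 1ℝ * (r * r)) e) (sym (trans (cong A h) (trans (A-lin s r v₁ v₂)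
            (cong₂ (λ a b → a * (s * s) + t * (s * r) + b * (r * r)) V.A₁ V.A₂)))))) }

      module From-pair {p q r s : ℤ} (w₁≡ : w₁ ≡ comb v₁ v₂ p q) (w₂≡ : w₂ ≡ comb v₁ v₂ r s) where

        pair : ReducedPair ℓ t u x p q r s
        pair = reducedPair ℓ-prime congruence V W (inj₁ 1<u) {p} {q} {r} {s} w₁≡ w₂≡

        open ReducedPair pair using (norm-pq; norm-rs; degenerate)

        norm-pq′ : norm 1ℝ t′ 1ℝ p q ≡ u′
        norm-pq′ = trans (sym (B-comb p q)) (trans (cong ⟦ B ⟧ (sym w₁≡)) (on-S′ (W.b₁∈ , W.A₁)))

        norm-rs′ : norm 1ℝ t′ 1ℝ r s ≡ u′
        norm-rs′ = trans (sym (B-comb r s)) (trans (cong ⟦ B ⟧ (sym w₂≡)) (on-S′ (W.b₂∈ , W.A₂)))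

        -- Both (p , q) and (r , s) have norm u under A and u′ under B. The difference B - A is t′ -
        -- t times the product of the coordinates, and it takes the value u′ - u at both.
        determined : (fromℤ p * fromℤ q + - (fromℤ r * fromℤ s)) * (t′ + - t) ≡ 0ℝ
        determined = trans (ℝS.solve 6 (λ t′ t p q r s → let N = λ t p q → con (pos 1) :* (p :* p) :+ t :* (p :* q) :+ con (pos 1) :* (q :* q) in
            (p :* q :- r :* s) :* (t′ :- t) := N t′ p q :- N t p q :- (N t′ r s :- N t r s)) refl t′ t (fromℤ p) (fromℤ q) (fromℤ r) (fromℤ s))
          (trans (cong₂ (λ a b → a + - b) (cong₂ (λ a b → a + - b) norm-pq′ norm-pq) (cong₂ (λ a b → a + - b) norm-rs′ norm-rs)) (-‿inverseʳ (u′ + - u)))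

        t′-t : t′ + - t ≡ 0ℝ → t′ ≡ t
        t′-t e = trans (ℝS.solve 2 (λ x y → x := x :- y :+ y) refl t′ t) (trans (cong (_+ t) e) (+-identityˡ t))

        -- For t = ∓ 1 the vector v₁ ± v₂ lies in S too, and the value 1 of B there is a linear
        -- equation for t′.
        hexagonal : ∀ σ → t ≡ - (fromℤ (± σ) * 1ℝ) → t′ ≡ t
        hexagonal σ e = trans (solve-t σ (trans (sym (B-comb (pos 1) (± σ))) (on-S (V.comb∈ (pos 1) (± σ) , trans (V.A-norm (pos 1) (± σ)) (norm-t σ e))))) (sym e)
          where
          one : ∀ {n} → ℝS.Polynomial n
          one = con (pos 1) :+ con (pos 0)
          N : ∀ {n} → ℝS.Polynomial n → ℝS.Polynomial n → ℝS.Polynomial n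
          N t s = con (pos 1) :* (one :* one) :+ t :* (one :* s) :+ con (pos 1) :* (s :* s)
          norm-t : ∀ σ {t} → t ≡ - (fromℤ (± σ) * 1ℝ) → norm 1ℝ t 1ℝ (pos 1) (± σ) ≡ 1ℝ
          norm-t plus refl = ℝS.solve 0 (N (:- (one :* con (pos 1))) one := con (pos 1)) refl
          norm-t minus refl = ℝS.solve 0 (N (:- ((:- one) :* con (pos 1))) (:- one) := con (pos 1)) refl
          solve-t : ∀ σ {t} → norm 1ℝ t 1ℝ (pos 1) (± σ) ≡ 1ℝ → t ≡ - (fromℤ (± σ) * 1ℝ)
          solve-t plus {t} h = trans (ℝS.solve 1 (λ t → t := N t one :- con (pos 2)) refl t) (trans (cong (_+ - fromℤ (pos 2)) h) (ℝS.solve 0 (con (pos 1) :- con (pos 2) := :- (one :* con (pos 1))) refl))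
          solve-t minus {t} h = trans (ℝS.solve 1 (λ t → t := con (pos 2) :- N t (:- one)) refl t) (trans (cong (λ z → fromℤ (pos 2) + - z) h) (ℝS.solve 0 (con (pos 2) :- con (pos 1) := :- ((:- one) :* con (pos 1))) refl))

        t′≡t : t′ ≡ t
        t′≡t = decide ((p ℤ.* q) ℤₚ.≟ (r ℤ.* s))
          where
          decide : Dec (p ℤ.* q ≡ r ℤ.* s) → t′ ≡ t
          decide (yes e) = case degenerate e of λ { (σ , h) → hexagonal σ h }
          decide (no ne) = t′-t (x*y≡0 determined (λ z → ne (fromℤ-injective (trans (fromℤ-* p q) (trans (equal-of z) (sym (fromℤ-* r s)))))))
            where
            equal-of : ∀ {a b} → a + - b ≡ 0ℝ → a ≡ b
            equal-of {a} {b} z = trans (ℝS.solve 2 (λ x y → x := x :- y :+ y) refl a b) (trans (cong (_+ b) z) (+-identityˡ b))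

      result : (∀ v → ⟦ B ⟧ v ≡ A v) × u′ ≡ u
      result = case Congruence.∈⇒ congruence W.b₁∈ of λ { (p , q , e₁ , _) → case Congruence.∈⇒ congruence W.b₂∈ of λ { (r , s , e₂ , _) →
        equal (From-pair.t′≡t {p} {q} {r} {s} e₁ e₂) } }

    isPerfect : IsPerfect L M S S′
    isPerfect = record
      { S-nonempty = v₁ , V.b₁∈ , V.A₁
      ; S⊆L-M = λ p → proj₁ p , S∉M p
      ; S′-nonempty = w₁ , W.b₁∈ , W.A₁
      ; S′⊆M-0 = λ (p , e) → p , ≢0 W.0<ρ e
      ; u = u
      ; tempered = temperedA
      ; unique = λ B u′ _ tB → Unique.result B u′ tB
      }

  -- Scaling by 1 / √ρ brings the minimum of L to 1. The sets S and S′ are then the complete shells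
  -- of minimal vectors, and ρ < ρ′ makes S avoid M.
  doublyWellRounded : ∀ {ℓ} → Prime ℓ → ∀ {L M b₁ b₂ c₁ c₂ x ρ ρ′} → Congruence ℓ L M b₁ b₂ x →
    MinimalBasis L b₁ b₂ ρ → MinimalBasis M c₁ c₂ ρ′ → ρ < ρ′ → DoublyWellRounded ℓ L M
  doublyWellRounded {ℓ} ℓ-prime {L} {M} {b₁} {b₂} {c₁} {c₂} {x} {ρ} {ρ′} congruence V W ρ<ρ′ = build (sqrt V.0<ρ)
    where
    module V = MinimalBasis V
    module W = MinimalBasis W
    build : (∃ λ r → 0ℝ < r × r * r ≡ ρ) → DoublyWellRounded ℓ L M
    build (r , 0<r , r²) = F , proj₁ shellL , proj₁ shellM , (proj₂ (proj₂ shellL) , proj₂ (proj₂ shellM)) , proj₁ (proj₂ shellL) , proj₁ (proj₂ shellM)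
      where
      c : ℝ
      c = r ⁻¹
      0<c = positive-inverse 0<r
      γ≢0 : (c , 0ℝ) ≢ 0ᶜ
      γ≢0 e = <⇒≢ 0<c (sym (cong proj₁ e))
      module γ = Image (c , 0ℝ) γ≢0 (c ·_) (·≡ c)
      Aγρ : A (c , 0ℝ) * ρ ≡ 1ℝ
      Aγρ = trans (cong (A (c , 0ℝ) *_) (sym r²)) (trans (ℝS.solve 2 (λ c r → (c :* c :+ con (pos 0) :* con (pos 0)) :* (r :* r) := r :* c :* (r :* c)) refl c r)
        (trans (cong (λ z → z * z) (*-inverseʳ r (λ e → <⇒≢ 0<r (sym e)))) (*-identityˡ 1ℝ)))
      V′ : MinimalBasis (image (c ·_) L) ((c , 0ℝ) *ᶜ b₁) ((c , 0ℝ) *ᶜ b₂) 1ℝ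
      V′ = subst (MinimalBasis _ _ _) Aγρ (γ.minimalBasis-image V)
      W′ = γ.minimalBasis-image W
      1<u : 1ℝ < A (c , 0ℝ) * ρ′
      1<u = subst (_< A (c , 0ℝ) * ρ′) Aγρ (0<y-x⇒x<y (subst (0ℝ <_)
        (ℝS.solve 3 (λ g x y → g :* (y :- x) := g :* y :- g :* x) refl (A (c , 0ℝ)) ρ ρ′) (*-pos γ.0<Aγ (x<y⇒0<y-x ρ<ρ′))))
      module P = Tempered-pair ℓ-prime (γ.congruence-image congruence) V′ W′ 1<u
      F : TemperedPerfect ℓ L M
      F = record
        { prime = ℓ-prime
        ; L-lattice = b₁ , b₂ , toLatticeBasis V.basis
        ; M-lattice = c₁ , c₂ , toLatticeBasis W.basis
        ; M⊆L = Congruence.M⊆ congruence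
        ; index = congruence-index ℓ-prime congruence
        ; scale = c
        ; 0<scale = 0<c
        ; S = P.S
        ; S′ = P.S′
        ; perfect = P.isPerfect
        }
      shellL = ShellPairs.shell-pairs V′
      shellM = ShellPairs.shell-pairs W′

  -- From ideals to forms

  ℤSpan-subgroup : ∀ {n L} (g : Fin n → ℂ) → L ≐ ℤSpan g → IsSubgroup L
  ℤSpan-subgroup {n} {L} g (⇒ , ⇐) = record
    { 0∈ = ⇐ ((λ _ → pos 0) , sym (trans (Sums.sum-cong-≗ (λ i → zero· (g i))) (Sums.sum-replicate-zero n)))
    ; +∈ = λ p q → ⇐ (add (⇒ p) (⇒ q))
    ; neg∈ = λ p → ⇐ (neg (⇒ p))
    }
    where
    zero· : ∀ v → fromℤ (pos 0) · v ≡ 0ᶜ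
    zero· (x , y) = cong₂ _,_ (zeroˡ x) (zeroˡ y)
    add : ∀ {v w} → v ∈ ℤSpan g → w ∈ ℤSpan g → (v +ᶜ w) ∈ ℤSpan g
    add (m , refl) (m′ , refl) = (λ i → m i ℤ.+ m′ i) , trans (sym (Sums.∑-distrib-+ (λ i → fromℤ (m i) · g i) (λ i → fromℤ (m′ i) · g i)))
      (Sums.sum-cong-≗ (λ i → distrib (m i) (m′ i) (g i)))
      where
      distrib : ∀ m m′ v → fromℤ m · v +ᶜ fromℤ m′ · v ≡ fromℤ (m ℤ.+ m′) · v
      distrib m m′ (x , y) = trans (cong₂ _,_ (ℝS.solve 3 (λ m n x → m :* x :+ n :* x := (m :+ n) :* x) refl (fromℤ m) (fromℤ m′) x)
        (ℝS.solve 3 (λ m n x → m :* x :+ n :* x := (m :+ n) :* x) refl (fromℤ m) (fromℤ m′) y)) (cong (_· (x , y)) (sym (fromℤ-+ m m′)))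
    neg : ∀ {v} → v ∈ ℤSpan g → (-ᶜ v) ∈ ℤSpan g
    neg (m , refl) = (λ i → ℤ.- m i) , neg-sum m
      where
      neg-term : ∀ m v → -ᶜ (fromℤ m · v) ≡ fromℤ (ℤ.- m) · v
      neg-term m (x , y) = trans (cong₂ _,_ (ℝS.solve 2 (λ m x → :- (m :* x) := :- m :* x) refl (fromℤ m) x) (ℝS.solve 2 (λ m x → :- (m :* x) := :- m :* x) refl (fromℤ m) y))
        (cong (_· (x , y)) (sym (fromℤ-neg m)))
      neg-sum : (m : Fin n → ℤ) → -ᶜ sum (λ i → fromℤ (m i) · g i) ≡ sum (λ i → fromℤ (ℤ.- m i) · g i)
      neg-sum m = trans (sym (C.solve 2 (λ s t → s C.:- (s C.:+ t) C.:= C.:- t) refl s′ s)) (trans (cong (λ z → s′ -ᶜ z) total) (trans (cong (s′ +ᶜ_) -0ᶜ) (CR.+-identityʳ s′)))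
        where
        s = sum (λ i → fromℤ (m i) · g i)
        s′ = sum (λ i → fromℤ (ℤ.- m i) · g i)
        -0ᶜ : -ᶜ 0ᶜ ≡ 0ᶜ
        -0ᶜ = C.solve 0 (C.:- C.con (pos 0) C.:= C.con (pos 0)) refl
        total : s′ +ᶜ s ≡ 0ᶜ
        total = trans (sym (Sums.∑-distrib-+ (λ i → fromℤ (ℤ.- m i) · g i) (λ i → fromℤ (m i) · g i)))
          (trans (Sums.sum-cong-≗ (λ i → trans (cong (_+ᶜ fromℤ (m i) · g i) (sym (neg-term (m i) (g i)))) (CR.-‿inverseˡ (fromℤ (m i) · g i)))) (Sums.sum-replicate-zero n))

  ⊗-single : ∀ {I J v w} → v ∈ I → w ∈ J → (v *ᶜ w) ∈ (I ⊗ J)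
  ⊗-single {v = v} {w} p q = 1 , (λ _ → v) , (λ _ → w) , (λ _ → p) , (λ _ → q) , sym (CR.+-identityʳ (v *ᶜ w))

  similar-refl : ∀ {K I} → 1ᶜ ∈ K → Similar K I I
  similar-refl {K} {I} 1∈ = 1ᶜ , 1∈ , 1ᶜ≢0 , (λ {v} p → v , p , sym (CR.*-identityˡ v)) , λ { (v , p , e) → subst I (sym (trans e (CR.*-identityˡ v))) p }

  imaginary-summand : ∀ n (q : Fin n → ℝ) (w : Fin n → ℂ) → proj₂ (sum (λ i → q i · w i)) ≢ 0ℝ → ∃ λ i → proj₂ (w i) ≢ 0ℝ
  imaginary-summand zero q w h = ⊥-elim (h refl)
  imaginary-summand (suc n) q w h with proj₂ (w zero) O.≟ 0ℝ
  ... | no ne = zero , ne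
  ... | yes e = let i , p = imaginary-summand n (q ∘ suc) (w ∘ suc) (λ z → h (trans (cong₂ _+_ (trans (cong (q zero *_) e) (zeroʳ (q zero))) z) (+-identityˡ 0ℝ))) in suc i , p

  -- By Cramer's rule.
  sublattice-member? : ∀ {L M b₁ b₂ c₁ c₂} → Basis L b₁ b₂ → Basis M c₁ c₂ → M ⊆ L → ∀ {z} → z ∈ L → Dec (z ∈ M)
  sublattice-member? {L} {M} {b₁} {b₂} {c₁} {c₂} BL BM M⊆L {z} z∈ =
    case BL.coordinates (M⊆L (basis₁∈ BM)) of λ { (p , q , e₁) →
    case BL.coordinates (M⊆L (basis₂∈ BM)) of λ { (r , s , e₂) →
    case BL.coordinates z∈ of λ { (m , n , e) →
      decide p q r s m n e₁ e₂ e ((p ℤ.* s ℤ.- q ℤ.* r) ∣? (m ℤ.* s ℤ.- n ℤ.* r)) ((p ℤ.* s ℤ.- q ℤ.* r) ∣? (p ℤ.* n ℤ.- q ℤ.* m)) } } }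
    where
    module BL = Basis BL
    module BM = Basis BM
    D≢0 : ∀ p q r s → c₁ ≡ comb b₁ b₂ p q → c₂ ≡ comb b₁ b₂ r s → p ℤ.* s ℤ.- q ℤ.* r ≢ pos 0
    D≢0 p q r s e₁ e₂ h = BM.independent (trans (cong₂ det e₁ e₂) (trans (det-comb b₁ b₂ p q r s) (trans (cong (λ d → fromℤ d * det b₁ b₂) h) (zeroˡ (det b₁ b₂)))))
    coords : ∀ p q r s m n → c₁ ≡ comb b₁ b₂ p q → c₂ ≡ comb b₁ b₂ r s → z ≡ comb b₁ b₂ m n →
      ∀ i j → z ≡ comb c₁ c₂ i j → m ≡ i ℤ.* p ℤ.+ j ℤ.* r × n ≡ i ℤ.* q ℤ.+ j ℤ.* s
    coords p q r s m n e₁ e₂ e i j h = comb-injective BL.independent {m} {n} {i ℤ.* p ℤ.+ j ℤ.* r} {i ℤ.* q ℤ.+ j ℤ.* s}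
      (trans (sym e) (trans h (trans (cong₂ (λ c d → comb c d i j) e₁ e₂) (comb-comb b₁ b₂ p q r s i j))))
    divisible : ∀ p q r s m n i j → m ≡ i ℤ.* p ℤ.+ j ℤ.* r × n ≡ i ℤ.* q ℤ.+ j ℤ.* s →
      (p ℤ.* s ℤ.- q ℤ.* r) ∣ (m ℤ.* s ℤ.- n ℤ.* r) × (p ℤ.* s ℤ.- q ℤ.* r) ∣ (p ℤ.* n ℤ.- q ℤ.* m)
    divisible p q r s m n i j (f , g) =
        divides i (trans (cong₂ (λ m n → m ℤ.* s ℤ.- n ℤ.* r) f g)
          (Z.solve 6 (λ i j p q r s → (i Z.:* p Z.:+ j Z.:* r) Z.:* s Z.:- (i Z.:* q Z.:+ j Z.:* s) Z.:* r Z.:= i Z.:* (p Z.:* s Z.:- q Z.:* r)) refl i j p q r s))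
      , divides j (trans (cong₂ (λ m n → p ℤ.* n ℤ.- q ℤ.* m) f g)
          (Z.solve 6 (λ i j p q r s → p Z.:* (i Z.:* q Z.:+ j Z.:* s) Z.:- q Z.:* (i Z.:* p Z.:+ j Z.:* r) Z.:= j Z.:* (p Z.:* s Z.:- q Z.:* r)) refl i j p q r s))
    member : ∀ D x y i j → D ≢ pos 0 → ι D *ᶜ z ≡ comb c₁ c₂ x y → x ≡ i ℤ.* D → y ≡ j ℤ.* D → z ∈ M
    member D x y i j D≢0 h ex ey = subst M (sym (*ᶜ-cancelˡ (ι≢0 D≢0) (trans h (trans (cong₂ (comb c₁ c₂) (trans ex (ℤₚ.*-comm i D)) (trans ey (ℤₚ.*-comm j D))) (sym (comb-* c₁ c₂ D i j)))))) (BM.comb∈ i j)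
    scaled : ∀ p q r s m n → c₁ ≡ comb b₁ b₂ p q → c₂ ≡ comb b₁ b₂ r s → z ≡ comb b₁ b₂ m n →
      ι (p ℤ.* s ℤ.- q ℤ.* r) *ᶜ z ≡ comb c₁ c₂ (m ℤ.* s ℤ.- n ℤ.* r) (p ℤ.* n ℤ.- q ℤ.* m)
    scaled p q r s m n e₁ e₂ e = trans (cong (ι (p ℤ.* s ℤ.- q ℤ.* r) *ᶜ_) e) (trans (cramer-comb b₁ b₂ p q r s m n)
      (sym (cong₂ (λ c d → comb c d (m ℤ.* s ℤ.- n ℤ.* r) (p ℤ.* n ℤ.- q ℤ.* m)) e₁ e₂)))
    decide : ∀ p q r s m n → c₁ ≡ comb b₁ b₂ p q → c₂ ≡ comb b₁ b₂ r s → z ≡ comb b₁ b₂ m n →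
      Dec ((p ℤ.* s ℤ.- q ℤ.* r) ∣ (m ℤ.* s ℤ.- n ℤ.* r)) → Dec ((p ℤ.* s ℤ.- q ℤ.* r) ∣ (p ℤ.* n ℤ.- q ℤ.* m)) → Dec (z ∈ M)
    decide p q r s m n e₁ e₂ e (no nd) _ = no λ z∈M → case BM.coordinates z∈M of λ { (i , j , h) → nd (proj₁ (divisible p q r s m n i j (coords p q r s m n e₁ e₂ e i j h))) }
    decide p q r s m n e₁ e₂ e (yes _) (no nd) = no λ z∈M → case BM.coordinates z∈M of λ { (i , j , h) → nd (proj₂ (divisible p q r s m n i j (coords p q r s m n e₁ e₂ e i j h))) }
    decide p q r s m n e₁ e₂ e (yes (divides i ex)) (yes (divides j ey)) = yes (member (p ℤ.* s ℤ.- q ℤ.* r) (m ℤ.* s ℤ.- n ℤ.* r) (p ℤ.* n ℤ.- q ℤ.* m) i j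
      (D≢0 p q r s e₁ e₂) (scaled p q r s m n e₁ e₂ e) ex ey)

  module Forward {ℓ : ℕ} {K 𝒪 𝔞 𝔭 : Subset} (data′ : WellRoundedIdealData ℓ K 𝒪 𝔞 𝔭) where
    open WellRoundedIdealData data′
    open PrimeKit prime renaming (L to ℓℤ)
    module K = IsSubfield (IsImaginaryQuadratic.isSubfield isImaginaryQuadratic)
    module 𝒪 = IsOrder isOrder

    M : Subset
    M = 𝔭 ⊗ 𝔞

    𝒪-subgroup : IsSubgroup 𝒪
    𝒪-subgroup = let _ , g , h = IsFractionalIdeal.f-g 𝒪.isFractionalIdeal in ℤSpan-subgroup g h

    𝔭-subgroup : IsSubgroup 𝔭
    𝔭-subgroup = let _ , g , h = IsFractionalIdeal.f-g (proj₁ (proj₁ 𝔭-ideal)) in ℤSpan-subgroup g h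

    𝔭⊆𝒪 : 𝔭 ⊆ 𝒪
    𝔭⊆𝒪 = proj₂ 𝔭-ideal

    𝒪𝔭 : ∀ {α v} → α ∈ 𝒪 → v ∈ 𝔭 → (α *ᶜ v) ∈ 𝔭
    𝒪𝔭 α∈ = proj₂ (proj₂ (proj₂ (proj₁ 𝔭-ideal)) α∈)

    𝒪𝔞 : ∀ {α v} → α ∈ 𝒪 → v ∈ 𝔞 → (α *ᶜ v) ∈ 𝔞
    𝒪𝔞 α∈ = proj₂ (proj₂ (proj₂ (proj₁ 𝔞-ideal)) α∈)

    𝒪⊆K : 𝒪 ⊆ K
    𝒪⊆K = IsFractionalIdeal.L⊆K 𝒪.isFractionalIdeal

    -- A class contains its defining ideal, by α = 1, so the ideal itself is well rounded.
    V-exists = fromWellRounded (proj₂ 𝔞-wellRounded (proj₁ 𝔞-ideal , similar-refl K.1∈))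
    W-exists = fromWellRounded (proj₂ 𝔭𝔞-wellRounded (proj₁ 𝔭𝔞-wellRounded , similar-refl K.1∈))

    module WithBases {b₁ b₂ c₁ c₂ : ℂ} {ρ ρ′ : ℝ} (V : MinimalBasis 𝔞 b₁ b₂ ρ) (W : MinimalBasis M c₁ c₂ ρ′) where
      private
        module V = MinimalBasis V
        module W = MinimalBasis W
        module 𝒪S = IsSubgroup 𝒪-subgroup
        module 𝔭S = IsSubgroup 𝔭-subgroup
        module MS = IsSubgroup W.subgroup
        module 𝔞S = IsSubgroup V.subgroup
        module I = PrimeIndex prime 𝒪-subgroup 𝔭-subgroup 𝔭-norm

      M⊆𝔞 : M ⊆ 𝔞
      M⊆𝔞 (n , v , w , v∈ , w∈ , e) = subst 𝔞 (sym e) (𝔞S.sum∈ (λ i → v i *ᶜ w i) (λ i → 𝒪𝔞 (𝔭⊆𝒪 (v∈ i)) (w∈ i)))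

      ℓ∈𝔭 : ι ℓℤ ∈ 𝔭
      ℓ∈𝔭 = subst 𝔭 (CR.*-identityʳ (ι ℓℤ)) (I.ℓ∈ 𝒪.1∈)

      ℓ𝔞⊆M : ∀ {v} → v ∈ 𝔞 → (ι ℓℤ *ᶜ v) ∈ M
      ℓ𝔞⊆M v∈ = ⊗-single {𝔭} {𝔞} ℓ∈𝔭 v∈

      -- The quotient of 𝒪 by 𝔭 has prime order and 1 is nonzero in it, so 1 generates.
      modulo-𝔭 : ∀ {r} → r ∈ 𝒪 → ∃ λ k → (r -ᶜ ι k) ∈ 𝔭
      modulo-𝔭 {r} r∈ = let k , p = PrimeIndexGenerator.generates prime 𝒪-subgroup 𝔭-subgroup 𝔭-norm 𝒪.1∈ (proj₁ 𝔭-prime) r∈ in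
        k , subst 𝔭 (cong (λ z → r -ᶜ z) (CR.*-identityʳ (ι k))) p

      -- Expanding each second factor in the basis b₁, b₂ with integer coefficients leaves the
      -- coefficients of b₁ and b₂ in 𝔭.
      𝔭-coefficients : ∀ {z} → z ∈ M → ∃₂ λ P Q → P ∈ 𝔭 × Q ∈ 𝔭 × z ≡ P *ᶜ b₁ +ᶜ Q *ᶜ b₂
      𝔭-coefficients (n , v , w , v∈ , w∈ , refl) = go n v w v∈ w∈
        where
        go : ∀ n (v w : Fin n → ℂ) → (∀ i → v i ∈ 𝔭) → (∀ i → w i ∈ 𝔞) → ∃₂ λ P Q → P ∈ 𝔭 × Q ∈ 𝔭 × sum (λ i → v i *ᶜ w i) ≡ P *ᶜ b₁ +ᶜ Q *ᶜ b₂
        go zero v w v∈ w∈ = 0ᶜ , 0ᶜ , 𝔭S.0∈ , 𝔭S.0∈ , C.solve 2 (λ b c → C.con (pos 0) C.:= C.con (pos 0) C.:* b C.:+ C.con (pos 0) C.:* c) refl b₁ b₂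
        go (suc n) v w v∈ w∈ = step (go n (v ∘ suc) (w ∘ suc) (v∈ ∘ suc) (w∈ ∘ suc)) (V.coordinates (w∈ zero))
          where
          step : (∃₂ λ P Q → P ∈ 𝔭 × Q ∈ 𝔭 × sum (λ i → v (suc i) *ᶜ w (suc i)) ≡ P *ᶜ b₁ +ᶜ Q *ᶜ b₂) → (∃₂ λ m n → w zero ≡ comb b₁ b₂ m n) →
            ∃₂ λ P Q → P ∈ 𝔭 × Q ∈ 𝔭 × v zero *ᶜ w zero +ᶜ sum (λ i → v (suc i) *ᶜ w (suc i)) ≡ P *ᶜ b₁ +ᶜ Q *ᶜ b₂
          step (P , Q , P∈ , Q∈ , e) (m , n , f) = ι m *ᶜ v zero +ᶜ P , ι n *ᶜ v zero +ᶜ Q , 𝔭S.+∈ (𝔭S.ℤ∈ m (v∈ zero)) P∈ , 𝔭S.+∈ (𝔭S.ℤ∈ n (v∈ zero)) Q∈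
            , trans (cong₂ (λ x y → v zero *ᶜ x +ᶜ y) f e)
              (C.solve 7 (λ v m n b c P Q → v C.:* (m C.:* b C.:+ n C.:* c) C.:+ (P C.:* b C.:+ Q C.:* c) C.:= (m C.:* v C.:+ P) C.:* b C.:+ (n C.:* v C.:+ Q) C.:* c) refl (v zero) (ι m) (ι n) b₁ b₂ P Q)

      -- The determinant trick: b₁ and b₂ are killed by a matrix whose determinant
      -- is congruent to 1 modulo 𝔭.
      M≢𝔞 : b₁ ∈ M → b₂ ∈ M → ⊥
      M≢𝔞 b₁∈M b₂∈M = trick (𝔭-coefficients b₁∈M) (𝔭-coefficients b₂∈M)
        where
        trick : (∃₂ λ P Q → P ∈ 𝔭 × Q ∈ 𝔭 × b₁ ≡ P *ᶜ b₁ +ᶜ Q *ᶜ b₂) → (∃₂ λ P Q → P ∈ 𝔭 × Q ∈ 𝔭 × b₂ ≡ P *ᶜ b₁ +ᶜ Q *ᶜ b₂) → ⊥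
        trick (P , Q , P∈ , Q∈ , e) (P′ , Q′ , P′∈ , Q′∈ , e′) = proj₁ 𝔭-prime (subst 𝔭 (sym one) (𝔭S.+∈ (𝔭S.-∈ (𝔭S.+∈ P∈ Q′∈) (𝒪𝔭 (𝔭⊆𝒪 P∈) Q′∈)) (𝒪𝔭 (𝔭⊆𝒪 Q∈) P′∈)))
          where
          open ≡-Reasoning
          X : ℂ
          -- Chosen so that 1 - X is the determinant (1 - P)(1 - Q′) - Q P′.
          X = P +ᶜ Q′ -ᶜ P *ᶜ Q′ +ᶜ Q *ᶜ P′
          killed : b₁ *ᶜ 1ᶜ ≡ b₁ *ᶜ X
          killed = begin
            b₁ *ᶜ 1ᶜ ≡⟨ C.solve 7 (λ b c P Q P′ Q′ X → b C.:* C.con (pos 1) C.:= b C.:* (P C.:+ Q′ C.:- P C.:* Q′ C.:+ Q C.:* P′)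
                          C.:+ (C.con (pos 1) C.:- Q′) C.:* (b C.:- (P C.:* b C.:+ Q C.:* c)) C.:+ Q C.:* (c C.:- (P′ C.:* b C.:+ Q′ C.:* c))) refl b₁ b₂ P Q P′ Q′ X ⟩
            b₁ *ᶜ X +ᶜ (1ᶜ -ᶜ Q′) *ᶜ (b₁ -ᶜ (P *ᶜ b₁ +ᶜ Q *ᶜ b₂)) +ᶜ Q *ᶜ (b₂ -ᶜ (P′ *ᶜ b₁ +ᶜ Q′ *ᶜ b₂))
              ≡⟨ cong₂ (λ x y → b₁ *ᶜ X +ᶜ (1ᶜ -ᶜ Q′) *ᶜ (b₁ -ᶜ x) +ᶜ Q *ᶜ (b₂ -ᶜ y)) (sym e) (sym e′) ⟩
            b₁ *ᶜ X +ᶜ (1ᶜ -ᶜ Q′) *ᶜ (b₁ -ᶜ b₁) +ᶜ Q *ᶜ (b₂ -ᶜ b₂)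
              ≡⟨ C.solve 5 (λ a q b c Q → a C.:+ q C.:* (b C.:- b) C.:+ Q C.:* (c C.:- c) C.:= a) refl (b₁ *ᶜ X) (1ᶜ -ᶜ Q′) b₁ b₂ Q ⟩
            b₁ *ᶜ X ∎
          one : 1ᶜ ≡ X
          one = *ᶜ-cancelˡ (det≢0⇒≢0ˡ V.independent) killed

      -- If 𝔭 𝔞 ⊆ ℓ 𝔞 then 𝔭 ⊆ ℓ 𝒪, so 𝒪 = ℤ + ℓ 𝒪; the b₂-coordinate of r b₁
      -- for a nonreal r ∈ 𝒪 could then be divided by ℓ forever.
      M⊈ℓ𝔞 : ¬ (∀ {v} → v ∈ M → ∃ λ w → w ∈ 𝔞 × v ≡ ι ℓℤ *ᶜ w)
      M⊈ℓ𝔞 h = nonreal-element (IsImaginaryQuadratic.nonreal isImaginaryQuadratic)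
        where
        ℓ≢0ᶜ : ι ℓℤ ≢ 0ᶜ
        ℓ≢0ᶜ = ι≢0 L≢0
        -- By hypothesis p / ℓ maps 𝔞 into itself, so it lies in the coefficient ring of 𝔞, which is
        -- 𝒪.
        divide : ∀ {p} → p ∈ 𝔭 → ∃ λ p′ → p′ ∈ 𝒪 × p ≡ ι ℓℤ *ᶜ p′
        divide {p} p∈ = from (K.inverse (𝒪⊆K (𝔭⊆𝒪 ℓ∈𝔭)) ℓ≢0ᶜ)
          where
          from : (∃ λ w → w ∈ K × ι ℓℤ *ᶜ w ≡ 1ᶜ) → ∃ λ p′ → p′ ∈ 𝒪 × p ≡ ι ℓℤ *ᶜ p′
          from (w , w∈ , lw) = w *ᶜ p , proj₁ (proj₂ (proj₁ 𝔞-ideal)) (K.*-closed w∈ (𝒪⊆K (𝔭⊆𝒪 p∈)) , stable)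
              , sym (trans (sym (CR.*-assoc (ι ℓℤ) w p)) (trans (cong (_*ᶜ p) lw) (CR.*-identityˡ p)))
            where
            stable : ∀ {v} → v ∈ 𝔞 → ((w *ᶜ p) *ᶜ v) ∈ 𝔞
            stable {v} v∈ = case h (⊗-single {𝔭} {𝔞} p∈ v∈) of λ { (y , y∈ , e) → subst 𝔞 (sym (trans (CR.*-assoc w p v) (trans (cong (w *ᶜ_) e)
              (trans (C.solve 3 (λ w l y → w C.:* (l C.:* y) C.:= l C.:* w C.:* y) refl w (ι ℓℤ) y) (trans (cong (_*ᶜ y) lw) (CR.*-identityˡ y)))))) y∈ }
        real-if : ∀ {r X} → r *ᶜ b₁ ≡ comb b₁ b₂ X (pos 0) → proj₂ r ≡ 0ℝ
        real-if {r} {X} e = cong proj₂ (*ᶜ-cancelˡ {b₁} {r} {ι X} (det≢0⇒≢0ˡ V.independent) (trans (CR.*-comm b₁ r) (trans e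
          (C.solve 3 (λ x b c → x C.:* b C.:+ C.con (pos 0) C.:* c C.:= b C.:* x) refl (ι X) b₁ b₂))))
        -- The number n bounds |Y|. From r = k + ℓ r′ follows Y = ℓ Y′, and r′ is again nonreal; the
        -- descent ends at Y = 0, where r would be real.
        descend : ∀ n {r} → r ∈ 𝒪 → ∀ X Y → r *ᶜ b₁ ≡ comb b₁ b₂ X Y → ℤ.∣ Y ∣ ℕ.≤ n → proj₂ r ≢ 0ℝ → ⊥
        descend n {r} r∈ X (pos zero) e _ nonreal = nonreal (real-if {r} {X} e)
        descend zero {r} r∈ X (pos (suc y)) e () nonreal
        descend zero {r} r∈ X -[1+ y ] e () nonreal
        descend (suc n) {r} r∈ X Y e Y≤n nonreal = next (modulo-𝔭 r∈)
          where
          next : (∃ λ k → (r -ᶜ ι k) ∈ 𝔭) → ⊥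
          next (k , p) = next′ (divide p)
            where
            next′ : (∃ λ r′ → r′ ∈ 𝒪 × r -ᶜ ι k ≡ ι ℓℤ *ᶜ r′) → ⊥
            next′ (r′ , r′∈ , e′) = next″ (V.coordinates (𝒪𝔞 r′∈ V.b₁∈))
              where
              r≡ : r ≡ ι k +ᶜ ι ℓℤ *ᶜ r′
              r≡ = trans (C.solve 2 (λ r k → r C.:= k C.:+ (r C.:- k)) refl r (ι k)) (cong (ι k +ᶜ_) e′)
              next″ : (∃₂ λ X′ Y′ → r′ *ᶜ b₁ ≡ comb b₁ b₂ X′ Y′) → ⊥
              next″ (X′ , Y′ , f) = descend n r′∈ X′ Y′ f (smaller (ℤ.∣ Y′ ∣) refl)
                  (λ z → nonreal (trans (cong proj₂ r≡) (imaginary z)))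
                where
                Y≡ : Y ≡ ℓℤ ℤ.* Y′
                Y≡ = proj₂ (comb-injective V.independent {X} {Y} {k ℤ.+ ℓℤ ℤ.* X′} {ℓℤ ℤ.* Y′} (trans (sym e) (trans (cong (_*ᶜ b₁) r≡)
                  (trans (C.solve 4 (λ k l r b → (k C.:+ l C.:* r) C.:* b C.:= k C.:* b C.:+ l C.:* (r C.:* b)) refl (ι k) (ι ℓℤ) r′ b₁)
                  (trans (cong (λ z → ι k *ᶜ b₁ +ᶜ ι ℓℤ *ᶜ z) f)
                  (trans (C.solve 6 (λ k l x y b c → k C.:* b C.:+ l C.:* (x C.:* b C.:+ y C.:* c) C.:= (k C.:+ l C.:* x) C.:* b C.:+ (l C.:* y) C.:* c) refl (ι k) (ι ℓℤ) (ι X′) (ι Y′) b₁ b₂)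
                    (cong₂ (λ x y → x *ᶜ b₁ +ᶜ y *ᶜ b₂) (sym (C.cast 3 (λ k l x → k C.:+ l C.:* x) (k ∷ ℓℤ ∷ X′ ∷ []))) (sym (ι-* ℓℤ Y′)))))))))
                imaginary : proj₂ r′ ≡ 0ℝ → proj₂ (ι k +ᶜ ι ℓℤ *ᶜ r′) ≡ 0ℝ
                imaginary z = trans (cong (λ y → 0ℝ + (fromℤ ℓℤ * y + 0ℝ * proj₁ r′)) z)
                  (ℝS.solve 2 (λ l x → con (pos 0) :+ (l :* con (pos 0) :+ con (pos 0) :* x) := con (pos 0)) refl (fromℤ ℓℤ) (proj₁ r′))
                smaller : ∀ y → y ≡ ℤ.∣ Y′ ∣ → ℤ.∣ Y′ ∣ ℕ.≤ n
                smaller zero z = subst (ℕ._≤ n) z ℕ.z≤n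
                smaller (suc y) z = subst (ℕ._≤ n) z (ℕₚ.≤-pred (ℕₚ.≤-trans (ℕₚ.≤-trans lt (ℕₚ.≤-reflexive (sym abs-Y))) Y≤n))
                  where
                  abs-Y : ℤ.∣ Y ∣ ≡ ℓ ℕ.* suc y
                  abs-Y = trans (cong ℤ.∣_∣ Y≡) (trans (ℤₚ.abs-* ℓℤ Y′) (cong (ℓ ℕ.*_) (sym z)))
                  lt : suc (suc y) ℕ.≤ ℓ ℕ.* suc y
                  lt = ℕₚ.≤-trans (ℕₚ.≤-trans (ℕ.s≤s (ℕₚ.m≤n+m (suc y) y)) (ℕₚ.≤-reflexive (cong (λ w → suc y ℕ.+ w) (sym (ℕₚ.+-identityʳ (suc y)))))) (ℕₚ.*-monoˡ-≤ (suc y) 2≤ℓ)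
        nonreal-element : (∃ λ z → z ∈ K × proj₂ z ≢ 0ℝ) → ⊥
        nonreal-element (z , z∈ , nz) = case IsFractionalIdeal.spans 𝒪.isFractionalIdeal z∈ of λ { (n , q , w , w∈ , e) →
          case imaginary-summand n (λ i → fromℚ (q i)) w (λ h → nz (trans (cong proj₂ e) h)) of λ { (i , ne) →
            case V.coordinates (𝒪𝔞 (w∈ i) V.b₁∈) of λ { (X , Y , f) → descend (ℤ.∣ Y ∣) (w∈ i) X Y f ℕₚ.≤-refl ne } } }

      -- A vector of M no longer than b₁ would make c₁, c₂ a basis of 𝔞.
      M-longer : ∀ {v} → v ∈ M → v ≢ 0ᶜ → ¬ A v ≤ ρ
      M-longer {v} v∈ v≢0 h = M≢𝔞 (⊆M V.b₁∈) (⊆M V.b₂∈)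
        where
        c₁∈ = M⊆𝔞 W.b₁∈
        ρ′≡ρ : ρ′ ≡ ρ
        ρ′≡ρ = ≤-antisym (≤-trans (W.lower v∈ v≢0) h) (≤-trans (V.lower c₁∈ (det≢0⇒≢0ˡ W.independent)) (inj₂ W.A₁))
        C-basis : Basis 𝔞 c₁ c₂
        C-basis = minimal⇒Basis V.basis V.0<ρ V.lower c₁∈ (M⊆𝔞 W.b₂∈) (trans W.A₁ ρ′≡ρ) (trans W.A₂ ρ′≡ρ) W.independent
        ⊆M : 𝔞 ⊆ M
        ⊆M p = case Basis.coordinates C-basis p of λ { (m , n , e) → subst M (sym e) (W.comb∈ m n) }

      b₁∉M : b₁ ∉ M
      b₁∉M p = M-longer p (det≢0⇒≢0ˡ V.independent) (inj₂ V.A₁)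

      ρ<ρ′ : ρ < ρ′
      ρ<ρ′ = ≰⇒> λ h → M-longer W.b₁∈ (det≢0⇒≢0ˡ W.independent) (≤-trans (inj₂ W.A₁) h)

      b₂-kb₁ : ∀ k → (b₂ -ᶜ ι k *ᶜ b₁) ∈ 𝔞
      b₂-kb₁ k = 𝔞S.-∈ V.b₂∈ (𝔞S.ℤ∈ k V.b₁∈)

      -- The index of M in 𝔞 is not yet known, so there are no cosets to count. Instead all residues
      -- x are searched, membership in M being decidable. If none works, n is divisible by ℓ for
      -- every m b₁ + n b₂ in M, then m as well because b₁ ∉ M, and M ⊆ ℓ 𝔞.
      generator : ∃ λ x → (b₂ -ᶜ ι x *ᶜ b₁) ∈ M
      generator = decide (Finₚ.any? λ (k : Fin ℓ) → sublattice-member? V.basis W.basis M⊆𝔞 (b₂-kb₁ (pos (toℕ k))))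
        where
        instance _ = ℕ.≢-nonZero ℓ≢0
        decide : Dec (∃ λ (k : Fin ℓ) → (b₂ -ᶜ ι (pos (toℕ k)) *ᶜ b₁) ∈ M) → ∃ λ x → (b₂ -ᶜ ι x *ᶜ b₁) ∈ M
        decide (yes (k , p)) = pos (toℕ k) , p
        decide (no none) = ⊥-elim (M⊈ℓ𝔞 λ {v} v∈ → case V.coordinates (M⊆𝔞 v∈) of λ { (m , n , e) → divisible v∈ m n e (ℓℤ ∣? n) })
          where
          -- As ℓ b₁ ∈ M, only the residue of x matters, so the finite search covers every integer.
          no-integer : ∀ x → ¬ (b₂ -ᶜ ι x *ᶜ b₁) ∈ M
          no-integer x p = none (fromℕ< r<ℓ , subst M (trans eq (cong (λ j → b₂ -ᶜ ι (pos j) *ᶜ b₁) (sym (Finₚ.toℕ-fromℕ< r<ℓ))))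
              (MS.+∈ p (MS.ℤ∈ q (ℓ𝔞⊆M V.b₁∈))))
            where
            r<ℓ = ℤD.n%ℕd<d x ℓ
            r = pos (x ℤD.%ℕ ℓ)
            q = x ℤD./ℕ ℓ
            eq : (b₂ -ᶜ ι x *ᶜ b₁) +ᶜ ι q *ᶜ (ι ℓℤ *ᶜ b₁) ≡ b₂ -ᶜ ι r *ᶜ b₁
            eq = trans (cong (λ z → (b₂ -ᶜ z *ᶜ b₁) +ᶜ ι q *ᶜ (ι ℓℤ *ᶜ b₁)) (trans (cong ι (ℤD.a≡a%ℕn+[a/ℕn]*n x ℓ)) (C.cast 3 (λ r q l → r C.:+ q C.:* l) (r ∷ q ∷ ℓℤ ∷ []))))
              (C.solve 5 (λ b c r q l → (c C.:- (r C.:+ q C.:* l) C.:* b) C.:+ q C.:* (l C.:* b) C.:= c C.:- r C.:* b) refl b₁ b₂ (ι r) (ι q) (ι ℓℤ))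
          divisible : ∀ {v} → v ∈ M → ∀ m n → v ≡ comb b₁ b₂ m n → Dec (ℓℤ ∣ n) → ∃ λ w → w ∈ 𝔞 × v ≡ ι ℓℤ *ᶜ w
          divisible {v} v∈ m n e (no nd) = ⊥-elim (from (prime-bezout nd))
            where
            from : (∃₂ λ i j → i ℤ.* n ℤ.+ j ℤ.* ℓℤ ≡ pos 1) → ⊥
            -- With i n + j ℓ = 1, the combination i v + j ℓ b₂ of elements of M is b₂ + i m b₁.
            from (i , j , f) = no-integer (ℤ.- (i ℤ.* m)) (subst M eq (MS.+∈ (MS.ℤ∈ i v∈) (MS.ℤ∈ j (ℓ𝔞⊆M V.b₂∈))))
              where
              one : ι i *ᶜ ι n +ᶜ ι j *ᶜ ι ℓℤ ≡ 1ᶜ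
              one = trans (sym (C.cast 4 (λ i n j l → i C.:* n C.:+ j C.:* l) (i ∷ n ∷ j ∷ ℓℤ ∷ []))) (trans (cong ι f) ι-1)
              eq : ι i *ᶜ v +ᶜ ι j *ᶜ (ι ℓℤ *ᶜ b₂) ≡ b₂ -ᶜ ι (ℤ.- (i ℤ.* m)) *ᶜ b₁
              eq = trans (cong (λ z → ι i *ᶜ z +ᶜ ι j *ᶜ (ι ℓℤ *ᶜ b₂)) e)
                (trans (C.solve 7 (λ i j m n l b c → i C.:* (m C.:* b C.:+ n C.:* c) C.:+ j C.:* (l C.:* c) C.:= (i C.:* n C.:+ j C.:* l) C.:* c C.:- (C.:- (i C.:* m)) C.:* b) refl (ι i) (ι j) (ι m) (ι n) (ι ℓℤ) b₁ b₂)
                (cong₂ (λ x y → x -ᶜ y *ᶜ b₁) (trans (cong (_*ᶜ b₂) one) (CR.*-identityˡ b₂)) (sym (C.cast 2 (λ i m → C.:- (i C.:* m)) (i ∷ m ∷ [])))))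
          divisible {v} v∈ m n e (yes (divides n′ f)) = from (Multiples.k∈⇒ℓ∣k prime W.subgroup {b₁} {m} (ℓ𝔞⊆M V.b₁∈) b₁∉M
              (subst M eq (MS.-∈ v∈ (MS.ℤ∈ n′ (ℓ𝔞⊆M V.b₂∈)))))
            where
            eq : v -ᶜ ι n′ *ᶜ (ι ℓℤ *ᶜ b₂) ≡ ι m *ᶜ b₁
            eq = trans (cong (λ z → z -ᶜ ι n′ *ᶜ (ι ℓℤ *ᶜ b₂)) (trans e (cong (λ z → ι m *ᶜ b₁ +ᶜ z *ᶜ b₂) (trans (cong ι f) (ι-* n′ ℓℤ)))))
              (C.solve 5 (λ m n l b c → m C.:* b C.:+ (n C.:* l) C.:* c C.:- n C.:* (l C.:* c) C.:= m C.:* b) refl (ι m) (ι n′) (ι ℓℤ) b₁ b₂)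
            from : ℓℤ ∣ m → ∃ λ w → w ∈ 𝔞 × v ≡ ι ℓℤ *ᶜ w
            from (divides m′ g) = comb b₁ b₂ m′ n′ , V.comb∈ m′ n′ , trans e (trans (cong₂ (comb b₁ b₂) (trans g (ℤₚ.*-comm m′ ℓℤ)) (trans f (ℤₚ.*-comm n′ ℓℤ))) (sym (comb-* b₁ b₂ ℓℤ m′ n′)))

      result : DoublyWellRounded ℓ 𝔞 M
      result = doublyWellRounded prime
        (sublattice-congruence prime {x = proj₁ generator} V.basis W.subgroup M⊆𝔞 (ℓ𝔞⊆M V.b₁∈) b₁∉M (proj₂ generator)) V W ρ<ρ′

  forward : (ℓ : ℕ) (K 𝒪 𝔞 𝔭 : Subset) → WellRoundedIdealData ℓ K 𝒪 𝔞 𝔭 → DoublyWellRounded ℓ 𝔞 (𝔭 ⊗ 𝔞)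
  forward ℓ K 𝒪 𝔞 𝔭 d = case Forward.V-exists d of λ { (_ , _ , _ , V) → case Forward.W-exists d of λ { (_ , _ , _ , W) → Forward.WithBases.result d V W } }

  -- From forms to ideals

  A-conj : ∀ z → A (conj z) ≡ A z
  A-conj (x , y) = ℝS.solve 2 (λ x y → x :* x :+ :- y :* :- y := x :* x :+ y :* y) refl x y

  square-trace-norm : ∀ z → z *ᶜ z ≡ (fromℤ (pos 2) * proj₁ z , 0ℝ) *ᶜ z -ᶜ (A z , 0ℝ)
  square-trace-norm (x , y) = cong₂ _,_
    (ℝS.solve 2 (λ x y → x :* x :- y :* y := con (pos 2) :* x :* x :- con (pos 0) :* y :- (x :* x :+ y :* y)) refl x y)
    (ℝS.solve 2 (λ x y → x :* y :+ y :* x := con (pos 2) :* x :* y :+ con (pos 0) :* x :- con (pos 0)) refl x y)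

  trace-conj : ∀ v w → fromℤ (pos 2) * proj₁ (w *ᶜ conj v) ≡ cross v w
  trace-conj (x , y) (x′ , y′) = ℝS.solve 4 (λ x y x′ y′ → con (pos 2) :* (x′ :* x :- y′ :* :- y) := con (pos 2) :* (x :* x′ :+ y :* y′)) refl x y x′ y′

  -- If m + n x = k ℓ, then m v₁ + n v₂ = k (ℓ v₁) + n (v₂ - x v₁).
  congruence-basis : ∀ {ℓ L M v₁ v₂ x} → Prime ℓ → Congruence ℓ L M v₁ v₂ x → Basis M (ι (pos ℓ) *ᶜ v₁) (v₂ -ᶜ ι x *ᶜ v₁)
  congruence-basis {ℓ} {L} {M} {v₁} {v₂} {x} ℓ-prime c = record
    { independent = λ e → *-≢0 (fromℤ≢0 L≢0) independent (trans (sym det≡) e)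
    ; coordinates = λ p → case ∈⇒ p of λ { (m , n , e , d) → coords m n e d }
    ; comb∈ = λ m n → subst M (sym (comb≡ m n)) (⇒∈ (m ℤ.* pos ℓ ℤ.- n ℤ.* x) n (divides m
        (Z.solve 4 (λ m n l x → m Z.:* l Z.:- n Z.:* x Z.:+ n Z.:* x Z.:= m Z.:* l) refl m n (pos ℓ) x)))
    }
    where
    open Congruence c
    open Basis basis using (independent)
    open PrimeKit ℓ-prime using (L≢0)
    comb≡ : ∀ m n → comb (ι (pos ℓ) *ᶜ v₁) (v₂ -ᶜ ι x *ᶜ v₁) m n ≡ comb v₁ v₂ (m ℤ.* pos ℓ ℤ.- n ℤ.* x) n
    comb≡ m n = trans (C.solve 6 (λ v w m n l x → m C.:* (l C.:* v) C.:+ n C.:* (w C.:- x C.:* v) C.:= (m C.:* l C.:- n C.:* x) C.:* v C.:+ n C.:* w) refl v₁ v₂ (ι m) (ι n) (ι (pos ℓ)) (ι x))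
      (cong (λ z → z *ᶜ v₁ +ᶜ ι n *ᶜ v₂) (sym (C.cast 4 (λ m l n x → m C.:* l C.:- n C.:* x) (m ∷ pos ℓ ∷ n ∷ x ∷ []))))
    coords : ∀ m n {v} → v ≡ comb v₁ v₂ m n → pos ℓ ∣ m ℤ.+ n ℤ.* x → ∃₂ λ m n → v ≡ comb (ι (pos ℓ) *ᶜ v₁) (v₂ -ᶜ ι x *ᶜ v₁) m n
    coords m n e (divides k f) = k , n , trans e (sym (trans (comb≡ k n) (cong (λ m → comb v₁ v₂ m n)
      (trans (cong (ℤ._- n ℤ.* x) (sym f)) (Z.solve 2 (λ m y → m Z.:+ y Z.:- y Z.:= m) refl m (n ℤ.* x))))))
    det≡ : det (ι (pos ℓ) *ᶜ v₁) (v₂ -ᶜ ι x *ᶜ v₁) ≡ fromℤ (pos ℓ) * det v₁ v₂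
    det≡ = lemma (fromℤ (pos ℓ)) (fromℤ x) v₁ v₂
      where
      lemma : ∀ l x v w → det ((l , 0ℝ) *ᶜ v) (w -ᶜ (x , 0ℝ) *ᶜ v) ≡ l * det v w
      lemma l x (a , b) (c , d) = ℝS.solve 6 (λ l x a b c d → let z = con (pos 0) in
        (l :* a :- z :* b) :* (d :- (x :* b :+ z :* a)) :- (l :* b :+ z :* a) :* (c :- (x :* a :- z :* b)) := l :* (a :* d :- b :* c)) refl l x a b c d

  wellRounded-similar : ∀ {I J K b₁ b₂ ρ} → MinimalBasis I b₁ b₂ ρ → Similar K I J → WellRounded J
  wellRounded-similar B (α , _ , α≢0 , J⊆ , ⊆J) =
    toWellRounded (MinimalBasis-≐ (⊆J , J⊆) (Image.minimalBasis-image α α≢0 (α *ᶜ_) (λ _ → refl) B))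

  -- A certificate that the polynomial A′ X² - B′ X + C′ is primitive, as `Proper` requires.
  record Bezout₃ (A′ B′ C′ : ℤ) : Set where
    constructor bezout₃
    field
      {i′ j′ l′} : ℤ
      relation : i′ ℤ.* A′ ℤ.+ j′ ℤ.* B′ ℤ.+ l′ ℤ.* C′ ≡ pos 1

  -- Multiply the two relations: every term of the product contains a l, b or n.
  bezout-product : ∀ f a j b v l w z n → f ℤ.* a ℤ.+ j ℤ.* b ≡ pos 1 → v ℤ.* l ℤ.+ w ℤ.* b ℤ.+ z ℤ.* n ≡ pos 1 →
    Bezout₃ (a ℤ.* l) b n
  bezout-product f a j b v l w z n e₁ e₂ = bezout₃ {i′ = f ℤ.* v} {j′ = j ℤ.* (v ℤ.* l ℤ.+ w ℤ.* b ℤ.+ z ℤ.* n) ℤ.+ f ℤ.* a ℤ.* w} {l′ = f ℤ.* a ℤ.* z} (trans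
    (Z.solve 9 (λ f a j b v l w z n → (f Z.:* v) Z.:* (a Z.:* l) Z.:+ (j Z.:* (v Z.:* l Z.:+ w Z.:* b Z.:+ z Z.:* n) Z.:+ f Z.:* a Z.:* w) Z.:* b Z.:+ (f Z.:* a Z.:* z) Z.:* n
      Z.:= (f Z.:* a Z.:+ j Z.:* b) Z.:* (v Z.:* l Z.:+ w Z.:* b Z.:+ z Z.:* n)) refl f a j b v l w z n)
    (cong₂ ℤ._*_ e₁ e₂))

  -- Insert 1 = f a + j b into the term z n of the second relation.
  bezout-multiple : ∀ f a j b v l w z n → f ℤ.* a ℤ.+ j ℤ.* b ≡ pos 1 → v ℤ.* l ℤ.+ w ℤ.* b ℤ.+ z ℤ.* n ≡ pos 1 →
    Bezout₃ l b (a ℤ.* n)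
  bezout-multiple f a j b v l w z n e₁ e₂ = bezout₃ {i′ = v} {j′ = w ℤ.+ z ℤ.* n ℤ.* j} {l′ = z ℤ.* f} (trans
    (Z.solve 9 (λ f a j b v l w z n → v Z.:* l Z.:+ (w Z.:+ z Z.:* n Z.:* j) Z.:* b Z.:+ (z Z.:* f) Z.:* (a Z.:* n)
      Z.:= v Z.:* l Z.:+ w Z.:* b Z.:+ z Z.:* n Z.:* (f Z.:* a Z.:+ j Z.:* b)) refl f a j b v l w z n)
    (trans (cong (λ y → v ℤ.* l ℤ.+ w ℤ.* b ℤ.+ z ℤ.* n ℤ.* y) e₁)
      (trans (cong (λ y → v ℤ.* l ℤ.+ w ℤ.* b ℤ.+ y) (ℤₚ.*-identityʳ (z ℤ.* n))) e₂)))

  module Construction {ℓ : ℕ} (ℓ-prime : Prime ℓ) {L M : Subset} {v₁ v₂ w₁ w₂ : ℂ} {x : ℤ} {u : ℝ}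
    (congruence : Congruence ℓ L M v₁ v₂ x) (V : MinimalBasis L v₁ v₂ 1ℝ) (W : MinimalBasis M w₁ w₂ u)
    (a b i j : ℤ) (0<a : 0ℝ < fromℤ a) (at≡b : fromℤ a * cross v₁ v₂ ≡ fromℤ b) (bezout : i ℤ.* a ℤ.+ j ℤ.* b ≡ pos 1)
    (n₁ : ℤ) (n₀≡ : a ℤ.* (x ℤ.* x) ℤ.- b ℤ.* x ℤ.+ a ≡ n₁ ℤ.* pos ℓ)
    (ℓ²∤n₀ : pos ℓ ∣ pos 2 ℤ.* (a ℤ.* x) ℤ.- b → ¬ pos ℓ ℤ.* pos ℓ ∣ a ℤ.* (x ℤ.* x) ℤ.- b ℤ.* x ℤ.+ a) where

    private
      module V = MinimalBasis V
      module W = MinimalBasis W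

    open PrimeKit ℓ-prime renaming (L to ℓℤ)

    a≢0 : a ≢ pos 0
    a≢0 e = <⇒≢ 0<a (sym (cong fromℤ e))

    -- As A v₁ = 1, `conj v₁` is the inverse of v₁, so τ = v₂ / v₁. Multiplication by β sends v₁ to
    -- a and v₂ to ω = a τ, which places the image of L inside ℤ[ω].
    τ ω β : ℂ
    τ = v₂ *ᶜ conj v₁
    ω = ι a *ᶜ τ
    β = ι a *ᶜ conj v₁

    conj-v₁ : v₁ *ᶜ conj v₁ ≡ 1ᶜ
    conj-v₁ = trans (*-conj v₁) (cong (_, 0ℝ) V.A₁)

    βv₁ : β *ᶜ v₁ ≡ ι a
    βv₁ = trans (C.solve 3 (λ a v v̄ → a C.:* v̄ C.:* v C.:= a C.:* (v C.:* v̄)) refl (ι a) v₁ (conj v₁))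
      (trans (cong (ι a *ᶜ_) conj-v₁) (CR.*-identityʳ (ι a)))

    βv₂ : β *ᶜ v₂ ≡ ω
    βv₂ = C.solve 3 (λ a w v̄ → a C.:* v̄ C.:* w C.:= a C.:* (w C.:* v̄)) refl (ι a) v₂ (conj v₁)

    conj≢0 : conj v₁ ≢ 0ᶜ
    conj≢0 e = 1ᶜ≢0 (trans (sym conj-v₁) (trans (cong (v₁ *ᶜ_) e) (*ᶜ-zeroʳ v₁)))

    β≢0 : β ≢ 0ᶜ
    β≢0 = *ᶜ≢0 (ι≢0 a≢0) conj≢0

    module β = Image β β≢0 (β *ᶜ_) (λ _ → refl)

    τ² : τ *ᶜ τ ≡ (cross v₁ v₂ , 0ℝ) *ᶜ τ -ᶜ 1ᶜ
    τ² = trans (square-trace-norm τ) (cong₂ (λ t n → (t , 0ℝ) *ᶜ τ -ᶜ (n , 0ℝ)) (trace-conj v₁ v₂)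
      (trans (A-* v₂ (conj v₁)) (trans (cong₂ _*_ V.A₂ (trans (A-conj v₁) V.A₁)) (*-identityˡ 1ℝ))))

    at : ι a *ᶜ (cross v₁ v₂ , 0ℝ) ≡ ι b
    at = trans (sym (·≡ (fromℤ a) (cross v₁ v₂ , 0ℝ))) (cong₂ _,_ at≡b (zeroʳ (fromℤ a)))

    ω² : ω *ᶜ ω ≡ ι b *ᶜ ω -ᶜ ι (a ℤ.* a)
    ω² = begin
      ι a *ᶜ τ *ᶜ (ι a *ᶜ τ)                     ≡⟨ C.solve 2 (λ a t → a C.:* t C.:* (a C.:* t) C.:= a C.:* a C.:* (t C.:* t)) refl (ι a) τ ⟩
      ι a *ᶜ ι a *ᶜ (τ *ᶜ τ)                     ≡⟨ cong (ι a *ᶜ ι a *ᶜ_) τ² ⟩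
      ι a *ᶜ ι a *ᶜ (T *ᶜ τ -ᶜ 1ᶜ)               ≡⟨ C.solve 3 (λ a t s → a C.:* a C.:* (s C.:* t C.:- C.con (pos 1)) C.:= (a C.:* s) C.:* (a C.:* t) C.:- a C.:* a) refl (ι a) τ T ⟩
      (ι a *ᶜ T) *ᶜ ω -ᶜ ι a *ᶜ ι a              ≡⟨ cong₂ (λ y z → y *ᶜ ω -ᶜ z) at (sym (ι-* a a)) ⟩
      ι b *ᶜ ω -ᶜ ι (a ℤ.* a)                    ∎
      where
      open ≡-Reasoning
      T : ℂ
      T = cross v₁ v₂ , 0ℝ

    𝔞 𝔪 : Subset
    𝔞 = image (β *ᶜ_) L
    𝔪 = image (β *ᶜ_) M

    𝔪-congruence : Congruence ℓ 𝔞 𝔪 (ι a) ω x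
    𝔪-congruence = subst₂ (λ v w → Congruence ℓ 𝔞 𝔪 v w x) βv₁ βv₂ (β.congruence-image congruence)

    𝔞-basis : Basis 𝔞 (ι a) ω
    𝔞-basis = Congruence.basis 𝔪-congruence

    independent : det 1ᶜ ω ≢ 0ℝ
    independent e = Basis.independent 𝔞-basis (trans (scale (fromℤ a) ω) (trans (cong (fromℤ a *_) e) (zeroʳ (fromℤ a))))
      where
      scale : ∀ a z → det (a , 0ℝ) z ≡ a * det 1ᶜ z
      scale a (x , y) = ℝS.solve 3 (λ a x y → a :* y :- con (pos 0) :* x := a :* (con (pos 1) :* y :- con (pos 0) :* x)) refl a x y

    open QuadraticOrder ω b (a ℤ.* a) ω² independent

    k B : ℤ
    k = x ℤ.* a
    B = b ℤ.- pos 2 ℤ.* (a ℤ.* x)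

    -- The image under β of the generator v₂ - x v₁ of M. It is the second basis vector of both 𝔪 =
    -- ℤ ℓ a + ℤ g and 𝔭 = ℤ ℓ + ℤ g.
    g : ℂ
    g = ω -ᶜ ι k

    -- B is the trace of g, and its norm is k² - b k + a² = a (a x² - b x + a) = a n₁ ℓ. Thus g / (ℓ
    -- a) is a root of a ℓ X² - B X + n₁, and g / ℓ of ℓ X² - B X + a n₁.
    g*g : g *ᶜ g ≡ ι B *ᶜ g -ᶜ ι (a ℤ.* n₁) *ᶜ ι ℓℤ
    g*g = begin
      (ω -ᶜ ι k) *ᶜ (ω -ᶜ ι k)
        ≡⟨ cong (λ z → (ω -ᶜ z) *ᶜ (ω -ᶜ z)) (ι-* x a) ⟩
      (ω -ᶜ ι x *ᶜ ι a) *ᶜ (ω -ᶜ ι x *ᶜ ι a)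
        ≡⟨ C.solve 4 (λ w a b x → (w C.:- x C.:* a) C.:* (w C.:- x C.:* a) C.:=
             (b C.:- C.con (pos 2) C.:* (a C.:* x)) C.:* (w C.:- x C.:* a) C.:- a C.:* (a C.:* (x C.:* x) C.:- b C.:* x C.:+ a)
             C.:+ (w C.:* w C.:- (b C.:* w C.:- a C.:* a))) refl ω (ι a) (ι b) (ι x) ⟩
      Y +ᶜ (ω *ᶜ ω -ᶜ (ι b *ᶜ ω -ᶜ ι a *ᶜ ι a))
        ≡⟨ cong (λ z → Y +ᶜ (z -ᶜ (ι b *ᶜ ω -ᶜ ι a *ᶜ ι a))) (trans ω² (cong (λ z → ι b *ᶜ ω -ᶜ z) (ι-* a a))) ⟩
      Y +ᶜ ((ι b *ᶜ ω -ᶜ ι a *ᶜ ι a) -ᶜ (ι b *ᶜ ω -ᶜ ι a *ᶜ ι a))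
        ≡⟨ C.solve 2 (λ y z → y C.:+ (z C.:- z) C.:= y) refl Y (ι b *ᶜ ω -ᶜ ι a *ᶜ ι a) ⟩
      Y
        ≡⟨ cong₂ _-ᶜ_ (cong₂ (λ y z → y *ᶜ (ω -ᶜ z)) (sym (C.cast 3 (λ a b x → b C.:- C.con (pos 2) C.:* (a C.:* x)) (a ∷ b ∷ x ∷ []))) (sym (ι-* x a)))
             (trans (cong (ι a *ᶜ_) (trans (sym (C.cast 3 (λ a b x → a C.:* (x C.:* x) C.:- b C.:* x C.:+ a) (a ∷ b ∷ x ∷ []))) (trans (cong ι n₀≡) (ι-* n₁ ℓℤ))))
               (trans (sym (CR.*-assoc (ι a) (ι n₁) (ι ℓℤ))) (cong (_*ᶜ ι ℓℤ) (sym (ι-* a n₁))))) ⟩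
      ι B *ᶜ g -ᶜ ι (a ℤ.* n₁) *ᶜ ι ℓℤ ∎
      where
      open ≡-Reasoning
      Y = (ι b -ᶜ ι (pos 2) *ᶜ (ι a *ᶜ ι x)) *ᶜ (ω -ᶜ ι x *ᶜ ι a) -ᶜ ι a *ᶜ (ι a *ᶜ (ι x *ᶜ ι x) -ᶜ ι b *ᶜ ι x +ᶜ ι a)

    bezout-aB : (i ℤ.+ pos 2 ℤ.* (j ℤ.* x)) ℤ.* a ℤ.+ j ℤ.* B ≡ pos 1
    bezout-aB = trans (Z.solve 5 (λ i j x a b → (i Z.:+ Z.con (pos 2) Z.:* (j Z.:* x)) Z.:* a Z.:+ j Z.:* (b Z.:- Z.con (pos 2) Z.:* (a Z.:* x)) Z.:= i Z.:* a Z.:+ j Z.:* b) refl i j x a b) bezout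

    -- A common divisor could only come from ℓ. If ℓ ∣ B, then ℓ² does not divide n₁ ℓ, so ℓ does
    -- not divide n₁.
    bezout-ℓBn : Bezout₃ ℓℤ B n₁
    bezout-ℓBn = decide (ℓℤ ∣? B)
      where
      decide : Dec (ℓℤ ∣ B) → Bezout₃ ℓℤ B n₁
      decide (no nd) = case prime-bezout nd of λ { (y , z , e) → bezout₃ {i′ = z} {j′ = y} {l′ = pos 0} (trans
        (Z.solve 5 (λ y z l b n → z Z.:* l Z.:+ y Z.:* b Z.:+ Z.con (pos 0) Z.:* n Z.:= y Z.:* b Z.:+ z Z.:* l) refl y z ℓℤ B n₁) e) }
      decide (yes d) = case prime-bezout ℓ∤n₁ of λ { (y , z , e) → bezout₃ {i′ = z} {j′ = pos 0} {l′ = y} (trans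
        (Z.solve 5 (λ y z l b n → z Z.:* l Z.:+ Z.con (pos 0) Z.:* b Z.:+ y Z.:* n Z.:= y Z.:* n Z.:+ z Z.:* l) refl y z ℓℤ B n₁) e) }
        where
        ℓ∤n₁ : ¬ ℓℤ ∣ n₁
        ℓ∤n₁ h = ℓ²∤n₀ (∣-by (∣m⇒∣-m d) (Z.solve 2 (λ b c → c Z.:- b Z.:= Z.:- (b Z.:- c)) refl b (pos 2 ℤ.* (a ℤ.* x))))
          (∣-by (∣-*-* h ∣-refl) n₀≡)

    bezout-𝔪 : Bezout₃ (a ℤ.* ℓℤ) B n₁
    bezout-𝔪 = combine bezout-ℓBn
      where
      combine : Bezout₃ ℓℤ B n₁ → Bezout₃ (a ℤ.* ℓℤ) B n₁
      combine (bezout₃ {i′ = v} {w} {z} e) = bezout-product (i ℤ.+ pos 2 ℤ.* (j ℤ.* x)) a j B v ℓℤ w z n₁ bezout-aB e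

    bezout-𝔭 : Bezout₃ ℓℤ B (a ℤ.* n₁)
    bezout-𝔭 = combine bezout-ℓBn
      where
      combine : Bezout₃ ℓℤ B n₁ → Bezout₃ ℓℤ B (a ℤ.* n₁)
      combine (bezout₃ {i′ = v} {w} {z} e) = bezout-multiple (i ℤ.+ pos 2 ℤ.* (j ℤ.* x)) a j B v ℓℤ w z n₁ bezout-aB e

    ω-0 : ω -ᶜ ι (pos 0) ≡ ω
    ω-0 = C.solve 1 (λ w → w C.:- C.con (pos 0) C.:= w) refl ω

    module 𝔞P = Proper 𝔞-basis (pos 0) a b a
      (trans (cong (λ w → w *ᶜ ι a) ω-0) (CR.*-comm ω (ι a)))
      (trans (cong (λ w → w *ᶜ ω) ω-0) (trans ω² (cong (λ z → ι b *ᶜ ω -ᶜ z) (ι-* a a))))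
      {i} {j} {pos 0} (trans (Z.solve 2 (λ y a → y Z.:+ Z.con (pos 0) Z.:* a Z.:= y) refl (i ℤ.* a ℤ.+ j ℤ.* b) a) bezout) a≢0
    𝔞⊆𝒪 : 𝔞 ⊆ 𝒪
    𝔞⊆𝒪 p = case Basis.coordinates 𝔞-basis p of λ { (m , n , e₁) → subst 𝒪 (sym e₁) (+∈𝒪 (ℤ∈𝒪 m (ι∈𝒪 a)) (ℤ∈𝒪 n ω∈𝒪)) }

    𝔞-subgroup : IsSubgroup 𝔞
    𝔞-subgroup = Basis⇒IsSubgroup 𝔞-basis

    𝔞-fractional : IsFractionalIdeal K 𝔞
    𝔞-fractional = fractionalIdeal 𝔞-basis (λ p → 𝒪⊆K (𝔞⊆𝒪 p)) a a≢0 (basis₁∈ 𝔞-basis) (IsSubgroup.ℤ∈ 𝔞-subgroup a (basis₂∈ 𝔞-basis))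

    𝔞-proper : IsProper K 𝒪 𝔞
    𝔞-proper = 𝔞-fractional , 𝔞P.coefficientRing≐

    -- The kernel of the reduction of 𝒪 to ℤ / ℓ with ω ↦ k. In this form its index and its basis ℓ,
    -- g are instances of the facts on congruence sublattices.
    𝔭 : Subset
    𝔭 z = ∃₂ λ m n → z ≡ comb 1ᶜ ω m n × ℓℤ ∣ m ℤ.+ n ℤ.* k

    𝔭-congruence : Congruence ℓ 𝒪 𝔭 1ᶜ ω k
    𝔭-congruence = record { basis = 𝒪-basis ; ∈⇒ = λ p → p ; ⇒∈ = λ m n d → m , n , refl , d }

    𝔭-basis : Basis 𝔭 (ι ℓℤ) g
    𝔭-basis = subst₂ (Basis 𝔭) (CR.*-identityʳ (ι ℓℤ)) (cong (λ z → ω -ᶜ z) (CR.*-identityʳ (ι k))) (congruence-basis ℓ-prime 𝔭-congruence)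

    𝔭⊆𝒪 : 𝔭 ⊆ 𝒪
    𝔭⊆𝒪 (m , n , e₁ , _) = m , n , e₁

    module 𝔭B = Bezout₃ bezout-𝔭
    module 𝔭P = Proper 𝔭-basis k ℓℤ B (a ℤ.* n₁) (CR.*-comm g (ι ℓℤ)) g*g {𝔭B.i′} {𝔭B.j′} {𝔭B.l′} 𝔭B.relation L≢0

    ℓ∈𝔭 : ι ℓℤ ∈ 𝔭
    ℓ∈𝔭 = basis₁∈ 𝔭-basis

    g∈𝔭 : g ∈ 𝔭
    g∈𝔭 = basis₂∈ 𝔭-basis

    𝔭-proper : IsProper K 𝒪 𝔭
    𝔭-proper = fractionalIdeal 𝔭-basis (λ p → 𝒪⊆K (𝔭⊆𝒪 p)) ℓℤ L≢0 ℓ∈𝔭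
        (subst 𝔭 (CR.*-comm ω (ι ℓℤ)) (𝔭P.𝒪-closed ω∈𝒪 ℓ∈𝔭))
      , 𝔭P.coefficientRing≐

    -- Since ω ≡ k modulo 𝔭, the residue of m + n ω is m + n k.
    𝔭-prime : IsPrimeIdeal 𝒪 𝔭
    𝔭-prime = (λ p → L∤1 (∣-by (Congruence.∈M⇒ 𝔭-congruence (pos 1) (pos 0) (subst 𝔭 (sym (comb-10 1ᶜ ω)) p))
                 (Z.solve 1 (λ k → Z.con (pos 1) Z.:= Z.con (pos 1) Z.:+ Z.con (pos 0) Z.:* k) refl k)))
      , λ { (m , n , refl) (m′ , n′ , refl) p → split m n m′ n′ (subst 𝔭 (e-* m n m′ n′) p) }
      where
      a²-bk : ∀ {a b x l n} → a ℤ.* (x ℤ.* x) ℤ.- b ℤ.* x ℤ.+ a ≡ n ℤ.* l →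
              l ∣ (x ℤ.* a) ℤ.* (x ℤ.* a) ℤ.- b ℤ.* (x ℤ.* a) ℤ.+ a ℤ.* a
      a²-bk {a} {b} {x} {l} {n} e = divides (a ℤ.* n) (trans (Z.solve 3 (λ a b x → (x Z.:* a) Z.:* (x Z.:* a) Z.:- b Z.:* (x Z.:* a) Z.:+ a Z.:* a
        Z.:= a Z.:* (a Z.:* (x Z.:* x) Z.:- b Z.:* x Z.:+ a)) refl a b x) (trans (cong (a ℤ.*_) e) (sym (ℤₚ.*-assoc a n l))))
      -- The map ω ↦ k is multiplicative modulo ℓ because k is a root there of X² - b X + a².
      k-root : ℓℤ ∣ k ℤ.* k ℤ.- b ℤ.* k ℤ.+ a ℤ.* a
      k-root = a²-bk {a} {b} {x} {ℓℤ} {n₁} n₀≡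
      product : ∀ m n m′ n′ b c k → ℓℤ ∣ k ℤ.* k ℤ.- b ℤ.* k ℤ.+ c →
        ℓℤ ∣ (m ℤ.* m′ ℤ.- n ℤ.* n′ ℤ.* c) ℤ.+ (m ℤ.* n′ ℤ.+ n ℤ.* m′ ℤ.+ n ℤ.* n′ ℤ.* b) ℤ.* k →
        ℓℤ ∣ (m ℤ.+ n ℤ.* k) ℤ.* (m′ ℤ.+ n′ ℤ.* k)
      product m n m′ n′ b c k r d = ∣-by (∣m∣n⇒∣m+n d (∣n⇒∣m*n (n ℤ.* n′) r))
        (Z.solve 7 (λ m n m′ n′ b c k → (m Z.:+ n Z.:* k) Z.:* (m′ Z.:+ n′ Z.:* k) Z.:=
          (m Z.:* m′ Z.:- n Z.:* n′ Z.:* c) Z.:+ (m Z.:* n′ Z.:+ n Z.:* m′ Z.:+ n Z.:* n′ Z.:* b) Z.:* k Z.:+ (n Z.:* n′) Z.:* (k Z.:* k Z.:- b Z.:* k Z.:+ c)) refl m n m′ n′ b c k)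
      split : ∀ m n m′ n′ → e (m ℤ.* m′ ℤ.- n ℤ.* n′ ℤ.* (a ℤ.* a)) (m ℤ.* n′ ℤ.+ n ℤ.* m′ ℤ.+ n ℤ.* n′ ℤ.* b) ∈ 𝔭 → e m n ∈ 𝔭 ⊎ e m′ n′ ∈ 𝔭
      split m n m′ n′ p = [ (λ d → inj₁ (m , n , refl , d)) , (λ d → inj₂ (m′ , n′ , refl , d)) ]′
        (euclid {m ℤ.+ n ℤ.* k} {m′ ℤ.+ n′ ℤ.* k} (product m n m′ n′ b (a ℤ.* a) k k-root
          (Congruence.∈M⇒ 𝔭-congruence (m ℤ.* m′ ℤ.- n ℤ.* n′ ℤ.* (a ℤ.* a)) (m ℤ.* n′ ℤ.+ n ℤ.* m′ ℤ.+ n ℤ.* n′ ℤ.* b) p)))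

    𝔪-basis : Basis 𝔪 (ι ℓℤ *ᶜ ι a) g
    𝔪-basis = subst (Basis 𝔪 (ι ℓℤ *ᶜ ι a)) (cong (λ z → ω -ᶜ z) (sym (ι-* x a))) (congruence-basis ℓ-prime 𝔪-congruence)

    𝔪-g₁ : g *ᶜ (ι ℓℤ *ᶜ ι a) ≡ ι (a ℤ.* ℓℤ) *ᶜ g
    𝔪-g₁ = trans (C.solve 3 (λ g l a → g C.:* (l C.:* a) C.:= a C.:* l C.:* g) refl g (ι ℓℤ) (ι a)) (cong (_*ᶜ g) (sym (ι-* a ℓℤ)))

    𝔪-g₂ : g *ᶜ g ≡ ι B *ᶜ g -ᶜ ι n₁ *ᶜ (ι ℓℤ *ᶜ ι a)
    𝔪-g₂ = trans g*g (cong (λ z → ι B *ᶜ g -ᶜ z) (trans (cong (_*ᶜ ι ℓℤ) (ι-* a n₁))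
      (C.solve 3 (λ a n l → a C.:* n C.:* l C.:= n C.:* (l C.:* a)) refl (ι a) (ι n₁) (ι ℓℤ))))

    -- The products of ℓ, g with a, ω lie in 𝔪, for g ω because 𝔪 is stable under 𝒪. Conversely ℓ a
    -- is one of these products, and g is an integral combination of them because a and b are
    -- coprime.
    𝔭⊗𝔞≐𝔪 : 𝔭 ⊗ 𝔞 ≐ 𝔪
    𝔭⊗𝔞≐𝔪 = ⊆𝔪 , 𝔪⊆
      where
      module 𝔪B = Bezout₃ bezout-𝔪
      module 𝔪P = Proper 𝔪-basis k (a ℤ.* ℓℤ) B n₁ 𝔪-g₁ 𝔪-g₂ {𝔪B.i′} {𝔪B.j′} {𝔪B.l′} 𝔪B.relation (i*i≢0 a≢0 L≢0)
      module S = IsSubgroup (Basis⇒IsSubgroup 𝔪-basis)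
      ga : g *ᶜ ι a ∈ 𝔪
      ga = subst 𝔪 (CR.*-comm (ι a) g) (S.ℤ∈ a (basis₂∈ 𝔪-basis))
      gω : g *ᶜ ω ∈ 𝔪
      gω = subst 𝔪 (CR.*-comm ω g) (𝔪P.𝒪-closed ω∈𝒪 (basis₂∈ 𝔪-basis))
      ℓa : ι ℓℤ *ᶜ ι a ∈ 𝔪
      ℓa = basis₁∈ 𝔪-basis
      ℓω : ι ℓℤ *ᶜ ω ∈ 𝔪
      ℓω = subst 𝔪 (C.solve 3 (λ l w a → C.con (pos 0) C.:* a C.:+ l C.:* w C.:= l C.:* w) refl (ι ℓℤ) ω (ι a))
        (Congruence.⇒∈ 𝔪-congruence (pos 0) ℓℤ (∣-by (∣m⇒∣m*n x ∣-refl) (ℤₚ.+-identityˡ (ℓℤ ℤ.* x))))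
      product : ∀ {p q} → p ∈ 𝔭 → q ∈ 𝔞 → (p *ᶜ q) ∈ 𝔪
      product {p} {q} p∈ q∈ = case (Basis.coordinates 𝔭-basis p∈ , Basis.coordinates 𝔞-basis q∈) of λ { ((m , n , e₁) , (m′ , n′ , e₂)) →
        subst 𝔪 (sym (trans (cong₂ _*ᶜ_ e₁ e₂) (C.solve 8 (λ l g a w m n m′ n′ → (m C.:* l C.:+ n C.:* g) C.:* (m′ C.:* a C.:+ n′ C.:* w) C.:=
            m C.:* (m′ C.:* (l C.:* a) C.:+ n′ C.:* (l C.:* w)) C.:+ n C.:* (m′ C.:* (g C.:* a) C.:+ n′ C.:* (g C.:* w))) refl (ι ℓℤ) g (ι a) ω (ι m) (ι n) (ι m′) (ι n′))))
          (S.+∈ (S.ℤ∈ m (S.+∈ (S.ℤ∈ m′ ℓa) (S.ℤ∈ n′ ℓω))) (S.ℤ∈ n (S.+∈ (S.ℤ∈ m′ ga) (S.ℤ∈ n′ gω)))) }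
      ⊆𝔪 : 𝔭 ⊗ 𝔞 ⊆ 𝔪
      ⊆𝔪 (n , v , w , v∈ , w∈ , e₁) = subst 𝔪 (sym e₁) (S.sum∈ (λ i → v i *ᶜ w i) (λ i → product (v∈ i) (w∈ i)))
      -- From g ω = (B + k) g - n₁ ℓ a, the right side is ((i + j x) a + j (B + k)) g, and that
      -- factor is i a + j b = 1.
      g-split : g ≡ ι (i ℤ.+ j ℤ.* x) *ᶜ (g *ᶜ ι a) +ᶜ ι j *ᶜ (g *ᶜ ω +ᶜ ι n₁ *ᶜ (ι ℓℤ *ᶜ ι a))
      g-split = sym (begin
        ι f *ᶜ (g *ᶜ ι a) +ᶜ ι j *ᶜ (g *ᶜ ω +ᶜ z)
          ≡⟨ cong (λ w → ι f *ᶜ (g *ᶜ ι a) +ᶜ ι j *ᶜ (w +ᶜ z)) gω≡ ⟩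
        ι f *ᶜ (g *ᶜ ι a) +ᶜ ι j *ᶜ (ι B *ᶜ g -ᶜ z +ᶜ ι k *ᶜ g +ᶜ z)
          ≡⟨ C.solve 7 (λ f g a j b k z → f C.:* (g C.:* a) C.:+ j C.:* (b C.:* g C.:- z C.:+ k C.:* g C.:+ z) C.:= (f C.:* a C.:+ j C.:* (b C.:+ k)) C.:* g) refl (ι f) g (ι a) (ι j) (ι B) (ι k) z ⟩
        (ι f *ᶜ ι a +ᶜ ι j *ᶜ (ι B +ᶜ ι k)) *ᶜ g
          ≡⟨ cong (_*ᶜ g) (trans (sym (C.cast 5 (λ f a j b k → f C.:* a C.:+ j C.:* (b C.:+ k)) (f ∷ a ∷ j ∷ B ∷ k ∷ []))) (trans (cong ι one) ι-1)) ⟩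
        1ᶜ *ᶜ g ≡⟨ CR.*-identityˡ g ⟩
        g ∎)
        where
        open ≡-Reasoning
        f = i ℤ.+ j ℤ.* x
        z = ι n₁ *ᶜ (ι ℓℤ *ᶜ ι a)
        gω≡ : g *ᶜ ω ≡ ι B *ᶜ g -ᶜ z +ᶜ ι k *ᶜ g
        gω≡ = trans (C.solve 2 (λ w k → (w C.:- k) C.:* w C.:= (w C.:- k) C.:* (w C.:- k) C.:+ k C.:* (w C.:- k)) refl ω (ι k)) (cong (_+ᶜ ι k *ᶜ g) 𝔪-g₂)
        one : f ℤ.* a ℤ.+ j ℤ.* (B ℤ.+ k) ≡ pos 1
        one = trans (Z.solve 5 (λ i j x a b → (i Z.:+ j Z.:* x) Z.:* a Z.:+ j Z.:* (b Z.:- Z.con (pos 2) Z.:* (a Z.:* x) Z.:+ x Z.:* a) Z.:= i Z.:* a Z.:+ j Z.:* b) refl i j x a b) bezout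
      𝔪⊆ : 𝔪 ⊆ 𝔭 ⊗ 𝔞
      𝔪⊆ {y} y∈ = case Basis.coordinates 𝔪-basis y∈ of λ { (m , n , e₁) → 2 , v , w m n , v∈ , w∈ m n , trans e₁ (sum≡ m n) }
        where
        v : Fin 2 → ℂ
        v zero = ι ℓℤ
        v (suc zero) = g
        v∈ : ∀ i → v i ∈ 𝔭
        v∈ zero = ℓ∈𝔭
        v∈ (suc zero) = g∈𝔭
        -- The cofactors of ℓ and of g in m ℓ a + n g after g is expanded by `g-split`.
        w : ℤ → ℤ → Fin 2 → ℂ
        w m n zero = ι m *ᶜ ι a +ᶜ ι n *ᶜ (ι j *ᶜ (ι n₁ *ᶜ ι a))
        w m n (suc zero) = ι n *ᶜ (ι (i ℤ.+ j ℤ.* x) *ᶜ ι a +ᶜ ι j *ᶜ ω)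
        module 𝔞S = IsSubgroup 𝔞-subgroup
        w∈ : ∀ m n i → w m n i ∈ 𝔞
        w∈ m n zero = 𝔞S.+∈ (𝔞S.ℤ∈ m a∈) (𝔞S.ℤ∈ n (𝔞S.ℤ∈ j (𝔞S.ℤ∈ n₁ a∈)))
          where a∈ = basis₁∈ 𝔞-basis
        w∈ m n (suc zero) = 𝔞S.ℤ∈ n (𝔞S.+∈ (𝔞S.ℤ∈ (i ℤ.+ j ℤ.* x) (basis₁∈ 𝔞-basis)) (𝔞S.ℤ∈ j (basis₂∈ 𝔞-basis)))
        sum≡ : ∀ m n → comb (ι ℓℤ *ᶜ ι a) g m n ≡ ι ℓℤ *ᶜ w m n zero +ᶜ (g *ᶜ w m n (suc zero) +ᶜ 0ᶜ)
        sum≡ m n = trans (cong (λ z → ι m *ᶜ (ι ℓℤ *ᶜ ι a) +ᶜ ι n *ᶜ z) g-split)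
          (C.solve 9 (λ l a g w m n f j n₁ → m C.:* (l C.:* a) C.:+ n C.:* (f C.:* (g C.:* a) C.:+ j C.:* (g C.:* w C.:+ n₁ C.:* (l C.:* a)))
            C.:= l C.:* (m C.:* a C.:+ n C.:* (j C.:* (n₁ C.:* a))) C.:+ (g C.:* (n C.:* (f C.:* a C.:+ j C.:* w)) C.:+ C.con (pos 0))) refl
            (ι ℓℤ) (ι a) g ω (ι m) (ι n) (ι (i ℤ.+ j ℤ.* x)) (ι j) (ι n₁))

    𝔭𝔞-basis : Basis (𝔭 ⊗ 𝔞) (ι ℓℤ *ᶜ ι a) g
    𝔭𝔞-basis = Basis-≐ (proj₂ 𝔭⊗𝔞≐𝔪 , proj₁ 𝔭⊗𝔞≐𝔪) 𝔪-basis

    module 𝔪B = Bezout₃ bezout-𝔪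
    module 𝔭𝔞P = Proper 𝔭𝔞-basis k (a ℤ.* ℓℤ) B n₁ 𝔪-g₁ 𝔪-g₂ {𝔪B.i′} {𝔪B.j′} {𝔪B.l′} 𝔪B.relation (i*i≢0 a≢0 L≢0)

    𝔭𝔞-proper : IsProper K 𝒪 (𝔭 ⊗ 𝔞)
    𝔭𝔞-proper = fractionalIdeal 𝔭𝔞-basis (λ p → 𝒪⊆K (𝔞⊆𝒪 (Congruence.M⊆ 𝔪-congruence (proj₁ 𝔭⊗𝔞≐𝔪 p)))) (ℓℤ ℤ.* a) (i*i≢0 L≢0 a≢0)
        (subst (𝔭 ⊗ 𝔞) (sym (ι-* ℓℤ a)) (basis₁∈ 𝔭𝔞-basis))
        (subst (𝔭 ⊗ 𝔞) (trans (CR.*-comm ω _) (cong (_*ᶜ ω) (sym (ι-* ℓℤ a)))) (𝔭𝔞P.𝒪-closed ω∈𝒪 (basis₁∈ 𝔭𝔞-basis)))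
      , 𝔭𝔞P.coefficientRing≐

    idealData : WellRoundedIdealData ℓ K 𝒪 𝔞 𝔭
    idealData = record
      { prime = ℓ-prime
      ; isImaginaryQuadratic = K-isImaginaryQuadratic
      ; isOrder = record
          { isFractionalIdeal = fractionalIdeal 𝒪-basis 𝒪⊆K (pos 1) (λ ()) (ι∈𝒪 (pos 1)) (ℤ∈𝒪 (pos 1) ω∈𝒪)
          ; 1∈ = 1∈𝒪
          ; *-closed = *∈𝒪
          }
      ; 𝔞-ideal = 𝔞-proper , 𝔞⊆𝒪
      ; 𝔞-wellRounded = 𝔞-proper , λ (_ , s) → wellRounded-similar {K = K} (β.minimalBasis-image V) s
      ; 𝔭-ideal = 𝔭-proper , 𝔭⊆𝒪
      ; 𝔭-prime = 𝔭-prime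
      ; 𝔭-norm = congruence-index ℓ-prime 𝔭-congruence
      ; 𝔭𝔞-wellRounded = 𝔭𝔞-proper , λ (_ , s) → wellRounded-similar {K = K}
          (MinimalBasis-≐ (proj₂ 𝔭⊗𝔞≐𝔪 , proj₁ 𝔭⊗𝔞≐𝔪) (β.minimalBasis-image W)) s
      }

  -- The identity A(v + w) A(v - w) = (A v - A w)² + 4 det² shows that vectors of equal length and
  -- zero determinant are equal or opposite.
  independent-pair : ∀ {v w ρ} → A v ≡ ρ → A w ≡ ρ → v ≢ w → v ≢ -ᶜ w → det v w ≢ 0ℝ
  independent-pair {v} {w} {ρ} ev ew v≢w v≢-w d = v≢w (difference (A≡0 (x*y≡0 product (λ z → v≢-w (opposite (A≡0 z))))))
    where
    identity : ∀ v w → A (v +ᶜ w) * A (v -ᶜ w) ≡ (A v + - A w) * (A v + - A w) + fromℤ (pos 4) * (det v w * det v w)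
    identity (a , b) (c , d) = ℝS.solve 4 (λ a b c d →
      ((a :+ c) :* (a :+ c) :+ (b :+ d) :* (b :+ d)) :* ((a :- c) :* (a :- c) :+ (b :- d) :* (b :- d))
      := (a :* a :+ b :* b :- (c :* c :+ d :* d)) :* (a :* a :+ b :* b :- (c :* c :+ d :* d))
         :+ con (pos 4) :* ((a :* d :- b :* c) :* (a :* d :- b :* c))) refl a b c d
    product : A (v +ᶜ w) * A (v -ᶜ w) ≡ 0ℝ
    product = trans (identity v w) (trans (cong₂ (λ x y → (x + - y) * (x + - y) + fromℤ (pos 4) * (det v w * det v w)) ev ew)
      (trans (cong (λ x → (ρ + - ρ) * (ρ + - ρ) + fromℤ (pos 4) * (x * x)) d)
        (ℝS.solve 1 (λ r → (r :- r) :* (r :- r) :+ con (pos 4) :* (con (pos 0) :* con (pos 0)) := con (pos 0)) refl ρ)))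
    difference : v -ᶜ w ≡ 0ᶜ → v ≡ w
    difference e = trans (C.solve 2 (λ v w → v C.:= v C.:- w C.:+ w) refl v w) (trans (cong (_+ᶜ w) e) (CR.+-identityˡ w))
    opposite : v +ᶜ w ≡ 0ᶜ → v ≡ -ᶜ w
    opposite e = trans (C.solve 2 (λ v w → v C.:= v C.:+ w C.:- w) refl v w) (trans (cong (_-ᶜ w) e) (CR.+-identityˡ (-ᶜ w)))

  two-vectors : ∀ {s S} → ConsistsOfPairs s S → 2 ℕ.≤ s → ∃₂ λ v w → v ∈ S × w ∈ S × v ≢ w × v ≢ -ᶜ w
  two-vectors (p , injective , _ , ⊆S) (ℕ.s≤s (ℕ.s≤s _)) = p zero , p (suc zero)
    , ⊆S (zero , inj₁ refl) , ⊆S (suc zero , inj₁ refl)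
    , (λ e → case injective (inj₁ e) of λ ()) , (λ e → case injective (inj₂ e) of λ ())

  rotation-orthogonal : ∀ z → A z ≡ 1ℝ → IsOrthogonal (z *ᶜ_)
  rotation-orthogonal z e = record
    { additive = CR.distribˡ z
    ; homogeneous = λ c v → trans (cong (z *ᶜ_) (·≡ c v)) (trans (C.solve 3 (λ z c v → z C.:* (c C.:* v) C.:= c C.:* (z C.:* v)) refl z (c , 0ℝ) v) (sym (·≡ c (z *ᶜ v))))
    ; isometric = λ v w → trans (inner z v w) (trans (cong (_* ⟨ v , w ⟩) e) (*-identityˡ ⟨ v , w ⟩))
    }
    where
    inner : ∀ z v w → ⟨ z *ᶜ v , z *ᶜ w ⟩ ≡ A z * ⟨ v , w ⟩
    inner (a , b) (c , d) (e , f) = ℝS.solve 6 (λ a b c d e f →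
      (a :* c :- b :* d) :* (a :* e :- b :* f) :+ (a :* d :+ b :* c) :* (a :* f :+ b :* e)
      := (a :* a :+ b :* b) :* (c :* e :+ d :* f)) refl a b c d e f

  module Backward {ℓ : ℕ} {L M : Subset} (F : TemperedPerfect ℓ L M) where
    open TemperedPerfect F
    open IsPerfect perfect
    open Tempered tempered
    open PrimeKit prime renaming (L to ℓℤ)

    L′ M′ : Subset
    L′ = image (scale ·_) L
    M′ = image (scale ·_) M

    scale≢0 : (scale , 0ℝ) ≢ 0ᶜ
    scale≢0 e = <⇒≢ 0<scale (sym (cong proj₁ e))

    module γ = Image (scale , 0ℝ) scale≢0 (scale ·_) (·≡ scale)

    L-basis = γ.basis-image (fromLatticeBasis (proj₂ (proj₂ L-lattice)))
    M-basis = γ.basis-image (fromLatticeBasis (proj₂ (proj₂ M-lattice)))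

    module I = PrimeIndex prime (Basis⇒IsSubgroup L-basis) (Basis⇒IsSubgroup M-basis) (γ.index-image index)

    -- Membership in S′ is not assumed decidable; A v < u excludes it, and then the condition off S′
    -- gives the opposite inequality.
    M-lower : LowerBound M′ u
    M-lower {v} v∈ nz = ≮⇒≥ λ A<u → <-irrefl (O.trans (off-S′ v∈ nz (λ v∈S′ → <⇒≢ A<u (on-S′ v∈S′))) A<u)

    -- Vectors of M are covered by 1 ≤ u and the others by the condition off S; the finite index
    -- decides which case applies.
    L-lower : LowerBound L′ 1ℝ
    L-lower {v} v∈ nz = decide (I.∈M? v∈)
      where
      decide : Dec (v ∈ M′) → 1ℝ ≤ A v
      decide (yes p) = ≤-trans 1≤u (M-lower p nz)
      decide (no np) = ≮⇒≥ λ A<1 → <-irrefl (O.trans (off-S v∈ np (λ v∈S → <⇒≢ A<1 (on-S v∈S))) A<1)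

    module Vectors {v₁ v₂ w₁ w₂ : ℂ} (v₁∈ : v₁ ∈ S) (v₂∈ : v₂ ∈ S) (v₁≢v₂ : v₁ ≢ v₂) (v₁≢-v₂ : v₁ ≢ -ᶜ v₂)
      (w₁∈ : w₁ ∈ S′) (w₂∈ : w₂ ∈ S′) (w₁≢w₂ : w₁ ≢ w₂) (w₁≢-w₂ : w₁ ≢ -ᶜ w₂) where

      V : MinimalBasis L′ v₁ v₂ 1ℝ
      V = record
        { basis = minimal⇒Basis L-basis 0<1 L-lower (proj₁ (S⊆L-M v₁∈)) (proj₁ (S⊆L-M v₂∈)) (on-S v₁∈) (on-S v₂∈)
            (independent-pair (on-S v₁∈) (on-S v₂∈) v₁≢v₂ v₁≢-v₂)
        ; A₁ = on-S v₁∈ ; A₂ = on-S v₂∈ ; lower = L-lower }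

      W : MinimalBasis M′ w₁ w₂ u
      W = record
        { basis = minimal⇒Basis M-basis (<-≤-trans 0<1 1≤u) M-lower (proj₁ (S′⊆M-0 w₁∈)) (proj₁ (S′⊆M-0 w₂∈)) (on-S′ w₁∈) (on-S′ w₂∈)
            (independent-pair (on-S′ w₁∈) (on-S′ w₂∈) w₁≢w₂ w₁≢-w₂)
        ; A₁ = on-S′ w₁∈ ; A₂ = on-S′ w₂∈ ; lower = M-lower }

      generator : ∃ λ x → (v₂ -ᶜ ι x *ᶜ v₁) ∈ M′
      generator = PrimeIndexGenerator.generates prime (Basis⇒IsSubgroup L-basis) (Basis⇒IsSubgroup M-basis) (γ.index-image index)
        (proj₁ (S⊆L-M v₁∈)) (proj₂ (S⊆L-M v₁∈)) (proj₁ (S⊆L-M v₂∈))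

      x : ℤ
      x = proj₁ generator

      congruence : Congruence ℓ L′ M′ v₁ v₂ x
      congruence = sublattice-congruence prime (MinimalBasis.basis V) (Basis⇒IsSubgroup M-basis)
        (λ { (z , z∈ , e) → z , M⊆L z∈ , e }) (I.ℓ∈ (proj₁ (S⊆L-M v₁∈))) (proj₂ (S⊆L-M v₁∈)) (proj₂ generator)

      module Rational-case (a b i j : ℤ) (0<a : 0ℝ < fromℤ a) (at≡b : fromℤ a * cross v₁ v₂ ≡ fromℤ b) (bezout : i ℤ.* a ℤ.+ j ℤ.* b ≡ pos 1)
        (n₁ : ℤ) (n₀≡ : a ℤ.* (x ℤ.* x) ℤ.- b ℤ.* x ℤ.+ a ≡ n₁ ℤ.* pos ℓ)
        (ℓ²∤n₀ : pos ℓ ∣ pos 2 ℤ.* (a ℤ.* x) ℤ.- b → ¬ pos ℓ ℤ.* pos ℓ ∣ a ℤ.* (x ℤ.* x) ℤ.- b ℤ.* x ℤ.+ a) where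

        module X = Construction prime congruence V W a b i j 0<a at≡b bezout n₁ n₀≡ ℓ²∤n₀
        module Q = QuadraticOrder X.ω b (a ℤ.* a) X.ω² X.independent

        c : ℝ
        c = (fromℤ a * scale) ⁻¹

        0<as : 0ℝ < fromℤ a * scale
        0<as = *-pos 0<a 0<scale

        -- Since v₁ β = a, the rotation by v₁ undoes the argument of β, and the homothety by 1 / (a
        -- `scale`) undoes the remaining real factor.
        return : ∀ w → c · (v₁ *ᶜ (X.β *ᶜ (scale · w))) ≡ w
        return w = trans (cong (c ·_) (begin
            v₁ *ᶜ (ι a *ᶜ conj v₁ *ᶜ (scale · w))    ≡⟨ C.solve 4 (λ v v̄ a y → v C.:* (a C.:* v̄ C.:* y) C.:= v C.:* v̄ C.:* (a C.:* y)) refl v₁ (conj v₁) (ι a) (scale · w) ⟩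
            v₁ *ᶜ conj v₁ *ᶜ (ι a *ᶜ (scale · w))    ≡⟨ cong (_*ᶜ (ι a *ᶜ (scale · w))) X.conj-v₁ ⟩
            1ᶜ *ᶜ (ι a *ᶜ (scale · w))               ≡⟨ CR.*-identityˡ (ι a *ᶜ (scale · w)) ⟩
            ι a *ᶜ (scale · w)                       ≡⟨ ·≡ (fromℤ a) (scale · w) ⟨
            fromℤ a · (scale · w)                    ≡⟨ cong₂ _,_ (*-assoc (fromℤ a) scale (proj₁ w)) (*-assoc (fromℤ a) scale (proj₂ w)) ⟨
            (fromℤ a * scale) · w                    ∎))
          (unscale (λ e → <⇒≢ 0<as (sym e)) w)
          where open ≡-Reasoning

        rescale : ∀ {N} → N ≐ image (λ v → c · (v₁ *ᶜ v)) (image (X.β *ᶜ_) (image (scale ·_) N))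
        rescale {N} = (λ {w} w∈ → X.β *ᶜ (scale · w) , (scale · w , (w , w∈ , refl) , refl) , sym (return w))
          , λ { (_ , (_ , (w , w∈ , refl) , refl) , e) → subst N (sym (trans e (return w))) w∈ }

        result : ∃₂ λ K 𝒪 → ∃₂ λ 𝔞 𝔭 → WellRoundedIdealData ℓ K 𝒪 𝔞 𝔭 × EquivalentPairs L M 𝔞 (𝔭 ⊗ 𝔞)
        result = Q.K , Q.𝒪 , X.𝔞 , X.𝔭 , X.idealData
          , (v₁ *ᶜ_) , c , rotation-orthogonal v₁ (on-S v₁∈) , positive-inverse 0<as , rescale
          , (λ p → case proj₁ rescale p of λ { (z , z∈ , e) → z , proj₂ X.𝔭⊗𝔞≐𝔪 z∈ , e })
          , λ { (z , z∈ , e) → proj₂ rescale (z , proj₁ X.𝔭⊗𝔞≐𝔪 z∈ , e) }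

      module From-pair {p q r s : ℤ} (pair : ReducedPair ℓ (cross v₁ v₂) u x p q r s) where
        open ReducedPair.Rational (ReducedPair.rational pair)
        open ReducedPair.Integral pair a b at≡b {i} {j} bezout

        result : ∃₂ λ K 𝒪 → ∃₂ λ 𝔞 𝔭 → WellRoundedIdealData ℓ K 𝒪 𝔞 𝔭 × EquivalentPairs L M 𝔞 (𝔭 ⊗ 𝔞)
        result = Rational-case.result a b i j 0<a at≡b bezout (_∣_.quotient ℓ∣n₀) (_∣_.equality ℓ∣n₀) ℓ²∤n₀

      result : ∃₂ λ K 𝒪 → ∃₂ λ 𝔞 𝔭 → WellRoundedIdealData ℓ K 𝒪 𝔞 𝔭 × EquivalentPairs L M 𝔞 (𝔭 ⊗ 𝔞)
      result = case (Congruence.∈⇒ congruence (MinimalBasis.b₁∈ W)) of λ { (p , q , e₁ , _) →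
        case (Congruence.∈⇒ congruence (MinimalBasis.b₂∈ W)) of λ { (r , s , e₂ , _) →
          From-pair.result (reducedPair prime congruence V W 1≤u {p} {q} {r} {s} e₁ e₂) } }

  converse : (ℓ : ℕ) (L M : Subset) → DoublyWellRounded ℓ L M →
    ∃₂ λ K 𝒪 → ∃₂ λ 𝔞 𝔭 → WellRoundedIdealData ℓ K 𝒪 𝔞 𝔭 × EquivalentPairs L M 𝔞 (𝔭 ⊗ 𝔞)
  converse ℓ L M (F , s , s′ , (S-pairs , S′-pairs) , 2≤s , 2≤s′) with two-vectors S-pairs 2≤s | two-vectors S′-pairs 2≤s′
  ... | v₁ , v₂ , v₁∈ , v₂∈ , v≢ , v≢- | w₁ , w₂ , w₁∈ , w₂∈ , w≢ , w≢- =
    Backward.Vectors.result F {v₁} {v₂} {w₁} {w₂} v₁∈ v₂∈ v≢ v≢- w₁∈ w₂∈ w≢ w≢-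

corollary5 : (R : RealNumbers) → let open Over R in
    ((ℓ : ℕ) (K 𝒪 𝔞 𝔭 : Subset) → WellRoundedIdealData ℓ K 𝒪 𝔞 𝔭 →
    DoublyWellRounded ℓ 𝔞 (𝔭 ⊗ 𝔞))
    ×
    ((ℓ : ℕ) (L M : Subset) → DoublyWellRounded ℓ L M →
    ∃₂ λ K 𝒪 → ∃₂ λ 𝔞 𝔭 → WellRoundedIdealData ℓ K 𝒪 𝔞 𝔭 ×
    EquivalentPairs L M 𝔞 (𝔭 ⊗ 𝔞))
corollary5 R = forward R , converse R
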